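{- Let $n\ge3$ and let $\Phi$ be the root system of type $D_n$ with coroot lattice $\check Q=\{x\in\mathbb Z^n:\sum_ix_i\in2\mathbb Z\}$ and uniform zeta map $\zeta:\check Q/(2n-1)\check Q\to\operatorname{Park}(\Phi)$. Then $\zeta\circ\psi=\varphi\circ\zeta_D$ as maps $\operatorname{Vert}(D_n)\to\operatorname{Park}(\Phi)$, where $\psi(\pi,v)=u\cdot\lambda+(2n-1)\check Q$, $\varphi(\beta,w)=[w,A_\beta]$ and $\zeta_D(\pi,v)=(\zeta_D(\pi),d_D(\pi,v))$.
   Context: Uniform setting: $\Phi$ irreducible crystallographic root system in Euclidean $V$, positive roots $\Phi^+$, simple roots $\Delta$, highest root $\tilde\alpha$, Weyl group $W$, Coxeter number $h$, coroot lattice $\check Q$ (span of $2\alpha/\langle\alpha,\alpha\rangle$). $H_{\alpha,k}=\{x:\langle x,\alpha\rangle=k\}$; the affine Weyl group $\widetilde W$ (generated by reflections in all $H_{\alpha,k}$) acts simply transitively on alcoves; $A_\circ=\{x:\langle x,\alpha\rangle>0\ \forall\alpha\in\Delta,\langle x,\tilde\alpha\rangle<1\}$; $C=\{x:\langle x,\alpha\rangle>0\ \forall\alpha\in\Delta\}$, chambers are $wC$, $w\in W$. Shi arrangement: $H_{\alpha,k}$, $\alpha\in\Phi^+$, $k\in\{0,1\}$; each region $R$ contains a unique alcove closest to the origin, $\widetilde w_RA_\circ$. $\widetilde w_f\in\widetilde W$ with $\widetilde w_fA_\circ=\{x:\langle x,\alpha\rangle>1\ \forall\alpha\in\Delta,\langle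 x,\tilde\alpha\rangle<h\}$. Anderson map $\mathcal A(\widetilde w_R)=-\widetilde w_R\widetilde w_f^{ -1}(0)+(h+1)\check Q$ (a bijection onto $\check Q/(h+1)\check Q$). Floors of an alcove: hyperplanes $H_{\alpha,k}$ supporting a facet, not through the origin, separating it from the origin. Root poset: $\alpha\le\beta$ iff $\beta-\alpha$ is a sum of positive roots. $\operatorname{Park}(\Phi)$: classes $[w,A]$, $w\in W$, $A$ an antichain, $(w,A)\sim(w',A')$ iff $A=A'$ and $wH=w'H$, $H=\langle s_\alpha:\alpha\in A\rangle$. $\Theta^{ -1}(\widetilde w_R)=[w,A]$ with $\widetilde w_RA_\circ\subseteq wC$, $A=\{\alpha\in\Phi^+:H_{\alpha,1}$ a floor of $w^{ -1}\widetilde w_RA_\circ\}$ (a bijection); $\zeta=\Theta^{ -1}\circ\mathcal A^{ -1}$. Type $D_n$: $\Phi^+=\{\pm e_i+e_j:i<j\}$, $\Delta=\{e_1+e_2\}\cup\{e_{i+1}-e_i\}$, $\tilde\alpha=e_{n-1}+e_n$, $h=2n-2$, $W=\mathfrak S_n^D$ (signed permutations, i.e. bijections $w$ of $\{\pm1,\dots,\pm n\}$ with $w(-i)=-w(i)$, having an even number of $i\in[n]$ with $w(i)<0$; $\mathfrak S_n^B$ denotes all signed permutations), acting by $w\cdot e_i=e_{w(i)}$, $e_{ -i}=-e_i$. Combinatorics: rise $i$ = $i$-th North step followed by North step; valley $(i,j)$ = $i$-th East step followed by $j$-th North step, plus $(i,j+1)$ if a ballot path with $i$ East and $j$ North steps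 ends with East; $E^\pm$ count as East steps. $\mathcal L^\bullet_{n-1,n}$: words with $n-1$ East and $n$ North steps, first step if East replaced by $E^+$ or $E^-$; $\epsilon(\cdot)=-1$ iff the path contains $E^-$. $\pi_i$ = East steps before $i$-th North step; $\lambda_1=\epsilon(\pi)\pi_1$, $\lambda_i=\pi_i$ ($1<i<n$), $\lambda_n=2\pi_n-\pi_{n-1}$ if $\pi_1+\dots+\pi_{n-2}$ even, else $2n-1-2\pi_n+\pi_{n-1}$. $\nu=(0,\dots,n-2,n-1)$ if $n-1\equiv0,3\pmod4$, $\nu=(0,\dots,n-2,n)$ if $n-1\equiv1,2\pmod4$; $\mu=(\lambda_1,\lambda_2-1,\dots,\lambda_{n-1}-(n-2),\lambda_n-(n-1))$ resp. $(-\lambda_1,\lambda_2-1,\dots,\lambda_{n-1}-(n-2),n-\lambda_n)$. $\overrightarrow{S}^\pm_j,\overleftarrow{S}^\pm_j$: reading $a\in\mathbb Z^n$ left to right resp. right to left, writing $N$ for entries $j$ (resp. $-j$) and $E$ for entries $j+1$ (resp. $-j-1$). $\zeta_D(\pi)$: from $\overleftarrow{S}^-_{2n-1}(\mu)\overrightarrow{S}^+_{2n-1}(\mu)\cdots\overleftarrow{S}^-_0(\mu)\overrightarrow{S}^+_0(\mu)$ delete the last letter; if the $n$-th North step is followed by an East step, make it $E^+$ if $\#\{r:\mu_r>0\}$ is even, $E^-$ if odd. $\operatorname{Vert}(D_n)$: $(\pi,v)$, $v\in\mathfrak S_n^B$, $v(i)<v(i+1)$ for rises $i$, $|v(1)|<v(2)$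 if $\pi$ starts with $NN$, $\prod_i\operatorname{sgn}v(i)=\epsilon(\pi)(-1)^{\lambda_{n-1}+\lambda_n}$. $u\in\mathfrak S_n^D$: $u(1)=\epsilon(\pi)v(1)$, $u(i)=v(i)$ ($1<i<n$), $u(n)=(-1)^{\lambda_{n-1}+\lambda_n}v(n)$. $d_D(\pi,v)$: for $i=0,1,\dots$ write $v(j)$ for $j$ with $\mu_j=-i$ (increasing $j$), then $-v(j)$ for $j$ with $\mu_j=i+1$ (decreasing $j$); multiply the entry from row $n$ by $(-1)^{1+\mu_{n-1}+\mu_n}$ and from row 1 by $\epsilon(\pi)(-1)^{1+\nu_{n-1}+\nu_n}$; change the sign of the first entry if $\mu$ has an odd number of positive entries. Signed ballot paths $\mathcal B^\bullet_{2n-1}$: length-$2n-1$ ballot words (prefixes have at least as many $N$ as $E$) where, if the $n$-th North step is followed by an East step, that step is $E^+$ or $E^-$. For a valley $(i,j)$ of $\beta$: $\alpha_{i,j}=e_{n+1-i}-e_{n+1-j}$ ($j\le n-1$), $e_{n+1-i}-\epsilon(\beta)e_1$ ($j=n$), $e_{n+1-i}+\epsilon(\beta)e_1$ ($j=n+1$), $e_{n+1-i}+e_{j-n}$ ($j\ge n+2$); $A_\beta$ is the set of these, except that for a valley $(i,n)$ whose $n$-th North step is not followed by an East step both $\alpha_{i,n},\alpha_{i,n+1}$ are included. $\operatorname{Diag}(D_n)$: $(\beta,w)$, $w\in\mathfrak S_n^D$, with for each valley $(i,j)$: $w(n+1-i)>w(n+1-j)$ ($j\le n-1$), $>\epsilon(\beta)w(1)$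 ($j=n$), $>-\epsilon(\beta)w(1)$ ($j=n+1$), $>w(n-j)$ ($j\ge n+2$), and $w(n+1-i)>|w(1)|$ if $(i,n)$ is a valley whose $n$-th North step is not followed by an East step. -}

module Defs where

open import Data.Bool using (Bool; true; false; if_then_else_; _∧_; _∨_; not)
open import Data.Nat as ℕ using (ℕ; zero; suc; _≡ᵇ_; _∸_; _%_)
open import Data.Integer as ℤ using (ℤ; +_; -[1+_]; -_; _-_; ∣_∣)
  renaming (_+_ to _+ℤ_; _*_ to _*ℤ_; _<_ to _<ℤ_; _≤_ to _≤ℤ_)
import Data.Integer.Properties as ℤP
open import Data.Integer.Divisibility using () renaming (_∣_ to _∣ℤ_)
open import Data.List using (List; []; _∷_; _++_; map; foldr; concatMap; downFrom; upTo; reverse; length)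
open import Data.Product using (Σ; ∃; ∃-syntax; _×_; _,_)
open import Data.Sum using (_⊎_)
open import Data.Unit using (⊤)
open import Data.Empty using (⊥)
open import Data.List.Membership.Propositional using (_∈_)
open import Relation.Nullary using (does)
open import Relation.Binary.PropositionalEquality using (_≡_)
open import Function.Bundles using (_⇔_)

-- Generic helpers.  Vectors in ℤ^n are functions ℕ → ℤ of which only the
-- coordinates 1..n matter (1-based indexing as in the paper).

ZV : Set
ZV = ℕ → ℤ

-- signed permutations in one-line notation: i ↦ w(i), i = 1..n
SP : Set
SP = ℕ → ℤ

eqZ : ℤ → ℤ → Bool
eqZ x y = does (x ℤP.≟ y)

ltZ : ℤ → ℤ → Bool
ltZ x y = does (x ℤP.<? y)

sgn : ℤ → ℤ
sgn (+ zero)  = + 0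
sgn (+ suc _) = + 1
sgn -[1+ _ ]  = - (+ 1)

sumTo : ℕ → (ℕ → ℤ) → ℤ
sumTo zero    f = + 0
sumTo (suc n) f = sumTo n f +ℤ f (suc n)

prodTo : ℕ → (ℕ → ℤ) → ℤ
prodTo zero    f = + 1
prodTo (suc n) f = prodTo n f *ℤ f (suc n)

countTo : ℕ → (ℕ → Bool) → ℕ
countTo zero    p = 0
countTo (suc n) p = countTo n p ℕ.+ (if p (suc n) then 1 else 0)

negOnePow : ℤ → ℤ
negOnePow x = if (∣ x ∣ % 2) ≡ᵇ 0 then + 1 else - (+ 1)

_≗[_]_ : ZV → ℕ → ZV → Set
x ≗[ n ] y = ∀ k → 1 ℕ.≤ k → k ℕ.≤ n → x k ≡ y k

InRange : ℕ → ℕ → Set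
InRange n i = 1 ℕ.≤ i × i ℕ.≤ n

_⊕_ : ZV → ZV → ZV
(x ⊕ y) k = x k +ℤ y k

_⊖_ : ZV → ZV → ZV
(x ⊖ y) k = x k - y k

neg : ZV → ZV
neg x k = - x k

_·v_ : ℤ → ZV → ZV
(c ·v x) k = c *ℤ x k

inner : ℕ → ZV → ZV → ℤ
inner n x y = sumTo n (λ i → x i *ℤ y i)

-- e_a for a signed index a ∈ {±1,…,±n}, with e_{-i} = - e_i
e : ℤ → ZV
e a k = if ∣ a ∣ ≡ᵇ k then sgn a else + 0

IsSignedPerm : ℕ → SP → Set
IsSignedPerm n w =
  (∀ i → InRange n i → InRange n ∣ w i ∣) ×
  (∀ i j → InRange n i → InRange n j → ∣ w i ∣ ≡ ∣ w j ∣ → i ≡ j)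

negCount : ℕ → SP → ℕ
negCount n w = countTo n (λ i → ltZ (w i) (+ 0))

IsDPerm : ℕ → SP → Set
IsDPerm n w = IsSignedPerm n w × (negCount n w % 2 ≡ 0)

-- action w · e_i = e_{w(i)} on ℤ^n :  (w·x)_k = Σ_{i : |w i| = k} sgn(w i) x_i
act : ℕ → SP → ZV → ZV
act n w x k = sumTo n (λ i → if ∣ w i ∣ ≡ᵇ k then sgn (w i) *ℤ x i else + 0)

-- composition (w ∘ u)(i) = w(u(i)), using w(-k) = -w(k)
comp : SP → SP → SP
comp w u i = sgn (u i) *ℤ w ∣ u i ∣

inv : ℕ → SP → SP
inv n w k = sumTo n (λ i → if ∣ w i ∣ ≡ᵇ k then sgn (w i) *ℤ + i else + 0)

idSP : SP
idSP i = + i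

-- Coxeter number h = 2n-2
hD : ℕ → ℤ
hD n = + (2 ℕ.* n ∸ 2)

InCoroot : ℕ → ZV → Set
InCoroot n x = (+ 2) ∣ℤ sumTo n x

-- x ≡ y  mod (h+1) Q̌ = (2n-1) Q̌
ModEq : ℕ → ZV → ZV → Set
ModEq n x y = ∃[ z ] (InCoroot n z × ((x ⊖ y) ≗[ n ] ((+ (2 ℕ.* n ∸ 1)) ·v z)))

-- positive roots ±e_i + e_j (i<j) are encoded by pairs (a , j) with
-- a ∈ {±1,…,±n}, 1 ≤ |a| < j ≤ n, standing for e_a + e_j
record PR : Set where
  constructor pr
  field
    a : ℤ
    j : ℕ
open PR public

ValidPR : ℕ → PR → Set
ValidPR n c = 1 ℕ.≤ ∣ a c ∣ × ∣ a c ∣ ℕ.< j c × j c ℕ.≤ n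

vecPR : PR → ZV
vecPR c = e (a c) ⊕ e (+ j c)

simpleR : ℕ → ZV
simpleR zero          = e (+ 1) ⊕ e (+ 2)   -- unused index
simpleR (suc zero)    = e (+ 1) ⊕ e (+ 2)
simpleR (suc (suc k)) = e (+ suc (suc k)) ⊖ e (+ suc k)

highR : ℕ → ZV
highR n = e (+ (n ∸ 1)) ⊕ e (+ n)

reflSP : PR → SP
reflSP c i =
  if i ≡ᵇ j c then - a c
  else if i ≡ᵇ ∣ a c ∣ then - (sgn (a c) *ℤ + j c)
  else + i

-- The affine Weyl group W̃ = W ⋉ Q̌ : x ↦ w·x + t

record Aff : Set where
  constructor aff
  field
    lin : SP
    tr  : ZV
open Aff public

IsAff : ℕ → Aff → Set
IsAff n b = IsDPerm n (lin b) × InCoroot n (tr b)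

-- ρ̌ = (0,1,…,n-1); ρ̌/h is an interior point of A∘
-- (⟨ρ̌,α_i⟩ = 1, ⟨ρ̌,α̃⟩ = h-1).
rhoV : ZV
rhoV k = + (k ∸ 1)

-- pt b = h · b(ρ̌/h) = w·ρ̌ + h t : (h times) an interior point of the alcove b A∘.
-- Since alcoves meet no hyperplane H_{α,k}, the side of H_{α,k} on which the
-- alcove b A∘ lies is the side of this point:  ⟨x,α⟩ > k on b A∘  iff
-- ⟨pt b, α⟩ > h k.
pt : ℕ → Aff → ZV
pt n b = act n (lin b) rhoV ⊕ (hD n ·v tr b)

-- b A∘ ⊆ {x : ⟨x,α⟩ > k}
AboveH : ℕ → Aff → ZV → ℤ → Set
AboveH n b α k = hD n *ℤ k <ℤ inner n (pt n b) α

aboveB : ℕ → Aff → ZV → ℤ → Bool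
aboveB n b α k = ltZ (hD n *ℤ k) (inner n (pt n b) α)

posRoots : ℕ → List PR
posRoots n = concatMap (λ j → concatMap (λ i → pr (+ i) j ∷ pr (- (+ i)) j ∷ [])
                                        (map suc (upTo (j ∸ 1))))
                       (map suc (upTo n))

-- number of integers m such that H_{α,m} separates A∘ from b A∘
-- (it suffices to range over |m| ≤ |⟨pt b,α⟩| + 1)
sepCount : ℕ → Aff → ZV → ℕ
sepCount n b α = countTo (2 ℕ.* B ℕ.+ 1) (λ k → sep (+ k - + suc B))
  where
  P : ℤ
  P = inner n (pt n b) α
  B : ℕ
  B = ∣ P ∣ ℕ.+ 1
  R : ℤ
  R = inner n rhoV α     -- h · (value on the interior point ρ̌/h of A∘)
  sep : ℤ → Bool
  sep m = (ltZ R (hD n *ℤ m) ∧ ltZ (hD n *ℤ m) P) ∨ (ltZ P (hD n *ℤ m) ∧ ltZ (hD n *ℤ m) R)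

dist : ℕ → Aff → ℕ
dist n b = foldr (λ c s → sepCount n b (vecPR c) ℕ.+ s) 0 (posRoots n)

SameShi : ℕ → Aff → Aff → Set
SameShi n b b' = ∀ c → ValidPR n c → ∀ k → (k ≡ + 0 ⊎ k ≡ + 1) →
  (AboveH n b (vecPR c) k ⇔ AboveH n b' (vecPR c) k)

MinAlcove : ℕ → Aff → Set
MinAlcove n b = IsAff n b × (∀ b' → IsAff n b' → SameShi n b b' → dist n b ℕ.≤ dist n b')

-- w̃_f : w̃_f A∘ = {x : ⟨x,α⟩ > 1 ∀ α ∈ Δ, ⟨x,α̃⟩ < h}
-- (an alcove contained in this alcove equals it)
IsWf : ℕ → Aff → Set
IsWf n b = IsAff n b ×
  (∀ i → InRange n i → AboveH n b (simpleR i) (+ 1)) ×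
  (inner n (pt n b) (highR n) <ℤ hD n *ℤ hD n)

-- Anderson map  𝒜(w̃) = - w̃ w̃_f⁻¹(0)  (representative in Q̌)
anderson : ℕ → Aff → Aff → ZV
anderson n wf b = act n (lin b) (act n (inv n (lin wf)) (tr wf)) ⊖ tr b

InChamber : ℕ → Aff → SP → Set
InChamber n b w = ∀ i → InRange n i → AboveH n b (act n w (simpleR i)) (+ 0)

relative : ℕ → SP → Aff → Aff
relative n w b = aff (comp (inv n w) (lin b)) (act n (inv n w) (tr b))

SameHyp : ℕ → ZV → ℤ → ZV → ℤ → Set
SameHyp n γ m γ' m' = (γ ≗[ n ] γ' × m ≡ m') ⊎ (γ ≗[ n ] neg γ' × m ≡ - m')

-- H_{γ,m} supports a facet of b A∘ : it is the image under b of a wall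
-- H_{α_i,0} (α_i ∈ Δ) or H_{α̃,1} of A∘;  b(H_{β,k}) = H_{wβ, k + ⟨t,wβ⟩}
IsWall : ℕ → Aff → ZV → ℤ → Set
IsWall n b γ m =
  (∃[ i ] (InRange n i ×
     SameHyp n γ m (act n (lin b) (simpleR i)) (inner n (tr b) (act n (lin b) (simpleR i)))))
  ⊎ SameHyp n γ m (act n (lin b) (highR n)) (+ 1 +ℤ inner n (tr b) (act n (lin b) (highR n)))

-- H_{α,1} (α ∈ Φ⁺) is a floor of b A∘: it supports a facet, does not pass
-- through 0, and separates b A∘ from 0 (i.e. ⟨x,α⟩ > 1 on b A∘)
FloorH1 : ℕ → Aff → PR → Set
FloorH1 n b c = IsWall n b (vecPR c) (+ 1) × AboveH n b (vecPR c) (+ 1)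

data Generated (n : ℕ) (A : PR → Set) : SP → Set where
  gen-id   : Generated n A idSP
  gen-step : ∀ c g → ValidPR n c → A c → Generated n A g → Generated n A (comp (reflSP c) g)

-- [w , A] = [w' , A'] in Park(Φ):  A = A' and wH = w'H
ParkEq : ℕ → SP → (PR → Set) → SP → (PR → Set) → Set
ParkEq n w A w' A' =
  (∀ c → ValidPR n c → (A c ⇔ A' c)) ×
  (∃[ g ] (Generated n A g × (w' ≗[ n ] comp w g)))

data Step : Set where
  N E E⁺ E⁻ : Step

isN : Step → Bool
isN N = true
isN _ = false

isEast : Step → Bool
isEast s = not (isN s)

isPlain : Step → Bool
isPlain N = true
isPlain E = true
isPlain _ = false

hasEm : List Step → Bool
hasEm [] = false
hasEm (E⁻ ∷ xs) = true
hasEm (_ ∷ xs) = hasEm xs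

epsP : List Step → ℤ
epsP p = if hasEm p then - (+ 1) else + 1

countN : List Step → ℕ
countN [] = 0
countN (x ∷ xs) = (if isN x then 1 else 0) ℕ.+ countN xs

countE : List Step → ℕ
countE [] = 0
countE (x ∷ xs) = (if isEast x then 1 else 0) ℕ.+ countE xs

allPlain : List Step → Bool
allPlain [] = true
allPlain (x ∷ xs) = isPlain x ∧ allPlain xs

FirstOK : List Step → Set
FirstOK [] = ⊤
FirstOK (N ∷ xs)  = allPlain xs ≡ true
FirstOK (E ∷ xs)  = ⊥
FirstOK (E⁺ ∷ xs) = allPlain xs ≡ true
FirstOK (E⁻ ∷ xs) = allPlain xs ≡ true

InL : ℕ → List Step → Set
InL n p = countE p ≡ n ∸ 1 × countN p ≡ n × FirstOK p

eastBefore : List Step → ℕ → ℕ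
eastBefore [] i = 0
eastBefore (x ∷ xs) i with isN x
... | true  = if i ≡ᵇ 1 then 0 else eastBefore xs (i ∸ 1)
... | false = suc (eastBefore xs i)

afterNorth : List Step → ℕ → List Step
afterNorth [] i = []
afterNorth (x ∷ xs) i with isN x
... | true  = if i ≡ᵇ 1 then take1 xs else afterNorth xs (i ∸ 1)
  where
  take1 : List Step → List Step
  take1 [] = []
  take1 (y ∷ _) = y ∷ []
... | false = afterNorth xs i

NorthFollowedByN : List Step → ℕ → Bool
NorthFollowedByN p i = anyB isN (afterNorth p i)
  where
  anyB : (Step → Bool) → List Step → Bool
  anyB f [] = false
  anyB f (y ∷ ys) = f y ∨ anyB f ys

NorthFollowedByE : List Step → ℕ → Bool
NorthFollowedByE p i = anyB isEast (afterNorth p i)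
  where
  anyB : (Step → Bool) → List Step → Bool
  anyB f [] = false
  anyB f (y ∷ ys) = f y ∨ anyB f ys

startsNN : List Step → Bool
startsNN (N ∷ N ∷ _) = true
startsNN _ = false

piZ : List Step → ℕ → ℤ
piZ p i = + eastBefore p i

lam : ℕ → List Step → ZV
lam n p k =
  if k ≡ᵇ 1 then epsP p *ℤ piZ p 1
  else if k ≡ᵇ n then
    (if (s % 2) ≡ᵇ 0
       then (+ 2) *ℤ piZ p n - piZ p (n ∸ 1)
       else (+ (2 ℕ.* n ∸ 1) - (+ 2) *ℤ piZ p n) +ℤ piZ p (n ∸ 1))
  else piZ p k
  where
  s : ℕ
  s = foldr ℕ._+_ 0 (map (λ i → eastBefore p (suc i)) (upTo (n ∸ 2)))

caseA : ℕ → Bool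
caseA n = ((n ∸ 1) % 4 ≡ᵇ 0) ∨ ((n ∸ 1) % 4 ≡ᵇ 3)

nu : ℕ → ZV
nu n k = if k ≡ᵇ n then (if caseA n then + (n ∸ 1) else + n) else + (k ∸ 1)

mu : ℕ → List Step → ZV
mu n p k =
  if k ≡ᵇ 1 then (if caseA n then lam n p 1 else - lam n p 1)
  else if k ≡ᵇ n then (if caseA n then lam n p n - + (n ∸ 1) else + n - lam n p n)
  else lam n p k - + (k ∸ 1)

idxUp : ℕ → List ℕ
idxUp n = map suc (upTo n)

idxDown : ℕ → List ℕ
idxDown n = reverse (idxUp n)

Sright : ℕ → ZV → ℤ → List Step
Sright n x j = concatMap (λ k → if eqZ (x k) j then N ∷ []
                               else if eqZ (x k) (j +ℤ + 1) then E ∷ [] else []) (idxUp n)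

Sleft : ℕ → ZV → ℤ → List Step
Sleft n x j = concatMap (λ k → if eqZ (x k) (- j) then N ∷ []
                              else if eqZ (x k) (- j - + 1) then E ∷ [] else []) (idxDown n)

dropLast : List Step → List Step
dropLast [] = []
dropLast (x ∷ []) = []
dropLast (x ∷ y ∷ xs) = x ∷ dropLast (y ∷ xs)

markAfterNorth : ℕ → Step → List Step → List Step
markAfterNorth i s [] = []
markAfterNorth i s (x ∷ xs) with isN x
... | true  = if i ≡ᵇ 1 then x ∷ mk xs else x ∷ markAfterNorth (i ∸ 1) s xs
  where
  mk : List Step → List Step
  mk [] = []
  mk (y ∷ ys) = (if isEast y then s else y) ∷ ys
... | false = x ∷ markAfterNorth i s xs

posCount : ℕ → ZV → ℕ
posCount n x = countTo n (λ k → ltZ (+ 0) (x k))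

zetaDpath : ℕ → List Step → List Step
zetaDpath n p =
  markAfterNorth n (if (posCount n m % 2) ≡ᵇ 0 then E⁺ else E⁻)
    (dropLast (concatMap (λ j → Sleft n m (+ j) ++ Sright n m (+ j)) (downFrom (2 ℕ.* n))))
  where
  m : ZV
  m = mu n p

nthZ : List ℤ → ℕ → ℤ
nthZ [] k = + 0
nthZ (x ∷ xs) zero = + 0
nthZ (x ∷ xs) (suc zero) = x
nthZ (x ∷ xs) (suc (suc k)) = nthZ xs (suc k)

record Entry : Set where
  constructor ent
  field
    row : ℕ
    val : ℤ

dD : ℕ → List Step → SP → SP
dD n p v = nthZ (flipFirst (map fix raw))
  where
  m : ZV
  m = mu n p
  -- for i = 0,1,…  (i ≤ Σ|μ_j| suffices to exhaust all entries)
  bound : ℕ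
  bound = foldr ℕ._+_ 0 (map (λ k → ∣ m k ∣) (idxUp n))
  block : ℕ → List Entry
  block i = concatMap (λ j → if eqZ (m j) (- (+ i)) then ent j (v j) ∷ [] else []) (idxUp n)
         ++ concatMap (λ j → if eqZ (m j) (+ suc i) then ent j (- v j) ∷ [] else []) (idxDown n)
  raw : List Entry
  raw = concatMap block (upTo (suc bound))
  fix : Entry → ℤ
  fix (ent r x) =
    if r ≡ᵇ n then negOnePow (+ 1 +ℤ m (n ∸ 1) +ℤ m n) *ℤ x
    else if r ≡ᵇ 1 then (epsP p *ℤ negOnePow (+ 1 +ℤ nu n (n ∸ 1) +ℤ nu n n)) *ℤ x
    else x
  flipFirst : List ℤ → List ℤ
  flipFirst [] = []
  flipFirst (x ∷ xs) = if (posCount n m % 2) ≡ᵇ 0 then x ∷ xs else (- x) ∷ xs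

InVert : ℕ → List Step → SP → Set
InVert n p v =
  InL n p × IsSignedPerm n v ×
  (∀ i → 1 ℕ.≤ i → i ℕ.< n → NorthFollowedByN p i ≡ true → v i <ℤ v (suc i)) ×
  (startsNN p ≡ true → + ∣ v 1 ∣ <ℤ v 2) ×
  (prodTo n (λ i → sgn (v i)) ≡ epsP p *ℤ negOnePow (lam n p (n ∸ 1) +ℤ lam n p n))

uOf : ℕ → List Step → SP → SP
uOf n p v i =
  if i ≡ᵇ 1 then epsP p *ℤ v 1
  else if i ≡ᵇ n then negOnePow (lam n p (n ∸ 1) +ℤ lam n p n) *ℤ v n
  else v i

-- ψ(π,v) = u · λ  (representative in Q̌ of its class mod (2n-1)Q̌)
psi : ℕ → List Step → SP → ZV
psi n p v = act n (uOf n p v) (lam n p)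

-- valleys (i,j) of a path (E⁺,E⁻ count as East); if the path ends with its
-- i-th East step after j North steps, (i,j+1) is a valley as well
valleys : List Step → List (ℕ × ℕ)
valleys = go 0 0
  where
  go : ℕ → ℕ → List Step → List (ℕ × ℕ)
  go e k [] = []
  go e k (x ∷ []) = if isEast x then (suc e , suc k) ∷ [] else []
  go e k (x ∷ y ∷ xs) =
    (if isEast x ∧ isN y then (suc e , suc k) ∷ [] else [])
    ++ go (if isEast x then suc e else e) (if isN x then suc k else k) (y ∷ xs)

alphaIJ : ℕ → List Step → ℕ → ℕ → ZV
alphaIJ n β i j =
  if j ℕ.≤ᵇ (n ∸ 1) then e (+ (n ℕ.+ 1 ∸ i)) ⊖ e (+ (n ℕ.+ 1 ∸ j))
  else if j ≡ᵇ n then e (+ (n ℕ.+ 1 ∸ i)) ⊖ (epsP β ·v e (+ 1))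
  else if j ≡ᵇ suc n then e (+ (n ℕ.+ 1 ∸ i)) ⊕ (epsP β ·v e (+ 1))
  else e (+ (n ℕ.+ 1 ∸ i)) ⊕ e (+ (j ∸ n))

Abeta : ℕ → List Step → PR → Set
Abeta n β c = ∃[ i ] ∃[ j ] ((i , j) ∈ valleys β ×
  (vecPR c ≗[ n ] alphaIJ n β i j
   ⊎ (j ≡ n × NorthFollowedByE β n ≡ false × vecPR c ≗[ n ] alphaIJ n β i (suc n))))

-- the set A of Θ⁻¹(w̃) = [w , A]
floorSet : ℕ → SP → Aff → PR → Set
floorSet n w b c = FloorH1 n (relative n w b) c

-- In the frame x(i) = ⟨pt b , w eᵢ⟩ = i − 1 + h τ(i) of b = (w , t), the walls of b A∘ are the pairs of signed rows whose
-- values differ by 1 modulo h, and b A∘ is minimal in its Shi region iff every wall lies below level 1, or at level 1 with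
-- a positive root (the Sommers condition): a discrete intermediate value argument splits any other pair of rows at a
-- third row. Modulo h + 1, the Anderson map sends b to pt b, and pt b is determined by its class since the affine Weyl
-- group acts freely. A labelled path (π , v) gives the alcove b₀ with τ = −μ and the signed labels v as w; it satisfies
-- the Sommers condition, and pt b₀ ≡ u λ.
--
-- The chamber of b A∘ lists the rows by increasing |x|, and so does d_D. The word defining ζ_D(π) lists its letters by
-- decreasing height: row k has North steps at |x k| and, if |x k| ≤ n − 1, at −|x k|, and otherwise an East step at
-- |x k| − h − 1. By the same intermediate value argument a North step follows an East step only at equal height, which
-- says that the root of this valley takes the value h + 1 at the point of w⁻¹ b A∘, i.e. that it is a floor.

module Submission where

open import Defs
open import Data.Bool using (Bool; true; false; if_then_else_; _∧_; _∨_; not; T)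
open import Data.Nat as ℕ using (ℕ; zero; suc; _+_; _≤_; z≤n; s≤s; _∸_; _≡ᵇ_; _<ᵇ_; _%_)
import Data.Nat.Properties as ℕP
open import Data.Integer as ℤ using (ℤ; +_; -[1+_]; -_; _-_; ∣_∣; +≤+; -≤+)
  renaming (_+_ to _+ℤ_; _*_ to _*ℤ_; _<_ to _<ℤ_; _≤_ to _≤ℤ_)
import Data.Integer.Properties as ℤP
open import Data.List using (List; []; _∷_; _++_; map; foldr; concatMap; length; downFrom; upTo; reverse)
import Data.List.Properties as LP
open import Data.Product using (Σ; ∃-syntax; _×_; _,_; proj₁; proj₂)
open import Data.Sum using (_⊎_; inj₁; inj₂)
open import Data.Unit using (tt)
open import Data.Empty using (⊥; ⊥-elim)
open import Relation.Nullary using (¬_; Dec; yes; no)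
open import Relation.Binary.PropositionalEquality
open import Relation.Binary.Definitions using (Tri; tri<; tri≈; tri>)
open import Function using (_∘_; id)
open import Data.Nat.Divisibility using (divides; m%n≡0⇒n∣m; n∣m⇒m%n≡0) renaming (_∣_ to _∣ℕ_)
open import Data.Bool.Properties using (∧-identityʳ; ∧-zeroʳ; ∨-identityʳ; ∨-zeroʳ; ¬-not)
open import Relation.Nullary.Decidable using (dec-true; dec-false)
open import Data.List.Membership.Propositional using (_∈_; lose; find)
open import Data.List.Membership.Propositional.Properties using (∈-++⁺ˡ; ∈-++⁺ʳ; ∈-++⁻; ∈-concatMap⁺; ∈-concatMap⁻; ∈-map⁺; ∈-map⁻; ∈-upTo⁺; ∈-upTo⁻; ∈-downFrom⁺)
open import Data.List.Relation.Unary.Any using (here; there)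
import Data.List.Relation.Unary.Any.Properties as AnyP
open import Data.List.Relation.Unary.All using (All; []; _∷_)
import Data.List.Relation.Unary.All as All
import Data.List.Relation.Unary.All.Properties as AllP
open import Data.List.Relation.Unary.AllPairs using (AllPairs; []; _∷_)
import Data.List.Relation.Unary.AllPairs as AllPairs
import Data.List.Relation.Unary.AllPairs.Properties as AllPairsP
open import Function.Bundles using (mk⇔; Equivalence)

-- A root is a pair of signed rows (a , b), with value X b - X a at `pt b`. Modulo h = 2n - 2 the 2n
-- signed rows meet every residue class once, except that ±1 share the class 0 and ±n the class n -
-- 1. This coincidence is the obstacle of type D. The intermediate value argument may return -a or
-- -b, and a and -a span no root, so a mirror argument has to find another row. The smallest |x| may
-- be 0; then `pt b` does not determine the sign of the first label, which comes from the even
-- number of sign changes in W. In the uniqueness of `pt b` the sign of row n is fixed only because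
-- translations lie in Q̌. Freeness is applied to the inverse alcove: the Sommers condition puts
-- b⁻¹A∘ + ρ̌ into (h + 1)A∘, where two points of one orbit must coincide. Since `dist` is an
-- explicit count, minimality is proved by comparing the separating hyperplanes root by root, and
-- refuted by a reflection in one wall. What remains is arithmetic that is linear once products with
-- h are atoms; it is left to a certified procedure.

infixl 7 _:*_
infixl 6 _:+_ _:-_
infix 4 _:≤_ _:<_ _:≡_
infixr 3 _⟹_

-- Certified linear arithmetic over the integers.

data Expr : Set where
  var : ℕ → Expr
  K : ℕ → Expr
  _:+_ _:-_ _:*_ : Expr → Expr → Expr
  :-_ : Expr → Expr

data Form : Set where
  _:≤_ _:<_ _:≡_ : Expr → Expr → Form
  _⟹_ : Form → Form → Form
  :⊥ : Form

look : List ℤ → ℕ → ℤ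
look [] i = + 0
look (x ∷ ρ) zero = x
look (x ∷ ρ) (suc i) = look ρ i

⟦_⟧ : Expr → List ℤ → ℤ
⟦ var i ⟧ ρ = look ρ i
⟦ K k ⟧ ρ = + k
⟦ a :+ b ⟧ ρ = ⟦ a ⟧ ρ +ℤ ⟦ b ⟧ ρ
⟦ a :- b ⟧ ρ = ⟦ a ⟧ ρ - ⟦ b ⟧ ρ
⟦ a :* b ⟧ ρ = ⟦ a ⟧ ρ *ℤ ⟦ b ⟧ ρ
⟦ :- a ⟧ ρ = - ⟦ a ⟧ ρ

⟦_⟧F : Form → List ℤ → Set
⟦ a :≤ b ⟧F ρ = ⟦ a ⟧ ρ ≤ℤ ⟦ b ⟧ ρ
⟦ a :< b ⟧F ρ = ⟦ a ⟧ ρ <ℤ ⟦ b ⟧ ρ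
⟦ a :≡ b ⟧F ρ = ⟦ a ⟧ ρ ≡ ⟦ b ⟧ ρ
⟦ f ⟹ g ⟧F ρ = ⟦ f ⟧F ρ → ⟦ g ⟧F ρ
⟦ :⊥ ⟧F ρ = ⊥

-- Variable indices with multiplicity, kept in increasing order by `insM`, so that products equal up
-- to commutativity become the same list.
Mono : Set
Mono = List ℕ

Poly : Set
Poly = List (ℤ × Mono)

⟦_⟧M : Mono → List ℤ → ℤ
⟦ [] ⟧M ρ = + 1
⟦ i ∷ m ⟧M ρ = look ρ i *ℤ ⟦ m ⟧M ρ

⟦_⟧L : Poly → List ℤ → ℤ
⟦ [] ⟧L ρ = + 0
⟦ (c , m) ∷ p ⟧L ρ = c *ℤ ⟦ m ⟧M ρ +ℤ ⟦ p ⟧L ρ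

data Cmp {A : Set} (x y : A) : Set where
  less greater : Cmp x y
  same : x ≡ y → Cmp x y

cmpℕ : (i j : ℕ) → Cmp i j
cmpℕ i j with i ≡ᵇ j in e
... | true = same (ℕP.≡ᵇ⇒≡ i j (subst T (sym e) tt))
... | false = if i <ᵇ j then less else greater

cmpM : (m m' : Mono) → Cmp m m'
cmpM [] [] = same refl
cmpM [] (_ ∷ _) = less
cmpM (_ ∷ _) [] = greater
cmpM (i ∷ m) (j ∷ m') with cmpℕ i j
... | less = less
... | greater = greater
... | same refl with cmpM m m'
... | less = less
... | greater = greater
... | same refl = same refl

-- Zero terms are dropped, so that a combination in which all variables cancel is literally a
-- constant, which `isNeg` can recognise.
cons : ℤ → Mono → Poly → Poly
cons (+ 0) m p = p
cons c m p = (c , m) ∷ p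

addP : Poly → Poly → Poly
addT : ℤ → Mono → Poly → Poly → Poly
addP [] q = q
addP ((c , m) ∷ p) q = addT c m p q
addT c m p [] = (c , m) ∷ p
addT c m p ((d , m') ∷ q) with cmpM m m'
... | less = (c , m) ∷ addP p ((d , m') ∷ q)
... | greater = (d , m') ∷ addT c m p q
... | same _ = cons (c +ℤ d) m (addP p q)

mulM : Mono → Mono → Mono
insM : ℕ → Mono → Mono
insM i [] = i ∷ []
insM i (j ∷ m) = if j <ᵇ i then j ∷ insM i m else i ∷ j ∷ m
mulM [] m' = m'
mulM (i ∷ m) m' = insM i (mulM m m')

mulT : ℤ → Mono → Poly → Poly
mulT c m [] = []
mulT c m ((d , m') ∷ q) = addP (cons (c *ℤ d) (mulM m m') []) (mulT c m q)

mulP : Poly → Poly → Poly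
mulP [] q = []
mulP ((c , m) ∷ p) q = addP (mulT c m q) (mulP p q)

scaleP : ℤ → Poly → Poly
scaleP c [] = []
scaleP c ((d , m) ∷ p) = cons (c *ℤ d) m (scaleP c p)

norm : Expr → Poly
norm (var i) = (+ 1 , i ∷ []) ∷ []
norm (K k) = cons (+ k) [] []
norm (a :+ b) = addP (norm a) (norm b)
norm (a :- b) = addP (norm a) (scaleP (- + 1) (norm b))
norm (a :* b) = mulP (norm a) (norm b)
norm (:- a) = scaleP (- + 1) (norm a)

module _ (ρ : List ℤ) where
  open import Algebra.Properties.CommutativeSemigroup ℤP.+-commutativeSemigroup
    using (interchange; x∙yz≈y∙xz)
  open import Algebra.Properties.CommutativeSemigroup ℤP.*-commutativeSemigroup
    using () renaming (interchange to *-interchange; x∙yz≈y∙xz to *-x∙yz≈y∙xz)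

  ⟦cons⟧ : ∀ c m p → ⟦ cons c m p ⟧L ρ ≡ c *ℤ ⟦ m ⟧M ρ +ℤ ⟦ p ⟧L ρ
  ⟦cons⟧ (+ 0) m p = sym (ℤP.+-identityˡ _)
  ⟦cons⟧ (+ suc _) m p = refl
  ⟦cons⟧ -[1+ _ ] m p = refl

  ⟦addP⟧ : ∀ p q → ⟦ addP p q ⟧L ρ ≡ ⟦ p ⟧L ρ +ℤ ⟦ q ⟧L ρ
  ⟦addT⟧ : ∀ c m p q → ⟦ addT c m p q ⟧L ρ ≡ (c *ℤ ⟦ m ⟧M ρ +ℤ ⟦ p ⟧L ρ) +ℤ ⟦ q ⟧L ρ
  ⟦addP⟧ [] q = sym (ℤP.+-identityˡ _)
  ⟦addP⟧ ((c , m) ∷ p) q = ⟦addT⟧ c m p q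
  ⟦addT⟧ c m p [] = sym (ℤP.+-identityʳ _)
  ⟦addT⟧ c m p ((d , m') ∷ q) with cmpM m m'
  ... | less = trans (cong (c *ℤ ⟦ m ⟧M ρ +ℤ_) (⟦addP⟧ p ((d , m') ∷ q))) (sym (ℤP.+-assoc (c *ℤ ⟦ m ⟧M ρ) _ _))
  ... | greater = trans (cong (d *ℤ ⟦ m' ⟧M ρ +ℤ_) (⟦addT⟧ c m p q)) (x∙yz≈y∙xz (d *ℤ ⟦ m' ⟧M ρ) (c *ℤ ⟦ m ⟧M ρ +ℤ ⟦ p ⟧L ρ) _)
  ... | same refl = trans (⟦cons⟧ (c +ℤ d) m (addP p q))
    (trans (cong ((c +ℤ d) *ℤ ⟦ m ⟧M ρ +ℤ_) (⟦addP⟧ p q)) (trans (cong (_+ℤ (⟦ p ⟧L ρ +ℤ ⟦ q ⟧L ρ)) (ℤP.*-distribʳ-+ (⟦ m ⟧M ρ) c d))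
      (interchange (c *ℤ ⟦ m ⟧M ρ) _ _ _)))

  ⟦insM⟧ : ∀ i m → ⟦ insM i m ⟧M ρ ≡ look ρ i *ℤ ⟦ m ⟧M ρ
  ⟦insM⟧ i [] = refl
  ⟦insM⟧ i (j ∷ m) with j <ᵇ i
  ... | true = trans (cong (look ρ j *ℤ_) (⟦insM⟧ i m)) (*-x∙yz≈y∙xz (look ρ j) (look ρ i) _)
  ... | false = refl

  ⟦mulM⟧ : ∀ m m' → ⟦ mulM m m' ⟧M ρ ≡ ⟦ m ⟧M ρ *ℤ ⟦ m' ⟧M ρ
  ⟦mulM⟧ [] m' = sym (ℤP.*-identityˡ _)
  ⟦mulM⟧ (i ∷ m) m' = trans (⟦insM⟧ i (mulM m m'))
    (trans (cong (look ρ i *ℤ_) (⟦mulM⟧ m m')) (sym (ℤP.*-assoc (look ρ i) _ _)))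

  ⟦mulT⟧ : ∀ c m q → ⟦ mulT c m q ⟧L ρ ≡ c *ℤ ⟦ m ⟧M ρ *ℤ ⟦ q ⟧L ρ
  ⟦mulT⟧ c m [] = sym (ℤP.*-zeroʳ (c *ℤ ⟦ m ⟧M ρ))
  ⟦mulT⟧ c m ((d , m') ∷ q) = trans (⟦addP⟧ (cons (c *ℤ d) (mulM m m') []) (mulT c m q))
    (trans (cong₂ _+ℤ_ (trans (⟦cons⟧ (c *ℤ d) (mulM m m') [])
                          (trans (ℤP.+-identityʳ _) (cong (c *ℤ d *ℤ_) (⟦mulM⟧ m m')))) (⟦mulT⟧ c m q))
           (trans (cong (_+ℤ c *ℤ ⟦ m ⟧M ρ *ℤ ⟦ q ⟧L ρ) (*-interchange c d (⟦ m ⟧M ρ) (⟦ m' ⟧M ρ)))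
             (sym (ℤP.*-distribˡ-+ (c *ℤ ⟦ m ⟧M ρ) (d *ℤ ⟦ m' ⟧M ρ) _))))

  ⟦mulP⟧ : ∀ p q → ⟦ mulP p q ⟧L ρ ≡ ⟦ p ⟧L ρ *ℤ ⟦ q ⟧L ρ
  ⟦mulP⟧ [] q = refl
  ⟦mulP⟧ ((c , m) ∷ p) q = trans (⟦addP⟧ (mulT c m q) (mulP p q))
    (trans (cong₂ _+ℤ_ (⟦mulT⟧ c m q) (⟦mulP⟧ p q)) (sym (ℤP.*-distribʳ-+ (⟦ q ⟧L ρ) (c *ℤ ⟦ m ⟧M ρ) (⟦ p ⟧L ρ))))

  ⟦scaleP⟧ : ∀ c p → ⟦ scaleP c p ⟧L ρ ≡ c *ℤ ⟦ p ⟧L ρ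
  ⟦scaleP⟧ c [] = sym (ℤP.*-zeroʳ c)
  ⟦scaleP⟧ c ((d , m) ∷ p) = trans (⟦cons⟧ (c *ℤ d) m (scaleP c p))
    (trans (cong (c *ℤ d *ℤ ⟦ m ⟧M ρ +ℤ_) (⟦scaleP⟧ c p)) (trans (cong (_+ℤ c *ℤ ⟦ p ⟧L ρ) (ℤP.*-assoc c d (⟦ m ⟧M ρ))) (sym (ℤP.*-distribˡ-+ c (d *ℤ ⟦ m ⟧M ρ) _))))

  ⟦norm⟧ : ∀ e → ⟦ norm e ⟧L ρ ≡ ⟦ e ⟧ ρ
  ⟦norm⟧ (var i) = trans (ℤP.+-identityʳ _) (trans (ℤP.*-identityˡ _) (ℤP.*-identityʳ _))
  ⟦norm⟧ (K k) = trans (⟦cons⟧ (+ k) [] []) (trans (ℤP.+-identityʳ _) (ℤP.*-identityʳ _))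
  ⟦norm⟧ (a :+ b) = trans (⟦addP⟧ (norm a) (norm b)) (cong₂ _+ℤ_ (⟦norm⟧ a) (⟦norm⟧ b))
  ⟦norm⟧ (a :- b) = trans (⟦addP⟧ (norm a) (scaleP (- + 1) (norm b)))
    (cong₂ _+ℤ_ (⟦norm⟧ a) (trans (⟦scaleP⟧ (- + 1) (norm b)) (trans (ℤP.-1*i≡-i _) (cong -_ (⟦norm⟧ b)))))
  ⟦norm⟧ (a :* b) = trans (⟦mulP⟧ (norm a) (norm b)) (cong₂ _*ℤ_ (⟦norm⟧ a) (⟦norm⟧ b))
  ⟦norm⟧ (:- a) = trans (⟦scaleP⟧ (- + 1) (norm a)) (trans (ℤP.-1*i≡-i _) (cong -_ (⟦norm⟧ a)))

-- A row (isEq , p) asserts p ≡ 0 or p ≥ 0.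
Row : Set
Row = Bool × Poly

Holds : List ℤ → Row → Set
Holds ρ (true , p) = ⟦ p ⟧L ρ ≡ + 0
Holds ρ (false , p) = + 0 ≤ℤ ⟦ p ⟧L ρ

-- Integrality enters through the strict case: a < b is recorded as b - a - 1 ≥ 0.
row≤ row< row≡ : Expr → Expr → Row
row≤ a b = false , norm (b :- a)
row< a b = false , norm (b :- a :- K 1)
row≡ a b = true , norm (b :- a)

combine : List Row → List ℤ → Poly
combine [] _ = []
combine (_ ∷ _) [] = []
combine ((_ , p) ∷ rs) (c ∷ cs) = addP (scaleP c p) (combine rs cs)

signsOK : List Row → List ℤ → Bool
signsOK [] _ = true
signsOK (_ ∷ _) [] = true
signsOK ((true , _) ∷ rs) (_ ∷ cs) = signsOK rs cs
signsOK ((false , _) ∷ rs) (+ _ ∷ cs) = signsOK rs cs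
signsOK ((false , _) ∷ rs) (-[1+ _ ] ∷ cs) = false

isNeg : Poly → Bool
isNeg ((-[1+ _ ] , []) ∷ []) = true
isNeg _ = false

data AllHold (ρ : List ℤ) : List Row → Set where
  [] : AllHold ρ []
  _∷_ : ∀ {r rs} → Holds ρ r → AllHold ρ rs → AllHold ρ (r ∷ rs)

-- The easy half of Farkas' lemma: equations may be multiplied by any integer, inequalities only by
-- non-negative ones. A combination that is a negative constant is therefore a refutation.
combine-≥0 : ∀ ρ rs cs → T (signsOK rs cs) → AllHold ρ rs → + 0 ≤ℤ ⟦ combine rs cs ⟧L ρ
combine-≥0 ρ [] cs ok [] = ℤP.≤-refl
combine-≥0 ρ (_ ∷ _) [] ok _ = ℤP.≤-refl
combine-≥0 ρ ((true , p) ∷ rs) (c ∷ cs) ok (h ∷ hs)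
  rewrite ⟦addP⟧ ρ (scaleP c p) (combine rs cs) | ⟦scaleP⟧ ρ c p | h | ℤP.*-zeroʳ c
  = subst (+ 0 ≤ℤ_) (sym (ℤP.+-identityˡ _)) (combine-≥0 ρ rs cs ok hs)
combine-≥0 ρ ((false , p) ∷ rs) (+ c ∷ cs) ok (h ∷ hs)
  rewrite ⟦addP⟧ ρ (scaleP (+ c) p) (combine rs cs) | ⟦scaleP⟧ ρ (+ c) p
  = ℤP.+-mono-≤ (subst (_≤ℤ + c *ℤ ⟦ p ⟧L ρ) (ℤP.*-zeroʳ (+ c)) (ℤP.*-monoˡ-≤-nonNeg (+ c) h))
                (combine-≥0 ρ rs cs ok hs)

refuted : List Row → List ℤ → Bool
refuted rs cs = signsOK rs cs ∧ isNeg (combine rs cs)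

T∧ : ∀ {a b} → T (a ∧ b) → T a × T b
T∧ {true} {true} _ = tt , tt

isNeg-sound : ∀ ρ p → T (isNeg p) → + 0 ≤ℤ ⟦ p ⟧L ρ → ⊥
isNeg-sound ρ ((-[1+ n ] , []) ∷ []) _ h
  with subst (+ 0 ≤ℤ_) (trans (ℤP.+-identityʳ (-[1+ n ] *ℤ + 1)) (ℤP.*-identityʳ -[1+ n ])) h
... | ()

refute : ∀ ρ rs cs → T (refuted rs cs) → AllHold ρ rs → ⊥
refute ρ rs cs ok hs = let s , t = T∧ {signsOK rs cs} ok in
  isNeg-sound ρ (combine rs cs) t (combine-≥0 ρ rs cs s hs)

-- Untrusted search for the multipliers: Gaussian elimination on the equations, then Fourier–Motzkin.
record Cand : Set where
  constructor cand
  field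
    isEq : Bool
    poly : Poly
    mult : List ℤ

addV : List ℤ → List ℤ → List ℤ
addV [] w = w
addV v [] = v
addV (x ∷ v) (y ∷ w) = (x +ℤ y) ∷ addV v w

scaleV : ℤ → List ℤ → List ℤ
scaleV c [] = []
scaleV c (x ∷ v) = (c *ℤ x) ∷ scaleV c v

coef : Mono → Poly → ℤ
coef m [] = + 0
coef m ((c , m') ∷ p) with cmpM m m'
... | same _ = c
... | less = + 0
... | greater = coef m p

comb : ℤ → Cand → ℤ → Cand → Bool → Cand
comb c (cand _ p v) d (cand _ q w) b = cand b (addP (scaleP c p) (scaleP d q)) (addV (scaleV c v) (scaleV d w))

unitMults : ℕ → List Row → List Cand
unitMults k [] = []
unitMults k ((b , p) ∷ rs) = cand b p (unit k) ∷ unitMults (suc k) rs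
  where
  unit : ℕ → List ℤ
  unit zero = + 1 ∷ []
  unit (suc k) = + 0 ∷ unit k

pickMono : List Cand → List Mono
pickMono [] = []
pickMono (cand _ p _ ∷ cs) = go p
  where
  go : Poly → List Mono
  go [] = pickMono cs
  go ((c , []) ∷ p) = go p
  go ((c , m ∷ ms) ∷ _) = (m ∷ ms) ∷ []

findEq : Mono → List Cand → List Cand
findEq m [] = []
findEq m (cand true p v ∷ cs) with coef m p
... | + 0 = findEq m cs
... | _ = cand true p v ∷ []
findEq m (cand false p v ∷ cs) = findEq m cs

signum : ℤ → ℤ
signum (+ 0) = + 0
signum (+ _) = + 1
signum -[1+ _ ] = -[1+ 0 ]

elimEq : Mono → Cand → List Cand → List Cand
elimEq m e [] = []
elimEq m e (c ∷ cs) with coef m (Cand.poly c)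
... | + 0 = c ∷ elimEq m e cs
... | k = let d = coef m (Cand.poly e) in
          -- The row `c` itself is multiplied by the positive number |d|, which preserves the
          -- direction of an inequality.
          comb (+ ∣ d ∣) c (- (signum d *ℤ k)) e (Cand.isEq c) ∷ elimEq m e cs

split3 : Mono → List Cand → List Cand × List Cand × List Cand
split3 m [] = [] , [] , []
split3 m (c ∷ cs) with coef m (Cand.poly c) | split3 m cs
... | + 0 | z , p , n = c ∷ z , p , n
... | + _ | z , p , n = z , c ∷ p , n
... | -[1+ _ ] | z , p , n = z , p , c ∷ n

pairs : Mono → List Cand → List Cand → List Cand
pairs m [] ns = []
pairs m (p ∷ ps) ns = go ns
  where
  go : List Cand → List Cand
  go [] = pairs m ps ns
  go (n ∷ ns) = comb (+ ∣ coef m (Cand.poly n) ∣) p (+ ∣ coef m (Cand.poly p) ∣) n false ∷ go ns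

verdict : List Cand → List ℤ
verdict [] = []
verdict (cand _ ((-[1+ _ ] , []) ∷ []) v ∷ cs) = v
verdict (cand true ((+ suc _ , []) ∷ []) v ∷ cs) = scaleV (- + 1) v
verdict (_ ∷ cs) = verdict cs

eliminate : ℕ → List Cand → List ℤ
eliminate zero cs = verdict cs
eliminate (suc fuel) cs with pickMono cs
... | [] = verdict cs
... | m ∷ _ with findEq m cs
... | e ∷ _ = eliminate fuel (elimEq m e cs)
... | [] with split3 m cs
... | z , p , n = eliminate fuel (pairs m p n ++ z)

search : List Row → List ℤ
-- The fuel bounds the number of eliminated monomials. Running out of it can only make the check of
-- the certificate fail.
search rs = eliminate 40 (unitMults 0 rs)

hyps : Form → List Row → List Row
hyps (a :≤ b) rs = row≤ a b ∷ rs
hyps (a :< b) rs = row< a b ∷ rs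
hyps (a :≡ b) rs = row≡ a b ∷ rs
hyps _ rs = rs

closes : List Row → Bool
closes rs = refuted rs (search rs)

-- The negated goal is refuted together with the hypotheses. An equation takes two refutations, its
-- negation being a disjunction of two strict inequalities.
solvable : List Row → Form → Bool
solvable rs (a :≤ b) = closes (row< b a ∷ rs)
solvable rs (a :< b) = closes (row≤ b a ∷ rs)
solvable rs (a :≡ b) = closes (row< a b ∷ rs) ∧ closes (row< b a ∷ rs)
solvable rs :⊥ = closes rs
solvable rs (f ⟹ p) = solvable (hyps f rs) p

row≤-holds : ∀ ρ a b → ⟦ a ⟧ ρ ≤ℤ ⟦ b ⟧ ρ → Holds ρ (row≤ a b)
row≤-holds ρ a b h = subst (+ 0 ≤ℤ_) (sym (⟦norm⟧ ρ (b :- a))) (ℤP.i≤j⇒0≤j-i h)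

row<-holds : ∀ ρ a b → ⟦ a ⟧ ρ <ℤ ⟦ b ⟧ ρ → Holds ρ (row< a b)
row<-holds ρ a b h = subst (+ 0 ≤ℤ_) (sym (⟦norm⟧ ρ (b :- a :- K 1)))
  (subst (+ 0 ≤ℤ_) (lem (⟦ b ⟧ ρ) (⟦ a ⟧ ρ)) (ℤP.i≤j⇒0≤j-i (ℤP.i<j⇒suc[i]≤j h)))
  where
  lem : ∀ b a → b - (+ 1 +ℤ a) ≡ b - a - + 1
  lem b a = trans (cong (b +ℤ_) (trans (ℤP.neg-distrib-+ (+ 1) a) (ℤP.+-comm (- + 1) (- a)))) (sym (ℤP.+-assoc b (- a) (- + 1)))

row≡-holds : ∀ ρ a b → ⟦ a ⟧ ρ ≡ ⟦ b ⟧ ρ → Holds ρ (row≡ a b)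
row≡-holds ρ a b h = trans (⟦norm⟧ ρ (b :- a)) (ℤP.i≡j⇒i-j≡0 (sym h))

closed : ∀ ρ rs → T (closes rs) → AllHold ρ rs → ⊥
closed ρ rs = refute ρ rs (search rs)

solve-sound : ∀ ρ rs p → T (solvable rs p) → AllHold ρ rs → ⟦ p ⟧F ρ
solve-sound ρ rs (a :≤ b) ok hs = ℤP.≮⇒≥ λ q → closed ρ (row< b a ∷ rs) ok (row<-holds ρ b a q ∷ hs)
solve-sound ρ rs (a :< b) ok hs = ℤP.≰⇒> λ q → closed ρ (row≤ b a ∷ rs) ok (row≤-holds ρ b a q ∷ hs)
solve-sound ρ rs (a :≡ b) ok hs = let s , t = T∧ {closes (row< a b ∷ rs)} ok in
  ℤP.≤-antisym (ℤP.≮⇒≥ λ q → closed ρ (row< b a ∷ rs) t (row<-holds ρ b a q ∷ hs))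
               (ℤP.≮⇒≥ λ q → closed ρ (row< a b ∷ rs) s (row<-holds ρ a b q ∷ hs))
solve-sound ρ rs :⊥ ok hs = closed ρ rs ok hs
solve-sound ρ rs ((a :≤ b) ⟹ p) ok hs q = solve-sound ρ (row≤ a b ∷ rs) p ok (row≤-holds ρ a b q ∷ hs)
solve-sound ρ rs ((a :< b) ⟹ p) ok hs q = solve-sound ρ (row< a b ∷ rs) p ok (row<-holds ρ a b q ∷ hs)
solve-sound ρ rs ((a :≡ b) ⟹ p) ok hs q = solve-sound ρ (row≡ a b ∷ rs) p ok (row≡-holds ρ a b q ∷ hs)
solve-sound ρ rs (:⊥ ⟹ p) ok hs q = ⊥-elim q
solve-sound ρ rs ((_ ⟹ _) ⟹ p) ok hs q = solve-sound ρ rs p ok hs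

Abs : ℕ → Set
Abs zero = Form
Abs (suc k) = Expr → Abs k

inst : ∀ k → ℕ → Abs k → Form
inst zero i p = p
inst (suc k) i f = inst k (suc i) (f (var i))

-- lia (x ∷ y ∷ []) (λ x y → hypothesis ⟹ goal) proves linear consequences over ℤ; monomials of degree ≥ 2 count as
-- atoms. It is abstract, because with-abstraction would otherwise normalise the proofs.
abstract
  lia : (ρ : List ℤ) (f : Abs (length ρ)) {_ : T (solvable [] (inst (length ρ) 0 f))} → ⟦ inst (length ρ) 0 f ⟧F ρ
  lia ρ f {ok} = solve-sound ρ [] (inst (length ρ) 0 f) ok []

-- Signed permutations and their action on coordinates.

-- Signed indices a ∈ {±1,…,±n}: val f a extends f oddly, so comp w u i is val w (u i).
val : ZV → ℤ → ℤ
val f a = sgn a *ℤ f ∣ a ∣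

InRange? : ∀ n i → Dec (InRange n i)
InRange? n i with 1 ℕ.≤? i | i ℕ.≤? n
... | yes p | yes q = yes (p , q)
... | no ¬p | _ = no λ (p , _) → ¬p p
... | _ | no ¬q = no λ (_ , q) → ¬q q

∣sgn∣ : ∀ a x → 1 ≤ ∣ a ∣ → ∣ sgn a *ℤ x ∣ ≡ ∣ x ∣
∣sgn∣ (+ suc _) x _ = cong ∣_∣ (ℤP.*-identityˡ x)
∣sgn∣ -[1+ _ ] x _ = trans (cong ∣_∣ (ℤP.-1*i≡-i x)) (ℤP.∣-i∣≡∣i∣ x)

sgn-neg : ∀ a → sgn (- a) ≡ - sgn a
sgn-neg (+ zero) = refl
sgn-neg (+ suc _) = refl
sgn-neg -[1+ _ ] = refl

sgn-sgn : ∀ a → 1 ≤ ∣ a ∣ → sgn a *ℤ sgn a ≡ + 1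
sgn-sgn (+ suc _) _ = refl
sgn-sgn -[1+ _ ] _ = refl

sgn-* : ∀ a b → sgn (sgn a *ℤ b) ≡ sgn a *ℤ sgn b
sgn-* (+ zero) b = trans (cong sgn (ℤP.*-zeroˡ b)) (sym (ℤP.*-zeroˡ (sgn b)))
sgn-* (+ suc _) b = trans (cong sgn (ℤP.*-identityˡ b)) (sym (ℤP.*-identityˡ (sgn b)))
sgn-* -[1+ _ ] b = trans (cong sgn (ℤP.-1*i≡-i b)) (trans (sgn-neg b) (sym (ℤP.-1*i≡-i (sgn b))))

sgn-cases : ∀ a → 1 ≤ ∣ a ∣ → (sgn a ≡ + 1 × a ≡ + ∣ a ∣) ⊎ (sgn a ≡ - + 1 × a ≡ - + ∣ a ∣)
sgn-cases (+ suc _) _ = inj₁ (refl , refl)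
sgn-cases -[1+ _ ] _ = inj₂ (refl , refl)

sgn-∣∣ : ∀ a → sgn a *ℤ + ∣ a ∣ ≡ a
sgn-∣∣ (+ zero) = refl
sgn-∣∣ (+ suc k) = ℤP.*-identityˡ (+ suc k)
sgn-∣∣ -[1+ k ] = ℤP.-1*i≡-i (+ suc k)

val-+ : ∀ f i → 1 ≤ i → val f (+ i) ≡ f i
val-+ f (suc i) _ = ℤP.*-identityˡ _

val-neg : ∀ f a → val f (- a) ≡ - val f a
val-neg f a rewrite ℤP.∣-i∣≡∣i∣ a | sgn-neg a = sym (ℤP.neg-distribˡ-* (sgn a) (f ∣ a ∣))

val-sgn : ∀ f a b → 1 ≤ ∣ a ∣ → val f (sgn a *ℤ b) ≡ sgn a *ℤ val f b
val-sgn f (+ suc _) b _ = trans (cong (val f) (ℤP.*-identityˡ b)) (sym (ℤP.*-identityˡ (val f b)))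
val-sgn f -[1+ _ ] b _ = trans (cong (val f) (ℤP.-1*i≡-i b)) (trans (val-neg f b) (sym (ℤP.-1*i≡-i (val f b))))

val-val : ∀ f w a → 1 ≤ ∣ a ∣ → val f (val w a) ≡ val (λ i → val f (w i)) a
val-val f w a p = val-sgn f a (w ∣ a ∣) p

val-cong : ∀ f g a → f ∣ a ∣ ≡ g ∣ a ∣ → val f a ≡ val g a
val-cong f g a p = cong (sgn a *ℤ_) p

val-+ᵥ : ∀ f g a → val (λ i → f i +ℤ g i) a ≡ val f a +ℤ val g a
val-+ᵥ f g a = ℤP.*-distribˡ-+ (sgn a) (f ∣ a ∣) (g ∣ a ∣)

val-*ᵥ : ∀ c f a → val (λ i → c *ℤ f i) a ≡ c *ℤ val f a
val-*ᵥ c f a = lia (sgn a ∷ c ∷ f ∣ a ∣ ∷ []) λ s c x → s :* (c :* x) :≡ c :* (s :* x)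

∣val∣ : ∀ f a → 1 ≤ ∣ a ∣ → ∣ val f a ∣ ≡ ∣ f ∣ a ∣ ∣
∣val∣ f a p = ∣sgn∣ a (f ∣ a ∣) p

eqᵇ-true : ∀ {i j} → i ≡ j → (i ≡ᵇ j) ≡ true
eqᵇ-true {zero} refl = refl
eqᵇ-true {suc i} refl = eqᵇ-true {i} refl

eqᵇ-false : ∀ {i j} → ¬ i ≡ j → (i ≡ᵇ j) ≡ false
eqᵇ-false {i} {j} ne with i ≡ᵇ j in e
... | false = refl
... | true = ⊥-elim (ne (ℕP.≡ᵇ⇒≡ i j (subst T (sym e) tt)))

InRange-suc : ∀ {n i} → InRange n i → InRange (suc n) i
InRange-suc (p , q) = p , ℕP.m≤n⇒m≤1+n q

InRange-top : ∀ {n} → InRange (suc n) (suc n)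
InRange-top = s≤s z≤n , ℕP.≤-refl

sumTo-cong : ∀ n {f g} → (∀ i → InRange n i → f i ≡ g i) → sumTo n f ≡ sumTo n g
sumTo-cong zero p = refl
sumTo-cong (suc n) p = cong₂ _+ℤ_ (sumTo-cong n λ i r → p i (InRange-suc r)) (p (suc n) InRange-top)

sumTo-0 : ∀ n {f} → (∀ i → InRange n i → f i ≡ + 0) → sumTo n f ≡ + 0
sumTo-0 zero p = refl
sumTo-0 (suc n) p = cong₂ _+ℤ_ (sumTo-0 n λ i r → p i (InRange-suc r)) (p (suc n) InRange-top)

sumTo-+ : ∀ n f g → sumTo n (λ i → f i +ℤ g i) ≡ sumTo n f +ℤ sumTo n g
sumTo-+ zero f g = refl
sumTo-+ (suc n) f g rewrite sumTo-+ n f g =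
  lia (sumTo n f ∷ sumTo n g ∷ f (suc n) ∷ g (suc n) ∷ []) λ a b c d → a :+ b :+ (c :+ d) :≡ a :+ c :+ (b :+ d)

sumTo-* : ∀ n c f → sumTo n (λ i → c *ℤ f i) ≡ c *ℤ sumTo n f
sumTo-* zero c f = sym (ℤP.*-zeroʳ c)
sumTo-* (suc n) c f rewrite sumTo-* n c f = sym (ℤP.*-distribˡ-+ c (sumTo n f) (f (suc n)))

sumTo-neg : ∀ n f → sumTo n (λ i → - f i) ≡ - sumTo n f
sumTo-neg zero f = refl
sumTo-neg (suc n) f rewrite sumTo-neg n f = sym (ℤP.neg-distrib-+ (sumTo n f) (f (suc n)))

sumTo-single : ∀ n {f} k → InRange n k → (∀ i → InRange n i → ¬ i ≡ k → f i ≡ + 0) → sumTo n f ≡ f k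
sumTo-single zero k (p , q) z = ⊥-elim (ℕP.<⇒≱ p q)
sumTo-single (suc n) {f} k (p , q) z with k ℕ.≟ suc n
... | yes refl = trans (cong (_+ℤ f (suc n)) (sumTo-0 n λ i (r , s) → z i (r , ℕP.m≤n⇒m≤1+n s) λ { refl → ℕP.<-irrefl refl s }))
                       (ℤP.+-identityˡ _)
... | no ne = trans (cong₂ _+ℤ_ (sumTo-single n k (p , ℕP.≤-pred (ℕP.≤∧≢⇒< q ne)) λ i r → z i (InRange-suc r))
                      (z (suc n) InRange-top λ e → ne (sym e))) (ℤP.+-identityʳ _)

sumTo-swap : ∀ n m (f : ℕ → ℕ → ℤ) → sumTo n (λ i → sumTo m (f i)) ≡ sumTo m (λ k → sumTo n (λ i → f i k))
sumTo-swap zero m f = sym (sumTo-0 m λ _ _ → refl)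
sumTo-swap (suc n) m f = trans (cong (_+ℤ sumTo m (f (suc n))) (sumTo-swap n m f))
  (sym (sumTo-+ m (λ k → sumTo n (λ i → f i k)) (f (suc n))))

Injects : ℕ → (ℕ → ℕ) → Set
Injects n f = (∀ i → InRange n i → InRange n (f i)) × (∀ i j → InRange n i → InRange n j → f i ≡ f j → i ≡ j)

private
  anyTo : ∀ n {P : ℕ → Set} → (∀ i → Dec (P i)) → (∃[ i ] (InRange n i × P i)) ⊎ (∀ i → InRange n i → ¬ P i)
  anyTo zero P? = inj₂ λ i (p , q) _ → ℕP.<⇒≱ p q
  anyTo (suc n) P? with P? (suc n) | anyTo n P?
  ... | yes p | _ = inj₁ (suc n , InRange-top , p)
  ... | no _ | inj₁ (i , r , p) = inj₁ (i , InRange-suc r , p)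
  ... | no ¬p | inj₂ none = inj₂ go
    where
    go : ∀ i → InRange (suc n) i → ¬ _
    go i (p , q) with i ℕ.≟ suc n
    ... | yes refl = ¬p
    ... | no ne = none i (p , ℕP.≤-pred (ℕP.≤∧≢⇒< q ne))

surjects : ∀ n f → Injects n f → ∀ k → InRange n k → ∃[ i ] (InRange n i × f i ≡ k)
surjects n f (maps , inj) k r with anyTo n (λ i → f i ℕ.≟ k)
... | inj₁ found = found
... | inj₂ none = ⊥-elim (ℕP.<-irrefl refl (Data.Fin.Properties.injective⇒≤ {suc n} {n} {g} g-inj))
  where
  import Data.Fin as Fin
  import Data.Fin.Properties
  -- k together with the values of f would be n + 1 distinct elements of [1,n].
  h : ℕ → ℕ
  h zero = k
  h (suc i) = f (suc i)
  h-range : ∀ i → i ≤ n → InRange n (h i)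
  h-range zero _ = r
  h-range (suc i) p = maps (suc i) (s≤s z≤n , p)
  h-inj : ∀ i j → i ≤ n → j ≤ n → h i ≡ h j → i ≡ j
  h-inj zero zero _ _ _ = refl
  h-inj zero (suc j) _ q e = ⊥-elim (none (suc j) (s≤s z≤n , q) (sym e))
  h-inj (suc i) zero p _ e = ⊥-elim (none (suc i) (s≤s z≤n , p) e)
  h-inj (suc i) (suc j) p q e = inj (suc i) (suc j) (s≤s z≤n , p) (s≤s z≤n , q) e
  pred-lt : ∀ i → InRange n i → ℕ.pred i ℕ.< n
  pred-lt (suc i) (_ , q) = q
  pred-inj : ∀ {i j} → 1 ≤ i → 1 ≤ j → ℕ.pred i ≡ ℕ.pred j → i ≡ j
  pred-inj {suc i} {suc j} _ _ e = cong suc e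
  bound : ∀ (i : Fin.Fin (suc n)) → Fin.toℕ i ≤ n
  bound i = ℕP.≤-pred (Data.Fin.Properties.toℕ<n i)
  g : Fin.Fin (suc n) → Fin.Fin n
  g i = Fin.fromℕ< (pred-lt (h (Fin.toℕ i)) (h-range _ (bound i)))
  g-inj : ∀ {i j} → g i ≡ g j → i ≡ j
  g-inj {i} {j} e = Data.Fin.Properties.toℕ-injective (h-inj _ _ (bound i) (bound j)
    (pred-inj (proj₁ (h-range _ (bound i))) (proj₁ (h-range _ (bound j)))
      (trans (sym (Data.Fin.Properties.toℕ-fromℕ< _)) (trans (cong Fin.toℕ e) (Data.Fin.Properties.toℕ-fromℕ< _)))))

-- Double counting of the matrix with entry `g k` wherever `f i ≡ k`: each row has one such place
-- because `f` is a function, each column because `f` is a bijection.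
sumTo-reindex : ∀ n f → Injects n f → ∀ g → sumTo n (λ i → g (f i)) ≡ sumTo n g
sumTo-reindex n f inj@(maps , injective) g = begin
  sumTo n (λ i → g (f i)) ≡⟨ sumTo-cong n (λ i r → sym (row i r)) ⟩
  sumTo n (λ i → sumTo n (λ k → ind i k)) ≡⟨ sumTo-swap n n ind ⟩
  sumTo n (λ k → sumTo n (λ i → ind i k)) ≡⟨ sumTo-cong n col ⟩
  sumTo n g ∎
  where
  open ≡-Reasoning
  ind : ℕ → ℕ → ℤ
  ind i k = if f i ≡ᵇ k then g k else + 0
  hit : ∀ {i k} → f i ≡ k → ind i k ≡ g k
  hit e rewrite eqᵇ-true e = refl
  miss : ∀ {i k} → ¬ f i ≡ k → ind i k ≡ + 0
  miss e rewrite eqᵇ-false e = refl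
  row : ∀ i → InRange n i → sumTo n (ind i) ≡ g (f i)
  row i r = trans (sumTo-single n (f i) (maps i r) λ k _ ne → miss λ e → ne (sym e)) (hit refl)
  col : ∀ k → InRange n k → sumTo n (λ i → ind i k) ≡ g k
  col k r with surjects n f inj k r
  ... | i , ri , e = trans (sumTo-single n i ri λ i' r' ne → miss λ e' → ne (injective _ _ r' ri (trans e' (sym e)))) (hit e)

-- IsSignedPerm as a record, so that the permutation can be inferred from the type of a proof.
record Signed (n : ℕ) (w : SP) : Set where
  constructor signed
  field
    isSigned : IsSignedPerm n w
  maps : ∀ i → InRange n i → InRange n ∣ w i ∣
  maps = proj₁ isSigned
  injective : ∀ i j → InRange n i → InRange n j → ∣ w i ∣ ≡ ∣ w j ∣ → i ≡ j
  injective = proj₂ isSigned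
open Signed public using (isSigned) renaming (maps to sp-maps; injective to sp-inj)

module _ {n : ℕ} {w : SP} (sp : Signed n w) where


  sp-surj : ∀ k → InRange n k → ∃[ i ] (InRange n i × ∣ w i ∣ ≡ k)
  sp-surj = surjects n (λ i → ∣ w i ∣) (isSigned sp)

  sp-≥1 : ∀ i → InRange n i → 1 ≤ ∣ w i ∣
  sp-≥1 i r = proj₁ (sp-maps sp i r)

  val-range : ∀ a → InRange n ∣ a ∣ → InRange n ∣ val w a ∣
  val-range a r = subst (InRange n) (sym (∣val∣ w a (proj₁ r))) (sp-maps sp ∣ a ∣ r)

  act-∣∣ : ∀ x i → InRange n i → act n w x ∣ w i ∣ ≡ sgn (w i) *ℤ x i
  act-∣∣ x i r = trans (sumTo-single n i r λ i' r' ne → miss λ e → ne (sp-inj sp i' i r' r e)) hit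
    where
    hit : (if ∣ w i ∣ ≡ᵇ ∣ w i ∣ then sgn (w i) *ℤ x i else + 0) ≡ sgn (w i) *ℤ x i
    hit rewrite eqᵇ-true {∣ w i ∣} refl = refl
    miss : ∀ {i'} → ¬ ∣ w i' ∣ ≡ ∣ w i ∣ → (if ∣ w i' ∣ ≡ᵇ ∣ w i ∣ then sgn (w i') *ℤ x i' else + 0) ≡ + 0
    miss e rewrite eqᵇ-false e = refl

  act-val : ∀ x i → InRange n i → val (act n w x) (w i) ≡ x i
  act-val x i r = begin
    sgn (w i) *ℤ act n w x ∣ w i ∣ ≡⟨ cong (sgn (w i) *ℤ_) (act-∣∣ x i r) ⟩
    sgn (w i) *ℤ (sgn (w i) *ℤ x i) ≡⟨ ℤP.*-assoc (sgn (w i)) (sgn (w i)) (x i) ⟨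
    sgn (w i) *ℤ sgn (w i) *ℤ x i ≡⟨ cong (_*ℤ x i) (sgn-sgn (w i) (sp-≥1 i r)) ⟩
    + 1 *ℤ x i ≡⟨ ℤP.*-identityˡ (x i) ⟩
    x i ∎
    where open ≡-Reasoning

  -- A vector is determined by its values in the frame w.
  frame-ext : ∀ {x y : ZV} → (∀ i → InRange n i → val x (w i) ≡ val y (w i)) → x ≗[ n ] y
  frame-ext {x} {y} p k p1 p2 with sp-surj k (p1 , p2)
  ... | i , r , refl = cancel (sgn-cases (w i) (sp-≥1 i r)) (p i r)
    where
    cancel : ∀ {s a b} {A B : Set} → (s ≡ + 1 × A) ⊎ (s ≡ - + 1 × B) → s *ℤ a ≡ s *ℤ b → a ≡ b
    cancel (inj₁ (refl , _)) e = trans (sym (ℤP.*-identityˡ _)) (trans e (ℤP.*-identityˡ _))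
    cancel (inj₂ (refl , _)) e = ℤP.neg-injective (trans (sym (ℤP.-1*i≡-i _)) (trans e (ℤP.-1*i≡-i _)))

  inv-∣∣ : ∀ i → InRange n i → inv n w ∣ w i ∣ ≡ sgn (w i) *ℤ + i
  inv-∣∣ = act-∣∣ (λ i → + i)

  inv-sp : Signed n (inv n w)
  inv-sp = signed (maps , inj)
    where
    at : ∀ i → InRange n i → ∣ inv n w ∣ w i ∣ ∣ ≡ i
    at i r = trans (cong ∣_∣ (inv-∣∣ i r)) (∣sgn∣ (w i) (+ i) (sp-≥1 i r))
    maps : ∀ k → InRange n k → InRange n ∣ inv n w k ∣
    maps k r with sp-surj k r
    ... | i , ri , refl = subst (InRange n) (sym (at i ri)) ri
    inj : ∀ k l → InRange n k → InRange n l → ∣ inv n w k ∣ ≡ ∣ inv n w l ∣ → k ≡ l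
    inj k l r s e with sp-surj k r | sp-surj l s
    ... | i , ri , refl | j , rj , refl = cong (λ i → ∣ w i ∣) (trans (sym (at i ri)) (trans e (at j rj)))

  comp-sp : ∀ {u} → Signed n u → Signed n (comp w u)
  comp-sp {u} su = signed ((λ i r → val-range (u i) (sp-maps su i r)) ,
    λ i j ri rj e → sp-inj su i j ri rj (sp-inj sp _ _ (sp-maps su i ri) (sp-maps su j rj)
      (trans (sym (∣val∣ w (u i) (proj₁ (sp-maps su i ri)))) (trans e (∣val∣ w (u j) (proj₁ (sp-maps su j rj)))))))

sgn-+ : ∀ i → 1 ≤ i → sgn (+ i) ≡ + 1
sgn-+ (suc i) _ = refl

module _ {n : ℕ} {w : SP} (sp : Signed n w) where

  -- The k-th coordinate of w⁻¹x is the value of x at the label w k. This turns `relative` into a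
  -- change of frame.
  act-inv : ∀ x k → InRange n k → act n (inv n w) x k ≡ val x (w k)
  act-inv x k r = begin
    act n (inv n w) x k ≡⟨ cong (act n (inv n w) x) (sym ∣i∣) ⟩
    act n (inv n w) x ∣ inv n w ∣ w k ∣ ∣ ≡⟨ act-∣∣ (inv-sp sp) x ∣ w k ∣ (sp-maps sp k r) ⟩
    sgn (inv n w ∣ w k ∣) *ℤ x ∣ w k ∣ ≡⟨ cong (_*ℤ x ∣ w k ∣) sgn-i ⟩
    sgn (w k) *ℤ x ∣ w k ∣ ∎
    where
    open ≡-Reasoning
    ∣i∣ : ∣ inv n w ∣ w k ∣ ∣ ≡ k
    ∣i∣ = trans (cong ∣_∣ (inv-∣∣ sp k r)) (∣sgn∣ (w k) (+ k) (sp-≥1 sp k r))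
    sgn-i : sgn (inv n w ∣ w k ∣) ≡ sgn (w k)
    sgn-i = begin
      sgn (inv n w ∣ w k ∣) ≡⟨ cong sgn (inv-∣∣ sp k r) ⟩
      sgn (sgn (w k) *ℤ + k) ≡⟨ sgn-* (w k) (+ k) ⟩
      sgn (w k) *ℤ sgn (+ k) ≡⟨ cong (sgn (w k) *ℤ_) (sgn-+ k (proj₁ r)) ⟩
      sgn (w k) *ℤ + 1 ≡⟨ ℤP.*-identityʳ (sgn (w k)) ⟩
      sgn (w k) ∎

  act-cong : ∀ {x y} → x ≗[ n ] y → act n w x ≗[ n ] act n w y
  act-cong {x} {y} e = frame-ext sp λ i r →
    trans (act-val sp x i r) (trans (e i (proj₁ r) (proj₂ r)) (sym (act-val sp y i r)))

  act-⊕ : ∀ x y → act n w (x ⊕ y) ≗[ n ] (act n w x ⊕ act n w y)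
  act-⊕ x y = frame-ext sp λ i r → begin
    val (act n w (x ⊕ y)) (w i) ≡⟨ act-val sp (x ⊕ y) i r ⟩
    x i +ℤ y i ≡⟨ cong₂ _+ℤ_ (act-val sp x i r) (act-val sp y i r) ⟨
    val (act n w x) (w i) +ℤ val (act n w y) (w i) ≡⟨ val-+ᵥ (act n w x) (act n w y) (w i) ⟨
    val (act n w x ⊕ act n w y) (w i) ∎
    where open ≡-Reasoning

  act-·v : ∀ c x → act n w (c ·v x) ≗[ n ] (c ·v act n w x)
  act-·v c x = frame-ext sp λ i r → begin
    val (act n w (c ·v x)) (w i) ≡⟨ act-val sp (c ·v x) i r ⟩
    c *ℤ x i ≡⟨ cong (c *ℤ_) (act-val sp x i r) ⟨
    c *ℤ val (act n w x) (w i) ≡⟨ val-*ᵥ c (act n w x) (w i) ⟨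
    val (c ·v act n w x) (w i) ∎
    where open ≡-Reasoning

  act-comp : ∀ {u} → Signed n u → ∀ x → act n (comp w u) x ≗[ n ] act n w (act n u x)
  act-comp {u} su x = frame-ext (comp-sp sp su) λ i r → begin
    val (act n (comp w u) x) (comp w u i) ≡⟨ act-val (comp-sp sp su) x i r ⟩
    x i ≡⟨ act-val su x i r ⟨
    val (act n u x) (u i) ≡⟨ val-cong (act n u x) (λ k → val (act n w (act n u x)) (w k)) (u i) (sym (act-val sp (act n u x) ∣ u i ∣ (sp-maps su i r))) ⟩
    val (λ k → val (act n w (act n u x)) (w k)) (u i) ≡⟨ val-val (act n w (act n u x)) w (u i) (sp-≥1 su i r) ⟨
    val (act n w (act n u x)) (comp w u i) ∎
    where open ≡-Reasoning


-- In the frame of its own linear part an alcove is described by the levels ⟨t , w eᵢ⟩ alone; w has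
-- disappeared.
pt-frame : ∀ {n} {b : Aff} → Signed n (lin b) → ∀ i → InRange n i →
  val (pt n b) (lin b i) ≡ rhoV i +ℤ hD n *ℤ val (tr b) (lin b i)
pt-frame {n} {b} sp i r = begin
  val (pt n b) (lin b i) ≡⟨ val-+ᵥ (act n (lin b) rhoV) (hD n ·v tr b) (lin b i) ⟩
  val (act n (lin b) rhoV) (lin b i) +ℤ val (hD n ·v tr b) (lin b i) ≡⟨ cong₂ _+ℤ_ (act-val sp rhoV i r) (val-*ᵥ (hD n) (tr b) (lin b i)) ⟩
  rhoV i +ℤ hD n *ℤ val (tr b) (lin b i) ∎
  where open ≡-Reasoning

-- The point of w⁻¹b lists the values of `pt n b` at the labels w k, so floors of w⁻¹b can be tested
-- on `pt n b` in the frame of the chamber.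
pt-relative : ∀ {n} {w : SP} {b : Aff} → Signed n w → Signed n (lin b) → ∀ k → InRange n k →
  pt n (relative n w b) k ≡ val (pt n b) (w k)
pt-relative {n} {w} {b} sw sb k r = begin
  act n (comp (inv n w) (lin b)) rhoV k +ℤ hD n *ℤ act n (inv n w) (tr b) k
    ≡⟨ cong₂ (λ x y → x +ℤ hD n *ℤ y)
         (trans (act-comp (inv-sp sw) sb rhoV k (proj₁ r) (proj₂ r)) (act-inv sw (act n (lin b) rhoV) k r))
         (act-inv sw (tr b) k r) ⟩
  val (act n (lin b) rhoV) (w k) +ℤ hD n *ℤ val (tr b) (w k)
    ≡⟨ cong (val (act n (lin b) rhoV) (w k) +ℤ_) (val-*ᵥ (hD n) (tr b) (w k)) ⟨
  val (act n (lin b) rhoV) (w k) +ℤ val (hD n ·v tr b) (w k)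
    ≡⟨ val-+ᵥ (act n (lin b) rhoV) (hD n ·v tr b) (w k) ⟨
  val (pt n b) (w k) ∎
  where open ≡-Reasoning

-- Roots as linear forms.

e-hit : ∀ a k → ∣ a ∣ ≡ k → e a k ≡ sgn a
e-hit a k p rewrite eqᵇ-true p = refl

e-miss : ∀ a k → ¬ ∣ a ∣ ≡ k → e a k ≡ + 0
e-miss a k p rewrite eqᵇ-false p = refl

inner-cong : ∀ n {x x' y y'} → x ≗[ n ] x' → y ≗[ n ] y' → inner n x y ≡ inner n x' y'
inner-cong n p q = sumTo-cong n λ i r → cong₂ _*ℤ_ (p i (proj₁ r) (proj₂ r)) (q i (proj₁ r) (proj₂ r))

inner-⊕ : ∀ n x y z → inner n x (y ⊕ z) ≡ inner n x y +ℤ inner n x z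
inner-⊕ n x y z = trans (sumTo-cong n λ i _ → ℤP.*-distribˡ-+ (x i) (y i) (z i))
  (sumTo-+ n (λ i → x i *ℤ y i) (λ i → x i *ℤ z i))

inner-neg : ∀ n x y → inner n x (neg y) ≡ - inner n x y
inner-neg n x y = trans (sumTo-cong n λ i _ → sym (ℤP.neg-distribʳ-* (x i) (y i))) (sumTo-neg n (λ i → x i *ℤ y i))

inner-⊖ : ∀ n x y z → inner n x (y ⊖ z) ≡ inner n x y - inner n x z
inner-⊖ n x y z = trans (inner-⊕ n x y (neg z)) (cong (inner n x y +ℤ_) (inner-neg n x z))

inner-e : ∀ n x a → InRange n ∣ a ∣ → inner n x (e a) ≡ val x a
inner-e n x a r = trans (sumTo-single n ∣ a ∣ r λ i _ ne →
    trans (cong (x i *ℤ_) (e-miss a i (λ p → ne (sym p)))) (ℤP.*-zeroʳ (x i)))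
  (trans (cong (x ∣ a ∣ *ℤ_) (e-hit a ∣ a ∣ refl)) (ℤP.*-comm (x ∣ a ∣) (sgn a)))

e-neg : ∀ a k → e (- a) k ≡ - e a k
e-neg a k with ∣ a ∣ ≡ᵇ k | ∣ - a ∣ ≡ᵇ k | cong (_≡ᵇ k) (ℤP.∣-i∣≡∣i∣ a)
... | true | .true | refl = sgn-neg a
... | false | .false | refl = refl

PR-ranges : ∀ {n} c → ValidPR n c → InRange n ∣ a c ∣ × InRange n (j c)
PR-ranges c (p , q , r) = (p , ℕP.≤-trans (ℕP.<⇒≤ q) r) , (ℕP.≤-trans p (ℕP.<⇒≤ q) , r)

inner-PR : ∀ n x c → ValidPR n c → inner n x (vecPR c) ≡ val x (a c) +ℤ x (j c)
inner-PR n x c v = let ra , rj = PR-ranges c v in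
  trans (inner-⊕ n x (e (a c)) (e (+ j c)))
    (cong₂ _+ℤ_ (inner-e n x (a c) ra) (trans (inner-e n x (+ j c) rj) (val-+ x (j c) (proj₁ rj))))

act-e : ∀ {n w} → Signed n w → ∀ a → InRange n ∣ a ∣ → act n w (e a) ≗[ n ] e (val w a)
act-e {n} {w} sp a r = frame-ext sp λ i ri → trans (act-val sp (e a) i ri) (eq i ri)
  where
  eq : ∀ i → InRange n i → e a i ≡ val (e (val w a)) (w i)
  eq i ri with ∣ a ∣ ℕ.≟ i
  ... | yes refl = begin
    e a i ≡⟨ e-hit a i refl ⟩
    sgn a ≡⟨ lia (sgn a ∷ sgn (w i) ∷ []) (λ s t → s :* (t :* t) :≡ s :* K 1 ⟹ s :≡ t :* (s :* t))
                                                    (cong (sgn a *ℤ_) (sgn-sgn (w i) (sp-≥1 sp i ri))) ⟩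
    sgn (w i) *ℤ (sgn a *ℤ sgn (w i)) ≡⟨ cong (sgn (w i) *ℤ_) (sgn-* a (w i)) ⟨
    sgn (w i) *ℤ sgn (val w a) ≡⟨ cong (sgn (w i) *ℤ_) (e-hit (val w a) ∣ w i ∣ (∣val∣ w a (proj₁ r))) ⟨
    sgn (w i) *ℤ e (val w a) ∣ w i ∣ ∎
    where open ≡-Reasoning
  ... | no ne = trans (e-miss a i ne) (sym (trans (cong (sgn (w i) *ℤ_)
      (e-miss (val w a) ∣ w i ∣ λ p → ne (sp-inj sp _ _ r ri (trans (sym (∣val∣ w a (proj₁ r))) p)))) (ℤP.*-zeroʳ (sgn (w i)))))

-- Parity, the coroot lattice and the permutations of type D.

infix 4 _≡₂_

-- The quotient is part of the data, so that parity facts become linear equations for `lia`.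
record _≡₂_ (x y : ℤ) : Set where
  constructor mod₂
  field
    quot : ℤ
    quot-eq : x ≡ y +ℤ + 2 *ℤ quot

≡⇒≡₂ : ∀ {x y} → x ≡ y → x ≡₂ y
≡⇒≡₂ {x} {y} p = mod₂ (+ 0) (lia (x ∷ y ∷ []) (λ x y → x :≡ y ⟹ x :≡ y :+ K 2 :* K 0) p)

≡₂-sym : ∀ {x y} → x ≡₂ y → y ≡₂ x
≡₂-sym {x} {y} (mod₂ z p) = mod₂ (- z) (lia (x ∷ y ∷ z ∷ []) (λ x y z → x :≡ y :+ K 2 :* z ⟹ y :≡ x :+ K 2 :* :- z) p)

≡₂-trans : ∀ {x y z} → x ≡₂ y → y ≡₂ z → x ≡₂ z
≡₂-trans {x} {y} {z} (mod₂ s p) (mod₂ t q) = mod₂ (s +ℤ t) (lia (x ∷ y ∷ z ∷ s ∷ t ∷ [])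
  (λ x y z s t → x :≡ y :+ K 2 :* s ⟹ y :≡ z :+ K 2 :* t ⟹ x :≡ z :+ K 2 :* (s :+ t)) p q)

≡₂-+ : ∀ {x y x' y'} → x ≡₂ y → x' ≡₂ y' → x +ℤ x' ≡₂ y +ℤ y'
≡₂-+ {x} {y} {x'} {y'} (mod₂ s p) (mod₂ t q) = mod₂ (s +ℤ t) (lia (x ∷ y ∷ x' ∷ y' ∷ s ∷ t ∷ [])
  (λ x y x' y' s t → x :≡ y :+ K 2 :* s ⟹ x' :≡ y' :+ K 2 :* t ⟹ x :+ x' :≡ y :+ y' :+ K 2 :* (s :+ t)) p q)

≡₂-neg : ∀ x → - x ≡₂ x
≡₂-neg x = mod₂ (- x) (lia (x ∷ []) λ x → :- x :≡ x :+ K 2 :* :- x)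

1≢₂0 : ¬ (+ 1 ≡₂ + 0)
1≢₂0 (mod₂ z p) with ℤP.<-cmp z (+ 0)
... | tri< z<0 _ _ = lia (z ∷ []) (λ z → z :< K 0 ⟹ K 1 :≡ K 0 :+ K 2 :* z ⟹ :⊥) z<0 p
... | tri≈ _ refl _ = lia [] (K 1 :≡ K 0 ⟹ :⊥) p
... | tri> _ _ z>0 = lia (z ∷ []) (λ z → K 0 :< z ⟹ K 1 :≡ K 0 :+ K 2 :* z ⟹ :⊥) z>0 p

sgn*-≡₂ : ∀ a x → 1 ≤ ∣ a ∣ → sgn a *ℤ x ≡₂ x
sgn*-≡₂ (+ suc _) x _ = ≡⇒≡₂ (ℤP.*-identityˡ x)
sgn*-≡₂ -[1+ _ ] x _ = ≡₂-trans (≡⇒≡₂ (ℤP.-1*i≡-i x)) (≡₂-neg x)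

sumTo-≡₂ : ∀ n {f g} → (∀ i → InRange n i → f i ≡₂ g i) → sumTo n f ≡₂ sumTo n g
sumTo-≡₂ zero p = ≡⇒≡₂ refl
sumTo-≡₂ (suc n) p = ≡₂-+ (sumTo-≡₂ n λ i r → p i (InRange-suc r)) (p (suc n) InRange-top)


∣⇒even : ∀ x → 2 ∣ℕ ∣ x ∣ → x ≡₂ + 0
∣⇒even x (divides q p) = mod₂ (sgn x *ℤ + q) (begin
  x ≡⟨ sgn-∣∣ x ⟨
  sgn x *ℤ + ∣ x ∣ ≡⟨ cong (λ k → sgn x *ℤ + k) p ⟩
  sgn x *ℤ + (q ℕ.* 2) ≡⟨ cong (sgn x *ℤ_) (ℤP.pos-* q 2) ⟩
  sgn x *ℤ (+ q *ℤ + 2) ≡⟨ lia (sgn x ∷ + q ∷ []) (λ s q → s :* (q :* K 2) :≡ K 0 :+ K 2 :* (s :* q)) ⟩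
  + 0 +ℤ + 2 *ℤ (sgn x *ℤ + q) ∎)
  where open ≡-Reasoning

even⇒∣ : ∀ x → x ≡₂ + 0 → 2 ∣ℕ ∣ x ∣
even⇒∣ x (mod₂ z p) = divides ∣ z ∣ (trans (cong ∣_∣ (trans p (ℤP.+-identityˡ (+ 2 *ℤ z))))
  (trans (ℤP.abs-* (+ 2) z) (ℕP.*-comm 2 ∣ z ∣)))

nb : ℤ → ℤ
nb a = if ltZ a (+ 0) then + 1 else + 0

-- `negCount` as an integer sum, whose parity can be computed termwise and which can be reindexed.
negs : ℕ → SP → ℤ
negs n w = sumTo n (λ i → nb (w i))

negCount-negs : ∀ n w → + negCount n w ≡ negs n w
negCount-negs zero w = refl
negCount-negs (suc n) w with ltZ (w (suc n)) (+ 0)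
... | true = cong (_+ℤ + 1) (negCount-negs n w)
... | false = cong (_+ℤ + 0) (negCount-negs n w)

record DPerm (n : ℕ) (w : SP) : Set where
  constructor dperm
  field
    sgnd : Signed n w
    even : negs n w ≡₂ + 0
open DPerm public

toDPerm : ∀ {n w} → IsDPerm n w → DPerm n w
toDPerm {n} {w} (s , p) = dperm (signed s)
  (subst (_≡₂ + 0) (negCount-negs n w) (∣⇒even (+ negCount n w) (m%n≡0⇒n∣m (negCount n w) 2 p)))

fromDPerm : ∀ {n w} → DPerm n w → IsDPerm n w
fromDPerm {n} {w} (dperm (signed s) p) = s ,
  n∣m⇒m%n≡0 (negCount n w) 2 (even⇒∣ (+ negCount n w) (subst (_≡₂ + 0) (sym (negCount-negs n w)) p))

nb-* : ∀ a b → 1 ≤ ∣ a ∣ → 1 ≤ ∣ b ∣ → nb (sgn a *ℤ b) ≡₂ nb a +ℤ nb b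
nb-* (+ suc _) b _ _ = ≡⇒≡₂ (trans (cong nb (ℤP.*-identityˡ b)) (sym (ℤP.+-identityˡ (nb b))))
nb-* -[1+ _ ] (+ suc _) _ _ = ≡⇒≡₂ refl
nb-* -[1+ _ ] -[1+ _ ] _ _ = mod₂ (- + 1) refl

negs-comp : ∀ {n w u} → Signed n w → Signed n u → negs n (comp w u) ≡₂ negs n u +ℤ negs n w
negs-comp {n} {w} {u} sw su = ≡₂-trans
  (sumTo-≡₂ n λ i r → nb-* (u i) (w ∣ u i ∣) (sp-≥1 su i r) (sp-≥1 sw _ (sp-maps su i r)))
  (≡⇒≡₂ (trans (sumTo-+ n (λ i → nb (u i)) (λ i → nb (w ∣ u i ∣)))
    (cong (negs n u +ℤ_) (sumTo-reindex n (λ i → ∣ u i ∣) (isSigned su) (λ i → nb (w i))))))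

comp-D : ∀ {n w u} → DPerm n w → DPerm n u → DPerm n (comp w u)
comp-D (dperm sw ew) (dperm su eu) = dperm (comp-sp sw su) (≡₂-trans (negs-comp sw su) (≡₂-+ eu ew))

-- A signed permutation changes the order of the coordinates, which the sum ignores, and their
-- signs, which parity ignores. Hence W preserves Q̌.
act-sum : ∀ {n w} → Signed n w → ∀ x → sumTo n (act n w x) ≡₂ sumTo n x
act-sum {n} {w} sp x = ≡₂-trans (≡⇒≡₂ (trans (sym (sumTo-reindex n (λ i → ∣ w i ∣) (isSigned sp) (act n w x)))
    (sumTo-cong n λ i r → act-∣∣ sp x i r)))
  (sumTo-≡₂ n λ i r → sgn*-≡₂ (w i) (x i) (sp-≥1 sp i r))

module _ {n : ℕ} (c : PR) (v : ValidPR n c) where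
  private
    ∣a∣ = ∣ a c ∣
    a≥1 : 1 ≤ ∣a∣
    a≥1 = proj₁ v
    a<j : ∣a∣ ℕ.< j c
    a<j = proj₁ (proj₂ v)
    ra = proj₁ (PR-ranges {n} c v)
    rj = proj₂ (PR-ranges {n} c v)
    a≢j : ¬ ∣a∣ ≡ j c
    a≢j p = ℕP.<⇒≢ a<j p

  refl-j : reflSP c (j c) ≡ - a c
  refl-j rewrite eqᵇ-true {j c} refl = refl

  refl-a : reflSP c ∣ a c ∣ ≡ - (sgn (a c) *ℤ + j c)
  refl-a rewrite eqᵇ-false a≢j | eqᵇ-true {∣a∣} refl = refl

  refl-other : ∀ i → ¬ i ≡ j c → ¬ i ≡ ∣ a c ∣ → reflSP c i ≡ + i
  refl-other i p q rewrite eqᵇ-false p | eqᵇ-false q = refl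

  private
    ∣refl-j∣ : ∣ reflSP c (j c) ∣ ≡ ∣a∣
    ∣refl-j∣ = trans (cong ∣_∣ refl-j) (ℤP.∣-i∣≡∣i∣ (a c))
    ∣refl-a∣ : ∣ reflSP c ∣a∣ ∣ ≡ j c
    ∣refl-a∣ = trans (cong ∣_∣ refl-a) (trans (ℤP.∣-i∣≡∣i∣ (sgn (a c) *ℤ + j c)) (∣sgn∣ (a c) (+ j c) a≥1))
    ∣refl-o∣ : ∀ i → ¬ i ≡ j c → ¬ i ≡ ∣a∣ → ∣ reflSP c i ∣ ≡ i
    ∣refl-o∣ i p q = cong ∣_∣ (refl-other i p q)

    invol : ∀ i → ∣ reflSP c ∣ reflSP c i ∣ ∣ ≡ i
    invol i with i ℕ.≟ j c | i ℕ.≟ ∣a∣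
    ... | yes refl | _ = trans (cong (λ k → ∣ reflSP c k ∣) ∣refl-j∣) ∣refl-a∣
    ... | no _ | yes refl = trans (cong (λ k → ∣ reflSP c k ∣) ∣refl-a∣) ∣refl-j∣
    ... | no p | no q = trans (cong (λ k → ∣ reflSP c k ∣) (∣refl-o∣ i p q)) (∣refl-o∣ i p q)

  refl-sp : Signed n (reflSP c)
  refl-sp = signed (rmaps , λ i j _ _ p → trans (sym (invol i)) (trans (cong (λ k → ∣ reflSP c k ∣) p) (invol j)))
    where
    rmaps : ∀ i → InRange n i → InRange n ∣ reflSP c i ∣
    rmaps i r with i ℕ.≟ j c | i ℕ.≟ ∣a∣
    ... | yes refl | _ = subst (InRange n) (sym ∣refl-j∣) ra
    ... | no _ | yes refl = subst (InRange n) (sym ∣refl-a∣) rj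
    ... | no p | no q = subst (InRange n) (sym (∣refl-o∣ i p q)) r

  -- A reflection has two negative entries if `a c` is positive, and none if it is negative.
  refl-D : DPerm n (reflSP c)
  refl-D = dperm refl-sp (≡₂-trans (≡⇒≡₂ total) (parity (a c) (j c) a≥1 (proj₁ rj)))
    where
    f g : ℕ → ℤ
    f i = if i ≡ᵇ j c then nb (- a c) else + 0
    g i = if i ≡ᵇ ∣a∣ then nb (- (sgn (a c) *ℤ + j c)) else + 0
    pointwise : ∀ i → InRange n i → nb (reflSP c i) ≡ f i +ℤ g i
    pointwise i r with i ℕ.≟ j c | i ℕ.≟ ∣a∣
    ... | yes refl | _ rewrite eqᵇ-true {j c} refl | eqᵇ-false (λ p → a≢j (sym p)) = sym (ℤP.+-identityʳ _)
    ... | no p | yes refl rewrite eqᵇ-false p | eqᵇ-true {∣a∣} refl = sym (ℤP.+-identityˡ _)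
    ... | no p | no q rewrite eqᵇ-false p | eqᵇ-false q = refl
    f-miss : ∀ i → ¬ i ≡ j c → f i ≡ + 0
    f-miss i p rewrite eqᵇ-false p = refl
    g-miss : ∀ i → ¬ i ≡ ∣a∣ → g i ≡ + 0
    g-miss i p rewrite eqᵇ-false p = refl
    f-hit : f (j c) ≡ nb (- a c)
    f-hit rewrite eqᵇ-true {j c} refl = refl
    g-hit : g ∣a∣ ≡ nb (- (sgn (a c) *ℤ + j c))
    g-hit rewrite eqᵇ-true {∣a∣} refl = refl
    total : negs n (reflSP c) ≡ nb (- a c) +ℤ nb (- (sgn (a c) *ℤ + j c))
    total = trans (sumTo-cong n pointwise) (trans (sumTo-+ n f g) (cong₂ _+ℤ_
      (trans (sumTo-single n (j c) rj λ i _ → f-miss i) f-hit)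
      (trans (sumTo-single n ∣a∣ ra λ i _ → g-miss i) g-hit)))
    parity : ∀ a j → 1 ≤ ∣ a ∣ → 1 ≤ j → nb (- a) +ℤ nb (- (sgn a *ℤ + j)) ≡₂ + 0
    parity (+ suc _) (suc _) _ _ = mod₂ (+ 1) refl
    parity -[1+ _ ] (suc _) _ _ = mod₂ (+ 0) refl

-- The Sommers condition, and arithmetic of multiples of h.

record Sommers (n : ℕ) (w : SP) (τ : ℕ → ℤ) : Set where
  field
    up≤ : ∀ i → 1 ≤ i → i ℕ.< n → τ (suc i) - τ i ≤ℤ + 1
    -- The inequality of labels says that the root of the wall, e at w (i + 1) minus e at w i, is
    -- positive.
    up= : ∀ i → 1 ≤ i → i ℕ.< n → τ (suc i) - τ i ≡ + 1 → w i <ℤ w (suc i)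
    lo≤ : τ 1 +ℤ τ 2 ≤ℤ + 1
    lo= : τ 1 +ℤ τ 2 ≡ + 1 → - w 1 <ℤ w 2
    -- Oriented upwards, the wall of the affine root has the level -(τ (n - 1) + τ n) - 1; that it
    -- is at most 1 becomes this bound by -2.
    hi≤ : - + 2 ≤ℤ τ (n ∸ 1) +ℤ τ n
    hi= : τ (n ∸ 1) +ℤ τ n ≡ - + 2 → w (n ∸ 1) <ℤ - w n

-- The one non-linear fact that comparisons of multiples of h need, since `lia` treats monomials of
-- degree two as atoms.
*-nonneg : ∀ {x y} → + 0 ≤ℤ x → + 0 ≤ℤ y → + 0 ≤ℤ x *ℤ y
*-nonneg {+ x} {y} p q = subst (_≤ℤ + x *ℤ y) (ℤP.*-zeroʳ (+ x)) (ℤP.*-monoˡ-≤-nonNeg (+ x) q)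

noMult : ∀ h y z → + 0 <ℤ y → y <ℤ h → ¬ h *ℤ z ≡ y
noMult h y z y>0 y<h p with z ℤP.≤? + 0
... | yes z≤0 = lia (h ∷ y ∷ z ∷ []) (λ h y z → K 0 :≤ h :* (K 0 :- z) ⟹ K 0 :< y ⟹ h :* z :≡ y ⟹ :⊥)
  (*-nonneg (ℤP.<⇒≤ (ℤP.<-trans y>0 y<h)) (ℤP.i≤j⇒0≤j-i z≤0)) y>0 p
... | no z>0 = lia (h ∷ y ∷ z ∷ []) (λ h y z → K 0 :≤ h :* (z :- K 1) ⟹ y :< h ⟹ h :* z :≡ y ⟹ :⊥)
  (*-nonneg (ℤP.<⇒≤ (ℤP.<-trans y>0 y<h)) (lia (z ∷ []) (λ z → K 0 :< z ⟹ K 0 :≤ z :- K 1) (ℤP.≰⇒> z>0))) y<h p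

smallMult : ∀ h z → - h <ℤ h *ℤ z → h *ℤ z <ℤ h → z ≡ + 0
smallMult h z lo hi with ℤP.<-cmp z (+ 0)
... | tri≈ _ p _ = p
... | tri< z<0 _ _ = ⊥-elim (lia (h ∷ z ∷ []) (λ h z → K 0 :≤ h :* (K 0 :- K 1 :- z) ⟹ :- h :< h :* z ⟹ :⊥)
  (*-nonneg h≥0 (lia (z ∷ []) (λ z → z :< K 0 ⟹ K 0 :≤ K 0 :- K 1 :- z) z<0)) lo)
  where
  h≥0 = lia (h ∷ h *ℤ z ∷ []) (λ h y → :- h :< y ⟹ y :< h ⟹ K 0 :≤ h) lo hi
... | tri> _ _ z>0 = ⊥-elim (lia (h ∷ z ∷ []) (λ h z → K 0 :≤ h :* (z :- K 1) ⟹ h :* z :< h ⟹ :⊥)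
  (*-nonneg h≥0 (lia (z ∷ []) (λ z → K 0 :< z ⟹ K 0 :≤ z :- K 1) z>0)) hi)
  where
  h≥0 = lia (h ∷ h *ℤ z ∷ []) (λ h y → :- h :< y ⟹ y :< h ⟹ K 0 :≤ h) lo hi

odd≢even : ∀ x y → ¬ x +ℤ x ≡ y +ℤ y +ℤ + 1
odd≢even x y p = 1≢₂0 (mod₂ (x - y) (lia (x ∷ y ∷ []) (λ x y → x :+ x :≡ y :+ y :+ K 1 ⟹ K 1 :≡ K 0 :+ K 2 :* (x :- y)) p))

pos∸1 : ∀ {i} → 1 ≤ i → + (i ∸ 1) ≡ + i - + 1
pos∸1 {suc i} _ = lia (+ i ∷ []) λ i → i :≡ K 1 :+ i :- K 1

abs-cases : ∀ a b → ∣ a ∣ ≡ ∣ b ∣ → a ≡ b ⊎ a ≡ - b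
abs-cases (+ _) (+ _) refl = inj₁ refl
abs-cases (+ _) -[1+ _ ] refl = inj₂ refl
abs-cases -[1+ _ ] (+ _) refl = inj₂ refl
abs-cases -[1+ _ ] -[1+ _ ] refl = inj₁ refl

data Signed± (n : ℕ) : ℤ → Set where
  plus : ∀ i → InRange n i → Signed± n (+ i)
  minus : ∀ i → InRange n i → Signed± n (- + i)

signed± : ∀ {n} a → InRange n ∣ a ∣ → Signed± n a
signed± (+ i) r = plus i r
signed± -[1+ i ] r = minus (suc i) r

range≤ : ∀ {n i} → InRange n i → + 1 ≤ℤ + i × + i ≤ℤ + n
range≤ (p , q) = +≤+ p , +≤+ q

range-eq : ∀ {i k} → + i ≡ + k → i ≡ k
range-eq = ℤP.+-injective

divide : ∀ h → + 0 <ℤ h → ∀ p → ∃[ d ] ∃[ r ] (p ≡ + r +ℤ h *ℤ d × + r <ℤ h)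
divide h h>0 p = p /ℕ H , p %ℕ H ,
  trans (subst (λ y → p ≡ + (p %ℕ H) +ℤ (p /ℕ H) *ℤ y) H≡ (a≡a%ℕn+[a/ℕn]*n p H)) (cong (+ (p %ℕ H) +ℤ_) (ℤP.*-comm (p /ℕ H) h)) ,
  subst (+ (p %ℕ H) <ℤ_) H≡ (ℤ.+<+ (n%ℕd<d p H))
  where
  open import Data.Integer.DivMod using (_/ℕ_; _%ℕ_; a≡a%ℕn+[a/ℕn]*n; n%ℕd<d)
  H : ℕ
  H = ∣ h ∣
  H≡ : + H ≡ h
  H≡ = ℤP.0≤i⇒+∣i∣≡i (ℤP.<⇒≤ h>0)
  instance
    H≢0 : ℕ.NonZero H
    H≢0 = ℕ.≢-nonZero λ q → ℤP.<-irrefl (sym (ℤP.∣i∣≡0⇒i≡0 q)) h>0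

-- Residues of the signed rows modulo h, and the walls of an alcove.

module Frame (n : ℕ) (n≥3 : 3 ≤ n) (h : ℤ) (h≡ : h ≡ + 2 *ℤ + n - + 2) (w : SP) (x τ : ℕ → ℤ)
  (x-eq : ∀ i → InRange n i → x i ≡ + i - + 1 +ℤ h *ℤ τ i) where

  X : ℤ → ℤ
  X = val x

  X-neg : ∀ a → X (- a) ≡ - X a
  X-neg = val-neg x

  X+ : ∀ i → InRange n i → X (+ i) ≡ + i - + 1 +ℤ h *ℤ τ i
  X+ i r = trans (val-+ x i (proj₁ r)) (x-eq i r)

  X- : ∀ i → InRange n i → X (- + i) ≡ - (+ i - + 1 +ℤ h *ℤ τ i)
  X- i r = trans (X-neg (+ i)) (cong -_ (X+ i r))

  n≥3ℤ : + 3 ≤ℤ + n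
  n≥3ℤ = +≤+ n≥3

  h>0 : + 0 <ℤ h
  h>0 = lia (h ∷ + n ∷ []) (λ h n → h :≡ K 2 :* n :- K 2 ⟹ K 3 :≤ n ⟹ K 0 :< h) h≡ n≥3ℤ

  neg-range : ∀ {a} → InRange n ∣ a ∣ → InRange n ∣ - a ∣
  neg-range {a} = subst (InRange n) (sym (ℤP.∣-i∣≡∣i∣ a))

  -- Because h is even. It keeps -a from being the neighbour of a.
  not-odd : ∀ a m → ¬ X a +ℤ X a ≡ h *ℤ m +ℤ + 1
  not-odd a m p = odd≢even (X a) ((+ n - + 1) *ℤ m) (trans p
    (lia (+ n ∷ h ∷ m ∷ h *ℤ m ∷ []) (λ n h m y → y :≡ (K 2 :* n :- K 2) :* m ⟹ y :+ K 1 :≡ (n :- K 1) :* m :+ (n :- K 1) :* m :+ K 1)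
      (cong (_*ℤ m) h≡)))

  -- Row i has the residue i - 1, which covers 0, ..., n - 1; row -i has the residue h - (i - 1),
  -- which covers the rest.
  onClass : ∀ p → ∃[ a ] ∃[ d ] (InRange n ∣ a ∣ × X a ≡ p +ℤ h *ℤ d)
  onClass p with divide h h>0 p
  ... | t , r , p≡ , r<h = go (+ r) refl (+≤+ z≤n) r<h
    where
    go : ∀ r' → r' ≡ + r → + 0 ≤ℤ r' → r' <ℤ h → ∃[ a ] ∃[ d ] (InRange n ∣ a ∣ × X a ≡ p +ℤ h *ℤ d)
    go r' er r≥0 r<h with r' ℤP.<? + n
    ... | yes r<n = + suc r , τ (suc r) - t , rng , (begin
      X (+ suc r) ≡⟨ X+ (suc r) rng ⟩
      + suc r - + 1 +ℤ h *ℤ τ (suc r) ≡⟨ lia (+ r ∷ h ∷ τ (suc r) ∷ t ∷ p ∷ []) (λ r h τ t p → p :≡ r :+ h :* t ⟹ K 1 :+ r :- K 1 :+ h :* τ :≡ p :+ h :* (τ :- t)) p≡ ⟩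
      p +ℤ h *ℤ (τ (suc r) - t) ∎)
      where
      open ≡-Reasoning
      rng : InRange n (suc r)
      rng = s≤s z≤n , ℤP.drop‿+<+ (subst (_<ℤ + n) er r<n)
    ... | no r≮n = - + i , - + 1 - τ i - t , neg-range {+ i} rng , (begin
      X (- + i) ≡⟨ X- i rng ⟩
      - (+ i - + 1 +ℤ h *ℤ τ i) ≡⟨ lia (+ i ∷ r' ∷ h ∷ τ i ∷ t ∷ p ∷ []) (λ i r h τ t p → i :≡ h :- r :+ K 1 ⟹ p :≡ r :+ h :* t ⟹ :- (i :- K 1 :+ h :* τ) :≡ p :+ h :* (:- K 1 :- τ :- t)) i≡ (trans p≡ (cong (_+ℤ h *ℤ t) (sym er))) ⟩
      p +ℤ h *ℤ (- + 1 - τ i - t) ∎)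
      where
      open ≡-Reasoning
      i = ∣ h - r' +ℤ + 1 ∣
      i≡ : + i ≡ h - r' +ℤ + 1
      i≡ = ℤP.0≤i⇒+∣i∣≡i (lia (h ∷ r' ∷ []) (λ h r → r :< h ⟹ K 0 :≤ h :- r :+ K 1) r<h)
      rng : InRange n i
      rng = ℤP.drop‿+≤+ (subst (+ 1 ≤ℤ_) (sym i≡) (lia (h ∷ r' ∷ []) (λ h r → r :< h ⟹ K 1 :≤ h :- r :+ K 1) r<h))
          , ℤP.drop‿+≤+ (subst (_≤ℤ + n) (sym i≡) (lia (h ∷ r' ∷ + n ∷ []) (λ h r n → n :≤ r ⟹ h :≡ K 2 :* n :- K 2 ⟹ h :- r :+ K 1 :≤ n) (ℤP.≮⇒≥ r≮n) h≡))

  -- For equal signs the residues differ by k - i, which is non-zero and below h in absolute value;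
  -- for opposite signs by i + k - 2 up to sign, strictly between 0 and h. So `pt b` lies on no
  -- hyperplane of the affine arrangement.
  generic : ∀ a b → InRange n ∣ a ∣ → InRange n ∣ b ∣ → ¬ ∣ a ∣ ≡ ∣ b ∣ → ∀ m → ¬ X b - X a ≡ h *ℤ m
  generic a b ra rb = go (signed± a ra) (signed± b rb)
    where
    parallel : ∀ i k → InRange n i → InRange n k → ¬ i ≡ k → ∀ z → ¬ h *ℤ z ≡ + k - + i
    parallel i k ri rk ne z p = ne (range-eq (lia (+ i ∷ + k ∷ h ∷ z ∷ []) (λ i k h z → h :* z :≡ k :- i ⟹ h :* z :≡ h :* K 0 ⟹ i :≡ k) p (cong (h *ℤ_) z≡0)))
      where
      z≡0 : z ≡ + 0
      z≡0 = smallMult h z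
        (lia (h ∷ h *ℤ z ∷ + i ∷ + k ∷ + n ∷ []) (λ h y i k n → h :≡ K 2 :* n :- K 2 ⟹ K 3 :≤ n ⟹ y :≡ k :- i ⟹ K 1 :≤ k ⟹ i :≤ n ⟹ :- h :< y) h≡ n≥3ℤ p (+≤+ (proj₁ rk)) (+≤+ (proj₂ ri)))
        (lia (h ∷ h *ℤ z ∷ + i ∷ + k ∷ + n ∷ []) (λ h y i k n → h :≡ K 2 :* n :- K 2 ⟹ K 3 :≤ n ⟹ y :≡ k :- i ⟹ K 1 :≤ i ⟹ k :≤ n ⟹ y :< h) h≡ n≥3ℤ p (+≤+ (proj₁ ri)) (+≤+ (proj₂ rk)))
    crossed : ∀ i k → InRange n i → InRange n k → ¬ i ≡ k → ∀ z → ¬ h *ℤ z ≡ + k +ℤ + i - + 2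
    crossed i k ri rk ne z = bound (ℕP.<-cmp i k)
      where
      bound : Tri (i ℕ.< k) (i ≡ k) (k ℕ.< i) → ¬ h *ℤ z ≡ + k +ℤ + i - + 2
      bound (tri≈ _ q _) = ⊥-elim (ne q)
      bound (tri< q _ _) = noMult h (+ k +ℤ + i - + 2) z
        (lia (+ i ∷ + k ∷ []) (λ i k → K 1 :+ i :≤ k ⟹ K 1 :≤ i ⟹ K 0 :< k :+ i :- K 2) (+≤+ q) (+≤+ (proj₁ ri)))
        (lia (+ i ∷ + k ∷ + n ∷ h ∷ []) (λ i k n h → K 1 :+ i :≤ k ⟹ k :≤ n ⟹ h :≡ K 2 :* n :- K 2 ⟹ k :+ i :- K 2 :< h) (+≤+ q) (+≤+ (proj₂ rk)) h≡)
      bound (tri> _ _ q) = noMult h (+ k +ℤ + i - + 2) z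
        (lia (+ i ∷ + k ∷ []) (λ i k → K 1 :+ k :≤ i ⟹ K 1 :≤ k ⟹ K 0 :< k :+ i :- K 2) (+≤+ q) (+≤+ (proj₁ rk)))
        (lia (+ i ∷ + k ∷ + n ∷ h ∷ []) (λ i k n h → K 1 :+ k :≤ i ⟹ i :≤ n ⟹ h :≡ K 2 :* n :- K 2 ⟹ k :+ i :- K 2 :< h) (+≤+ q) (+≤+ (proj₂ ri)) h≡)
    go : ∀ {a b} → Signed± n a → Signed± n b → ¬ ∣ a ∣ ≡ ∣ b ∣ → ∀ m → ¬ X b - X a ≡ h *ℤ m
    go (plus i ri) (plus k rk) ne m p = parallel i k ri rk ne (m - (τ k - τ i))
      (lia (X (+ k) ∷ X (+ i) ∷ h ∷ m ∷ + k ∷ + i ∷ τ k ∷ τ i ∷ [])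
        (λ y x h m k i s t → y :- x :≡ h :* m ⟹ y :≡ k :- K 1 :+ h :* s ⟹ x :≡ i :- K 1 :+ h :* t ⟹ h :* (m :- (s :- t)) :≡ k :- i) p (X+ k rk) (X+ i ri))
    go (minus i ri) (minus k rk) ne m p = parallel k i rk ri (λ q → ne (trans (ℤP.∣-i∣≡∣i∣ (+ i)) (trans (sym q) (sym (ℤP.∣-i∣≡∣i∣ (+ k)))))) (m - (τ i - τ k))
      (lia (X (- + k) ∷ X (- + i) ∷ h ∷ m ∷ + k ∷ + i ∷ τ k ∷ τ i ∷ [])
        (λ y x h m k i s t → y :- x :≡ h :* m ⟹ y :≡ :- (k :- K 1 :+ h :* s) ⟹ x :≡ :- (i :- K 1 :+ h :* t) ⟹ h :* (m :- (t :- s)) :≡ i :- k) p (X- k rk) (X- i ri))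
    go (minus i ri) (plus k rk) ne m p = crossed i k ri rk (λ q → ne (trans (ℤP.∣-i∣≡∣i∣ (+ i)) q)) (m - (τ k +ℤ τ i))
      (lia (X (+ k) ∷ X (- + i) ∷ h ∷ m ∷ + k ∷ + i ∷ τ k ∷ τ i ∷ [])
        (λ y x h m k i s t → y :- x :≡ h :* m ⟹ y :≡ k :- K 1 :+ h :* s ⟹ x :≡ :- (i :- K 1 :+ h :* t) ⟹ h :* (m :- (s :+ t)) :≡ k :+ i :- K 2) p (X+ k rk) (X- i ri))
    go (plus i ri) (minus k rk) ne m p = crossed i k ri rk (λ q → ne (trans q (sym (ℤP.∣-i∣≡∣i∣ (+ k))))) (- m - (τ k +ℤ τ i))
      (lia (X (- + k) ∷ X (+ i) ∷ h ∷ m ∷ + k ∷ + i ∷ τ k ∷ τ i ∷ [])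
        (λ y x h m k i s t → y :- x :≡ h :* m ⟹ y :≡ :- (k :- K 1 :+ h :* s) ⟹ x :≡ i :- K 1 :+ h :* t ⟹ h :* (:- m :- (s :+ t)) :≡ k :+ i :- K 2) p (X- k rk) (X+ i ri))

  -- The pairs of signed rows whose values differ by 1 modulo h are the walls of the alcove.
  data Adjacent : ℤ → ℤ → ℤ → Set where
    up⁺ : ∀ i {m} → InRange n i → InRange n (suc i) → m ≡ τ (suc i) - τ i → Adjacent (+ i) (+ suc i) m
    up⁻ : ∀ i {m} → InRange n i → InRange n (suc i) → m ≡ τ (suc i) - τ i → Adjacent (- + suc i) (- + i) m
    lo⁺ : ∀ {m} → m ≡ τ 1 +ℤ τ 2 → Adjacent (- + 1) (+ 2) m
    lo⁻ : ∀ {m} → m ≡ τ 1 +ℤ τ 2 → Adjacent (- + 2) (+ 1) m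
    hi⁺ : ∀ {m} → m ≡ - (τ (n ∸ 1) +ℤ τ n) - + 1 → Adjacent (+ (n ∸ 1)) (- + n) m
    hi⁻ : ∀ {m} → m ≡ - (τ (n ∸ 1) +ℤ τ n) - + 1 → Adjacent (+ n) (- + (n ∸ 1)) m

  private
    n-pair : ∀ {i k} → + i ≡ + n → + i +ℤ + k ≡ + 2 *ℤ + n - + 1 → i ≡ n × k ≡ n ∸ 1
    n-pair {i} {k} p q = range-eq p , range-eq (trans
      (lia (+ i ∷ + k ∷ + n ∷ []) (λ i k n → i :≡ n ⟹ i :+ k :≡ K 2 :* n :- K 1 ⟹ k :≡ n :- K 1) p q)
      (sym (pos∸1 (ℕP.≤-trans (s≤s z≤n) n≥3))))

    h*0≡ : ∀ {z y} → z ≡ + 0 → h *ℤ z ≡ y → + 0 ≡ y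
    h*0≡ refl p = trans (sym (ℤP.*-zeroʳ h)) p

    i-j≡0⇒i≡j : ∀ {i j} → i - j ≡ + 0 → i ≡ j
    i-j≡0⇒i≡j {i} {j} = lia (i ∷ j ∷ []) λ i j → i :- j :≡ K 0 ⟹ i :≡ j


  -- In all four sign patterns the terms with levels are collected into a multiple of h, and what
  -- remains is below h in absolute value. Hence both vanish, which determines the level as well as
  -- the two rows.
  adjacent⁺⁺ : ∀ i k m → InRange n i → InRange n k → X (+ k) - X (+ i) ≡ h *ℤ m +ℤ + 1 → Adjacent (+ i) (+ k) m
  adjacent⁺⁺ i k m ri rk p = case1 (range≤ ri) (range≤ rk)
    where
    q : h *ℤ (m - (τ k - τ i)) ≡ + k - + i - + 1
    q = lia (X (+ k) ∷ X (+ i) ∷ h ∷ m ∷ + k ∷ + i ∷ τ k ∷ τ i ∷ [])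
      (λ xk xi h m k i tk ti → xk :- xi :≡ h :* m :+ K 1 ⟹ xk :≡ k :- K 1 :+ h :* tk ⟹ xi :≡ i :- K 1 :+ h :* ti ⟹ h :* (m :- (tk :- ti)) :≡ k :- i :- K 1)
      p (X+ k rk) (X+ i ri)
    case1 : + 1 ≤ℤ + i × + i ≤ℤ + n → + 1 ≤ℤ + k × + k ≤ℤ + n → Adjacent (+ i) (+ k) m
    case1 (i1 , i2) (k1 , k2) = fin (range-eq {k} {suc i} k≡)
      where
      z0 : m - (τ k - τ i) ≡ + 0
      z0 = smallMult h (m - (τ k - τ i))
        (lia (h ∷ h *ℤ (m - (τ k - τ i)) ∷ + k ∷ + i ∷ + n ∷ []) (λ h y k i n → h :≡ K 2 :* n :- K 2 ⟹ y :≡ k :- i :- K 1 ⟹ K 1 :≤ k ⟹ i :≤ n ⟹ K 3 :≤ n ⟹ :- h :< y) h≡ q k1 i2 n≥3ℤ)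
        (lia (h ∷ h *ℤ (m - (τ k - τ i)) ∷ + k ∷ + i ∷ + n ∷ []) (λ h y k i n → h :≡ K 2 :* n :- K 2 ⟹ y :≡ k :- i :- K 1 ⟹ K 1 :≤ i ⟹ k :≤ n ⟹ K 3 :≤ n ⟹ y :< h) h≡ q i1 k2 n≥3ℤ)
      k≡ : + k ≡ + 1 +ℤ + i
      k≡ = lia (+ k ∷ + i ∷ []) (λ k i → K 0 :≡ k :- i :- K 1 ⟹ k :≡ K 1 :+ i) (h*0≡ z0 q)
      fin : k ≡ suc i → Adjacent (+ i) (+ k) m
      fin refl = up⁺ i ri rk (i-j≡0⇒i≡j z0)

  adjacent⁻⁻ : ∀ i k m → InRange n i → InRange n k → X (- + k) - X (- + i) ≡ h *ℤ m +ℤ + 1 → Adjacent (- + i) (- + k) m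
  adjacent⁻⁻ i k m ri rk p = case2 (range≤ ri) (range≤ rk)
    where
    q : h *ℤ (m - (τ i - τ k)) ≡ + i - + k - + 1
    q = lia (X (- + k) ∷ X (- + i) ∷ h ∷ m ∷ + k ∷ + i ∷ τ k ∷ τ i ∷ [])
      (λ xk xi h m k i tk ti → xk :- xi :≡ h :* m :+ K 1 ⟹ xk :≡ :- (k :- K 1 :+ h :* tk) ⟹ xi :≡ :- (i :- K 1 :+ h :* ti) ⟹ h :* (m :- (ti :- tk)) :≡ i :- k :- K 1)
      p (X- k rk) (X- i ri)
    case2 : + 1 ≤ℤ + i × + i ≤ℤ + n → + 1 ≤ℤ + k × + k ≤ℤ + n → Adjacent (- + i) (- + k) m
    case2 (i1 , i2) (k1 , k2) = fin (range-eq {i} {suc k} k≡)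
      where
      z0 : m - (τ i - τ k) ≡ + 0
      z0 = smallMult h (m - (τ i - τ k))
        (lia (h ∷ h *ℤ (m - (τ i - τ k)) ∷ + i ∷ + k ∷ + n ∷ []) (λ h y k i n → h :≡ K 2 :* n :- K 2 ⟹ y :≡ k :- i :- K 1 ⟹ K 1 :≤ k ⟹ i :≤ n ⟹ K 3 :≤ n ⟹ :- h :< y) h≡ q i1 k2 n≥3ℤ)
        (lia (h ∷ h *ℤ (m - (τ i - τ k)) ∷ + i ∷ + k ∷ + n ∷ []) (λ h y k i n → h :≡ K 2 :* n :- K 2 ⟹ y :≡ k :- i :- K 1 ⟹ K 1 :≤ i ⟹ k :≤ n ⟹ K 3 :≤ n ⟹ y :< h) h≡ q k1 i2 n≥3ℤ)
      k≡ : + i ≡ + 1 +ℤ + k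
      k≡ = lia (+ i ∷ + k ∷ []) (λ k i → K 0 :≡ k :- i :- K 1 ⟹ k :≡ K 1 :+ i) (h*0≡ z0 q)
      fin : i ≡ suc k → Adjacent (- + i) (- + k) m
      fin refl = up⁻ k rk ri (i-j≡0⇒i≡j z0)

  adjacent⁻⁺ : ∀ i k m → InRange n i → InRange n k → X (+ k) - X (- + i) ≡ h *ℤ m +ℤ + 1 → Adjacent (- + i) (+ k) m
  adjacent⁻⁺ i k m ri rk p = case3 (range≤ ri) (range≤ rk)
    where
    q : h *ℤ (m - (τ k +ℤ τ i)) ≡ + k +ℤ + i - + 3
    q = lia (X (+ k) ∷ X (- + i) ∷ h ∷ m ∷ + k ∷ + i ∷ τ k ∷ τ i ∷ [])
      (λ xk xi h m k i tk ti → xk :- xi :≡ h :* m :+ K 1 ⟹ xk :≡ k :- K 1 :+ h :* tk ⟹ xi :≡ :- (i :- K 1 :+ h :* ti) ⟹ h :* (m :- (tk :+ ti)) :≡ k :+ i :- K 3)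
      p (X+ k rk) (X- i ri)
    case3 : + 1 ≤ℤ + i × + i ≤ℤ + n → + 1 ≤ℤ + k × + k ≤ℤ + n → Adjacent (- + i) (+ k) m
    case3 (i1 , i2) (k1 , k2) = fin (ℕP.≤-<-connex k 1)
      where
      z0 : m - (τ k +ℤ τ i) ≡ + 0
      z0 = smallMult h (m - (τ k +ℤ τ i))
        (lia (h ∷ h *ℤ (m - (τ k +ℤ τ i)) ∷ + k ∷ + i ∷ + n ∷ []) (λ h y k i n → h :≡ K 2 :* n :- K 2 ⟹ y :≡ k :+ i :- K 3 ⟹ K 1 :≤ k ⟹ K 1 :≤ i ⟹ K 3 :≤ n ⟹ :- h :< y) h≡ q k1 i1 n≥3ℤ)
        (lia (h ∷ h *ℤ (m - (τ k +ℤ τ i)) ∷ + k ∷ + i ∷ + n ∷ []) (λ h y k i n → h :≡ K 2 :* n :- K 2 ⟹ y :≡ k :+ i :- K 3 ⟹ i :≤ n ⟹ k :≤ n ⟹ y :< h) h≡ q i2 k2)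
      ki : + k +ℤ + i ≡ + 3
      ki = lia (+ k ∷ + i ∷ []) (λ k i → K 0 :≡ k :+ i :- K 3 ⟹ k :+ i :≡ K 3) (h*0≡ z0 q)
      m≡ = i-j≡0⇒i≡j {m} {τ k +ℤ τ i} z0
      fin12 : k ≡ 1 → i ≡ 2 → Adjacent (- + i) (+ k) m
      fin12 refl refl = lo⁻ m≡
      fin21 : k ≡ 2 → i ≡ 1 → Adjacent (- + i) (+ k) m
      fin21 refl refl = lo⁺ (trans m≡ (ℤP.+-comm (τ 2) (τ 1)))
      fin : k ≤ 1 ⊎ 1 ℕ.< k → Adjacent (- + i) (+ k) m
      fin (inj₁ k≤1) = fin12
        (range-eq (lia (+ k ∷ []) (λ k → k :≤ K 1 ⟹ K 1 :≤ k ⟹ k :≡ K 1) (+≤+ k≤1) k1))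
        (range-eq (lia (+ i ∷ + k ∷ []) (λ i k → k :≤ K 1 ⟹ K 1 :≤ k ⟹ k :+ i :≡ K 3 ⟹ i :≡ K 2) (+≤+ k≤1) k1 ki))
      fin (inj₂ 1<k) = fin21
        (range-eq (lia (+ i ∷ + k ∷ []) (λ i k → K 2 :≤ k ⟹ K 1 :≤ i ⟹ k :+ i :≡ K 3 ⟹ k :≡ K 2) (+≤+ 1<k) i1 ki))
        (range-eq (lia (+ i ∷ + k ∷ []) (λ i k → K 2 :≤ k ⟹ K 1 :≤ i ⟹ k :+ i :≡ K 3 ⟹ i :≡ K 1) (+≤+ 1<k) i1 ki))

  adjacent⁺⁻ : ∀ i k m → InRange n i → InRange n k → X (- + k) - X (+ i) ≡ h *ℤ m +ℤ + 1 → Adjacent (+ i) (- + k) m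
  adjacent⁺⁻ i k m ri rk p = case4 (range≤ ri) (range≤ rk)
    where
    q : h *ℤ (- + 1 - m - (τ k +ℤ τ i)) ≡ + k +ℤ + i - + 1 - h
    q = lia (X (- + k) ∷ X (+ i) ∷ h ∷ m ∷ + k ∷ + i ∷ τ k ∷ τ i ∷ [])
      (λ xk xi h m k i tk ti → xk :- xi :≡ h :* m :+ K 1 ⟹ xk :≡ :- (k :- K 1 :+ h :* tk) ⟹ xi :≡ i :- K 1 :+ h :* ti ⟹ h :* (:- K 1 :- m :- (tk :+ ti)) :≡ k :+ i :- K 1 :- h)
      p (X- k rk) (X+ i ri)
    case4 : + 1 ≤ℤ + i × + i ≤ℤ + n → + 1 ≤ℤ + k × + k ≤ℤ + n → Adjacent (+ i) (- + k) m
    case4 (i1 , i2) (k1 , k2) = fin (+ i ℤP.≟ + n)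
      where
      z0 : - + 1 - m - (τ k +ℤ τ i) ≡ + 0
      z0 = smallMult h (- + 1 - m - (τ k +ℤ τ i))
        (lia (h ∷ h *ℤ (- + 1 - m - (τ k +ℤ τ i)) ∷ + k ∷ + i ∷ + n ∷ []) (λ h y k i n → h :≡ K 2 :* n :- K 2 ⟹ y :≡ k :+ i :- K 1 :- h ⟹ K 1 :≤ k ⟹ K 1 :≤ i ⟹ K 3 :≤ n ⟹ :- h :< y) h≡ q k1 i1 n≥3ℤ)
        (lia (h ∷ h *ℤ (- + 1 - m - (τ k +ℤ τ i)) ∷ + k ∷ + i ∷ + n ∷ []) (λ h y k i n → h :≡ K 2 :* n :- K 2 ⟹ y :≡ k :+ i :- K 1 :- h ⟹ i :≤ n ⟹ k :≤ n ⟹ K 3 :≤ n ⟹ y :< h) h≡ q i2 k2 n≥3ℤ)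
      ki : + k +ℤ + i ≡ + 2 *ℤ + n - + 1
      ki = lia (h ∷ + n ∷ + k ∷ + i ∷ []) (λ h n k i → h :≡ K 2 :* n :- K 2 ⟹ K 0 :≡ k :+ i :- K 1 :- h ⟹ k :+ i :≡ K 2 :* n :- K 1) h≡ (h*0≡ z0 q)
      m≡ : m ≡ - (τ k +ℤ τ i) - + 1
      m≡ = lia (m ∷ τ k ∷ τ i ∷ []) (λ m s t → :- K 1 :- m :- (s :+ t) :≡ K 0 ⟹ m :≡ :- (s :+ t) :- K 1) z0
      fin : Dec (+ i ≡ + n) → Adjacent (+ i) (- + k) m
      fin (yes i≡n) = let i' , k' = n-pair i≡n (trans (ℤP.+-comm (+ i) (+ k)) ki) in
        finish i' k' m≡
        where
        finish : i ≡ n → k ≡ n ∸ 1 → m ≡ - (τ k +ℤ τ i) - + 1 → Adjacent (+ i) (- + k) m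
        finish refl refl e = hi⁻ e
      fin (no i≢n) = let k' , i' = n-pair {k} {i} (lia (+ i ∷ + k ∷ + n ∷ []) (λ i k n → i :≤ n :- K 1 ⟹ k :≤ n ⟹ k :+ i :≡ K 2 :* n :- K 1 ⟹ k :≡ n)
                               (lia (+ i ∷ + n ∷ []) (λ i n → i :< n ⟹ i :≤ n :- K 1) (ℤP.≤∧≢⇒< i2 i≢n)) k2 ki) ki in
        finish k' i' (trans m≡ (cong (λ y → - y - + 1) (ℤP.+-comm (τ k) (τ i))))
        where
        finish : k ≡ n → i ≡ n ∸ 1 → m ≡ - (τ i +ℤ τ k) - + 1 → Adjacent (+ i) (- + k) m
        finish refl refl e = hi⁺ e

  adjacent : ∀ a b m → InRange n ∣ a ∣ → InRange n ∣ b ∣ → X b - X a ≡ h *ℤ m +ℤ + 1 → Adjacent a b m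
  adjacent a b m ra rb p = dispatch (signed± a ra) (signed± b rb) p
    where
    dispatch : ∀ {a b} → Signed± n a → Signed± n b → X b - X a ≡ h *ℤ m +ℤ + 1 → Adjacent a b m
    dispatch (plus i ri) (plus k rk) = adjacent⁺⁺ i k m ri rk
    dispatch (minus i ri) (minus k rk) = adjacent⁻⁻ i k m ri rk
    dispatch (minus i ri) (plus k rk) = adjacent⁻⁺ i k m ri rk
    dispatch (plus i ri) (minus k rk) = adjacent⁺⁻ i k m ri rk

  module Walls (som : Sommers n w τ) where
    open Sommers som

    Wall : ℤ → ℤ → ℤ → Set
    Wall a b m = m ≤ℤ + 1 × (m ≡ + 1 → val w a <ℤ val w b)

    private
      val-w+ : ∀ i → 1 ≤ i → val w (+ i) ≡ w i
      val-w+ i r = val-+ w i r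

      val-w- : ∀ i → 1 ≤ i → val w (- + i) ≡ - w i
      val-w- i r = trans (val-neg w (+ i)) (cong -_ (val-w+ i r))

      subst-wall : ∀ {a b m y z} → val w a ≡ y → val w b ≡ z → m ≤ℤ + 1 × (m ≡ + 1 → y <ℤ z) → Wall a b m
      subst-wall refl refl p = p

      n≥1 : 1 ≤ n
      n≥1 = ℕP.≤-trans (s≤s z≤n) n≥3

      p≥1 : 1 ≤ n ∸ 1
      p≥1 = ℕP.m+n≤o⇒m≤o∸n 1 (ℕP.≤-trans (s≤s (s≤s z≤n)) n≥3)

      hi-wall : ∀ {m} → m ≡ - (τ (n ∸ 1) +ℤ τ n) - + 1 → m ≤ℤ + 1 × (m ≡ + 1 → w (n ∸ 1) <ℤ - w n)
      hi-wall {m} e =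
          lia (m ∷ τ (n ∸ 1) ∷ τ n ∷ []) (λ m s t → m :≡ :- (s :+ t) :- K 1 ⟹ :- K 2 :≤ s :+ t ⟹ m :≤ K 1) e hi≤
        , λ m1 → hi= (lia (m ∷ τ (n ∸ 1) ∷ τ n ∷ []) (λ m s t → m :≡ :- (s :+ t) :- K 1 ⟹ m :≡ K 1 ⟹ s :+ t :≡ :- K 2) e m1)

    -- The mirrored pair (-b , -a) has the same level and the same order of labels, so that each
    -- pair of fields of `Sommers` serves two adjacent pairs.
    wall : ∀ a b m → InRange n ∣ a ∣ → InRange n ∣ b ∣ → X b - X a ≡ h *ℤ m +ℤ + 1 → Wall a b m
    wall a b m ra rb e = go (adjacent a b m ra rb e)
      where
      go : ∀ {a b m} → Adjacent a b m → Wall a b m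
      go (up⁺ i ri@(p , _) (_ , q) refl) = subst-wall {+ i} {+ suc i} (val-w+ i p) (val-w+ (suc i) (s≤s z≤n)) (up≤ i p q , up= i p q)
      go (up⁻ i ri@(p , _) (_ , q) refl) = subst-wall { - + suc i} { - + i} (val-w- (suc i) (s≤s z≤n)) (val-w- i p) (up≤ i p q , λ m1 → ℤP.neg-mono-< (up= i p q m1))
      go (lo⁺ refl) = subst-wall { - + 1} {+ 2} (val-w- 1 (s≤s z≤n)) (val-w+ 2 (s≤s z≤n)) (lo≤ , lo=)
      go (lo⁻ refl) = subst-wall { - + 2} {+ 1} (val-w- 2 (s≤s z≤n)) (val-w+ 1 (s≤s z≤n))
        (lo≤ , λ m1 → lia (w 1 ∷ w 2 ∷ []) (λ y z → :- y :< z ⟹ :- z :< y) (lo= m1))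
      go (hi⁺ m≡) = subst-wall {+ (n ∸ 1)} { - + n} (val-w+ (n ∸ 1) p≥1) (val-w- n n≥1) (hi-wall m≡)
      go (hi⁻ m≡) = subst-wall {+ n} { - + (n ∸ 1)} (val-w+ n n≥1) (val-w- (n ∸ 1) p≥1)
        (proj₁ (hi-wall m≡) , λ m1 → lia (w n ∷ w (n ∸ 1) ∷ []) (λ y z → z :< :- y ⟹ y :< :- z) (proj₂ (hi-wall m≡) m1))

-- The discrete intermediate value argument.

module Levels (n : ℕ) (n≥3 : 3 ≤ n) (h : ℤ) (h≡ : h ≡ + 2 *ℤ + n - + 2) (w : SP) (x τ : ℕ → ℤ)
  (x-eq : ∀ i → InRange n i → x i ≡ + i - + 1 +ℤ h *ℤ τ i) (som : Sommers n w τ) where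

  open Frame n n≥3 h h≡ w x τ x-eq public
  open Walls som public

  -- The signed row a lies over p at level d.
  On : ℤ → ℤ → ℤ → Set
  On a p d = InRange n ∣ a ∣ × X a ≡ p +ℤ h *ℤ d

  On-cast : ∀ a d {p p'} → p ≡ p' → On a p d → On a p' d
  On-cast a d refl o = o

  over : ∀ a → InRange n ∣ a ∣ → On a (X a) (+ 0)
  over a r = r , lia (X a ∷ h ∷ []) λ x h → x :≡ x :+ h :* K 0

  -- Rows over consecutive classes differ by 1 modulo h, so they form a wall, and walls have level
  -- at most 1.
  step : ∀ a b p d d' → On a p d → On b (p +ℤ + 1) d' → d' ≤ℤ d +ℤ + 1
  step a b p d d' (ra , ea) (rb , eb) = lia (d ∷ d' ∷ []) (λ d d' → d' :- d :≤ K 1 ⟹ d' :≤ d :+ K 1)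
    (proj₁ (wall a b (d' - d) ra rb
      (lia (X a ∷ X b ∷ p ∷ h ∷ d ∷ d' ∷ []) (λ xa xb p h d d' → xa :≡ p :+ h :* d ⟹ xb :≡ p :+ K 1 :+ h :* d' ⟹ xb :- xa :≡ h :* (d' :- d) :+ K 1) ea eb)))

  -- Levels increase by at most one from a class to the next, so a walk from below 0 to above 0 meets 0.
  walk : ∀ k a p d b d' → On a p d → d <ℤ + 0 → On b (p +ℤ + suc k) d' → + 1 ≤ℤ d' →
    ∃[ s ] ∃[ c ] (1 ≤ s × s ≤ k × On c (p +ℤ + s) (+ 0))
  walk zero a p d b d' oa d<0 ob d'≥1 = ⊥-elim (lia (d ∷ d' ∷ [])
    (λ d d' → d :< K 0 ⟹ K 1 :≤ d' ⟹ d' :≤ d :+ K 1 ⟹ :⊥) d<0 d'≥1 (step a b p d d' oa ob))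
  walk (suc k) a p d b d' oa d<0 ob d'≥1 with onClass (p +ℤ + 1)
  ... | c , e , oc = next (ℤP.<-cmp e (+ 0))
    where
    next : Tri (e <ℤ + 0) (e ≡ + 0) (e ℤ.> + 0) → _
    next (tri≈ _ e≡0 _) = 1 , c , ℕP.≤-refl , s≤s z≤n , subst (On c (p +ℤ + 1)) e≡0 oc
    next (tri> _ _ e>0) = ⊥-elim (lia (d ∷ e ∷ []) (λ d e → d :< K 0 ⟹ K 0 :< e ⟹ e :≤ d :+ K 1 ⟹ :⊥) d<0 e>0 (step a c p d e oa oc))
    next (tri< e<0 _ _) with walk k c (p +ℤ + 1) e b d' oc e<0
      (On-cast b d' (lia (p ∷ + k ∷ []) λ p k → p :+ (K 2 :+ k) :≡ p :+ K 1 :+ (K 1 :+ k)) ob) d'≥1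
    ... | s , c' , s≥1 , s≤k , oc' = suc s , c' , s≤s z≤n , s≤s s≤k ,
      On-cast c' (+ 0) (lia (p ∷ + s ∷ []) λ p s → p :+ K 1 :+ s :≡ p :+ (K 1 :+ s)) oc'

  -- Discrete intermediate value theorem along the classes between two signed rows.
  between : ∀ k a p b m → On a p (+ 0) → On b (p +ℤ + suc (suc k)) m → + 1 ≤ℤ m →
    ∃[ s ] ∃[ c ] ∃[ d ] (1 ≤ s × s ≤ suc k × On c (p +ℤ + s) d × (d ≡ + 0 ⊎ d ≡ + 1))
  between k a p b m oa ob m≥1 with onClass (p +ℤ + 1)
  ... | c , d , oc = next (ℤP.<-cmp d (+ 0))
    where
    next : Tri (d <ℤ + 0) (d ≡ + 0) (d ℤ.> + 0) → _
    next (tri≈ _ d≡0 _) = 1 , c , d , ℕP.≤-refl , s≤s z≤n , oc , inj₁ d≡0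
    next (tri> _ _ d>0) = 1 , c , d , ℕP.≤-refl , s≤s z≤n , oc ,
      inj₂ (lia (d ∷ []) (λ d → K 0 :< d ⟹ d :≤ K 0 :+ K 1 ⟹ d :≡ K 1) d>0 (step a c p (+ 0) d oa oc))
    next (tri< d<0 _ _) with walk k c (p +ℤ + 1) d b m oc d<0
      (On-cast b m (lia (p ∷ + k ∷ []) λ p k → p :+ (K 2 :+ k) :≡ p :+ K 1 :+ (K 1 :+ k)) ob) m≥1
    ... | s , c' , s≥1 , s≤k , oc' = suc s , c' , + 0 , s≤s z≤n , s≤s s≤k ,
      On-cast c' (+ 0) (lia (p ∷ + s ∷ []) λ p s → p :+ K 1 :+ s :≡ p :+ (K 1 :+ s)) oc' , inj₁ refl

  -- A third row c that cuts the residue r into s and r - s and the level m into d and m - d, with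
  -- non-negative parts. The conditions on |c| make both (a , c) and (c , b) roots again.
  Split : ℤ → ℤ → ℤ → ℤ → Set
  Split a b m r = ∃[ c ] ∃[ s ] ∃[ d ] (InRange n ∣ c ∣ × ¬ ∣ c ∣ ≡ ∣ a ∣ × ¬ ∣ c ∣ ≡ ∣ b ∣ ×
    + 1 ≤ℤ s × s <ℤ r × + 0 ≤ℤ d × d ≤ℤ m × X c - X a ≡ h *ℤ d +ℤ s)

  -- If −a itself occurs between a and b, the levels of c and of the mirror image −c add up to that of −a.
  module Mirror (a b m r s d : ℤ) (ra : InRange n ∣ a ∣) (rb : InRange n ∣ b ∣) (r<h : r <ℤ h) (m≥1 : + 1 ≤ℤ m)
    (ab : X b - X a ≡ h *ℤ m +ℤ r) (aa : X (- a) - X a ≡ h *ℤ d +ℤ s) (d≥0 : + 0 ≤ℤ d) (s<r : s <ℤ r) where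

    aa' : - X a - X a ≡ h *ℤ d +ℤ s
    aa' = subst (λ y → y - X a ≡ h *ℤ d +ℤ s) (X-neg a) aa

    -- Relative to a, the rows -a, b and -b have the residues s, r and s - r. As s < r < h, none of
    -- them, nor 0, is congruent to an offset t with 0 < t < s.
    fresh : ∀ c t e → On c (X a +ℤ t) e → + 1 ≤ℤ t → t <ℤ s → ¬ ∣ c ∣ ≡ ∣ a ∣ × ¬ ∣ c ∣ ≡ ∣ b ∣
    fresh c t e (rc , oc) t≥1 t<s = (λ q → go-a (abs-cases c a q)) , (λ q → go-b (abs-cases c b q))
      where
      go-a : c ≡ a ⊎ c ≡ - a → ⊥
      go-a (inj₁ refl) = noMult h t (- e) (lia (t ∷ []) (λ t → K 1 :≤ t ⟹ K 0 :< t) t≥1)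
        (lia (t ∷ s ∷ r ∷ h ∷ []) (λ t s r h → t :< s ⟹ s :< r ⟹ r :< h ⟹ t :< h) t<s s<r r<h)
        (lia (X a ∷ t ∷ h ∷ e ∷ []) (λ x t h e → x :≡ x :+ t :+ h :* e ⟹ h :* :- e :≡ t) oc)
      go-a (inj₂ refl) = noMult h (s - t) (e - d) (lia (s ∷ t ∷ []) (λ s t → t :< s ⟹ K 0 :< s :- t) t<s)
        (lia (t ∷ s ∷ r ∷ h ∷ []) (λ t s r h → K 1 :≤ t ⟹ s :< r ⟹ r :< h ⟹ s :- t :< h) t≥1 s<r r<h)
        (lia (X (- a) ∷ X a ∷ t ∷ s ∷ h ∷ e ∷ d ∷ []) (λ y x t s h e d → y :≡ x :+ t :+ h :* e ⟹ y :- x :≡ h :* d :+ s ⟹ h :* (e :- d) :≡ s :- t) oc aa)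
      go-b : c ≡ b ⊎ c ≡ - b → ⊥
      go-b (inj₁ refl) = noMult h (r - t) (e - m) (lia (s ∷ t ∷ r ∷ []) (λ s t r → t :< s ⟹ s :< r ⟹ K 0 :< r :- t) t<s s<r)
        (lia (t ∷ r ∷ h ∷ []) (λ t r h → K 1 :≤ t ⟹ r :< h ⟹ r :- t :< h) t≥1 r<h)
        (lia (X c ∷ X a ∷ t ∷ r ∷ h ∷ e ∷ m ∷ []) (λ y x t r h e m → y :≡ x :+ t :+ h :* e ⟹ y :- x :≡ h :* m :+ r ⟹ h :* (e :- m) :≡ r :- t) oc ab)
      go-b (inj₂ refl) = noMult h (r +ℤ t - s) (d - m - e)
        (lia (s ∷ t ∷ r ∷ []) (λ s t r → K 1 :≤ t ⟹ s :< r ⟹ K 0 :< r :+ t :- s) t≥1 s<r)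
        (lia (s ∷ t ∷ r ∷ h ∷ []) (λ s t r h → t :< s ⟹ r :< h ⟹ r :+ t :- s :< h) t<s r<h)
        (lia (X b ∷ X a ∷ t ∷ s ∷ r ∷ h ∷ e ∷ d ∷ m ∷ [])
          (λ y x t s r h e d m → :- y :≡ x :+ t :+ h :* e ⟹ y :- x :≡ h :* m :+ r ⟹ :- x :- x :≡ h :* d :+ s ⟹ h :* (d :- m :- e) :≡ r :+ t :- s)
          (trans (sym (X-neg b)) oc) ab aa')

    toSplit : ∀ c t e → On c (X a +ℤ t) e → + 1 ≤ℤ t → t <ℤ s → e ≡ + 0 ⊎ e ≡ + 1 → Split a b m r
    toSplit c t e oc t≥1 t<s e01 = let na , nb = fresh c t e oc t≥1 t<s ; e≥0 , e≤m = range e01 in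
      c , t , e , proj₁ oc , na , nb , t≥1 , ℤP.<-trans t<s s<r , e≥0 , e≤m ,
      lia (X c ∷ X a ∷ t ∷ h ∷ e ∷ []) (λ y x t h e → y :≡ x :+ t :+ h :* e ⟹ y :- x :≡ h :* e :+ t) (proj₂ oc)
      where
      range : ∀ {e} → e ≡ + 0 ⊎ e ≡ + 1 → + 0 ≤ℤ e × e ≤ℤ m
      range (inj₁ refl) = ℤP.≤-refl , lia (m ∷ []) (λ m → K 1 :≤ m ⟹ K 0 :≤ m) m≥1
      range (inj₂ refl) = +≤+ z≤n , m≥1

    -- Negation exchanges a and -a and so reverses the stretch between them.
    mirror : ∀ c e → On c (X a +ℤ + 1) e → On (- c) (X a +ℤ (s - + 1)) (d - e)
    mirror c e (rc , oc) = neg-range {c} rc , trans (X-neg c) (lia (X c ∷ X a ∷ s ∷ d ∷ e ∷ h ∷ [])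
      (λ y x s d e h → y :≡ x :+ K 1 :+ h :* e ⟹ :- x :- x :≡ h :* d :+ s ⟹ :- y :≡ x :+ (s :- K 1) :+ h :* (d :- e)) oc aa')

    -- The row c right after a has level e ≤ 1. Level 0 or 1 is what is wanted. If e < 0, the mirror
    -- image -c at the offset s - 1 has level d - e ≥ 1, and the walk from c to -c meets level 0;
    -- for s = 2 both offsets are 1 and -c itself has level 1.
    split : ∀ k → s ≡ + suc (suc k) → Split a b m r
    split k s≡ with onClass (X a +ℤ + 1)
    ... | c , e , oc = next k s≡ (ℤP.<-cmp e (+ 0))
      where
      1<s : + 1 <ℤ s
      1<s = subst (+ 1 <ℤ_) (sym s≡) (ℤ.+<+ (s≤s (s≤s z≤n)))
      e≤1 : e ≤ℤ + 1
      e≤1 = step a c (X a) (+ 0) e (over a ra) oc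
      next : ∀ k → s ≡ + suc (suc k) → Tri (e <ℤ + 0) (e ≡ + 0) (e ℤ.> + 0) → Split a b m r
      next _ _ (tri≈ _ e≡0 _) = toSplit c (+ 1) e oc ℤP.≤-refl 1<s (inj₁ e≡0)
      next _ _ (tri> _ _ e>0) = toSplit c (+ 1) e oc ℤP.≤-refl 1<s
        (inj₂ (lia (e ∷ []) (λ e → K 0 :< e ⟹ e :≤ K 1 ⟹ e :≡ K 1) e>0 e≤1))
      next zero s≡2 (tri< e<0 _ _) = toSplit (- c) (+ 1) (d - e) oc' ℤP.≤-refl 1<s
        (inj₂ (lia (d ∷ e ∷ []) (λ d e → e :< K 0 ⟹ K 0 :≤ d ⟹ d :- e :≤ K 0 :+ K 1 ⟹ d :- e :≡ K 1) e<0 d≥0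
          (step a (- c) (X a) (+ 0) (d - e) (over a ra) oc')))
        where
        oc' : On (- c) (X a +ℤ + 1) (d - e)
        oc' = On-cast (- c) (d - e) (lia (X a ∷ s ∷ []) (λ x s → s :≡ K 2 ⟹ x :+ (s :- K 1) :≡ x :+ K 1) s≡2) (mirror c e oc)
      next (suc k) s≡ (tri< e<0 _ _) with walk k c (X a +ℤ + 1) e (- c) (d - e) oc e<0
        (On-cast (- c) (d - e) (lia (X a ∷ s ∷ + k ∷ []) (λ x s k → s :≡ K 3 :+ k ⟹ x :+ (s :- K 1) :≡ x :+ K 1 :+ (K 1 :+ k)) s≡) (mirror c e oc))
        (lia (d ∷ e ∷ []) (λ d e → e :< K 0 ⟹ K 0 :≤ d ⟹ K 1 :≤ d :- e) e<0 d≥0)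
      ... | t , c' , t≥1 , t≤k , oc' = toSplit c' (+ 1 +ℤ + t) (+ 0)
        (On-cast c' (+ 0) (lia (X a ∷ + t ∷ []) λ x t → x :+ K 1 :+ t :≡ x :+ (K 1 :+ t)) oc')
        (+≤+ (s≤s z≤n)) (lia (s ∷ + t ∷ + k ∷ []) (λ s t k → s :≡ K 3 :+ k ⟹ t :≤ k ⟹ K 1 :+ t :< s) s≡ (+≤+ t≤k)) (inj₁ refl)

  mirrorSplit : ∀ a b m r s d → InRange n ∣ a ∣ → InRange n ∣ b ∣ → r <ℤ h → + 1 ≤ℤ m → X b - X a ≡ h *ℤ m +ℤ r →
    X (- a) - X a ≡ h *ℤ d +ℤ + s → + 0 ≤ℤ d → 1 ≤ s → + s <ℤ r → Split a b m r
  -- For s = 1 the mirror image -a would follow a directly, which parity forbids.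
  mirrorSplit a b m r (suc zero) d ra rb r<h m≥1 ab aa d≥0 _ s<r = ⊥-elim (not-odd (- a) d
    (lia (X (- a) ∷ X a ∷ h ∷ d ∷ []) (λ y x h d → y :≡ :- x ⟹ y :- x :≡ h :* d :+ K 1 ⟹ y :+ y :≡ h :* d :+ K 1) (X-neg a) aa))
  mirrorSplit a b m r (suc (suc k)) d ra rb r<h m≥1 ab aa d≥0 _ s<r =
    Mirror.split a b m r (+ suc (suc k)) d ra rb r<h m≥1 ab aa d≥0 s<r k refl

  -- `between` gives a row of level 0 or 1 strictly between a and b. It is neither a nor b, since
  -- its offset is no multiple of h away from theirs. If it is -a or -b, the mirror argument
  -- replaces it.
  splits : ∀ a b m k → InRange n ∣ a ∣ → InRange n ∣ b ∣ → + suc (suc k) <ℤ h → + 1 ≤ℤ m →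
    X b - X a ≡ h *ℤ m +ℤ + suc (suc k) → Split a b m (+ suc (suc k))
  splits a b m k ra rb r<h m≥1 ab with between k a (X a) b m (over a ra)
    (rb , lia (X b ∷ X a ∷ h ∷ m ∷ + suc (suc k) ∷ []) (λ y x h m r → y :- x :≡ h :* m :+ r ⟹ y :≡ x :+ r :+ h :* m) ab) m≥1
  ... | s , c , d , s≥1 , s≤k , (rc , oc) , d01 = pick (∣ c ∣ ℕ.≟ ∣ a ∣) (∣ c ∣ ℕ.≟ ∣ b ∣)
    where
    r = + suc (suc k)
    s<r : + s <ℤ r
    s<r = ℤ.+<+ (s≤s s≤k)
    s>0 : + 0 <ℤ + s
    s>0 = ℤ.+<+ s≥1
    range : ∀ {d} → d ≡ + 0 ⊎ d ≡ + 1 → + 0 ≤ℤ d × d ≤ℤ m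
    range (inj₁ refl) = ℤP.≤-refl , lia (m ∷ []) (λ m → K 1 :≤ m ⟹ K 0 :≤ m) m≥1
    range (inj₂ refl) = +≤+ z≤n , m≥1
    d≥0 = proj₁ (range d01)
    d≤m = proj₂ (range d01)
    ac : X c - X a ≡ h *ℤ d +ℤ + s
    ac = lia (X c ∷ X a ∷ + s ∷ h ∷ d ∷ []) (λ y x t h e → y :≡ x :+ t :+ h :* e ⟹ y :- x :≡ h :* e :+ t) oc
    t = suc (suc k) ∸ s
    t≡ : + t ≡ r - + s
    t≡ = trans (sym (ℤP.⊖-≥ {suc (suc k)} {s} (ℕP.m≤n⇒m≤1+n s≤k))) (sym (ℤP.m-n≡m⊖n (suc (suc k)) s))
    pick : Dec (∣ c ∣ ≡ ∣ a ∣) → Dec (∣ c ∣ ≡ ∣ b ∣) → Split a b m r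
    pick (no na) (no nb) = c , + s , d , rc , na , nb , +≤+ s≥1 , s<r , d≥0 , d≤m , ac
    pick (yes ca) _ = go (abs-cases c a ca)
      where
      go : c ≡ a ⊎ c ≡ - a → Split a b m r
      go (inj₁ refl) = ⊥-elim (noMult h (+ s) (- d) s>0 (ℤP.<-trans s<r r<h)
        (lia (X a ∷ + s ∷ h ∷ d ∷ []) (λ x t h e → x :- x :≡ h :* e :+ t ⟹ h :* :- e :≡ t) ac))
      go (inj₂ refl) = mirrorSplit a b m r s d ra rb r<h m≥1 ab ac d≥0 s≥1 s<r
    pick (no na) (yes cb) = go (abs-cases c b cb)
      where
      -- Negation carries a split of (-b , -a) to one of (a , b), which reduces the case of -b to
      -- that of -a.
      swap : Split (- b) (- a) m r → Split a b m r
      swap (c' , s' , d' , rc' , nb , na' , s≥1' , s<r' , d≥0' , d≤m' , e) =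
        - c' , r - s' , m - d' , neg-range {c'} rc' ,
        (λ q → na' (trans (trans (sym (ℤP.∣-i∣≡∣i∣ c')) q) (sym (ℤP.∣-i∣≡∣i∣ a)))) ,
        (λ q → nb (trans (trans (sym (ℤP.∣-i∣≡∣i∣ c')) q) (sym (ℤP.∣-i∣≡∣i∣ b)))) ,
        lia (r ∷ s' ∷ []) (λ r s → s :< r ⟹ K 1 :≤ r :- s) s<r' ,
        lia (r ∷ s' ∷ []) (λ r s → K 1 :≤ s ⟹ r :- s :< r) s≥1' ,
        lia (m ∷ d' ∷ []) (λ m d → d :≤ m ⟹ K 0 :≤ m :- d) d≤m' ,
        lia (m ∷ d' ∷ []) (λ m d → K 0 :≤ d ⟹ m :- d :≤ m) d≥0' ,
        lia (X (- c') ∷ X c' ∷ X (- b) ∷ X b ∷ X a ∷ r ∷ s' ∷ m ∷ d' ∷ h ∷ [])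
          (λ y z yb xb xa r s m d h → y :≡ :- z ⟹ yb :≡ :- xb ⟹ xb :- xa :≡ h :* m :+ r ⟹ z :- yb :≡ h :* d :+ s ⟹ y :- xa :≡ h :* (m :- d) :+ (r :- s))
          (X-neg c') (X-neg b) ab e
      go : c ≡ b ⊎ c ≡ - b → Split a b m r
      go (inj₁ refl) = ⊥-elim (noMult h (r - + s) (d - m) (lia (r ∷ + s ∷ []) (λ r s → s :< r ⟹ K 0 :< r :- s) s<r)
        (lia (r ∷ + s ∷ h ∷ []) (λ r s h → K 0 :< s ⟹ r :< h ⟹ r :- s :< h) s>0 r<h)
        (lia (X c ∷ X a ∷ + s ∷ r ∷ h ∷ d ∷ m ∷ []) (λ y x t r h e m → y :- x :≡ h :* e :+ t ⟹ y :- x :≡ h :* m :+ r ⟹ h :* (e :- m) :≡ r :- t) ac ab))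
      go (inj₂ refl) = swap (mirrorSplit (- b) (- a) m r t (m - d) (neg-range {b} rb) (neg-range {a} ra) r<h m≥1
        (lia (X (- b) ∷ X b ∷ X (- a) ∷ X a ∷ h ∷ m ∷ r ∷ []) (λ yb xb ya xa h m r → yb :≡ :- xb ⟹ ya :≡ :- xa ⟹ xb :- xa :≡ h :* m :+ r ⟹ ya :- yb :≡ h :* m :+ r) (X-neg b) (X-neg a) ab)
        (trans (cong (λ y → X y - X (- b)) (ℤP.neg-involutive b))
          (lia (X (- b) ∷ X b ∷ X a ∷ h ∷ m ∷ d ∷ r ∷ + s ∷ + t ∷ [])
            (λ yb xb xa h m d r s t → xb :- xa :≡ h :* m :+ r ⟹ yb :- xa :≡ h :* d :+ s ⟹ t :≡ r :- s ⟹ xb :- yb :≡ h :* (m :- d) :+ t) ab ac t≡))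
        (lia (m ∷ d ∷ []) (λ m d → d :≤ m ⟹ K 0 :≤ m :- d) d≤m)
        (ℤP.drop‿+≤+ (lia (+ t ∷ r ∷ + s ∷ []) (λ t r s → t :≡ r :- s ⟹ s :< r ⟹ K 1 :≤ t) t≡ s<r))
        (lia (+ t ∷ r ∷ + s ∷ []) (λ t r s → t :≡ r :- s ⟹ K 0 :< s ⟹ t :< r) t≡ s>0))

  -- Here `x'` is the point of another alcove of the same Shi region, read in the frame of the
  -- first. The two hypotheses are the agreement of sides at the levels 0 and 1, as far as it is
  -- needed.
  module Minimal (x' : ℕ → ℤ)
    (same₀ : ∀ a b → InRange n ∣ a ∣ → InRange n ∣ b ∣ → ¬ ∣ a ∣ ≡ ∣ b ∣ → X a <ℤ X b → val x' a <ℤ val x' b)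
    (same₁ : ∀ a b → InRange n ∣ a ∣ → InRange n ∣ b ∣ → ¬ ∣ a ∣ ≡ ∣ b ∣ → val w a <ℤ val w b →
      h <ℤ X b - X a → h <ℤ val x' b - val x' a) where

    X' : ℤ → ℤ
    X' = val x'

    -- Induction on the residue r, bounded by the fuel. Level 0 is `same₀`; residue 1 is a wall,
    -- hence of level 1 with a positive root, which is `same₁`. Any other pair splits into two of
    -- smaller residue, and their bounds add up.
    beyond : ∀ fuel a b m r → r ≤ fuel → 1 ≤ r → + r <ℤ h → InRange n ∣ a ∣ → InRange n ∣ b ∣ → ¬ ∣ a ∣ ≡ ∣ b ∣ →
      + 0 ≤ℤ m → X b - X a ≡ h *ℤ m +ℤ + r → h *ℤ m <ℤ X' b - X' a
    beyond fuel a b m r r≤f r≥1 r<h ra rb ne m≥0 ab with m ℤP.≟ + 0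
    ... | yes refl = lia (X' a ∷ X' b ∷ h ∷ []) (λ y z h → y :< z ⟹ h :* K 0 :< z :- y)
      (same₀ a b ra rb ne (lia (X a ∷ X b ∷ h ∷ + r ∷ []) (λ x y h r → y :- x :≡ h :* K 0 :+ r ⟹ K 1 :≤ r ⟹ x :< y) ab (+≤+ r≥1)))
    beyond fuel a b m (suc zero) r≤f r≥1 r<h ra rb ne m≥0 ab | no m≢0 =
      lia (h ∷ m ∷ X' b ∷ X' a ∷ []) (λ h m y z → m :≡ K 1 ⟹ h :* m :≡ h :* K 1 ⟹ h :< y :- z ⟹ h :* m :< y :- z) m≡1 (cong (h *ℤ_) m≡1)
        (same₁ a b ra rb ne (proj₂ wl m≡1)
          (lia (X a ∷ X b ∷ h ∷ m ∷ []) (λ x y h m → y :- x :≡ h :* m :+ K 1 ⟹ h :* m :≡ h :* K 1 ⟹ h :< y :- x) ab (cong (h *ℤ_) m≡1)))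
      where
      wl = wall a b m ra rb ab
      m≡1 : m ≡ + 1
      m≡1 = lia (m ∷ []) (λ m → K 0 :< m ⟹ m :≤ K 1 ⟹ m :≡ K 1) (ℤP.≤∧≢⇒< m≥0 (λ q → m≢0 (sym q))) (proj₁ wl)
    beyond (suc fuel) a b m (suc (suc k)) (s≤s r≤f) r≥1 r<h ra rb ne m≥0 ab | no m≢0
      with splits a b m k ra rb r<h (lia (m ∷ []) (λ m → K 0 :< m ⟹ K 1 :≤ m) (ℤP.≤∧≢⇒< m≥0 (λ q → m≢0 (sym q)))) ab
    ... | c , + s , d , rc , na , nb , s≥1 , s<r , d≥0 , d≤m , ac =
      lia (X' a ∷ X' b ∷ X' c ∷ h ∷ d ∷ m ∷ []) (λ xa xb xc h d m → h :* d :< xc :- xa ⟹ h :* (m :- d) :< xb :- xc ⟹ h :* m :< xb :- xa)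
        (beyond fuel a c d s (ℕP.≤-trans (ℕP.≤-pred s<r') r≤f) (ℤP.drop‿+≤+ s≥1) (ℤP.<-trans s<r r<h) ra rc (λ q → na (sym q)) d≥0 ac)
        (beyond fuel c b (m - d) t (ℕP.≤-trans t≤ r≤f) t≥1 t<h rc rb nb (lia (m ∷ d ∷ []) (λ m d → d :≤ m ⟹ K 0 :≤ m :- d) d≤m)
          (lia (X a ∷ X b ∷ X c ∷ h ∷ d ∷ m ∷ + s ∷ + r ∷ + t ∷ [])
            (λ xa xb xc h d m s r t → xb :- xa :≡ h :* m :+ r ⟹ xc :- xa :≡ h :* d :+ s ⟹ t :≡ r :- s ⟹ xb :- xc :≡ h :* (m :- d) :+ t) ab ac t≡))
      where
      r = suc (suc k)
      s<r' : s ℕ.< r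
      s<r' = ℤP.drop‿+<+ s<r
      t = r ∸ s
      t≡ : + t ≡ + r - + s
      t≡ = trans (sym (ℤP.⊖-≥ {r} {s} (ℕP.<⇒≤ s<r'))) (sym (ℤP.m-n≡m⊖n r s))
      t≥1 : 1 ≤ t
      t≥1 = ℤP.drop‿+≤+ (lia (+ t ∷ + r ∷ + s ∷ []) (λ t r s → t :≡ r :- s ⟹ s :< r ⟹ K 1 :≤ t) t≡ s<r)
      t≤ : t ≤ suc k
      t≤ = ℤP.drop‿+≤+ (lia (+ t ∷ + k ∷ + s ∷ []) (λ t k s → t :≡ K 2 :+ k :- s ⟹ K 1 :≤ s ⟹ t :≤ K 1 :+ k) t≡ s≥1)
      t<h : + t <ℤ h
      t<h = lia (+ t ∷ + r ∷ + s ∷ h ∷ []) (λ t r s h → t :≡ r :- s ⟹ K 1 :≤ s ⟹ r :< h ⟹ t :< h) t≡ s≥1 r<h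

-- Counting separating hyperplanes

ltZ-true : ∀ {x y} → x <ℤ y → ltZ x y ≡ true
ltZ-true {x} {y} p = dec-true (x ℤP.<? y) p

ltZ-false : ∀ {x y} → ¬ x <ℤ y → ltZ x y ≡ false
ltZ-false {x} {y} p = dec-false (x ℤP.<? y) p

ltZ-sound : ∀ {x y} → ltZ x y ≡ true → x <ℤ y
ltZ-sound {x} {y} p with x ℤP.<? y
... | yes q = q

countTo-cong : ∀ n {f g} → (∀ k → f k ≡ g k) → countTo n f ≡ countTo n g
countTo-cong zero p = refl
countTo-cong (suc n) p = cong₂ (λ c b → c + (if b then 1 else 0)) (countTo-cong n p) (p (suc n))

_⊑_ : (f g : ℕ → Bool) → Set
f ⊑ g = ∀ k → f k ≡ true → g k ≡ true

indicator-mono : ∀ {a b} → (a ≡ true → b ≡ true) → (if a then 1 else 0) ≤ (if b then 1 else 0)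
indicator-mono {false} p = z≤n
indicator-mono {true} {b} p rewrite p refl = ℕP.≤-refl

countTo-mono : ∀ n {f g} → f ⊑ g → countTo n f ≤ countTo n g
countTo-mono zero p = z≤n
countTo-mono (suc n) p = ℕP.+-mono-≤ (countTo-mono n p) (indicator-mono (p (suc n)))

countTo-strict : ∀ n {f g} → f ⊑ g → ∀ k → InRange n k → f k ≡ false → g k ≡ true → countTo n f ℕ.< countTo n g
countTo-strict zero p k (r , s) _ _ = ⊥-elim (ℕP.<⇒≱ r s)
countTo-strict (suc n) {f} {g} p k (r , s) fk gk with k ℕ.≟ suc n
... | yes refl rewrite fk | gk = ℕP.+-mono-≤-< (countTo-mono n {f} {g} p) (s≤s z≤n)
... | no ne = ℕP.+-mono-<-≤ (countTo-strict n {f} {g} p k (r , ℕP.≤-pred (ℕP.≤∧≢⇒< s ne)) fk gk) (indicator-mono (p (suc n)))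

countTo-front : ∀ n f → countTo (suc n) f ≡ (if f 1 then 1 else 0) + countTo n (λ k → f (suc k))
countTo-front zero f = ℕP.+-comm 0 _
countTo-front (suc n) f = trans (cong (_+ (if f (suc (suc n)) then 1 else 0)) (countTo-front n f))
  (ℕP.+-assoc (if f 1 then 1 else 0) _ _)

-- The shape of `sepCount`: the test runs over the levels -B, ..., B.
window : ℕ → (ℤ → Bool) → ℕ
window B s = countTo (2 ℕ.* B + 1) (λ k → s (+ k - + suc B))

window-suc : ∀ B s → s (- + suc B) ≡ false → s (+ suc B) ≡ false → window (suc B) s ≡ window B s
window-suc B s lo hi = begin
  window (suc B) s ≡⟨ cong (λ N → countTo N F) N≡ ⟩
  countTo (suc (suc M)) F ≡⟨ countTo-front (suc M) F ⟩
  (if F 1 then 1 else 0) + countTo (suc M) (λ k → F (suc k))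
    ≡⟨ cong₂ (λ a c → (if a then 1 else 0) + c) (trans (cong s lo≡) lo) (cong (λ b → countTo M (λ k → F (suc k)) + (if b then 1 else 0)) (trans (cong s hi≡) hi)) ⟩
  countTo M (λ k → F (suc k)) + 0 ≡⟨ ℕP.+-identityʳ _ ⟩
  countTo M (λ k → F (suc k)) ≡⟨ countTo-cong M (λ k → cong s (shift k)) ⟩
  window B s ∎
  where
  open ≡-Reasoning
  M = 2 ℕ.* B + 1
  F : ℕ → Bool
  F k = s (+ k - + suc (suc B))
  N≡ : 2 ℕ.* suc B + 1 ≡ suc (suc M)
  N≡ = cong (λ k → suc k + 1) (ℕP.+-suc B (B + 0))
  lo≡ : + 1 - + suc (suc B) ≡ - + suc B
  lo≡ = lia (+ B ∷ []) λ B → K 1 :- (K 2 :+ B) :≡ :- (K 1 :+ B)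
  hi≡ : + suc (suc M) - + suc (suc B) ≡ + suc B
  hi≡ = trans (cong (λ y → + 2 +ℤ y - + suc (suc B)) (trans (ℤP.pos-+ (2 ℕ.* B) 1) (cong (_+ℤ + 1) (ℤP.pos-* 2 B))))
    (lia (+ B ∷ []) λ B → K 2 :+ (K 2 :* B :+ K 1) :- (K 2 :+ B) :≡ K 1 :+ B)
  shift : ∀ k → + suc k - + suc (suc B) ≡ + k - + suc B
  shift k = lia (+ k ∷ + B ∷ []) λ k B → K 1 :+ k :- (K 2 :+ B) :≡ k :- (K 1 :+ B)

Bounded : ℕ → (ℤ → Bool) → Set
Bounded B s = ∀ m → s m ≡ true → ∣ m ∣ ≤ B

bounded-false : ∀ {B s} → Bounded B s → ∀ m → B ℕ.< ∣ m ∣ → s m ≡ false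
bounded-false {B} {s} b m lt with s m in eq
... | false = refl
... | true = ⊥-elim (ℕP.<⇒≱ lt (b m eq))

-- Different alcoves are counted in windows of different sizes. Nothing is counted outside the
-- bound, so both windows extend to a common one, in which they are compared level by level.
window-extend : ∀ d B s → Bounded B s → window (d + B) s ≡ window B s
window-extend zero B s b = refl
window-extend (suc d) B s b = trans (window-suc (d + B) s
    (bounded-false b (- + suc (d + B)) (s≤s (ℕP.m≤n+m B d)))
    (bounded-false b (+ suc (d + B)) (s≤s (ℕP.m≤n+m B d))))
  (window-extend d B s b)

module _ {B B' : ℕ} {s s' : ℤ → Bool} (b : Bounded B s) (b' : Bounded B' s') (s⊑s' : ∀ m → s m ≡ true → s' m ≡ true) where

  private
    common : window B s ≡ window (B' + B) s × window B' s' ≡ window (B' + B) s'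
    common = sym (window-extend B' B s b) ,
      trans (sym (window-extend B B' s' b')) (cong (λ N → window N s') (ℕP.+-comm B B'))

  window-mono : window B s ≤ window B' s'
  window-mono = subst₂ _≤_ (sym (proj₁ common)) (sym (proj₂ common)) (countTo-mono (2 ℕ.* (B' + B) + 1) (λ k → s⊑s' (+ k - + suc (B' + B))))

  window-strict : ∀ m → s m ≡ false → s' m ≡ true → window B s ℕ.< window B' s'
  window-strict m sm s'm = subst₂ ℕ._<_ (sym (proj₁ common)) (sym (proj₂ common))
    (countTo-strict (2 ℕ.* C + 1) (λ k → s⊑s' (+ k - + suc C)) ∣ y ∣ (in-range) (trans (cong s back) sm) (trans (cong s' back) s'm))
    where
    C = B' + B
    y = m +ℤ + suc C
    m-low : - + C ≤ℤ m
    m-high : m ≤ℤ + C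
    m-low = ℤP.≤-trans (ℤP.neg-mono-≤ (+≤+ (ℕP.≤-trans (b' m s'm) (ℕP.m≤m+n B' B)))) (low m)
      where
      low : ∀ m → - + ∣ m ∣ ≤ℤ m
      low (+ zero) = ℤP.≤-refl
      low (+ suc _) = -≤+
      low -[1+ _ ] = ℤP.≤-refl
    m-high = ℤP.≤-trans (high m) (+≤+ (ℕP.≤-trans (b' m s'm) (ℕP.m≤m+n B' B)))
      where
      high : ∀ m → m ≤ℤ + ∣ m ∣
      high (+ _) = ℤP.≤-refl
      high -[1+ _ ] = -≤+
    y≡ : + ∣ y ∣ ≡ m +ℤ + suc C
    y≡ = ℤP.0≤i⇒+∣i∣≡i (lia (m ∷ + C ∷ []) (λ m C → :- C :≤ m ⟹ K 0 :≤ m :+ (K 1 :+ C)) m-low)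
    back : + ∣ y ∣ - + suc C ≡ m
    back = lia (+ ∣ y ∣ ∷ m ∷ + C ∷ []) (λ y m C → y :≡ m :+ (K 1 :+ C) ⟹ y :- (K 1 :+ C) :≡ m) y≡
    top : + (2 ℕ.* C + 1) ≡ + 2 *ℤ + C +ℤ + 1
    top = trans (ℤP.pos-+ (2 ℕ.* C) 1) (cong (_+ℤ + 1) (ℤP.pos-* 2 C))
    in-range : InRange (2 ℕ.* C + 1) ∣ y ∣
    in-range = ℤP.drop‿+≤+ (lia (+ ∣ y ∣ ∷ m ∷ + C ∷ []) (λ y m C → y :≡ m :+ (K 1 :+ C) ⟹ :- C :≤ m ⟹ K 1 :≤ y) y≡ m-low)
             , ℤP.drop‿+≤+ (lia (+ ∣ y ∣ ∷ m ∷ + C ∷ + (2 ℕ.* C + 1) ∷ []) (λ y m C T → y :≡ m :+ (K 1 :+ C) ⟹ m :≤ C ⟹ T :≡ K 2 :* C :+ K 1 ⟹ y :≤ T) y≡ m-high top)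

sepAt : ℤ → ℤ → ℤ → ℤ → Bool
sepAt h R P m = (ltZ R (h *ℤ m) ∧ ltZ (h *ℤ m) P) ∨ (ltZ P (h *ℤ m) ∧ ltZ (h *ℤ m) R)

-- On A∘ a positive root takes values in (0 , 1), so the hyperplanes of level m ≥ 1 lie above A∘ and
-- those of level m ≤ 0 below it.
Separated : ℤ → ℤ → ℤ → Set
Separated h P m = (+ 1 ≤ℤ m × h *ℤ m <ℤ P) ⊎ (m ≤ℤ + 0 × P <ℤ h *ℤ m)

module _ (h R : ℤ) (R>0 : + 0 <ℤ R) (R<h : R <ℤ h) where
  private
    h≥0 : + 0 ≤ℤ h
    h≥0 = ℤP.<⇒≤ (ℤP.<-trans R>0 R<h)

    above : ∀ m → + 1 ≤ℤ m → R <ℤ h *ℤ m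
    above m m≥1 = lia (R ∷ h ∷ m ∷ []) (λ R h m → K 0 :≤ h :* (m :- K 1) ⟹ R :< h ⟹ R :< h :* m)
      (*-nonneg h≥0 (lia (m ∷ []) (λ m → K 1 :≤ m ⟹ K 0 :≤ m :- K 1) m≥1)) R<h

    below : ∀ m → m ≤ℤ + 0 → h *ℤ m <ℤ R
    below m m≤0 = lia (R ∷ h ∷ m ∷ []) (λ R h m → K 0 :≤ h :* (:- m) ⟹ K 0 :< R ⟹ h :* m :< R)
      (*-nonneg h≥0 (lia (m ∷ []) (λ m → m :≤ K 0 ⟹ K 0 :≤ :- m) m≤0)) R>0

  sepAt-sound : ∀ P m → sepAt h R P m ≡ true → Separated h P m
  sepAt-sound P m p with m ℤP.≤? + 0
  ... | yes m≤0 rewrite ltZ-false {R} {h *ℤ m} (ℤP.<-asym (below m m≤0)) | ltZ-true (below m m≤0) =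
    inj₂ (m≤0 , ltZ-sound (trans (sym (∧-identityʳ (ltZ P (h *ℤ m)))) p))
  ... | no m≰0 with lia (m ∷ []) (λ m → K 0 :< m ⟹ K 1 :≤ m) (ℤP.≰⇒> m≰0)
  ... | m≥1 rewrite ltZ-false {h *ℤ m} {R} (ℤP.<-asym (above m m≥1)) | ltZ-true (above m m≥1)
    | ∧-zeroʳ (ltZ P (h *ℤ m)) | ∨-identityʳ (ltZ (h *ℤ m) P) = inj₁ (m≥1 , ltZ-sound p)

  sepAt-complete : ∀ P m → Separated h P m → sepAt h R P m ≡ true
  sepAt-complete P m (inj₁ (m≥1 , q)) rewrite ltZ-true (above m m≥1) | ltZ-true q = refl
  sepAt-complete P m (inj₂ (m≤0 , q)) rewrite ltZ-true (below m m≤0) | ltZ-true q = ∨-zeroʳ _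

  -- The window of `sepCount` misses no separating hyperplane: since h ≥ 1, a separating level
  -- satisfies |m| ≤ |P|.
  sepAt-bounded : ∀ P → Bounded (∣ P ∣ + 1) (sepAt h R P)
  sepAt-bounded P m p = bound (sepAt-sound P m p)
    where
    h≥1 : + 0 ≤ℤ h - + 1
    h≥1 = lia (R ∷ h ∷ []) (λ R h → K 0 :< R ⟹ R :< h ⟹ K 0 :≤ h :- K 1) R>0 R<h
    high : ∀ P → P ≤ℤ + ∣ P ∣
    high (+ _) = ℤP.≤-refl
    high -[1+ _ ] = -≤+
    ∣∣≤ : ∀ m k → m ≤ℤ k → - m ≤ℤ k → + ∣ m ∣ ≤ℤ k
    ∣∣≤ (+ _) k p _ = p
    ∣∣≤ -[1+ _ ] k _ p = p
    fin : + ∣ m ∣ ≤ℤ + ∣ P ∣ → ∣ m ∣ ≤ ∣ P ∣ + 1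
    fin q = ℕP.≤-trans (ℤP.drop‿+≤+ q) (ℕP.m≤m+n ∣ P ∣ 1)
    bound : Separated h P m → ∣ m ∣ ≤ ∣ P ∣ + 1
    bound (inj₁ (m≥1 , q)) = fin (∣∣≤ m (+ ∣ P ∣)
      (lia (h ∷ m ∷ P ∷ + ∣ P ∣ ∷ []) (λ h m P A → K 0 :≤ (h :- K 1) :* m ⟹ h :* m :< P ⟹ P :≤ A ⟹ m :≤ A) (*-nonneg h≥1 (ℤP.≤-trans (+≤+ z≤n) m≥1)) q (high P))
      (lia (m ∷ + ∣ P ∣ ∷ []) (λ m A → K 1 :≤ m ⟹ K 0 :≤ A ⟹ :- m :≤ A) m≥1 (+≤+ z≤n)))
    bound (inj₂ (m≤0 , q)) = fin (∣∣≤ m (+ ∣ P ∣)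
      (lia (m ∷ + ∣ P ∣ ∷ []) (λ m A → m :≤ K 0 ⟹ K 0 :≤ A ⟹ m :≤ A) m≤0 (+≤+ z≤n))
      (lia (h ∷ m ∷ P ∷ + ∣ P ∣ ∷ []) (λ h m P A → K 0 :≤ (h :- K 1) :* (:- m) ⟹ P :< h :* m ⟹ :- P :≤ A ⟹ :- m :≤ A)
        (*-nonneg h≥1 (lia (m ∷ []) (λ m → m :≤ K 0 ⟹ K 0 :≤ :- m) m≤0)) q (subst (λ A → - P ≤ℤ + A) (ℤP.∣-i∣≡∣i∣ P) (high (- P)))))


-- Comparing distances to the fundamental alcove root by root.

∈-idxUp⁺ : ∀ {n i} → InRange n i → i ∈ idxUp n
∈-idxUp⁺ {n} {suc i} (_ , q) = ∈-map⁺ suc (∈-upTo⁺ q)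

∈-idxUp⁻ : ∀ {n i} → i ∈ idxUp n → InRange n i
∈-idxUp⁻ {n} p with ∈-map⁻ suc p
... | j , q , refl = s≤s z≤n , ∈-upTo⁻ q

posRoots-valid : ∀ n c → c ∈ posRoots n → ValidPR n c
posRoots-valid n c p with find (∈-concatMap⁻ (λ j → concatMap (λ i → pr (+ i) j ∷ pr (- + i) j ∷ []) (map suc (upTo (j ∸ 1)))) p)
... | j , j∈ , q with find (∈-concatMap⁻ (λ i → pr (+ i) j ∷ pr (- + i) j ∷ []) q)
... | i , i∈ , r = go (∈-idxUp⁻ j∈) (∈-idxUp⁻ {j ∸ 1} i∈) r
  where
  go : ∀ {i j} → InRange n j → InRange (j ∸ 1) i → c ∈ pr (+ i) j ∷ pr (- + i) j ∷ [] → ValidPR n c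
  go {i} {suc j} (_ , q) (r , s) (here refl) = r , s≤s s , q
  go {i} {suc j} (_ , q) (r , s) (there (here refl)) rewrite ℤP.∣-i∣≡∣i∣ (+ i) = r , s≤s s , q

posRoots-complete : ∀ n c → ValidPR n c → c ∈ posRoots n
posRoots-complete n (pr a (suc j)) (p , s≤s q , r) =
  ∈-concatMap⁺ _ (lose (∈-idxUp⁺ (s≤s z≤n , r)) (∈-concatMap⁺ _ (lose (∈-idxUp⁺ {j} (p , q)) (pick a))))
  where
  pick : ∀ a → pr a (suc j) ∈ pr (+ ∣ a ∣) (suc j) ∷ pr (- + ∣ a ∣) (suc j) ∷ []
  pick (+ i) = here refl
  pick -[1+ i ] = there (here refl)

foldr-sum-≤ : ∀ {A : Set} (f g : A → ℕ) xs → (∀ x → x ∈ xs → f x ≤ g x) →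
  foldr (λ x s → f x + s) 0 xs ≤ foldr (λ x s → g x + s) 0 xs
foldr-sum-≤ f g [] p = z≤n
foldr-sum-≤ f g (x ∷ xs) p = ℕP.+-mono-≤ (p x (here refl)) (foldr-sum-≤ f g xs λ y q → p y (there q))

foldr-sum-< : ∀ {A : Set} (f g : A → ℕ) xs → (∀ x → x ∈ xs → f x ≤ g x) → ∀ y → y ∈ xs → f y ℕ.< g y →
  foldr (λ x s → f x + s) 0 xs ℕ.< foldr (λ x s → g x + s) 0 xs
foldr-sum-< f g (x ∷ xs) p y (here refl) lt = ℕP.+-mono-<-≤ lt (foldr-sum-≤ f g xs λ y q → p y (there q))
foldr-sum-< f g (x ∷ xs) p y (there m) lt = ℕP.+-mono-≤-< (p x (here refl)) (foldr-sum-< f g xs (λ y q → p y (there q)) y m lt)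

hD≡ : ∀ {n} → 1 ≤ n → hD n ≡ + 2 *ℤ + n - + 2
hD≡ {suc n} _ = trans (cong +_ (cong ℕ.pred (ℕP.+-suc n (n + 0))))
  (trans (trans (ℤP.pos-+ n (n + 0)) (cong (λ k → + n +ℤ + k) (ℕP.+-identityʳ n)))
    (lia (+ n ∷ []) λ n → n :+ n :≡ K 2 :* (K 1 :+ n) :- K 2))

rho-PR : ∀ {n} → 1 ≤ n → ∀ c → ValidPR n c → + 0 <ℤ inner n rhoV (vecPR c) × inner n rhoV (vecPR c) <ℤ hD n
rho-PR {n} n≥1 c v = subst (λ R → + 0 <ℤ R × R <ℤ hD n) (sym (inner-PR n rhoV c v)) (go (a c) (j c) v)
  where
  go : ∀ a j → 1 ≤ ∣ a ∣ × ∣ a ∣ ℕ.< j × j ≤ n → + 0 <ℤ val rhoV a +ℤ rhoV j × val rhoV a +ℤ rhoV j <ℤ hD n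
  go (+ suc i) (suc j) (_ , s≤s p , q) =
      lia (val rhoV (+ suc i) ∷ + i ∷ + j ∷ []) (λ v i j → v :≡ i ⟹ K 1 :+ i :≤ j ⟹ K 0 :≤ i ⟹ K 0 :< v :+ j) (ℤP.*-identityˡ (+ i)) (+≤+ p) (+≤+ z≤n)
    , lia (val rhoV (+ suc i) ∷ + i ∷ + j ∷ + n ∷ hD n ∷ []) (λ v i j n h → v :≡ i ⟹ K 1 :+ i :≤ j ⟹ K 1 :+ j :≤ n ⟹ h :≡ K 2 :* n :- K 2 ⟹ v :+ j :< h) (ℤP.*-identityˡ (+ i)) (+≤+ p) (+≤+ q) (hD≡ n≥1)
  go -[1+ i ] (suc j) (_ , s≤s p , q) =
      lia (val rhoV -[1+ i ] ∷ + i ∷ + j ∷ []) (λ v i j → v :≡ :- i ⟹ K 1 :+ i :≤ j ⟹ K 0 :≤ i ⟹ K 0 :< v :+ j) (ℤP.-1*i≡-i (+ i)) (+≤+ p) (+≤+ z≤n)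
    , lia (val rhoV -[1+ i ] ∷ + i ∷ + j ∷ + n ∷ hD n ∷ []) (λ v i j n h → v :≡ :- i ⟹ K 1 :+ i :≤ j ⟹ K 0 :≤ i ⟹ K 1 :+ j :≤ n ⟹ h :≡ K 2 :* n :- K 2 ⟹ v :+ j :< h) (ℤP.-1*i≡-i (+ i)) (+≤+ p) (+≤+ z≤n) (+≤+ q) (hD≡ n≥1)

module _ {n : ℕ} (n≥1 : 1 ≤ n) (b b' : Aff) where
  private
    h = hD n
    P P' : PR → ℤ
    P c = inner n (pt n b) (vecPR c)
    P' c = inner n (pt n b') (vecPR c)

  Inside : PR → Set
  Inside c = ∀ m → Separated h (P c) m → Separated h (P' c) m

  sepCount-≤ : ∀ c → ValidPR n c → Inside c → sepCount n b (vecPR c) ≤ sepCount n b' (vecPR c)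
  sepCount-≤ c v i = let R>0 , R<h = rho-PR n≥1 c v ; R = inner n rhoV (vecPR c) in
    window-mono {s = sepAt h R (P c)} {sepAt h R (P' c)} (sepAt-bounded h R R>0 R<h (P c)) (sepAt-bounded h R R>0 R<h (P' c))
      (λ m q → sepAt-complete h R R>0 R<h (P' c) m (i m (sepAt-sound h R R>0 R<h (P c) m q)))

  sepCount-< : ∀ c → ValidPR n c → Inside c → ∀ m → ¬ Separated h (P c) m → Separated h (P' c) m →
    sepCount n b (vecPR c) ℕ.< sepCount n b' (vecPR c)
  sepCount-< c v i m no-m yes-m = let R>0 , R<h = rho-PR n≥1 c v ; R = inner n rhoV (vecPR c) in
    window-strict {s = sepAt h R (P c)} {sepAt h R (P' c)} (sepAt-bounded h R R>0 R<h (P c)) (sepAt-bounded h R R>0 R<h (P' c))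
      (λ m q → sepAt-complete h R R>0 R<h (P' c) m (i m (sepAt-sound h R R>0 R<h (P c) m q)))
      m (¬-not λ q → no-m (sepAt-sound h R R>0 R<h (P c) m q)) (sepAt-complete h R R>0 R<h (P' c) m yes-m)

  dist-≤ : (∀ c → ValidPR n c → Inside c) → dist n b ≤ dist n b'
  dist-≤ i = foldr-sum-≤ (λ c → sepCount n b (vecPR c)) (λ c → sepCount n b' (vecPR c)) (posRoots n)
    λ c p → let v = posRoots-valid n c p in sepCount-≤ c v (i c v)

  dist-< : (∀ c → ValidPR n c → Inside c) → ∀ c → ValidPR n c → ∀ m → ¬ Separated h (P c) m → Separated h (P' c) m →
    dist n b ℕ.< dist n b'
  dist-< i c v m no-m yes-m = foldr-sum-< (λ c → sepCount n b (vecPR c)) (λ c → sepCount n b' (vecPR c)) (posRoots n)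
    (λ c p → let v = posRoots-valid n c p in sepCount-≤ c v (i c v)) c (posRoots-complete n c v)
    (sepCount-< c v (i c v) m no-m yes-m)

3≤⇒1≤ : ∀ {n} → 3 ≤ n → 1 ≤ n
3≤⇒1≤ = ℕP.≤-trans (s≤s z≤n)

module Ends {n : ℕ} (n≥3 : 3 ≤ n) where
  n≥1 = 3≤⇒1≤ n≥3
  r1 : InRange n 1
  r1 = s≤s z≤n , n≥1
  r2 : InRange n 2
  r2 = s≤s z≤n , ℕP.≤-trans (s≤s (s≤s z≤n)) n≥3
  rn : InRange n n
  rn = n≥1 , ℕP.≤-refl
  p = n ∸ 1
  p≡ : + p ≡ + n - + 1
  p≡ = pos∸1 n≥1
  rp : InRange n p
  rp = ℤP.drop‿+≤+ (lia (+ p ∷ + n ∷ []) (λ p n → p :≡ n :- K 1 ⟹ K 3 :≤ n ⟹ K 1 :≤ p) p≡ (+≤+ n≥3)) , ℕP.m∸n≤m n 1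
  p<n : p ℕ.< n
  p<n = ℤP.drop‿+<+ (lia (+ p ∷ + n ∷ []) (λ p n → p :≡ n :- K 1 ⟹ p :< n) p≡)
  p≢n : ¬ p ≡ n
  p≢n e = ℕP.<⇒≢ p<n e

-- Minimality from the Sommers condition.

PairOf : ℕ → PR → ℤ → ℤ → Set
PairOf n c U V = ∀ q → inner n q (vecPR c) ≡ val q V - val q U

-- The index of larger absolute value plays the part of `j`. By A < B it is positive if it is B and
-- negative if it is A, so in both cases it enters the root with the sign +.
rootOf : ∀ {n} A B → InRange n ∣ A ∣ → InRange n ∣ B ∣ → ¬ ∣ A ∣ ≡ ∣ B ∣ → A <ℤ B → ∃[ c ] (ValidPR n c × PairOf n c A B)
rootOf {n} A B rA rB ne A<B with ℕP.<-cmp ∣ A ∣ ∣ B ∣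
... | tri≈ _ q _ = ⊥-elim (ne q)
... | tri< lt _ _ = pr (- A) ∣ B ∣ , v , λ q → trans (inner-PR n q (pr (- A) ∣ B ∣) v)
    (trans (cong₂ _+ℤ_ (val-neg q A) (sym (trans (cong (val q) (B>0 B A<B lt)) (val-+ q ∣ B ∣ (proj₁ rB)))))
      (ℤP.+-comm (- val q A) (val q B)))
  where
  v : ValidPR n (pr (- A) ∣ B ∣)
  v = subst (1 ≤_) (sym (ℤP.∣-i∣≡∣i∣ A)) (proj₁ rA) , subst (ℕ._< ∣ B ∣) (sym (ℤP.∣-i∣≡∣i∣ A)) lt , proj₂ rB
  B>0 : ∀ B → A <ℤ B → ∣ A ∣ ℕ.< ∣ B ∣ → B ≡ + ∣ B ∣
  B>0 (+ _) _ _ = refl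
  B>0 -[1+ k ] (ℤ.-<- p) q = ⊥-elim (ℕP.<⇒≱ q (ℕP.<⇒≤ (s≤s p)))
... | tri> _ _ gt = pr B ∣ A ∣ , v , λ q → trans (inner-PR n q (pr B ∣ A ∣) v)
    (cong (val q B +ℤ_) (trans (sym (ℤP.neg-involutive (q ∣ A ∣)))
      (cong -_ (sym (trans (cong (val q) (A<0 A A<B gt)) (trans (val-neg q (+ ∣ A ∣)) (cong -_ (val-+ q ∣ A ∣ (proj₁ rA)))))))))
  where
  v : ValidPR n (pr B ∣ A ∣)
  v = proj₁ rB , gt , proj₂ rA
  A<0 : ∀ A → A <ℤ B → ∣ B ∣ ℕ.< ∣ A ∣ → A ≡ - + ∣ A ∣
  A<0 -[1+ _ ] _ _ = refl
  A<0 (+ k) (ℤ.+<+ p) q = ⊥-elim (ℕP.<⇒≱ q (ℕP.<⇒≤ p))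

pairOf : ∀ {n} c → ValidPR n c → PairOf n c (- a c) (+ j c) × - a c <ℤ + j c × ¬ ∣ - a c ∣ ≡ ∣ + j c ∣ ×
  InRange n ∣ - a c ∣ × InRange n (j c)
pairOf {n} c v@(p , q , r) = (λ x → trans (inner-PR n x c v)
      (lia (val x (- a c) ∷ val x (a c) ∷ val x (+ j c) ∷ x (j c) ∷ []) (λ s t y z → s :≡ :- t ⟹ y :≡ z ⟹ t :+ z :≡ y :- s)
        (val-neg x (a c)) (val-+ x (j c) (proj₁ rj))))
  , less' (a c) q , (λ e → ℕP.<⇒≢ q (trans (sym (ℤP.∣-i∣≡∣i∣ (a c))) e))
  , subst (InRange n) (sym (ℤP.∣-i∣≡∣i∣ (a c))) (proj₁ (PR-ranges {n} c v)) , rj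
  where
  rj = proj₂ (PR-ranges {n} c v)
  less' : ∀ a → ∣ a ∣ ℕ.< j c → - a <ℤ + j c
  less' (+ zero) lt = ℤ.+<+ lt
  less' (+ suc _) lt = ℤ.-<+
  less' -[1+ _ ] lt = ℤ.+<+ lt

toIndex : ∀ {n w} → Signed n w → ∀ A → InRange n ∣ A ∣ → ∃[ i ] (InRange n ∣ i ∣ × val w i ≡ A)
toIndex {n} {w} sp A r with sp-surj sp ∣ A ∣ r
... | i , ri , e with abs-cases (w i) A e
... | inj₁ q = + i , ri , trans (val-+ w i (proj₁ ri)) q
... | inj₂ q = - + i , subst (InRange n) (sym (ℤP.∣-i∣≡∣i∣ (+ i))) ri ,
  trans (val-neg w (+ i)) (trans (cong -_ (trans (val-+ w i (proj₁ ri)) q)) (ℤP.neg-involutive A))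

module _ {n : ℕ} (n≥3 : 3 ≤ n) where
  private
    n≥1 = 3≤⇒1≤ n≥3
    h = hD n
    h-pos : + 0 <ℤ h
    h-pos = lia (h ∷ + n ∷ []) (λ h n → h :≡ K 2 :* n :- K 2 ⟹ K 3 :≤ n ⟹ K 0 :< h) (hD≡ n≥1) (+≤+ n≥3)

  module FrameOf (b : Aff) (sb : Signed n (lin b)) where
    w : SP
    w = lin b
    x τ : ℕ → ℤ
    x i = val (pt n b) (w i)
    τ i = val (tr b) (w i)
    x-eq : ∀ i → InRange n i → x i ≡ + i - + 1 +ℤ h *ℤ τ i
    x-eq i r = trans (pt-frame {n} {b} sb i r) (cong (_+ℤ h *ℤ τ i) (pos∸1 (proj₁ r)))
    module F = Frame n n≥3 h (hD≡ n≥1) w x τ x-eq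

    index : ∀ A → InRange n ∣ A ∣ → ∃[ i ] (InRange n ∣ i ∣ × val w i ≡ A × ∣ A ∣ ≡ ∣ w ∣ i ∣ ∣ × F.X i ≡ val (pt n b) A)
    index A r with toIndex sb A r
    ... | i , ri , refl = i , ri , refl , ∣val∣ w i (proj₁ ri) , sym (val-val (pt n b) w i (proj₁ ri))

    index-≢ : ∀ {A B} (p : ∃[ i ] (InRange n ∣ i ∣ × val w i ≡ A × ∣ A ∣ ≡ ∣ w ∣ i ∣ ∣ × F.X i ≡ val (pt n b) A))
      (q : ∃[ i ] (InRange n ∣ i ∣ × val w i ≡ B × ∣ B ∣ ≡ ∣ w ∣ i ∣ ∣ × F.X i ≡ val (pt n b) B)) →
      ¬ ∣ A ∣ ≡ ∣ B ∣ → ¬ ∣ proj₁ p ∣ ≡ ∣ proj₁ q ∣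
    index-≢ (i , _ , _ , ei , _) (k , _ , _ , ek , _) ne e = ne (trans ei (trans (cong (λ i → ∣ w i ∣) e) (sym ek)))

    generic : ∀ A B → InRange n ∣ A ∣ → InRange n ∣ B ∣ → ¬ ∣ A ∣ ≡ ∣ B ∣ → ∀ m → ¬ val (pt n b) B - val (pt n b) A ≡ h *ℤ m
    generic A B rA rB ne m with index A rA | index B rB
    ... | p@(i , ri , _ , _ , ei) | q@(k , rk , _ , _ , ek) = subst₂ (λ y x → ¬ y - x ≡ h *ℤ m) ek ei
      (F.generic i k ri rk (index-≢ {A} {B} p q ne) m)

  frameτ : Aff → ℕ → ℤ
  frameτ b i = val (tr b) (lin b i)

  aff-sp : ∀ b → IsAff n b → Signed n (lin b)
  aff-sp b ((s , _) , _) = signed s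

  -- By `beyond`, every hyperplane between A∘ and b also lies between A∘ and any alcove b' of the
  -- same Shi region, so no root contributes more to the distance of b.
  sommers⇒min : ∀ b → IsAff n b → Sommers n (lin b) (frameτ b) → MinAlcove n b
  sommers⇒min b ab som = ab , minimal
    where
    module B = FrameOf b (aff-sp b ab)
    w = lin b
    minimal : ∀ b' → IsAff n b' → SameShi n b b' → dist n b ≤ dist n b'
    minimal b' ab' shi = dist-≤ n≥1 b b' inside
      where
      module B' = FrameOf b' (aff-sp b' ab')
      open Levels n n≥3 h (hD≡ n≥1) w B.x B.τ B.x-eq som
      x' : ℕ → ℤ
      x' i = val (pt n b') (w i)
      rng : ∀ i → InRange n ∣ i ∣ → InRange n ∣ val w i ∣
      rng = val-range (aff-sp b ab)
      X'≡ : ∀ i → InRange n ∣ i ∣ → val x' i ≡ val (pt n b') (val w i)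
      X'≡ i r = sym (val-val (pt n b') w i (proj₁ r))
      X≡ : ∀ i → InRange n ∣ i ∣ → X i ≡ val (pt n b) (val w i)
      X≡ i r = sym (val-val (pt n b) w i (proj₁ r))
      ne' : ∀ i k → InRange n ∣ i ∣ → InRange n ∣ k ∣ → ¬ ∣ i ∣ ≡ ∣ k ∣ → ¬ ∣ val w i ∣ ≡ ∣ val w k ∣
      ne' i k ri rk ne e = ne (sp-inj (aff-sp b ab) _ _ ri rk (trans (sym (∣val∣ w i (proj₁ ri))) (trans e (∣val∣ w k (proj₁ rk)))))
      module _ (i k : ℤ) (ri : InRange n ∣ i ∣) (rk : InRange n ∣ k ∣) (ne : ¬ ∣ i ∣ ≡ ∣ k ∣) where
        A = val w i
        B = val w k
        q : ℤ → ℤ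
        q = val (pt n b)
        q' : ℤ → ℤ
        q' = val (pt n b')
        pos₀ : ∀ A B → (∃[ c ] (ValidPR n c × PairOf n c A B)) → (q A <ℤ q B → q' A <ℤ q' B) × (q' A <ℤ q' B → q A <ℤ q B)
        pos₀ A B (c , v , e) =
            (λ lt → un (e (pt n b')) (Equivalence.to (shi c v (+ 0) (inj₁ refl)) (mk (e (pt n b)) lt)))
          , (λ lt → un (e (pt n b)) (Equivalence.from (shi c v (+ 0) (inj₁ refl)) (mk (e (pt n b')) lt)))
          where
          mk : ∀ {P y z} → P ≡ z - y → y <ℤ z → h *ℤ + 0 <ℤ P
          mk {P} {y} {z} = lia (h ∷ P ∷ y ∷ z ∷ []) λ h P y z → P :≡ z :- y ⟹ y :< z ⟹ h :* K 0 :< P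
          un : ∀ {P y z} → P ≡ z - y → h *ℤ + 0 <ℤ P → y <ℤ z
          un {P} {y} {z} = lia (h ∷ P ∷ y ∷ z ∷ []) λ h P y z → P :≡ z :- y ⟹ h :* K 0 :< P ⟹ y :< z
        same₀' : q A <ℤ q B → q' A <ℤ q' B
        same₀' lt with ℤP.<-cmp A B
        ... | tri< A<B _ _ = proj₁ (pos₀ A B (rootOf A B (rng i ri) (rng k rk) (ne' i k ri rk ne) A<B)) lt
        ... | tri≈ _ e _ = ⊥-elim (ne' i k ri rk ne (cong ∣_∣ e))
        -- Here the positive root belongs to (B , A), and agreement of sides only excludes q' B < q'
        -- A. Equality is excluded because b' avoids all hyperplanes.
        ... | tri> _ _ B<A = ℤP.≤∧≢⇒< (ℤP.≮⇒≥ λ lt' → ℤP.<-asym lt (proj₂ (pos₀ B A (rootOf B A (rng k rk) (rng i ri) (λ e → ne' i k ri rk ne (sym e)) B<A)) lt'))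
          λ e → B'.generic A B (rng i ri) (rng k rk) (ne' i k ri rk ne) (+ 0)
            (lia (q' A ∷ q' B ∷ h ∷ []) (λ x y h → x :≡ y ⟹ y :- x :≡ h :* K 0) e)
        same₁' : A <ℤ B → h <ℤ q B - q A → h <ℤ q' B - q' A
        same₁' A<B lt with rootOf A B (rng i ri) (rng k rk) (ne' i k ri rk ne) A<B
        ... | c , v , e = subst (h <ℤ_) (e (pt n b')) (subst (_<ℤ inner n (pt n b') (vecPR c)) (ℤP.*-identityʳ h)
          (Equivalence.to (shi c v (+ 1) (inj₂ refl)) (subst (_<ℤ inner n (pt n b) (vecPR c)) (sym (ℤP.*-identityʳ h)) (subst (h <ℤ_) (sym (e (pt n b))) lt))))
      same₀ : ∀ i k → InRange n ∣ i ∣ → InRange n ∣ k ∣ → ¬ ∣ i ∣ ≡ ∣ k ∣ → X i <ℤ X k → val x' i <ℤ val x' k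
      same₀ i k ri rk ne lt = subst₂ _<ℤ_ (sym (X'≡ i ri)) (sym (X'≡ k rk)) (same₀' i k ri rk ne (subst₂ _<ℤ_ (X≡ i ri) (X≡ k rk) lt))
      same₁ : ∀ i k → InRange n ∣ i ∣ → InRange n ∣ k ∣ → ¬ ∣ i ∣ ≡ ∣ k ∣ → val w i <ℤ val w k → h <ℤ X k - X i → h <ℤ val x' k - val x' i
      same₁ i k ri rk ne lt p = subst₂ (λ y z → h <ℤ y - z) (sym (X'≡ k rk)) (sym (X'≡ i ri))
        (same₁' i k ri rk ne lt (subst₂ (λ y z → h <ℤ y - z) (X≡ k rk) (X≡ i ri) p))
      open Minimal x' same₀ same₁
      -- `beyond` expects the difference in the form h m + r with 0 < r < h. Genericity excludes the
      -- remainder 0, and M ≤ m follows.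
      far : ∀ i k → InRange n ∣ i ∣ → InRange n ∣ k ∣ → ¬ ∣ i ∣ ≡ ∣ k ∣ → ∀ M → + 0 ≤ℤ M → h *ℤ M <ℤ X k - X i → h *ℤ M <ℤ X' k - X' i
      far i k ri rk ne M M≥0 lt with divide h h-pos (X k - X i)
      ... | m , zero , e , _ = ⊥-elim (F.generic i k ri rk ne m (trans e (ℤP.+-identityˡ (h *ℤ m))))
        where module F = B.F
      ... | m , suc r , e , r<h = ℤP.≤-<-trans
          (lia (h ∷ M ∷ m ∷ []) (λ h M m → K 0 :≤ h :* (m :- M) ⟹ h :* M :≤ h :* m)
            (*-nonneg (ℤP.<⇒≤ h-pos) (lia (m ∷ M ∷ []) (λ m M → M :≤ m ⟹ K 0 :≤ m :- M) M≤m)))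
          (beyond (suc r) i k m (suc r) ℕP.≤-refl (s≤s z≤n) r<h ri rk ne (ℤP.≤-trans M≥0 M≤m) (trans e (ℤP.+-comm (+ suc r) (h *ℤ m))))
        where
        M≤m : M ≤ℤ m
        M≤m = ℤP.≮⇒≥ λ m<M → lia (h ∷ M ∷ m ∷ X k - X i ∷ + suc r ∷ [])
          (λ h M m D r → h :* M :< D ⟹ D :≡ r :+ h :* m ⟹ r :< h ⟹ K 0 :≤ h :* (M :- m :- K 1) ⟹ :⊥) lt e r<h
          (*-nonneg (ℤP.<⇒≤ h-pos) (lia (m ∷ M ∷ []) (λ m M → m :< M ⟹ K 0 :≤ M :- m :- K 1) m<M))
      inside : ∀ c → ValidPR n c → Inside n≥1 b b' c
      inside c v m sep with pairOf {n} c v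
      ... | e , lt , ne , rU , rV with B.index (- a c) rU | B.index (+ j c) rV
      ... | pU@(i , ri , ei , _ , xi) | pV@(k , rk , ek , _ , xk) = move sep
        where
        ik : ¬ ∣ i ∣ ≡ ∣ k ∣
        ik = B.index-≢ { - a c} {+ j c} pU pV ne
        P≡ : inner n (pt n b) (vecPR c) ≡ X k - X i
        P≡ = trans (e (pt n b)) (sym (cong₂ _-_ xk xi))
        P'≡ : inner n (pt n b') (vecPR c) ≡ X' k - X' i
        P'≡ = trans (e (pt n b')) (sym (cong₂ _-_ (trans (X'≡ k rk) (cong (val (pt n b')) ek)) (trans (X'≡ i ri) (cong (val (pt n b')) ei))))
        move : Separated h (inner n (pt n b) (vecPR c)) m → Separated h (inner n (pt n b') (vecPR c)) m
        move (inj₁ (m≥1 , lt)) = inj₁ (m≥1 , subst (h *ℤ m <ℤ_) (sym P'≡) (far i k ri rk ik m (ℤP.≤-trans (+≤+ z≤n) m≥1) (subst (h *ℤ m <ℤ_) P≡ lt)))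
        -- For the reversed pair the hyperplane has the level -m ≥ 0, and `far` applies.
        move (inj₂ (m≤0 , lt)) = inj₂ (m≤0 , subst (_<ℤ h *ℤ m) (sym P'≡)
          (lia (X' k ∷ X' i ∷ h ∷ m ∷ []) (λ y x h m → h :* :- m :< x :- y ⟹ y :- x :< h :* m)
            (far k i rk ri (λ q → ik (sym q)) (- m) (lia (m ∷ []) (λ m → m :≤ K 0 ⟹ K 0 :≤ :- m) m≤0)
              (lia (X k ∷ X i ∷ h ∷ m ∷ []) (λ y x h m → y :- x :< h :* m ⟹ h :* :- m :< x :- y) (subst (_<ℤ h *ℤ m) P≡ lt)))))

-- The Sommers condition from minimality, by reflection in a wall.

-- How the pairing with a root changes when the alcove is reflected in one of its walls:
-- P is replaced by P', and only the hyperplane of the wall may be crossed.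
data Near (h P P' : ℤ) : Set where
  near-close : P' ≤ℤ P +ℤ + 1 → P ≤ℤ P' +ℤ + 1 → (∀ m → ¬ P ≡ h *ℤ m) → (∀ m → ¬ P' ≡ h *ℤ m) → Near h P P'
  near-high : ∀ k → + 2 ≤ℤ k → P ≡ h *ℤ k +ℤ + 1 → P' ≡ h *ℤ k - + 1 → Near h P P'
  near-low : ∀ k → + 1 ≤ℤ k → P ≡ - (h *ℤ k +ℤ + 1) → P' ≡ - (h *ℤ k - + 1) → Near h P P'

module _ {h P P' : ℤ} (h≥4 : + 4 ≤ℤ h) where
  private
    h≥0 : + 0 ≤ℤ h
    h≥0 = ℤP.≤-trans (+≤+ z≤n) h≥4

    h*≥ : ∀ {s} k → s ≤ℤ k → + 0 ≤ℤ h *ℤ (k - s)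
    h*≥ k p = *-nonneg h≥0 (ℤP.i≤j⇒0≤j-i p)

  -- In the close case P and P' differ by at most 1 and are no multiples of h, so no level fits
  -- between them. In the other two cases P' lies on the side of A∘ of the crossed hyperplane.
  near-separated : Near h P P' → ∀ m → Separated h P' m → Separated h P m
  near-separated (near-close up lo nP nP') m (inj₁ (m≥1 , q)) = inj₁ (m≥1 , ℤP.≤∧≢⇒<
    (lia (P ∷ P' ∷ h *ℤ m ∷ []) (λ P P' y → P' :≤ P :+ K 1 ⟹ y :< P' ⟹ y :≤ P) up q) λ e → nP m (sym e))
  near-separated (near-close up lo nP nP') m (inj₂ (m≤0 , q)) = inj₂ (m≤0 , ℤP.≤∧≢⇒<
    (lia (P ∷ P' ∷ h *ℤ m ∷ []) (λ P P' y → P :≤ P' :+ K 1 ⟹ P' :< y ⟹ P :≤ y) lo q) (nP m))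
  near-separated (near-high k k≥2 eP eP') m (inj₁ (m≥1 , q)) = inj₁ (m≥1 ,
    lia (P ∷ P' ∷ h *ℤ m ∷ h *ℤ k ∷ []) (λ P P' y z → P :≡ z :+ K 1 ⟹ P' :≡ z :- K 1 ⟹ y :< P' ⟹ y :< P) eP eP' q)
  near-separated (near-high k k≥2 eP eP') m (inj₂ (m≤0 , q)) = ⊥-elim
    (lia (P' ∷ h ∷ m ∷ k ∷ []) (λ P' h m k → P' :≡ h :* k :- K 1 ⟹ P' :< h :* m ⟹ K 0 :≤ h :* (K 0 :- m) ⟹ K 0 :≤ h :* (k :- K 2) ⟹ K 4 :≤ h ⟹ :⊥)
      eP' q (h*≥ (+ 0) m≤0) (h*≥ k k≥2) h≥4)
  near-separated (near-low k k≥1 eP eP') m (inj₁ (m≥1 , q)) = ⊥-elim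
    (lia (P' ∷ h ∷ m ∷ k ∷ []) (λ P' h m k → P' :≡ :- (h :* k :- K 1) ⟹ h :* m :< P' ⟹ K 0 :≤ h :* (m :- K 1) ⟹ K 0 :≤ h :* (k :- K 1) ⟹ K 4 :≤ h ⟹ :⊥)
      eP' q (h*≥ m m≥1) (h*≥ k k≥1) h≥4)
  near-separated (near-low k k≥1 eP eP') m (inj₂ (m≤0 , q)) = inj₂ (m≤0 ,
    lia (P ∷ P' ∷ h *ℤ m ∷ h *ℤ k ∷ []) (λ P P' y z → P :≡ :- (z :+ K 1) ⟹ P' :≡ :- (z :- K 1) ⟹ P' :< y ⟹ P :< y) eP eP' q)

  -- The crossed level is at least 2 or at most -1, hence no Shi hyperplane is crossed.
  near-shi : Near h P P' → ∀ m → m ≡ + 0 ⊎ m ≡ + 1 → (h *ℤ m <ℤ P → h *ℤ m <ℤ P') × (h *ℤ m <ℤ P' → h *ℤ m <ℤ P)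
  near-shi (near-close up lo nP nP') m _ =
      (λ q → ℤP.≤∧≢⇒< (lia (P ∷ P' ∷ h *ℤ m ∷ []) (λ P P' y → P :≤ P' :+ K 1 ⟹ y :< P ⟹ y :≤ P') lo q) λ e → nP' m (sym e))
    , (λ q → ℤP.≤∧≢⇒< (lia (P ∷ P' ∷ h *ℤ m ∷ []) (λ P P' y → P' :≤ P :+ K 1 ⟹ y :< P' ⟹ y :≤ P) up q) λ e → nP m (sym e))
  near-shi (near-high k k≥2 eP eP') m m01 = (λ _ → big P' eP') ,
      (λ _ → ℤP.<-trans (big P' eP') (lia (P ∷ P' ∷ h *ℤ k ∷ []) (λ P P' z → P :≡ z :+ K 1 ⟹ P' :≡ z :- K 1 ⟹ P' :< P) eP eP'))
    where
    hm≤h : ∀ {m} → m ≡ + 0 ⊎ m ≡ + 1 → h *ℤ m ≤ℤ h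
    hm≤h (inj₁ refl) = lia (h ∷ []) (λ h → K 0 :≤ h ⟹ h :* K 0 :≤ h) h≥0
    hm≤h (inj₂ refl) = lia (h ∷ []) (λ h → h :* K 1 :≤ h)
    big : ∀ Q → Q ≡ h *ℤ k - + 1 → h *ℤ m <ℤ Q
    big Q eQ = lia (h ∷ h *ℤ m ∷ k ∷ Q ∷ []) (λ h y k Q → y :≤ h ⟹ Q :≡ h :* k :- K 1 ⟹ K 0 :≤ h :* (k :- K 2) ⟹ K 4 :≤ h ⟹ y :< Q) (hm≤h m01) eQ (h*≥ k k≥2) h≥4
  near-shi (near-low k k≥1 eP eP') m m01 = (λ q → ⊥-elim (ℤP.<-asym q (ℤP.<-trans (lia (P ∷ P' ∷ h *ℤ k ∷ []) (λ P P' z → P :≡ :- (z :+ K 1) ⟹ P' :≡ :- (z :- K 1) ⟹ P :< P') eP eP') small))) ,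
      (λ q → ⊥-elim (ℤP.<-asym q small))
    where
    hm≥0 : ∀ {m} → m ≡ + 0 ⊎ m ≡ + 1 → + 0 ≤ℤ h *ℤ m
    hm≥0 (inj₁ refl) = ℤP.≤-reflexive (sym (ℤP.*-zeroʳ h))
    hm≥0 (inj₂ refl) = subst (+ 0 ≤ℤ_) (sym (ℤP.*-identityʳ h)) h≥0
    small : P' <ℤ h *ℤ m
    small = lia (h ∷ h *ℤ m ∷ k ∷ P' ∷ []) (λ h y k Q → K 0 :≤ y ⟹ Q :≡ :- (h :* k :- K 1) ⟹ K 0 :≤ h :* (k :- K 1) ⟹ K 4 :≤ h ⟹ Q :< y) (hm≥0 m01) eP' (h*≥ k k≥1) h≥4

-- The alcove b' is b reflected in the wall of (A , B): the value h k + 1 of the root becomes h k -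
-- 1, which raises the coordinate at A by 1 and lowers the one at B by 1. If k ≥ 2, or k ≥ 1 and the
-- root is negative, the wall is no Shi hyperplane; then b' lies in the same region, closer to A∘.
module _ {n : ℕ} (n≥3 : 3 ≤ n) (b b' : Aff) (ab : IsAff n b) (ab' : IsAff n b') (A B : ℤ) (rA : InRange n ∣ A ∣) (rB : InRange n ∣ B ∣)
  (A≢B : ¬ ∣ A ∣ ≡ ∣ B ∣) (k : ℤ)
  (qA : val (pt n b') A ≡ val (pt n b) A +ℤ + 1) (qB : val (pt n b') B ≡ val (pt n b) B - + 1)
  (qo : ∀ C → InRange n ∣ C ∣ → ¬ ∣ C ∣ ≡ ∣ A ∣ → ¬ ∣ C ∣ ≡ ∣ B ∣ → val (pt n b') C ≡ val (pt n b) C)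
  (gap : val (pt n b) B - val (pt n b) A ≡ hD n *ℤ k +ℤ + 1) (nonShi : + 2 ≤ℤ k ⊎ (+ 1 ≤ℤ k × B <ℤ A)) where

  private
    h = hD n
    n≥1 = 3≤⇒1≤ n≥3
    h≥4 : + 4 ≤ℤ h
    h≥4 = lia (h ∷ + n ∷ []) (λ h n → h :≡ K 2 :* n :- K 2 ⟹ K 3 :≤ n ⟹ K 4 :≤ h) (hD≡ n≥1) (+≤+ n≥3)
    q q' : ℤ → ℤ
    q = val (pt n b)
    q' = val (pt n b')
    module G = FrameOf n≥3 b (aff-sp n≥3 b ab)
    module G' = FrameOf n≥3 b' (aff-sp n≥3 b' ab')

    k≥1 : + 1 ≤ℤ k
    k≥1 = go nonShi
      where
      go : + 2 ≤ℤ k ⊎ (+ 1 ≤ℤ k × B <ℤ A) → + 1 ≤ℤ k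
      go (inj₁ p) = ℤP.≤-trans (+≤+ (s≤s z≤n)) p
      go (inj₂ (p , _)) = p

    k≥2 : A <ℤ B → + 2 ≤ℤ k
    k≥2 A<B = go nonShi
      where
      go : + 2 ≤ℤ k ⊎ (+ 1 ≤ℤ k × B <ℤ A) → + 2 ≤ℤ k
      go (inj₁ p) = p
      go (inj₂ (_ , p)) = ⊥-elim (ℤP.<-asym A<B p)

    data Shift (C : ℤ) : Set where
      up : C ≡ A ⊎ C ≡ - B → q' C ≡ q C +ℤ + 1 → Shift C
      down : C ≡ B ⊎ C ≡ - A → q' C ≡ q C - + 1 → Shift C
      flat : q' C ≡ q C → Shift C

    negate : ∀ {C d} → q' C ≡ q C +ℤ d → q' (- C) ≡ q (- C) - d
    negate {C} {d} p = lia (q' (- C) ∷ q (- C) ∷ q' C ∷ q C ∷ d ∷ []) (λ s t u v d → s :≡ :- u ⟹ t :≡ :- v ⟹ u :≡ v :+ d ⟹ s :≡ t :- d)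
      (val-neg (pt n b') C) (val-neg (pt n b) C) p

    shift : ∀ C → InRange n ∣ C ∣ → Shift C
    shift C r with ∣ C ∣ ℕ.≟ ∣ A ∣ | ∣ C ∣ ℕ.≟ ∣ B ∣
    ... | yes e | _ = go (abs-cases C A e)
      where
      go : ∀ {C} → C ≡ A ⊎ C ≡ - A → Shift C
      go (inj₁ refl) = up (inj₁ refl) qA
      go (inj₂ refl) = down (inj₂ refl) (negate {A} {+ 1} qA)
    ... | no _ | yes e = go (abs-cases C B e)
      where
      go : ∀ {C} → C ≡ B ⊎ C ≡ - B → Shift C
      go (inj₁ refl) = down (inj₁ refl) qB
      go (inj₂ refl) = up (inj₂ refl) (negate {B} { - + 1} qB)
    ... | no p | no s = flat (qo C r p s)

    ∣-∣ = ℤP.∣-i∣≡∣i∣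

    near : ∀ U V → InRange n ∣ U ∣ → InRange n ∣ V ∣ → ¬ ∣ U ∣ ≡ ∣ V ∣ → U <ℤ V → Near h (q V - q U) (q' V - q' U)
    near U V rU rV ne U<V = go (shift U rU) (shift V rV)
      where
      flip : ∀ {x y} → - x <ℤ - y → y <ℤ x
      flip {x} {y} = lia (x ∷ y ∷ []) λ x y → :- x :< :- y ⟹ y :< x
      close' : q' V - q' U ≤ℤ q V - q U +ℤ + 1 → q V - q U ≤ℤ q' V - q' U +ℤ + 1 → Near h (q V - q U) (q' V - q' U)
      close' p s = near-close p s (G.generic U V rU rV ne) (G'.generic U V rU rV ne)
      vs = q' V ∷ q' U ∷ q V ∷ q U ∷ []
      gap⁻ : q (- A) - q (- B) ≡ h *ℤ k +ℤ + 1
      gap⁻ = lia (q (- A) ∷ q (- B) ∷ q A ∷ q B ∷ h *ℤ k ∷ []) (λ s t u v y → s :≡ :- u ⟹ t :≡ :- v ⟹ v :- u :≡ y :+ K 1 ⟹ s :- t :≡ y :+ K 1)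
        (val-neg (pt n b) A) (val-neg (pt n b) B) gap
      high' : A <ℤ B → q V - q U ≡ h *ℤ k +ℤ + 1 → q' U ≡ q U +ℤ + 1 → q' V ≡ q V - + 1 → Near h (q V - q U) (q' V - q' U)
      high' lt g u v = near-high k (k≥2 lt) g (lia (h *ℤ k ∷ vs) (λ y v' u' v u → v :- u :≡ y :+ K 1 ⟹ u' :≡ u :+ K 1 ⟹ v' :≡ v :- K 1 ⟹ v' :- u' :≡ y :- K 1) g u v)
      low' : q U - q V ≡ h *ℤ k +ℤ + 1 → q' U ≡ q U - + 1 → q' V ≡ q V +ℤ + 1 → Near h (q V - q U) (q' V - q' U)
      low' g u v = near-low k k≥1
        (lia (h *ℤ k ∷ vs) (λ y v' u' v u → u :- v :≡ y :+ K 1 ⟹ v :- u :≡ :- (y :+ K 1)) g)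
        (lia (h *ℤ k ∷ vs) (λ y v' u' v u → u :- v :≡ y :+ K 1 ⟹ u' :≡ u :- K 1 ⟹ v' :≡ v :+ K 1 ⟹ v' :- u' :≡ :- (y :- K 1)) g u v)
      go : Shift U → Shift V → Near h (q V - q U) (q' V - q' U)
      go (up (inj₁ refl) u) (down (inj₁ refl) v) = high' U<V gap u v
      go (up (inj₁ refl) u) (down (inj₂ refl) v) = ⊥-elim (ne (sym (∣-∣ A)))
      go (up (inj₂ refl) u) (down (inj₁ refl) v) = ⊥-elim (ne (∣-∣ B))
      go (up (inj₂ refl) u) (down (inj₂ refl) v) = high' (flip U<V) gap⁻ u v
      go (down (inj₁ refl) u) (up (inj₁ refl) v) = low' gap u v
      go (down (inj₁ refl) u) (up (inj₂ refl) v) = ⊥-elim (ne (sym (∣-∣ B)))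
      go (down (inj₂ refl) u) (up (inj₁ refl) v) = ⊥-elim (ne (∣-∣ A))
      go (down (inj₂ refl) u) (up (inj₂ refl) v) = low' gap⁻ u v
      -- In all remaining cases the difference changes by at most 1, and both alcoves avoid the
      -- multiples of h.
      go (up _ u) (up _ v) = close' (lia vs (λ v' u' v u → u' :≡ u :+ K 1 ⟹ v' :≡ v :+ K 1 ⟹ v' :- u' :≤ v :- u :+ K 1) u v)
        (lia vs (λ v' u' v u → u' :≡ u :+ K 1 ⟹ v' :≡ v :+ K 1 ⟹ v :- u :≤ v' :- u' :+ K 1) u v)
      go (down _ u) (down _ v) = close' (lia vs (λ v' u' v u → u' :≡ u :- K 1 ⟹ v' :≡ v :- K 1 ⟹ v' :- u' :≤ v :- u :+ K 1) u v)
        (lia vs (λ v' u' v u → u' :≡ u :- K 1 ⟹ v' :≡ v :- K 1 ⟹ v :- u :≤ v' :- u' :+ K 1) u v)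
      go (flat u) (flat v) = close' (lia vs (λ v' u' v u → u' :≡ u ⟹ v' :≡ v ⟹ v' :- u' :≤ v :- u :+ K 1) u v)
        (lia vs (λ v' u' v u → u' :≡ u ⟹ v' :≡ v ⟹ v :- u :≤ v' :- u' :+ K 1) u v)
      go (flat u) (up _ v) = close' (lia vs (λ v' u' v u → u' :≡ u ⟹ v' :≡ v :+ K 1 ⟹ v' :- u' :≤ v :- u :+ K 1) u v)
        (lia vs (λ v' u' v u → u' :≡ u ⟹ v' :≡ v :+ K 1 ⟹ v :- u :≤ v' :- u' :+ K 1) u v)
      go (flat u) (down _ v) = close' (lia vs (λ v' u' v u → u' :≡ u ⟹ v' :≡ v :- K 1 ⟹ v' :- u' :≤ v :- u :+ K 1) u v)
        (lia vs (λ v' u' v u → u' :≡ u ⟹ v' :≡ v :- K 1 ⟹ v :- u :≤ v' :- u' :+ K 1) u v)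
      go (up _ u) (flat v) = close' (lia vs (λ v' u' v u → u' :≡ u :+ K 1 ⟹ v' :≡ v ⟹ v' :- u' :≤ v :- u :+ K 1) u v)
        (lia vs (λ v' u' v u → u' :≡ u :+ K 1 ⟹ v' :≡ v ⟹ v :- u :≤ v' :- u' :+ K 1) u v)
      go (down _ u) (flat v) = close' (lia vs (λ v' u' v u → u' :≡ u :- K 1 ⟹ v' :≡ v ⟹ v' :- u' :≤ v :- u :+ K 1) u v)
        (lia vs (λ v' u' v u → u' :≡ u :- K 1 ⟹ v' :≡ v ⟹ v :- u :≤ v' :- u' :+ K 1) u v)

    near-PR : ∀ c → ValidPR n c → Near h (inner n (pt n b) (vecPR c)) (inner n (pt n b') (vecPR c))
    near-PR c v = let e , lt , ne , rU , rV = pairOf {n} c v in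
      subst₂ (Near h) (sym (e (pt n b))) (sym (e (pt n b'))) (near (- a c) (+ j c) rU rV ne lt)

    same-shi : SameShi n b b'
    same-shi c v m m01 = mk⇔ (proj₁ (near-shi h≥4 (near-PR c v) m m01)) (proj₂ (near-shi h≥4 (near-PR c v) m m01))

    inside : ∀ c → ValidPR n c → Inside n≥1 b' b c
    inside c v = near-separated h≥4 (near-PR c v)

    shorter : dist n b' ℕ.< dist n b
    shorter with ℤP.<-cmp A B
    ... | tri≈ _ e _ = ⊥-elim (A≢B (cong ∣_∣ e))
    ... | tri< A<B _ _ with rootOf {n} A B rA rB A≢B A<B
    ... | c , v , e = dist-< n≥1 b' b inside c v k
      (λ { (inj₁ (_ , p)) → lia (P' ∷ q' A ∷ q' B ∷ q A ∷ q B ∷ h *ℤ k ∷ []) (λ P a' b' a b y → P :≡ b' :- a' ⟹ a' :≡ a :+ K 1 ⟹ b' :≡ b :- K 1 ⟹ b :- a :≡ y :+ K 1 ⟹ y :< P ⟹ :⊥) (e (pt n b')) qA qB gap p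
         ; (inj₂ (p , _)) → lia (k ∷ []) (λ k → K 1 :≤ k ⟹ k :≤ K 0 ⟹ :⊥) k≥1 p })
      (inj₁ (k≥1 , lia (P ∷ q A ∷ q B ∷ h *ℤ k ∷ []) (λ P a b y → P :≡ b :- a ⟹ b :- a :≡ y :+ K 1 ⟹ y :< P) (e (pt n b)) gap))
      where
      P = inner n (pt n b) (vecPR c)
      P' = inner n (pt n b') (vecPR c)
    shorter | tri> _ _ B<A with rootOf {n} B A rB rA (λ e → A≢B (sym e)) B<A
    ... | c , v , e = dist-< n≥1 b' b inside c v (- k)
      (λ { (inj₂ (_ , p)) → lia (P' ∷ q' A ∷ q' B ∷ q A ∷ q B ∷ h ∷ k ∷ []) (λ P a' b' a b h k → P :≡ a' :- b' ⟹ a' :≡ a :+ K 1 ⟹ b' :≡ b :- K 1 ⟹ b :- a :≡ h :* k :+ K 1 ⟹ P :< h :* :- k ⟹ :⊥) (e (pt n b')) qA qB gap p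
         ; (inj₁ (p , _)) → lia (k ∷ []) (λ k → K 1 :≤ k ⟹ K 1 :≤ :- k ⟹ :⊥) k≥1 p })
      (inj₂ (lia (k ∷ []) (λ k → K 1 :≤ k ⟹ :- k :≤ K 0) k≥1 ,
        lia (P ∷ q A ∷ q B ∷ h ∷ k ∷ []) (λ P a b h k → P :≡ a :- b ⟹ b :- a :≡ h :* k :+ K 1 ⟹ P :< h :* :- k) (e (pt n b)) gap))
      where
      P = inner n (pt n b) (vecPR c)
      P' = inner n (pt n b') (vecPR c)

  not-minimal : ¬ MinAlcove n b
  not-minimal (_ , min) = ℕP.<⇒≱ shorter (min b' ab' same-shi)

refl-invol : ∀ {n} c → ValidPR n c → ∀ i → 1 ≤ i → val (reflSP c) (reflSP c i) ≡ + i
refl-invol {n} c v i i≥1 with i ℕ.≟ j c | i ℕ.≟ ∣ a c ∣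
... | yes refl | _ = begin
    val (reflSP c) (reflSP c (j c)) ≡⟨ cong (val (reflSP c)) (refl-j {n} c v) ⟩
    val (reflSP c) (- a c) ≡⟨ val-neg (reflSP c) (a c) ⟩
    - (sgn (a c) *ℤ reflSP c ∣ a c ∣) ≡⟨ cong (λ y → - (sgn (a c) *ℤ y)) (refl-a {n} c v) ⟩
    - (sgn (a c) *ℤ - (sgn (a c) *ℤ + j c)) ≡⟨ lia (sgn (a c) ∷ + j c ∷ []) (λ s j → (s :* s) :* j :≡ K 1 :* j ⟹ :- (s :* :- (s :* j)) :≡ j) (cong (_*ℤ + j c) (sgn-sgn (a c) (proj₁ v))) ⟩
    + j c ∎
  where open ≡-Reasoning
... | no _ | yes refl = begin
    val (reflSP c) (reflSP c ∣ a c ∣) ≡⟨ cong (val (reflSP c)) (refl-a {n} c v) ⟩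
    val (reflSP c) (- (sgn (a c) *ℤ + j c)) ≡⟨ val-neg (reflSP c) (sgn (a c) *ℤ + j c) ⟩
    - val (reflSP c) (sgn (a c) *ℤ + j c) ≡⟨ cong -_ (val-sgn (reflSP c) (a c) (+ j c) (proj₁ v)) ⟩
    - (sgn (a c) *ℤ val (reflSP c) (+ j c)) ≡⟨ cong (λ y → - (sgn (a c) *ℤ y)) (trans (val-+ (reflSP c) (j c) (proj₁ (proj₂ (PR-ranges {n} c v)))) (refl-j {n} c v)) ⟩
    - (sgn (a c) *ℤ - a c) ≡⟨ cong (λ y → - (sgn (a c) *ℤ - y)) (sgn-∣∣ (a c)) ⟨
    - (sgn (a c) *ℤ - (sgn (a c) *ℤ + ∣ a c ∣)) ≡⟨ lia (sgn (a c) ∷ + ∣ a c ∣ ∷ []) (λ s j → (s :* s) :* j :≡ K 1 :* j ⟹ :- (s :* :- (s :* j)) :≡ j) (cong (_*ℤ + ∣ a c ∣) (sgn-sgn (a c) (proj₁ v))) ⟩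
    + ∣ a c ∣ ∎
  where open ≡-Reasoning
... | no p | no q = trans (cong (val (reflSP c)) (refl-other {n} c v i p q)) (trans (val-+ (reflSP c) i i≥1) (refl-other {n} c v i p q))

module _ {n : ℕ} (n≥3 : 3 ≤ n) (b : Aff) (mb : MinAlcove n b) where
  private
    ab = proj₁ mb
    w = lin b
    t = tr b
    sb = aff-sp n≥3 b ab
    h = hD n
    τ = frameτ n≥3 b
    open Ends n≥3

    -- b s_c: the alcove adjacent to b through the wall of c, translated by t' − t when c is the affine wall.
    module Adjacent (c : PR) (v : ValidPR n c) (t' : ZV) (t'∈ : InCoroot n t') where
      b' : Aff
      b' = aff (comp w (reflSP c)) t'
      db' : DPerm n (lin b')
      db' = comp-D {n} {w} (toDPerm (proj₁ ab)) (refl-D {n} c v)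
      ab' : IsAff n b'
      ab' = fromDPerm db' , t'∈
      -- Because the reflection is an involution, the row i of w is the signed row `reflSP c i` of
      -- b'.
      pt' : ∀ i → InRange n i → val (pt n b') (w i) ≡ val rhoV (reflSP c i) +ℤ h *ℤ val t' (w i)
      pt' i r = begin
        val (pt n b') (w i) ≡⟨ val-+ᵥ (act n w' rhoV) (hD n ·v t') (w i) ⟩
        val (act n w' rhoV) (w i) +ℤ val (hD n ·v t') (w i) ≡⟨ cong₂ _+ℤ_ lemma (val-*ᵥ h t' (w i)) ⟩
        val rhoV (reflSP c i) +ℤ h *ℤ val t' (w i) ∎
        where
        open ≡-Reasoning
        w' = comp w (reflSP c)
        ri≥1 : 1 ≤ ∣ reflSP c i ∣
        ri≥1 = sp-≥1 (refl-sp {n} c v) i r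
        wi≡ : val w' (reflSP c i) ≡ w i
        wi≡ = trans (sym (val-val w (reflSP c) (reflSP c i) ri≥1)) (trans (cong (val w) (refl-invol {n} c v i (proj₁ r))) (val-+ w i (proj₁ r)))
        lemma : val (act n w' rhoV) (w i) ≡ val rhoV (reflSP c i)
        lemma = trans (cong (val (act n w' rhoV)) (sym wi≡)) (trans (val-val (act n w' rhoV) w' (reflSP c i) ri≥1)
          (val-cong (λ k → val (act n w' rhoV) (w' k)) rhoV (reflSP c i) (act-val (sgnd db') rhoV ∣ reflSP c i ∣ (sp-maps (refl-sp {n} c v) i r))))
      ptb : ∀ i → InRange n i → val (pt n b) (w i) ≡ rhoV i +ℤ h *ℤ τ i
      ptb = pt-frame {n} {b} sb

      others : ∀ i₁ i₂ A B → ∣ w i₁ ∣ ≡ ∣ A ∣ → ∣ w i₂ ∣ ≡ ∣ B ∣ →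
        (∀ i → InRange n i → ¬ i ≡ i₁ → ¬ i ≡ i₂ → val (pt n b') (w i) ≡ val (pt n b) (w i)) →
        ∀ C → InRange n ∣ C ∣ → ¬ ∣ C ∣ ≡ ∣ A ∣ → ¬ ∣ C ∣ ≡ ∣ B ∣ → val (pt n b') C ≡ val (pt n b) C
      others i₁ i₂ A B e₁ e₂ agree C r nA nB with sp-surj sb ∣ C ∣ r
      ... | i , ri , e = go C (abs-cases (w i) C e) (agree i ri (λ { refl → nA (trans (sym e) e₁) }) (λ { refl → nB (trans (sym e) e₂) }))
        where
        go : ∀ C → w i ≡ C ⊎ w i ≡ - C → val (pt n b') (w i) ≡ val (pt n b) (w i) → val (pt n b') C ≡ val (pt n b) C
        go C (inj₁ refl) p = p
        go C (inj₂ q) p = ℤP.neg-injective (trans (sym (val-neg (pt n b') C)) (trans (trans (cong (val (pt n b')) (sym q)) (trans p (cong (val (pt n b)) q))) (val-neg (pt n b) C)))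

    rho≡ : ∀ {i} → 1 ≤ i → rhoV i ≡ + i - + 1
    rho≡ = pos∸1

    w-≢ : ∀ i k → InRange n i → InRange n k → ¬ i ≡ k → ¬ ∣ w i ∣ ≡ ∣ w k ∣
    w-≢ i k ri rk ne e = ne (sp-inj sb i k ri rk e)

    suc≢ : ∀ i → ¬ i ≡ suc i
    suc≢ i ()

    lt-or : ∀ x y → ¬ x ≡ y → ¬ y <ℤ x → x <ℤ y
    lt-or x y ne nlt = ℤP.≤∧≢⇒< (ℤP.≮⇒≥ nlt) ne

    -- The reflection makes the rows i and i + 1 exchange their values of ρ̌, which differ by 1. So
    -- one coordinate rises and the other falls by 1, as `not-minimal` demands.
    up-step : ∀ i → 1 ≤ i → i ℕ.< n → ¬ (+ 2 ≤ℤ τ (suc i) - τ i ⊎ (+ 1 ≤ℤ τ (suc i) - τ i × w (suc i) <ℤ w i))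
    up-step i i≥1 i<n bad = not-minimal n≥3 b b' ab ab' (w i) (w (suc i)) (sp-maps sb i ri) (sp-maps sb (suc i) rs) (w-≢ i (suc i) ri rs (suc≢ i))
      (τ (suc i) - τ i)
      (lia (val (pt n b') (w i) ∷ val (pt n b) (w i) ∷ val rhoV (reflSP c i) ∷ rhoV i ∷ h ∷ τ i ∷ + i ∷ []) (λ Q P r s h t i → Q :≡ r :+ h :* t ⟹ P :≡ s :+ h :* t ⟹ r :≡ i ⟹ s :≡ i :- K 1 ⟹ Q :≡ P :+ K 1)
        (pt' i ri) (ptb i ri) r-i (rho≡ i≥1))
      (lia (val (pt n b') (w (suc i)) ∷ val (pt n b) (w (suc i)) ∷ val rhoV (reflSP c (suc i)) ∷ h ∷ τ (suc i) ∷ + i ∷ []) (λ Q P r h t i → Q :≡ r :+ h :* t ⟹ P :≡ i :+ h :* t ⟹ r :≡ i :- K 1 ⟹ Q :≡ P :- K 1)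
        (pt' (suc i) rs) (ptb (suc i) rs) r-s)
      (others i (suc i) (w i) (w (suc i)) refl refl λ k rk ne ne' → trans (pt' k rk) (trans (cong (λ y → val rhoV y +ℤ h *ℤ τ k) (refl-other {n} c v k ne' (λ e → ne (trans e (ℤP.∣-i∣≡∣i∣ (+ i))))))
        (trans (cong (_+ℤ h *ℤ τ k) (val-+ rhoV k (proj₁ rk))) (sym (ptb k rk)))))
      (lia (val (pt n b) (w (suc i)) ∷ val (pt n b) (w i) ∷ rhoV i ∷ h ∷ τ (suc i) ∷ τ i ∷ + i ∷ []) (λ Q P r h t s i → Q :≡ i :+ h :* t ⟹ P :≡ r :+ h :* s ⟹ r :≡ i :- K 1 ⟹ Q :- P :≡ h :* (t :- s) :+ K 1)
        (ptb (suc i) rs) (ptb i ri) (rho≡ i≥1))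
      bad mb
      where
      ri : InRange n i
      ri = i≥1 , ℕP.<⇒≤ i<n
      rs : InRange n (suc i)
      rs = s≤s z≤n , i<n
      c = pr (- + i) (suc i)
      v : ValidPR n c
      v = subst (1 ≤_) (sym (ℤP.∣-i∣≡∣i∣ (+ i))) i≥1 , subst (ℕ._< suc i) (sym (ℤP.∣-i∣≡∣i∣ (+ i))) ℕP.≤-refl , i<n
      open Adjacent c v t (proj₂ ab)
      r-i : val rhoV (reflSP c i) ≡ + i
      r-i = trans (cong (val rhoV) (trans (cong (reflSP c) (sym (ℤP.∣-i∣≡∣i∣ (+ i)))) (trans (refl-a {n} c v) (minus1 i i≥1)))) (val-+ rhoV (suc i) (s≤s z≤n))
        where
        minus1 : ∀ i → 1 ≤ i → - (sgn (- + i) *ℤ + suc i) ≡ + suc i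
        minus1 (suc i) _ = trans (cong -_ (ℤP.-1*i≡-i (+ suc (suc i)))) refl
      r-s : val rhoV (reflSP c (suc i)) ≡ + i - + 1
      r-s = trans (cong (val rhoV) (trans (refl-j {n} c v) (ℤP.neg-involutive (+ i)))) (trans (val-+ rhoV i i≥1) (rho≡ i≥1))

    lo-step : ¬ (+ 2 ≤ℤ τ 1 +ℤ τ 2 ⊎ (+ 1 ≤ℤ τ 1 +ℤ τ 2 × w 2 <ℤ - w 1))
    lo-step bad = not-minimal n≥3 b b' ab ab' (- w 1) (w 2) (subst (InRange n) (sym (ℤP.∣-i∣≡∣i∣ (w 1))) (sp-maps sb 1 r1)) (sp-maps sb 2 r2)
      (λ e → w-≢ 1 2 r1 r2 (λ ()) (trans (sym (ℤP.∣-i∣≡∣i∣ (w 1))) e)) (τ 1 +ℤ τ 2)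
      (lia (val (pt n b') (- w 1) ∷ val (pt n b) (- w 1) ∷ val (pt n b') (w 1) ∷ val (pt n b) (w 1) ∷ h *ℤ τ 1 ∷ []) (λ Q' P' Q P y → Q' :≡ :- Q ⟹ P' :≡ :- P ⟹ Q :≡ :- K 1 :+ y ⟹ P :≡ K 0 :+ y ⟹ Q' :≡ P' :+ K 1)
        (val-neg (pt n b') (w 1)) (val-neg (pt n b) (w 1)) (pt' 1 r1) (ptb 1 r1))
      (lia (val (pt n b') (w 2) ∷ val (pt n b) (w 2) ∷ h *ℤ τ 2 ∷ []) (λ Q P y → Q :≡ K 0 :+ y ⟹ P :≡ K 1 :+ y ⟹ Q :≡ P :- K 1)
        (pt' 2 r2) (ptb 2 r2))
      (others 1 2 (- w 1) (w 2) (sym (ℤP.∣-i∣≡∣i∣ (w 1))) refl λ k rk ne ne' → trans (pt' k rk) (trans (cong (λ y → val rhoV y +ℤ h *ℤ τ k) (refl-other {n} c v k ne' ne))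
        (trans (cong (_+ℤ h *ℤ τ k) (val-+ rhoV k (proj₁ rk))) (sym (ptb k rk)))))
      (lia (val (pt n b) (w 2) ∷ val (pt n b) (- w 1) ∷ val (pt n b) (w 1) ∷ h ∷ τ 1 ∷ τ 2 ∷ []) (λ Q P' P h s t → Q :≡ K 1 :+ h :* t ⟹ P' :≡ :- P ⟹ P :≡ K 0 :+ h :* s ⟹ Q :- P' :≡ h :* (s :+ t) :+ K 1)
        (ptb 2 r2) (val-neg (pt n b) (w 1)) (ptb 1 r1))
      bad mb
      where
      c = pr (+ 1) 2
      v : ValidPR n c
      v = ℕP.≤-refl , ℕP.≤-refl , proj₂ r2
      open Adjacent c v t (proj₂ ab)

    hi-step : ¬ (τ (n ∸ 1) +ℤ τ n ≤ℤ - + 3 ⊎ (τ (n ∸ 1) +ℤ τ n ≤ℤ - + 2 × - w n <ℤ w (n ∸ 1)))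
    hi-step bad = not-minimal n≥3 b b' ab ab' (w p) (- w n) (sp-maps sb p rp) (subst (InRange n) (sym (ℤP.∣-i∣≡∣i∣ (w n))) (sp-maps sb n rn))
      (λ e → w-≢ p n rp rn p≢n (trans e (ℤP.∣-i∣≡∣i∣ (w n)))) (- (τ p +ℤ τ n) - + 1)
      (lia (val (pt n b') (w p) ∷ val (pt n b) (w p) ∷ val rhoV (reflSP c p) ∷ rhoV p ∷ h ∷ val t' (w p) ∷ τ p ∷ + n ∷ []) (λ Q P r s h t' t n → Q :≡ r :+ h :* t' ⟹ P :≡ s :+ h :* t ⟹ h :* t' :≡ h :* (t :+ K 1) ⟹ r :≡ K 1 :- n ⟹ s :≡ n :- K 2 ⟹ h :≡ K 2 :* n :- K 2 ⟹ Q :≡ P :+ K 1)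
        (pt' p rp) (ptb p rp) (cong (h *ℤ_) t'p) r-p rho-p (hD≡ n≥1))
      (lia (val (pt n b') (- w n) ∷ val (pt n b) (- w n) ∷ val (pt n b') (w n) ∷ val (pt n b) (w n) ∷ val rhoV (reflSP c n) ∷ rhoV n ∷ h ∷ val t' (w n) ∷ τ n ∷ + n ∷ []) (λ Q' P' Q P r s h t' t n → Q' :≡ :- Q ⟹ P' :≡ :- P ⟹ Q :≡ r :+ h :* t' ⟹ P :≡ s :+ h :* t ⟹ h :* t' :≡ h :* (t :+ K 1) ⟹ r :≡ K 2 :- n ⟹ s :≡ n :- K 1 ⟹ h :≡ K 2 :* n :- K 2 ⟹ Q' :≡ P' :- K 1)
        (val-neg (pt n b') (w n)) (val-neg (pt n b) (w n)) (pt' n rn) (ptb n rn) (cong (h *ℤ_) t'n) r-n (rho≡ n≥1) (hD≡ n≥1))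
      (others p n (w p) (- w n) refl (sym (ℤP.∣-i∣≡∣i∣ (w n))) λ k rk ne ne' → trans (pt' k rk) (trans (cong₂ (λ y z → val rhoV y +ℤ h *ℤ z) (refl-other {n} c v k ne' ne) (t'o k rk ne ne'))
        (trans (cong (_+ℤ h *ℤ τ k) (val-+ rhoV k (proj₁ rk))) (sym (ptb k rk)))))
      (lia (val (pt n b) (- w n) ∷ val (pt n b) (w n) ∷ val (pt n b) (w p) ∷ rhoV n ∷ rhoV p ∷ h ∷ τ p ∷ τ n ∷ + n ∷ []) (λ Q' Q P r s h t t' n → Q' :≡ :- Q ⟹ Q :≡ r :+ h :* t' ⟹ P :≡ s :+ h :* t ⟹ r :≡ n :- K 1 ⟹ s :≡ n :- K 2 ⟹ h :≡ K 2 :* n :- K 2 ⟹ Q' :- P :≡ h :* (:- (t :+ t') :- K 1) :+ K 1)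
        (val-neg (pt n b) (w n)) (ptb n rn) (ptb p rp) (rho≡ n≥1) rho-p (hD≡ n≥1))
      (convert bad) mb
      where
      c = pr (+ p) n
      v : ValidPR n c
      v = proj₁ rp , p<n , ℕP.≤-refl
      t' : ZV
      -- The affine simple reflection is that of α̃ followed by the translation by α̃. Composed with
      -- b it adds w α̃ to the translation part.
      t' = t ⊕ (e (w n) ⊕ e (w p))
      sum-e : ∀ i → InRange n i → sumTo n (e (w i)) ≡₂ + 1
      sum-e i ri = ≡₂-trans (≡⇒≡₂ (trans (sumTo-single n ∣ w i ∣ (sp-maps sb i ri) λ k _ ne → e-miss (w i) k λ q → ne (sym q)) (e-hit (w i) ∣ w i ∣ refl)))
        (≡₂-trans (≡⇒≡₂ (sym (ℤP.*-identityʳ (sgn (w i))))) (sgn*-≡₂ (w i) (+ 1) (sp-≥1 sb i ri)))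
      t'∈ : InCoroot n t'
      t'∈ = even⇒∣ (sumTo n t') (≡₂-trans (≡⇒≡₂ (trans (sumTo-+ n t (e (w n) ⊕ e (w p))) (cong (sumTo n t +ℤ_) (sumTo-+ n (e (w n)) (e (w p))))))
        (≡₂-trans (≡₂-+ (∣⇒even (sumTo n t) (proj₂ ab)) (≡₂-+ (sum-e n rn) (sum-e p rp))) (mod₂ (+ 1) refl)))
      open Adjacent c v t' t'∈
      val-t' : ∀ i → val t' (w i) ≡ τ i +ℤ (val (e (w n)) (w i) +ℤ val (e (w p)) (w i))
      val-t' i = trans (val-+ᵥ t (e (w n) ⊕ e (w p)) (w i)) (cong (τ i +ℤ_) (val-+ᵥ (e (w n)) (e (w p)) (w i)))
      e-same : ∀ i → InRange n i → val (e (w i)) (w i) ≡ + 1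
      e-same i ri = trans (cong (sgn (w i) *ℤ_) (e-hit (w i) ∣ w i ∣ refl)) (sgn-sgn (w i) (sp-≥1 sb i ri))
      e-diff : ∀ i k → InRange n i → InRange n k → ¬ i ≡ k → val (e (w k)) (w i) ≡ + 0
      e-diff i k ri rk ne = trans (cong (sgn (w i) *ℤ_) (e-miss (w k) ∣ w i ∣ (w-≢ k i rk ri (λ q → ne (sym q))))) (ℤP.*-zeroʳ (sgn (w i)))
      t'p : val t' (w p) ≡ τ p +ℤ + 1
      t'p = trans (val-t' p) (cong (τ p +ℤ_) (cong₂ _+ℤ_ (e-diff p n rp rn p≢n) (e-same p rp)))
      t'n : val t' (w n) ≡ τ n +ℤ + 1
      t'n = trans (val-t' n) (cong (τ n +ℤ_) (cong₂ _+ℤ_ (e-same n rn) (e-diff n p rn rp (λ q → p≢n (sym q)))))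
      t'o : ∀ k → InRange n k → ¬ k ≡ p → ¬ k ≡ n → val t' (w k) ≡ τ k
      t'o k rk kp kn = trans (val-t' k) (trans (cong (τ k +ℤ_) (cong₂ _+ℤ_ (e-diff k n rk rn kn) (e-diff k p rk rp kp))) (ℤP.+-identityʳ (τ k)))
      rho-p : rhoV p ≡ + n - + 2
      rho-p = trans (rho≡ (proj₁ rp)) (lia (+ p ∷ + n ∷ []) (λ p n → p :≡ n :- K 1 ⟹ p :- K 1 :≡ n :- K 2) p≡)
      r-p : val rhoV (reflSP c p) ≡ + 1 - + n
      r-p = trans (cong (val rhoV) (trans (refl-a {n} c v) (cong (λ s → - (s *ℤ + n)) (sgn-+ p (proj₁ rp)))))
        (trans (val-neg rhoV (+ 1 *ℤ + n)) (trans (cong -_ (trans (cong (val rhoV) (ℤP.*-identityˡ (+ n))) (trans (val-+ rhoV n n≥1) (rho≡ n≥1))))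
          (lia (+ n ∷ []) λ n → :- (n :- K 1) :≡ K 1 :- n)))
      r-n : val rhoV (reflSP c n) ≡ + 2 - + n
      r-n = trans (cong (val rhoV) (refl-j {n} c v)) (trans (val-neg rhoV (+ p)) (trans (cong -_ (trans (val-+ rhoV p (proj₁ rp)) rho-p))
        (lia (+ n ∷ []) λ n → :- (n :- K 2) :≡ K 2 :- n)))
      y = τ p +ℤ τ n
      convert : (y ≤ℤ - + 3 ⊎ (y ≤ℤ - + 2 × - w n <ℤ w p)) → (+ 2 ≤ℤ - y - + 1 ⊎ (+ 1 ≤ℤ - y - + 1 × - w n <ℤ w p))
      convert (inj₁ q) = inj₁ (lia (y ∷ []) (λ y → y :≤ :- K 3 ⟹ K 2 :≤ :- y :- K 1) q)
      convert (inj₂ (q , s)) = inj₂ (lia (y ∷ []) (λ y → y :≤ :- K 2 ⟹ K 1 :≤ :- y :- K 1) q , s)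


  min⇒sommers : Sommers n w τ
  min⇒sommers = record
    { up≤ = λ i p q → ℤP.≮⇒≥ λ lt → up-step i p q (inj₁ (lia (τ (suc i) - τ i ∷ []) (λ y → K 1 :< y ⟹ K 2 :≤ y) lt))
    ; up= = λ i p q e → lt-or (w i) (w (suc i)) (λ e' → w-≢ i (suc i) (p , ℕP.<⇒≤ q) (s≤s z≤n , q) (suc≢ i) (cong ∣_∣ e'))
        λ lt → up-step i p q (inj₂ (ℤP.≤-reflexive (sym e) , lt))
    ; lo≤ = ℤP.≮⇒≥ λ lt → lo-step (inj₁ (lia (τ 1 +ℤ τ 2 ∷ []) (λ y → K 1 :< y ⟹ K 2 :≤ y) lt))
    ; lo= = λ e → lt-or (- w 1) (w 2) (λ e' → w-≢ 1 2 r1 r2 (λ ()) (trans (sym (ℤP.∣-i∣≡∣i∣ (w 1))) (cong ∣_∣ e')))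
        λ lt → lo-step (inj₂ (ℤP.≤-reflexive (sym e) , lt))
    ; hi≤ = ℤP.≮⇒≥ λ lt → hi-step (inj₁ (lia (τ (n ∸ 1) +ℤ τ n ∷ []) (λ y → y :< :- K 2 ⟹ y :≤ :- K 3) lt))
    ; hi= = λ e → lt-or (w (n ∸ 1)) (- w n)
        (λ e' → w-≢ (n ∸ 1) n rp (n≥1 , ℕP.≤-refl) (ℕP.<⇒≢ p<n) (trans (cong ∣_∣ e') (ℤP.∣-i∣≡∣i∣ (w n))))
        λ lt → hi-step (inj₂ (ℤP.≤-reflexive e , lt))
    }

-- Points of the open fundamental alcove dilated by M, and the free action on them.

record Chain (n : ℕ) (M : ℤ) (c : ℕ → ℤ) : Set where
  field
    rise : ∀ i → 1 ≤ i → i ℕ.< n → c i <ℤ c (suc i)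
    base : + 0 <ℤ c 1 +ℤ c 2
    roof : c (n ∸ 1) +ℤ c n <ℤ M

mono-id : ∀ n (f : ℕ → ℕ) → (∀ i → InRange n i → InRange n (f i)) →
  (∀ i → 1 ≤ i → i ℕ.< n → f i ℕ.< f (suc i)) → ∀ i → InRange n i → f i ≡ i
mono-id n f rng mono i r = ℕP.≤-antisym (upper (n ∸ i) i r (ℕP.m+[n∸m]≡n (proj₂ r))) (lower i r)
  where
  lower : ∀ i → InRange n i → i ≤ f i
  lower (suc zero) r = proj₁ (rng 1 r)
  lower (suc (suc i)) (_ , q) = ℕP.≤-<-trans (lower (suc i) (s≤s z≤n , ℕP.<⇒≤ q)) (mono (suc i) (s≤s z≤n) q)
  upper : ∀ d i → InRange n i → i + d ≡ n → f i ≤ i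
  upper zero i r e = subst (f i ≤_) (trans (sym e) (ℕP.+-identityʳ i)) (proj₂ (rng i r))
  upper (suc d) i r@(p , _) e = ℕP.≤-pred (ℕP.≤-trans (mono i p i<n) (upper d (suc i) (s≤s z≤n , i<n) e'))
    where
    e' : suc i + d ≡ n
    e' = trans (sym (ℕP.+-suc i d)) e
    i<n : i ℕ.< n
    i<n = subst (i ℕ.<_) e (ℕP.m<m+n i (s≤s z≤n))

∣∣-cases : ∀ x → (+ ∣ x ∣ ≡ x × + 0 ≤ℤ x) ⊎ (+ ∣ x ∣ ≡ - x × x <ℤ + 0)
∣∣-cases (+ _) = inj₁ (refl , +≤+ z≤n)
∣∣-cases -[1+ _ ] = inj₂ (refl , ℤ.-<+)

-- For |x| < M the distance from x to the multiples of M, an invariant under sign changes and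
-- translations by M.
fold : ℤ → ℤ → ℤ
fold M x = + ∣ x ∣ ℤ.⊓ (M - + ∣ x ∣)

-- With |x| and |y| below M only |x| = |y| or |x| + |y| = M is possible, and `fold` identifies both.
fold-shift : ∀ M x y z → + ∣ x ∣ <ℤ M → + ∣ y ∣ <ℤ M → (x ≡ y +ℤ M *ℤ z ⊎ x ≡ - y +ℤ M *ℤ z) → fold M x ≡ fold M y
fold-shift M x y z x<M y<M p = fin (plain p (∣∣-cases x) (∣∣-cases y))
  where
  A = + ∣ x ∣
  B = + ∣ y ∣
  A≥0 : + 0 ≤ℤ A
  A≥0 = +≤+ z≤n
  B≥0 : + 0 ≤ℤ B
  B≥0 = +≤+ z≤n
  Rel : Set
  Rel = ∃[ z ] (A ≡ B +ℤ M *ℤ z ⊎ A ≡ - B +ℤ M *ℤ z)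
  vs = x ∷ y ∷ A ∷ B ∷ M ∷ z ∷ []
  plain : (x ≡ y +ℤ M *ℤ z ⊎ x ≡ - y +ℤ M *ℤ z) → (A ≡ x × + 0 ≤ℤ x) ⊎ (A ≡ - x × x <ℤ + 0) → (B ≡ y × + 0 ≤ℤ y) ⊎ (B ≡ - y × y <ℤ + 0) → Rel
  plain (inj₁ p) (inj₁ (a , _)) (inj₁ (b , _)) = z , inj₁ (lia vs (λ x y A B M z → x :≡ y :+ M :* z ⟹ A :≡ x ⟹ B :≡ y ⟹ A :≡ B :+ M :* z) p a b)
  plain (inj₁ p) (inj₁ (a , _)) (inj₂ (b , _)) = z , inj₂ (lia vs (λ x y A B M z → x :≡ y :+ M :* z ⟹ A :≡ x ⟹ B :≡ :- y ⟹ A :≡ :- B :+ M :* z) p a b)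
  plain (inj₁ p) (inj₂ (a , _)) (inj₁ (b , _)) = - z , inj₂ (lia vs (λ x y A B M z → x :≡ y :+ M :* z ⟹ A :≡ :- x ⟹ B :≡ y ⟹ A :≡ :- B :+ M :* :- z) p a b)
  plain (inj₁ p) (inj₂ (a , _)) (inj₂ (b , _)) = - z , inj₁ (lia vs (λ x y A B M z → x :≡ y :+ M :* z ⟹ A :≡ :- x ⟹ B :≡ :- y ⟹ A :≡ B :+ M :* :- z) p a b)
  plain (inj₂ p) (inj₁ (a , _)) (inj₁ (b , _)) = z , inj₂ (lia vs (λ x y A B M z → x :≡ :- y :+ M :* z ⟹ A :≡ x ⟹ B :≡ y ⟹ A :≡ :- B :+ M :* z) p a b)
  plain (inj₂ p) (inj₁ (a , _)) (inj₂ (b , _)) = z , inj₁ (lia vs (λ x y A B M z → x :≡ :- y :+ M :* z ⟹ A :≡ x ⟹ B :≡ :- y ⟹ A :≡ B :+ M :* z) p a b)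
  plain (inj₂ p) (inj₂ (a , _)) (inj₁ (b , _)) = - z , inj₁ (lia vs (λ x y A B M z → x :≡ :- y :+ M :* z ⟹ A :≡ :- x ⟹ B :≡ y ⟹ A :≡ B :+ M :* :- z) p a b)
  plain (inj₂ p) (inj₂ (a , _)) (inj₂ (b , _)) = - z , inj₂ (lia vs (λ x y A B M z → x :≡ :- y :+ M :* z ⟹ A :≡ :- x ⟹ B :≡ :- y ⟹ A :≡ :- B :+ M :* :- z) p a b)
  fin : Rel → fold M x ≡ fold M y
  fin (z , inj₁ q) = cong (λ a → a ℤ.⊓ (M - a)) (lia (A ∷ B ∷ M *ℤ z ∷ []) (λ A B y → A :≡ B :+ y ⟹ y :≡ K 0 ⟹ A :≡ B) q
      (trans (cong (M *ℤ_) (smallMult M z (lia (A ∷ B ∷ M *ℤ z ∷ M ∷ []) (λ A B y M → A :≡ B :+ y ⟹ K 0 :≤ A ⟹ B :< M ⟹ :- M :< y) q A≥0 y<M)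
        (lia (A ∷ B ∷ M *ℤ z ∷ M ∷ []) (λ A B y M → A :≡ B :+ y ⟹ K 0 :≤ B ⟹ A :< M ⟹ y :< M) q B≥0 x<M))) (ℤP.*-zeroʳ M)))
  fin (z , inj₂ q) with ℤP.<-cmp (A +ℤ B) M
  ... | tri< lt _ _ = cong (λ a → a ℤ.⊓ (M - a)) (lia (A ∷ B ∷ M *ℤ z ∷ []) (λ A B y → A :≡ :- B :+ y ⟹ y :≡ K 0 ⟹ K 0 :≤ A ⟹ K 0 :≤ B ⟹ A :≡ B) q
      (trans (cong (M *ℤ_) (smallMult M z (lia (A ∷ B ∷ M *ℤ z ∷ M ∷ []) (λ A B y M → A :≡ :- B :+ y ⟹ K 0 :≤ A ⟹ K 0 :≤ B ⟹ A :< M ⟹ :- M :< y) q A≥0 B≥0 x<M)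
        (lia (A ∷ B ∷ M *ℤ z ∷ M ∷ []) (λ A B y M → A :≡ :- B :+ y ⟹ A :+ B :< M ⟹ y :< M) q lt))) (ℤP.*-zeroʳ M)) A≥0 B≥0)
  ... | tri≈ _ e _ = complement e
    where
    complement : A +ℤ B ≡ M → fold M x ≡ fold M y
    complement e = trans (cong₂ ℤ._⊓_ (lia (A ∷ B ∷ M ∷ []) (λ A B M → A :+ B :≡ M ⟹ A :≡ M :- B) e) (lia (A ∷ B ∷ M ∷ []) (λ A B M → A :+ B :≡ M ⟹ M :- A :≡ B) e))
      (ℤP.⊓-comm (M - B) B)
  ... | tri> _ _ gt = ⊥-elim (noMult M (A +ℤ B - M) (z - + 1) (lia (A ∷ B ∷ M ∷ []) (λ A B M → M :< A :+ B ⟹ K 0 :< A :+ B :- M) gt)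
      (lia (A ∷ B ∷ M ∷ []) (λ A B M → A :< M ⟹ B :< M ⟹ A :+ B :- M :< M) x<M y<M)
      (lia (A ∷ B ∷ M ∷ z ∷ []) (λ A B M z → A :≡ :- B :+ M :* z ⟹ M :* (z :- K 1) :≡ A :+ B :- M) q))

module ChainProps {n : ℕ} (n≥3 : 3 ≤ n) {M : ℤ} {c : ℕ → ℤ} (ch : Chain n M c) where
  open Chain ch

  mono : ∀ d i → 1 ≤ i → i + d ≤ n → c i ≤ℤ c (i + d)
  mono zero i p q = ℤP.≤-reflexive (cong c (sym (ℕP.+-identityʳ i)))
  mono (suc d) i p q = ℤP.≤-trans (ℤP.<⇒≤ (rise i p (ℕP.≤-trans (s≤s (ℕP.m≤m+n i d)) (subst (_≤ n) (ℕP.+-suc i d) q))))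
    (subst (λ k → c (suc i) ≤ℤ c k) (sym (ℕP.+-suc i d)) (mono d (suc i) (s≤s z≤n) (subst (_≤ n) (ℕP.+-suc i d) q)))

  mono-≤ : ∀ {i k} → 1 ≤ i → i ≤ k → k ≤ n → c i ≤ℤ c k
  mono-≤ {i} {k} p q r = subst (λ l → c i ≤ℤ c l) (ℕP.m+[n∸m]≡n q) (mono (k ∸ i) i p (subst (_≤ n) (sym (ℕP.m+[n∸m]≡n q)) r))

  mono-< : ∀ {i k} → 1 ≤ i → i ℕ.< k → k ≤ n → c i <ℤ c k
  mono-< {i} {k} p q r = ℤP.<-≤-trans (rise i p (ℕP.≤-trans q r)) (mono-≤ (s≤s z≤n) q r)

  private
    p = n ∸ 1
    n≥1 : 1 ≤ n
    n≥1 = 3≤⇒1≤ n≥3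
    sp≡n : suc p ≡ n
    sp≡n = ℕP.m+[n∸m]≡n n≥1
    2≤p : 2 ≤ p
    2≤p = ℕP.≤-pred (subst (3 ≤_) (sym sp≡n) n≥3)
    p<n : p ℕ.< n
    p<n = ℕP.≤-reflexive sp≡n

  c2>0 : + 0 <ℤ c 2
  c2>0 = lia (c 1 ∷ c 2 ∷ []) (λ c1 c2 → c1 :< c2 ⟹ K 0 :< c1 :+ c2 ⟹ K 0 :< c2) (rise 1 ℕP.≤-refl (ℕP.≤-trans (s≤s (s≤s z≤n)) n≥3)) base

  positive : ∀ {i} → 2 ≤ i → i ≤ n → + 0 <ℤ c i
  positive p q = ℤP.<-≤-trans c2>0 (mono-≤ (s≤s z≤n) p q)

  ∣c1∣<c2 : + ∣ c 1 ∣ <ℤ c 2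
  ∣c1∣<c2 with ∣∣-cases (c 1)
  ... | inj₁ (e , _) = subst (_<ℤ c 2) (sym e) (rise 1 ℕP.≤-refl (ℕP.≤-trans (s≤s (s≤s z≤n)) n≥3))
  ... | inj₂ (e , _) = subst (_<ℤ c 2) (sym e) (lia (c 1 ∷ c 2 ∷ []) (λ c1 c2 → K 0 :< c1 :+ c2 ⟹ :- c1 :< c2) base)

  ∣c∣ : ∀ {i} → 2 ≤ i → i ≤ n → + ∣ c i ∣ ≡ c i
  ∣c∣ p q = ℤP.0≤i⇒+∣i∣≡i (ℤP.<⇒≤ (positive p q))

  split1 : ∀ i → 1 ≤ i → i ≡ 1 ⊎ 2 ≤ i
  split1 (suc zero) _ = inj₁ refl
  split1 (suc (suc i)) _ = inj₂ (s≤s (s≤s z≤n))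

  ∣∣-mono : ∀ {i k} → 1 ≤ i → i ℕ.< k → k ≤ n → + ∣ c i ∣ <ℤ + ∣ c k ∣
  ∣∣-mono {i} {k} p q r = subst (+ ∣ c i ∣ <ℤ_) (sym (∣c∣ (ℕP.≤-trans (s≤s p) q) r)) (go (split1 i p))
    where
    go : i ≡ 1 ⊎ 2 ≤ i → + ∣ c i ∣ <ℤ c k
    go (inj₁ refl) = ℤP.<-≤-trans ∣c1∣<c2 (mono-≤ (s≤s z≤n) q r)
    go (inj₂ 2≤i) = subst (_<ℤ c k) (sym (∣c∣ 2≤i (ℕP.≤-trans (ℕP.<⇒≤ q) r))) (mono-< p q r)

  -- All of |c 1|, …, |c (n-1)| are below M/2, and |c n| is below M.
  ∣c∣≤p : ∀ {i} → 1 ≤ i → i ℕ.< n → + ∣ c i ∣ ≤ℤ c p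
  ∣c∣≤p {i} q r = go (split1 i q)
    where
    i≤p : i ≤ p
    i≤p = ℕP.≤-pred (subst (i ℕ.<_) (sym sp≡n) r)
    go : i ≡ 1 ⊎ 2 ≤ i → + ∣ c i ∣ ≤ℤ c p
    go (inj₁ refl) = ℤP.<⇒≤ (ℤP.<-≤-trans ∣c1∣<c2 (mono-≤ (s≤s z≤n) 2≤p (ℕP.<⇒≤ p<n)))
    go (inj₂ 2≤i) = subst (_≤ℤ c p) (sym (∣c∣ 2≤i (ℕP.<⇒≤ r))) (mono-≤ q i≤p (ℕP.<⇒≤ p<n))

  cp<cn : c p <ℤ c n
  cp<cn = mono-< (ℕP.≤-trans (s≤s z≤n) 2≤p) p<n ℕP.≤-refl

  half : ∀ {i} → 1 ≤ i → i ℕ.< n → + ∣ c i ∣ +ℤ + ∣ c i ∣ <ℤ M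
  half {i} q r = lia (+ ∣ c i ∣ ∷ c p ∷ c n ∷ M ∷ []) (λ a p n M → a :≤ p ⟹ p :< n ⟹ p :+ n :< M ⟹ a :+ a :< M) (∣c∣≤p q r) cp<cn roof

  cn>0 : + 0 <ℤ c n
  cn>0 = positive (ℕP.≤-trans (s≤s (s≤s z≤n)) n≥3) ℕP.≤-refl

  cn<M : c n <ℤ M
  cn<M = lia (c p ∷ c n ∷ M ∷ []) (λ p n M → K 0 :< p ⟹ p :+ n :< M ⟹ n :< M) (positive 2≤p (ℕP.<⇒≤ p<n)) roof

  range-split : ∀ i → InRange n i → i ℕ.< n ⊎ i ≡ n
  range-split i (_ , q) = ℕP.m≤n⇒m<n∨m≡n q

  ∣c∣<M : ∀ i → InRange n i → + ∣ c i ∣ <ℤ M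
  ∣c∣<M i r@(p , _) with range-split i r
  ... | inj₁ lt = ℤP.≤-<-trans (lia (+ ∣ c i ∣ ∷ []) (λ a → K 0 :≤ a ⟹ a :≤ a :+ a) (+≤+ z≤n)) (half p lt)
  ... | inj₂ refl = subst (_<ℤ M) (sym (∣c∣ (ℕP.≤-trans (s≤s (s≤s z≤n)) n≥3) ℕP.≤-refl)) cn<M

  -- For i < k one has |c i| < |c k|, and the roof gives |c i| + |c k| < M. So |c i| is below both
  -- candidates for the minimum at k.
  fold-mono : ∀ {i k} → 1 ≤ i → i ℕ.< k → k ≤ n → fold M (c i) <ℤ fold M (c k)
  fold-mono {i} {k} q r s = ℤP.≤-<-trans (ℤP.i⊓j≤i A (M - A)) (below (ℤP.⊓-sel B (M - B)))
    where
    A = + ∣ c i ∣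
    B = + ∣ c k ∣
    i<n : i ℕ.< n
    i<n = ℕP.<-≤-trans r s
    second : k ℕ.< n ⊎ k ≡ n → A <ℤ M - B
    second (inj₁ k<n) = lia (A ∷ B ∷ M ∷ []) (λ A B M → A :< B ⟹ B :+ B :< M ⟹ A :< M :- B) (∣∣-mono q r s) (half (ℕP.≤-trans (s≤s z≤n) r) k<n)
    second (inj₂ refl) = lia (A ∷ B ∷ c k ∷ c p ∷ M ∷ []) (λ A B n p M → A :≤ p ⟹ B :≡ n ⟹ p :+ n :< M ⟹ A :< M :- B)
      (∣c∣≤p q i<n) (∣c∣ (ℕP.≤-trans (s≤s (s≤s z≤n)) n≥3) ℕP.≤-refl) roof
    below : B ℤ.⊓ (M - B) ≡ B ⊎ B ℤ.⊓ (M - B) ≡ M - B → A <ℤ B ℤ.⊓ (M - B)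
    below (inj₁ e) = subst (A <ℤ_) (sym e) (∣∣-mono q r s)
    below (inj₂ e) = subst (A <ℤ_) (sym e) (second (range-split k (ℕP.≤-trans (s≤s z≤n) r , s)))

-- The affine Weyl group acts freely on interior points of the (dilated) fundamental alcove.
module Free {n : ℕ} (n≥3 : 3 ≤ n) {M : ℤ} {w w₀ : SP} (sw : Signed n w) (sw₀ : Signed n w₀) (W W₀ z : ZV)
  (ch : Chain n M (λ i → val W (w i))) (ch₀ : Chain n M (λ i → val W₀ (w₀ i)))
  (diff : ∀ k → InRange n k → W k ≡ W₀ k +ℤ M *ℤ z k) (even-z : sumTo n z ≡₂ + 0) where
  private
    c c₀ : ℕ → ℤ
    c i = val W (w i)
    c₀ i = val W₀ (w₀ i)
    module C = ChainProps n≥3 ch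
    module C₀ = ChainProps n≥3 ch₀

    relate : ∀ i l → InRange n i → ∣ w₀ l ∣ ≡ ∣ w i ∣ → c i ≡ c₀ l +ℤ M *ℤ (sgn (w i) *ℤ z ∣ w i ∣) × w i ≡ w₀ l
                                                     ⊎ c i ≡ - c₀ l +ℤ M *ℤ (sgn (w i) *ℤ z ∣ w i ∣) × w i ≡ - w₀ l
    relate i l r e with abs-cases (w i) (w₀ l) (sym e)
    ... | inj₁ q = inj₁ (trans base' (cong (_+ℤ M *ℤ (sgn (w i) *ℤ z ∣ w i ∣)) (cong (val W₀) q)) , q)
      where
      base' : c i ≡ val W₀ (w i) +ℤ M *ℤ (sgn (w i) *ℤ z ∣ w i ∣)
      base' = trans (cong (sgn (w i) *ℤ_) (diff ∣ w i ∣ (sp-maps sw i r)))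
        (lia (sgn (w i) ∷ W₀ ∣ w i ∣ ∷ M ∷ z ∣ w i ∣ ∷ []) λ s u M z → s :* (u :+ M :* z) :≡ s :* u :+ M :* (s :* z))
    ... | inj₂ q = inj₂ (trans base' (cong (_+ℤ M *ℤ (sgn (w i) *ℤ z ∣ w i ∣)) (trans (cong (val W₀) q) (val-neg W₀ (w₀ l)))) , q)
      where
      base' : c i ≡ val W₀ (w i) +ℤ M *ℤ (sgn (w i) *ℤ z ∣ w i ∣)
      base' = trans (cong (sgn (w i) *ℤ_) (diff ∣ w i ∣ (sp-maps sw i r)))
        (lia (sgn (w i) ∷ W₀ ∣ w i ∣ ∷ M ∷ z ∣ w i ∣ ∷ []) λ s u M z → s :* (u :+ M :* z) :≡ s :* u :+ M :* (s :* z))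

    match : ∀ i → ∃[ l ] (InRange n i → InRange n l × ∣ w₀ l ∣ ≡ ∣ w i ∣)
    match i with InRange? n i
    -- A dummy value outside the range, which makes the matching a total function.
    ... | no ¬r = 0 , λ r → ⊥-elim (¬r r)
    ... | yes r = let l , rl , e = sp-surj sw₀ ∣ w i ∣ (sp-maps sw i r) in l , λ _ → rl , e

    f : ℕ → ℕ
    f i = proj₁ (match i)
    f-range : ∀ i → InRange n i → InRange n (f i)
    f-range i r = proj₁ (proj₂ (match i) r)
    f-eq : ∀ i → InRange n i → ∣ w₀ (f i) ∣ ≡ ∣ w i ∣
    f-eq i r = proj₂ (proj₂ (match i) r)

    fold-eq : ∀ i → InRange n i → fold M (c i) ≡ fold M (c₀ (f i))
    fold-eq i r = fold-shift M (c i) (c₀ (f i)) (sgn (w i) *ℤ z ∣ w i ∣) (C.∣c∣<M i r) (C₀.∣c∣<M (f i) (f-range i r)) (forget (relate i (f i) r (f-eq i r)))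
      where
      forget : ∀ {A B C D : Set} → A × B ⊎ C × D → A ⊎ C
      forget (inj₁ (a , _)) = inj₁ a
      forget (inj₂ (c , _)) = inj₂ c

    f-mono : ∀ i → 1 ≤ i → i ℕ.< n → f i ℕ.< f (suc i)
    f-mono i p q with ℕP.<-cmp (f i) (f (suc i))
    ... | tri< lt _ _ = lt
    ... | tri≈ _ e _ = ⊥-elim (ℤP.<-irrefl (trans (fold-eq i ri) (trans (cong (λ k → fold M (c₀ k)) e) (sym (fold-eq (suc i) rs)))) (C.fold-mono p ℕP.≤-refl q))
      where
      ri = p , ℕP.<⇒≤ q
      rs = s≤s z≤n , q
    ... | tri> _ _ gt = ⊥-elim (ℤP.<-asym (C.fold-mono p ℕP.≤-refl q)
        (subst₂ _<ℤ_ (sym (fold-eq (suc i) rs)) (sym (fold-eq i ri)) (C₀.fold-mono (proj₁ (f-range (suc i) rs)) gt (proj₂ (f-range i ri)))))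
      where
      ri = p , ℕP.<⇒≤ q
      rs = s≤s z≤n , q

  -- The matching of rows preserves `fold`, which increases with the row number on both sides. So
  -- the matching is an increasing self-map of 1, ..., n, hence the identity.
  same-abs : ∀ i → InRange n i → ∣ w₀ i ∣ ≡ ∣ w i ∣
  same-abs i r = subst (λ l → ∣ w₀ l ∣ ≡ ∣ w i ∣) (mono-id n f f-range f-mono i r) (f-eq i r)

  private
    -≤∣∣ : ∀ x → - + ∣ x ∣ ≤ℤ x × x ≤ℤ + ∣ x ∣
    -≤∣∣ (+ k) = ℤP.neg-≤-pos , ℤP.≤-refl
    -≤∣∣ -[1+ k ] = ℤP.≤-refl , -≤+

    sz : ℕ → ℤ
    sz i = sgn (w i) *ℤ z ∣ w i ∣

    sz≡0⇒z≡0 : ∀ i → InRange n i → sz i ≡ + 0 → z ∣ w i ∣ ≡ + 0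
    sz≡0⇒z≡0 i r e = go (sgn-cases (w i) (sp-≥1 sw i r))
      where
      go : ∀ {A B : Set} → (sgn (w i) ≡ + 1 × A) ⊎ (sgn (w i) ≡ - + 1 × B) → z ∣ w i ∣ ≡ + 0
      go (inj₁ (q , _)) = trans (sym (trans (cong (_*ℤ z ∣ w i ∣) q) (ℤP.*-identityˡ _))) e
      go (inj₂ (q , _)) = ℤP.neg-injective (trans (sym (trans (cong (_*ℤ z ∣ w i ∣) q) (ℤP.-1*i≡-i _))) e)

    -- For i < n both |c i| and |c₀ i| are below M/2, which leaves no room for a translation. From
    -- row 2 on both values are positive, which excludes a change of sign.
    inner-rows : ∀ i → 1 ≤ i → i ℕ.< n → sz i ≡ + 0 × (2 ≤ i → w i ≡ w₀ i)
    inner-rows i p q = go (relate i i r (same-abs i r))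
      where
      r = p , ℕP.<⇒≤ q
      bounds : ∀ x → - + ∣ x ∣ ≤ℤ x × x ≤ℤ + ∣ x ∣
      bounds = -≤∣∣
      vs = c i ∷ c₀ i ∷ + ∣ c i ∣ ∷ + ∣ c₀ i ∣ ∷ M ∷ M *ℤ sz i ∷ []
      go : c i ≡ c₀ i +ℤ M *ℤ sz i × w i ≡ w₀ i ⊎ c i ≡ - c₀ i +ℤ M *ℤ sz i × w i ≡ - w₀ i → sz i ≡ + 0 × (2 ≤ i → w i ≡ w₀ i)
      go (inj₁ (e , we)) = smallMult M (sz i)
          (lia vs (λ c d A B M y → c :≡ d :+ y ⟹ :- A :≤ c ⟹ d :≤ B ⟹ A :+ A :< M ⟹ B :+ B :< M ⟹ :- M :< y) e (proj₁ (-≤∣∣ (c i))) (proj₂ (-≤∣∣ (c₀ i))) (C.half p q) (C₀.half p q))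
          (lia vs (λ c d A B M y → c :≡ d :+ y ⟹ c :≤ A ⟹ :- B :≤ d ⟹ A :+ A :< M ⟹ B :+ B :< M ⟹ y :< M) e (proj₂ (-≤∣∣ (c i))) (proj₁ (-≤∣∣ (c₀ i))) (C.half p q) (C₀.half p q))
        , λ _ → we
      go (inj₂ (e , _)) = sz≡0 , λ 2≤i → ⊥-elim (lia (c i ∷ c₀ i ∷ M ∷ sz i ∷ []) (λ c d M s → c :≡ :- d :+ M :* s ⟹ M :* s :≡ M :* K 0 ⟹ K 0 :< c ⟹ K 0 :< d ⟹ :⊥)
          e (cong (M *ℤ_) sz≡0) (C.positive 2≤i (ℕP.<⇒≤ q)) (C₀.positive 2≤i (ℕP.<⇒≤ q)))
        where
        sz≡0 = smallMult M (sz i)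
          (lia vs (λ c d A B M y → c :≡ :- d :+ y ⟹ :- A :≤ c ⟹ :- B :≤ d ⟹ A :+ A :< M ⟹ B :+ B :< M ⟹ :- M :< y) e (proj₁ (-≤∣∣ (c i))) (proj₁ (-≤∣∣ (c₀ i))) (C.half p q) (C₀.half p q))
          (lia vs (λ c d A B M y → c :≡ :- d :+ y ⟹ c :≤ A ⟹ d :≤ B ⟹ A :+ A :< M ⟹ B :+ B :< M ⟹ y :< M) e (proj₂ (-≤∣∣ (c i))) (proj₂ (-≤∣∣ (c₀ i))) (C.half p q) (C₀.half p q))

    rn : InRange n n
    rn = 3≤⇒1≤ n≥3 , ℕP.≤-refl

    z-others : ∀ k → InRange n k → ¬ k ≡ ∣ w n ∣ → z k ≡ + 0
    z-others k r ne with sp-surj sw k r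
    ... | i , ri , refl with ℕP.m≤n⇒m<n∨m≡n (proj₂ ri)
    ... | inj₁ i<n = sz≡0⇒z≡0 i ri (proj₁ (inner-rows i (proj₁ ri) i<n))
    ... | inj₂ refl = ⊥-elim (ne refl)

    z-n-even : z ∣ w n ∣ ≡₂ + 0
    z-n-even = subst (_≡₂ + 0) (sumTo-single n ∣ w n ∣ (sp-maps sw n rn) z-others) even-z

    last-row : sz n ≡ + 0 × w n ≡ w₀ n
    last-row = go (relate n n rn (same-abs n rn))
      where
      vs = c n ∷ c₀ n ∷ M ∷ M *ℤ sz n ∷ []
      go : c n ≡ c₀ n +ℤ M *ℤ sz n × w n ≡ w₀ n ⊎ c n ≡ - c₀ n +ℤ M *ℤ sz n × w n ≡ - w₀ n → sz n ≡ + 0 × w n ≡ w₀ n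
      go (inj₁ (e , we)) = smallMult M (sz n)
          (lia vs (λ c d M y → c :≡ d :+ y ⟹ K 0 :< c ⟹ d :< M ⟹ :- M :< y) e C.cn>0 C₀.cn<M)
          (lia vs (λ c d M y → c :≡ d :+ y ⟹ K 0 :< d ⟹ c :< M ⟹ y :< M) e C₀.cn>0 C.cn<M) , we
      -- A change of sign in row n needs a translation by exactly M there, while all other entries
      -- of z vanish. Then z would have an odd sum: the translations by Q̌, unlike those by ℤⁿ,
      -- exclude this.
      go (inj₂ (e , _)) = ⊥-elim (1≢₂0 (subst (_≡₂ + 0) sz≡1 (≡₂-trans (sgn*-≡₂ (w n) (z ∣ w n ∣) (sp-≥1 sw n rn)) z-n-even)))
        where
        sz-1 : sz n - + 1 ≡ + 0
        sz-1 = smallMult M (sz n - + 1)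
          (lia (c n ∷ c₀ n ∷ M ∷ sz n ∷ []) (λ c d M s → c :≡ :- d :+ M :* s ⟹ K 0 :< c ⟹ K 0 :< d ⟹ :- M :< M :* (s :- K 1)) e C.cn>0 C₀.cn>0)
          (lia (c n ∷ c₀ n ∷ M ∷ sz n ∷ []) (λ c d M s → c :≡ :- d :+ M :* s ⟹ c :< M ⟹ d :< M ⟹ M :* (s :- K 1) :< M) e C.cn<M C₀.cn<M)
        sz≡1 : sz n ≡ + 1
        sz≡1 = lia (sz n ∷ []) (λ s → s :- K 1 :≡ K 0 ⟹ s :≡ K 1) sz-1

  z-zero : ∀ k → InRange n k → z k ≡ + 0
  z-zero k r with k ℕ.≟ ∣ w n ∣
  ... | yes refl = sz≡0⇒z≡0 n rn (proj₁ last-row)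
  ... | no ne = z-others k r ne

  same-rows : ∀ i → 2 ≤ i → i ≤ n → w i ≡ w₀ i
  same-rows i p q with ℕP.m≤n⇒m<n∨m≡n q
  ... | inj₁ i<n = proj₂ (inner-rows i (ℕP.≤-trans (s≤s z≤n) p) i<n) p
  ... | inj₂ refl = proj₂ last-row

-- The Sommers region, the uniqueness of `pt b` and the Anderson map.

rho-mono : ∀ a b → 1 ≤ ∣ a ∣ → 1 ≤ ∣ b ∣ → ¬ ∣ a ∣ ≡ ∣ b ∣ → a <ℤ b → val rhoV a <ℤ val rhoV b
rho-mono (+ suc i) (+ suc k) _ _ _ (ℤ.+<+ (s≤s lt)) =
  subst₂ _<ℤ_ (sym (ℤP.*-identityˡ (+ i))) (sym (ℤP.*-identityˡ (+ k))) (ℤ.+<+ lt)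
rho-mono -[1+ i ] -[1+ k ] _ _ _ (ℤ.-<- lt) =
  subst₂ _<ℤ_ (sym (ℤP.-1*i≡-i (+ i))) (sym (ℤP.-1*i≡-i (+ k))) (ℤP.neg-mono-< (ℤ.+<+ lt))
rho-mono -[1+ i ] (+ suc k) _ _ ne _ =
  subst₂ _<ℤ_ (sym (ℤP.-1*i≡-i (+ i))) (sym (ℤP.*-identityˡ (+ k))) (go i k ne)
  where
  go : ∀ i k → ¬ suc i ≡ suc k → - + i <ℤ + k
  go zero zero ne = ⊥-elim (ne refl)
  go zero (suc k) _ = ℤ.+<+ (s≤s z≤n)
  go (suc i) k _ = ℤ.-<+

rho-bound : ∀ {n} a → InRange n ∣ a ∣ → - (+ n - + 1) ≤ℤ val rhoV a × val rhoV a ≤ℤ + n - + 1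
rho-bound {n} (+ suc i) (_ , q) =
    lia (val rhoV (+ suc i) ∷ + i ∷ + n ∷ []) (λ v i n → v :≡ i ⟹ K 0 :≤ i ⟹ K 1 :+ i :≤ n ⟹ :- (n :- K 1) :≤ v) (ℤP.*-identityˡ (+ i)) (+≤+ z≤n) (+≤+ q)
  , lia (val rhoV (+ suc i) ∷ + i ∷ + n ∷ []) (λ v i n → v :≡ i ⟹ K 1 :+ i :≤ n ⟹ v :≤ n :- K 1) (ℤP.*-identityˡ (+ i)) (+≤+ q)
rho-bound {n} -[1+ i ] (_ , q) =
    lia (val rhoV -[1+ i ] ∷ + i ∷ + n ∷ []) (λ v i n → v :≡ :- i ⟹ K 1 :+ i :≤ n ⟹ :- (n :- K 1) :≤ v) (ℤP.-1*i≡-i (+ i)) (+≤+ q)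
  , lia (val rhoV -[1+ i ] ∷ + i ∷ + n ∷ []) (λ v i n → v :≡ :- i ⟹ K 0 :≤ i ⟹ K 1 :+ i :≤ n ⟹ v :≤ n :- K 1) (ℤP.-1*i≡-i (+ i)) (+≤+ z≤n) (+≤+ q)

-- The bound is h - 1, the height of the highest root. So a term of absolute value at least h
-- outweighs any such sum.
rho-sum : ∀ {n} a b → InRange n ∣ a ∣ → InRange n ∣ b ∣ → ¬ ∣ a ∣ ≡ ∣ b ∣ →
  - (+ 2 *ℤ + n - + 3) ≤ℤ val rhoV a +ℤ val rhoV b × val rhoV a +ℤ val rhoV b ≤ℤ + 2 *ℤ + n - + 3
rho-sum {n} a b ra rb ne = neg-side , pos-side
  where
  -- |ρ(a)| = n − 1 forces |a| = n, which cannot happen for both a and b.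
  top : ∀ a → InRange n ∣ a ∣ → (val rhoV a ≡ + n - + 1 ⊎ val rhoV a ≡ - (+ n - + 1)) → ∣ a ∣ ≡ n
  top (+ suc i) (_ , q) (inj₁ e) = range-eq (lia (val rhoV (+ suc i) ∷ + i ∷ + n ∷ []) (λ v i n → v :≡ i ⟹ v :≡ n :- K 1 ⟹ K 1 :+ i :≡ n) (ℤP.*-identityˡ (+ i)) e)
  top (+ suc i) (_ , q) (inj₂ e) = range-eq (lia (val rhoV (+ suc i) ∷ + i ∷ + n ∷ []) (λ v i n → v :≡ i ⟹ v :≡ :- (n :- K 1) ⟹ K 0 :≤ i ⟹ K 1 :+ i :≤ n ⟹ K 1 :+ i :≡ n) (ℤP.*-identityˡ (+ i)) e (+≤+ z≤n) (+≤+ q))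
  top -[1+ i ] (_ , q) (inj₁ e) = range-eq (lia (val rhoV -[1+ i ] ∷ + i ∷ + n ∷ []) (λ v i n → v :≡ :- i ⟹ v :≡ n :- K 1 ⟹ K 0 :≤ i ⟹ K 1 :+ i :≤ n ⟹ K 1 :+ i :≡ n) (ℤP.-1*i≡-i (+ i)) e (+≤+ z≤n) (+≤+ q))
  top -[1+ i ] (_ , q) (inj₂ e) = range-eq (lia (val rhoV -[1+ i ] ∷ + i ∷ + n ∷ []) (λ v i n → v :≡ :- i ⟹ v :≡ :- (n :- K 1) ⟹ K 1 :+ i :≡ n) (ℤP.-1*i≡-i (+ i)) e)
  x = val rhoV a
  y = val rhoV b
  pos-side : x +ℤ y ≤ℤ + 2 *ℤ + n - + 3
  pos-side = ℤP.≮⇒≥ λ lt → ne (trans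
    (top a ra (inj₁ (lia (x ∷ y ∷ + n ∷ []) (λ x y n → x :≤ n :- K 1 ⟹ y :≤ n :- K 1 ⟹ K 2 :* n :- K 3 :< x :+ y ⟹ x :≡ n :- K 1) (proj₂ (rho-bound a ra)) (proj₂ (rho-bound b rb)) lt)))
    (sym (top b rb (inj₁ (lia (x ∷ y ∷ + n ∷ []) (λ x y n → x :≤ n :- K 1 ⟹ y :≤ n :- K 1 ⟹ K 2 :* n :- K 3 :< x :+ y ⟹ y :≡ n :- K 1) (proj₂ (rho-bound a ra)) (proj₂ (rho-bound b rb)) lt)))))
  neg-side : - (+ 2 *ℤ + n - + 3) ≤ℤ x +ℤ y
  neg-side = ℤP.≮⇒≥ λ lt → ne (trans
    (top a ra (inj₂ (lia (x ∷ y ∷ + n ∷ []) (λ x y n → :- (n :- K 1) :≤ x ⟹ :- (n :- K 1) :≤ y ⟹ x :+ y :< :- (K 2 :* n :- K 3) ⟹ x :≡ :- (n :- K 1)) (proj₁ (rho-bound a ra)) (proj₁ (rho-bound b rb)) lt)))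
    (sym (top b rb (inj₂ (lia (x ∷ y ∷ + n ∷ []) (λ x y n → :- (n :- K 1) :≤ x ⟹ :- (n :- K 1) :≤ y ⟹ x :+ y :< :- (K 2 :* n :- K 3) ⟹ y :≡ :- (n :- K 1)) (proj₁ (rho-bound a ra)) (proj₁ (rho-bound b rb)) lt)))))

module _ {n : ℕ} (n≥3 : 3 ≤ n) where
  private
    h = hD n
    open Ends n≥3
    h≡ : h ≡ + 2 *ℤ + n - + 2
    h≡ = hD≡ n≥1
    h≥0 : + 0 ≤ℤ h
    h≥0 = lia (h ∷ + n ∷ []) (λ h n → h :≡ K 2 :* n :- K 2 ⟹ K 3 :≤ n ⟹ K 0 :≤ h) h≡ (+≤+ n≥3)
    ∣-∣ = ℤP.∣-i∣≡∣i∣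

  -- In the frame of b this is h (b⁻¹(ρ̌/h) + ρ̌). The Sommers condition restricts b⁻¹A∘ to the
  -- simplex ⟨x , α⟩ > -1 for simple α and ⟨x , α̃⟩ < 2, and the translation by ρ̌ carries this
  -- simplex to (h + 1)A∘.
  dilated : Aff → ZV
  dilated b k = rhoV k +ℤ (h +ℤ + 1) *ℤ act n (lin b) rhoV k - pt n b k

  dilated-frame : ∀ {b} → Signed n (lin b) → ∀ i → InRange n i →
    val (dilated b) (lin b i) ≡ val rhoV (lin b i) +ℤ h *ℤ (rhoV i - frameτ n≥3 b i)
  dilated-frame {b} sb i r = lia (sgn (w i) ∷ rhoV ∣ w i ∣ ∷ act n w rhoV ∣ w i ∣ ∷ pt n b ∣ w i ∣ ∷ h ∷ rhoV i ∷ frameτ n≥3 b i ∷ [])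
    (λ s r A P h ρ τ → s :* A :≡ ρ ⟹ h :* (s :* A) :≡ h :* ρ ⟹ s :* P :≡ ρ :+ h :* τ ⟹ s :* (r :+ (h :+ K 1) :* A :- P) :≡ s :* r :+ h :* (ρ :- τ))
    (act-val sb rhoV i r) (cong (h *ℤ_) (act-val sb rhoV i r)) (pt-frame {n} {b} sb i r)
    where
    w = lin b

  -- At an extreme level the terms with h cancel, and the order of the labels decides through ρ̌. At
  -- any other level they contribute at least h, against a part from ρ̌ of at most h - 1.
  sommers⇒chain : ∀ {b} → Signed n (lin b) → Sommers n (lin b) (frameτ n≥3 b) → Chain n (h *ℤ (h +ℤ + 1)) (λ i → val (dilated b) (lin b i))
  sommers⇒chain {b} sb som = record { rise = rise' ; base = base' ; roof = roof' }
    where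
    open Sommers som
    w = lin b
    τ = frameτ n≥3 b
    c : ℕ → ℤ
    c i = val (dilated b) (w i)
    ρw : ℕ → ℤ
    ρw i = val rhoV (w i)
    w-≢ : ∀ i k → InRange n i → InRange n k → ¬ i ≡ k → ¬ ∣ w i ∣ ≡ ∣ w k ∣
    w-≢ i k ri rk ne e = ne (sp-inj sb i k ri rk e)
    rise' : ∀ i → 1 ≤ i → i ℕ.< n → c i <ℤ c (suc i)
    rise' i q r with ℤP.<-cmp (τ (suc i) - τ i) (+ 1)
    ... | tri> _ _ gt = ⊥-elim (ℤP.<⇒≱ gt (up≤ i q r))
    ... | tri≈ _ e _ = lia (c i ∷ c (suc i) ∷ ρw i ∷ ρw (suc i) ∷ rhoV i ∷ + i ∷ h ∷ τ i ∷ τ (suc i) ∷ [])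
      (λ c d u v s i h t t' → c :≡ u :+ h :* (s :- t) ⟹ d :≡ v :+ h :* (i :- t') ⟹ s :≡ i :- K 1 ⟹ h :* s :≡ h :* (i :- K 1) ⟹ h :* (t' :- t) :≡ h :* K 1 ⟹ u :< v ⟹ c :< d)
      (dilated-frame {b} sb i ri) (dilated-frame {b} sb (suc i) rs) (pos∸1 q) (cong (h *ℤ_) (pos∸1 q)) (cong (h *ℤ_) e)
      (rho-mono (w i) (w (suc i)) (sp-≥1 sb i ri) (sp-≥1 sb (suc i) rs) (w-≢ i (suc i) ri rs λ ()) (up= i q r e))
      where
      ri = q , ℕP.<⇒≤ r
      rs : InRange n (suc i)
      rs = s≤s z≤n , r
    ... | tri< lt _ _ = lia (c i ∷ c (suc i) ∷ ρw i ∷ ρw (suc i) ∷ - ρw i ∷ rhoV i ∷ + i ∷ h ∷ τ i ∷ τ (suc i) ∷ + n ∷ [])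
      (λ c d u v u' s i h t t' n → c :≡ u :+ h :* (s :- t) ⟹ d :≡ v :+ h :* (i :- t') ⟹ h :* s :≡ h :* (i :- K 1) ⟹ u' :≡ :- u ⟹ K 0 :≤ h :* (K 0 :- (t' :- t)) ⟹ h :≡ K 2 :* n :- K 2 ⟹ :- (K 2 :* n :- K 3) :≤ u' :+ v ⟹ c :< d)
      (dilated-frame {b} sb i ri) (dilated-frame {b} sb (suc i) rs) (cong (h *ℤ_) (pos∸1 q)) refl
      (*-nonneg h≥0 (lia (τ (suc i) ∷ τ i ∷ []) (λ t' t → t' :- t :< K 1 ⟹ K 0 :≤ K 0 :- (t' :- t)) lt)) h≡
      (subst (λ y → - (+ 2 *ℤ + n - + 3) ≤ℤ y +ℤ ρw (suc i)) (val-neg rhoV (w i)) (proj₁ (rho-sum (- w i) (w (suc i))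
        (subst (InRange n) (sym (∣-∣ (w i))) (sp-maps sb i ri)) (sp-maps sb (suc i) rs) (λ e → w-≢ i (suc i) ri rs (λ ()) (trans (sym (∣-∣ (w i))) e)))))
      where
      ri = q , ℕP.<⇒≤ r
      rs : InRange n (suc i)
      rs = s≤s z≤n , r
    base' : + 0 <ℤ c 1 +ℤ c 2
    base' with ℤP.<-cmp (τ 1 +ℤ τ 2) (+ 1)
    ... | tri> _ _ gt = ⊥-elim (ℤP.<⇒≱ gt lo≤)
    ... | tri≈ _ e _ = lia (c 1 ∷ c 2 ∷ ρw 1 ∷ ρw 2 ∷ val rhoV (- w 1) ∷ h ∷ τ 1 ∷ τ 2 ∷ [])
      (λ c d u v u' h s t → c :≡ u :+ h :* (K 0 :- s) ⟹ d :≡ v :+ h :* (K 1 :- t) ⟹ h :* (s :+ t) :≡ h :* K 1 ⟹ u' :≡ :- u ⟹ u' :< v ⟹ K 0 :< c :+ d)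
      (dilated-frame {b} sb 1 r1) (dilated-frame {b} sb 2 r2) (cong (h *ℤ_) e) (val-neg rhoV (w 1))
      (rho-mono (- w 1) (w 2) (subst (1 ≤_) (sym (∣-∣ (w 1))) (sp-≥1 sb 1 r1)) (sp-≥1 sb 2 r2) (λ e → w-≢ 1 2 r1 r2 (λ ()) (trans (sym (∣-∣ (w 1))) e)) (lo= e))
    ... | tri< lt _ _ = lia (c 1 ∷ c 2 ∷ ρw 1 ∷ ρw 2 ∷ h ∷ τ 1 ∷ τ 2 ∷ + n ∷ [])
      (λ c d u v h s t n → c :≡ u :+ h :* (K 0 :- s) ⟹ d :≡ v :+ h :* (K 1 :- t) ⟹ K 0 :≤ h :* (K 0 :- (s :+ t)) ⟹ h :≡ K 2 :* n :- K 2 ⟹ :- (K 2 :* n :- K 3) :≤ u :+ v ⟹ K 0 :< c :+ d)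
      (dilated-frame {b} sb 1 r1) (dilated-frame {b} sb 2 r2)
      (*-nonneg h≥0 (lia (τ 1 ∷ τ 2 ∷ []) (λ s t → s :+ t :< K 1 ⟹ K 0 :≤ K 0 :- (s :+ t)) lt)) h≡
      (proj₁ (rho-sum (w 1) (w 2) (sp-maps sb 1 r1) (sp-maps sb 2 r2) (w-≢ 1 2 r1 r2 λ ())))
    roof' : c p +ℤ c n <ℤ h *ℤ (h +ℤ + 1)
    roof' with ℤP.<-cmp (- + 2) (τ p +ℤ τ n)
    ... | tri> _ _ gt = ⊥-elim (ℤP.<⇒≱ gt hi≤)
    ... | tri≈ _ e _ = lia (c p ∷ c n ∷ ρw p ∷ ρw n ∷ val rhoV (- w n) ∷ rhoV p ∷ rhoV n ∷ h ∷ τ p ∷ τ n ∷ + n ∷ [])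
      (λ c d u v v' a b h s t n → c :≡ u :+ h :* (a :- s) ⟹ d :≡ v :+ h :* (b :- t) ⟹ h :* a :≡ h :* (n :- K 2) ⟹ h :* b :≡ h :* (n :- K 1) ⟹ h :* (:- K 2) :≡ h :* (s :+ t) ⟹ v' :≡ :- v ⟹ u :< v' ⟹ h :* h :≡ h :* (K 2 :* n :- K 2) ⟹ c :+ d :< h :* (h :+ K 1))
      (dilated-frame {b} sb p rp) (dilated-frame {b} sb n rn) (cong (h *ℤ_) rho-p) (cong (h *ℤ_) (pos∸1 n≥1)) (cong (h *ℤ_) e) (val-neg rhoV (w n))
      (rho-mono (w p) (- w n) (sp-≥1 sb p rp) (subst (1 ≤_) (sym (∣-∣ (w n))) (sp-≥1 sb n rn)) (λ e → w-≢ p n rp rn p≢n (trans e (∣-∣ (w n)))) (hi= (sym e)))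
      (cong (h *ℤ_) h≡)
      where
      rho-p : rhoV p ≡ + n - + 2
      rho-p = trans (pos∸1 (proj₁ rp)) (lia (+ p ∷ + n ∷ []) (λ p n → p :≡ n :- K 1 ⟹ p :- K 1 :≡ n :- K 2) p≡)
    ... | tri< lt _ _ = lia (c p ∷ c n ∷ ρw p ∷ ρw n ∷ rhoV p ∷ rhoV n ∷ h ∷ τ p ∷ τ n ∷ + n ∷ [])
      (λ c d u v a b h s t n → c :≡ u :+ h :* (a :- s) ⟹ d :≡ v :+ h :* (b :- t) ⟹ h :* a :≡ h :* (n :- K 2) ⟹ h :* b :≡ h :* (n :- K 1) ⟹ K 0 :≤ h :* (s :+ t :+ K 1) ⟹ h :* h :≡ h :* (K 2 :* n :- K 2) ⟹ h :≡ K 2 :* n :- K 2 ⟹ u :+ v :≤ K 2 :* n :- K 3 ⟹ c :+ d :< h :* (h :+ K 1))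
      (dilated-frame {b} sb p rp) (dilated-frame {b} sb n rn) (cong (h *ℤ_) rho-p) (cong (h *ℤ_) (pos∸1 n≥1))
      (*-nonneg h≥0 (lia (τ p ∷ τ n ∷ []) (λ s t → :- K 2 :< s :+ t ⟹ K 0 :≤ s :+ t :+ K 1) lt)) (cong (h *ℤ_) h≡) h≡
      (proj₂ (rho-sum (w p) (w n) (sp-maps sb p rp) (sp-maps sb n rn) (w-≢ p n rp rn p≢n)))
      where
      rho-p : rhoV p ≡ + n - + 2
      rho-p = trans (pos∸1 (proj₁ rp)) (lia (+ p ∷ + n ∷ []) (λ p n → p :≡ n :- K 1 ⟹ p :- K 1 :≡ n :- K 2) p≡)

  -- Congruence of the points modulo h + 1 becomes congruence of the dilated points modulo h (h + 1)
  -- by an even vector. As both lie in the same open dilated alcove, freeness makes the vector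
  -- vanish and the linear parts agree on ρ̌.
  pt-unique : ∀ b b₀ → IsAff n b → IsAff n b₀ → Sommers n (lin b) (frameτ n≥3 b) → Sommers n (lin b₀) (frameτ n≥3 b₀) →
    ∀ (z₁ : ZV) → (∀ k → InRange n k → pt n b k ≡ pt n b₀ k +ℤ (h +ℤ + 1) *ℤ z₁ k) → ∀ k → InRange n k → pt n b k ≡ pt n b₀ k
  pt-unique b b₀ ab ab₀ som som₀ z₁ cong-pt k r =
    lia (pt n b k ∷ pt n b₀ k ∷ rhoV k ∷ A k ∷ A₀ k ∷ h ∷ z k ∷ [])
      (λ P Q ρ a a₀ h z → ρ :+ (h :+ K 1) :* a :- P :≡ ρ :+ (h :+ K 1) :* a₀ :- Q :+ h :* (h :+ K 1) :* z ⟹ (h :+ K 1) :* a :≡ (h :+ K 1) :* a₀ ⟹ h :* (h :+ K 1) :* z :≡ h :* (h :+ K 1) :* K 0 ⟹ P :≡ Q)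
      (W-diff k r) (cong ((h +ℤ + 1) *ℤ_) (A≡ k r)) (cong (h *ℤ (h +ℤ + 1) *ℤ_) (z-zero k r))
    where
    w = lin b
    w₀ = lin b₀
    sb = aff-sp n≥3 b ab
    sb₀ = aff-sp n≥3 b₀ ab₀
    A A₀ z : ZV
    A = act n w rhoV
    A₀ = act n w₀ rhoV
    z k = z₁ k - (tr b k - tr b₀ k)
    -- (h + 1) z₁ = A − A₀ + h (t − t₀)
    D : ∀ k → InRange n k → A k +ℤ h *ℤ tr b k ≡ A₀ k +ℤ h *ℤ tr b₀ k +ℤ (h +ℤ + 1) *ℤ z₁ k
    D = cong-pt
    W-diff : ∀ k → InRange n k → dilated b k ≡ dilated b₀ k +ℤ h *ℤ (h +ℤ + 1) *ℤ z k
    W-diff k r = lia (rhoV k ∷ A k ∷ A₀ k ∷ h ∷ tr b k ∷ tr b₀ k ∷ z₁ k ∷ [])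
      (λ ρ a a₀ h t t₀ z → a :+ h :* t :≡ a₀ :+ h :* t₀ :+ (h :+ K 1) :* z ⟹ h :* (a :+ h :* t) :≡ h :* (a₀ :+ h :* t₀ :+ (h :+ K 1) :* z) ⟹
        ρ :+ (h :+ K 1) :* a :- (a :+ h :* t) :≡ ρ :+ (h :+ K 1) :* a₀ :- (a₀ :+ h :* t₀) :+ h :* (h :+ K 1) :* (z :- (t :- t₀)))
      (D k r) (cong (h *ℤ_) (D k r))
    -- As h is even, `D` reduces modulo 2 to z₁ ≡ A + A₀, so z is a sum of A, A₀ and the two
    -- translation parts. The sums of A and A₀ have the parity of that of ρ̌, and the translation
    -- parts have even sums.
    z-even : sumTo n z ≡₂ + 0
    z-even = ≡₂-trans (sumTo-≡₂ n pointwise) (≡₂-trans (≡⇒≡₂ (trans (sumTo-+ n (λ k → A k +ℤ A₀ k) (λ k → tr b k +ℤ tr b₀ k))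
        (cong₂ _+ℤ_ (sumTo-+ n A A₀) (sumTo-+ n (tr b) (tr b₀)))))
      (≡₂-trans (≡₂-+ (≡₂-+ (act-sum sb rhoV) (act-sum sb₀ rhoV)) (≡₂-+ (∣⇒even (sumTo n (tr b)) (proj₂ ab)) (∣⇒even (sumTo n (tr b₀)) (proj₂ ab₀))))
        (mod₂ (sumTo n rhoV) (lia (sumTo n rhoV ∷ []) λ s → s :+ s :+ (K 0 :+ K 0) :≡ K 0 :+ K 2 :* s))))
      where
      pointwise : ∀ k → InRange n k → z k ≡₂ A k +ℤ A₀ k +ℤ (tr b k +ℤ tr b₀ k)
      pointwise k r = mod₂ ((+ n - + 1) *ℤ (tr b k - tr b₀ k - z₁ k) - A₀ k - tr b k)
        (lia (A k ∷ A₀ k ∷ h ∷ tr b k ∷ tr b₀ k ∷ z₁ k ∷ + n ∷ [])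
          (λ a a₀ h t t₀ z n → a :+ h :* t :≡ a₀ :+ h :* t₀ :+ (h :+ K 1) :* z ⟹ h :* (t :- t₀ :- z) :≡ (K 2 :* n :- K 2) :* (t :- t₀ :- z) ⟹
            z :- (t :- t₀) :≡ a :+ a₀ :+ (t :+ t₀) :+ K 2 :* ((n :- K 1) :* (t :- t₀ :- z) :- a₀ :- t))
          (D k r) (cong (_*ℤ (tr b k - tr b₀ k - z₁ k)) h≡))
    open Free n≥3 sb sb₀ (dilated b) (dilated b₀) z (sommers⇒chain {b} sb som) (sommers⇒chain {b₀} sb₀ som₀) W-diff z-even
    A≡ : ∀ k → InRange n k → A k ≡ A₀ k
    A≡ k r with sp-surj sb k r
    ... | i , ri , refl = go (ChainProps.split1 n≥3 (sommers⇒chain {b} sb som) i (proj₁ ri))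
      where
      lhs : A ∣ w i ∣ ≡ sgn (w i) *ℤ rhoV i
      lhs = act-∣∣ sb rhoV i ri
      rhs : A₀ ∣ w i ∣ ≡ sgn (w₀ i) *ℤ rhoV i
      rhs = trans (cong A₀ (sym (same-abs i ri))) (act-∣∣ sb₀ rhoV i ri)
      go : i ≡ 1 ⊎ 2 ≤ i → A ∣ w i ∣ ≡ A₀ ∣ w i ∣
      -- The sign of row 1 is not determined by `same-rows`, but ρ̌ vanishes in this row.
      go (inj₁ refl) = trans lhs (trans (ℤP.*-zeroʳ (sgn (w i))) (sym (trans rhs (ℤP.*-zeroʳ (sgn (w₀ i))))))
      go (inj₂ 2≤i) = trans lhs (trans (cong (λ a → sgn a *ℤ rhoV i) (same-rows i 2≤i (proj₂ ri))) (sym rhs))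

  -- The alcove of w̃_f contains (h+1)ρ̌/h.
  module Wf (wf : Aff) (iswf : IsWf n wf) where
    private
      P = pt n wf
      inner1 : inner n P (simpleR 1) ≡ P 1 +ℤ P 2
      inner1 = trans (inner-⊕ n P (e (+ 1)) (e (+ 2))) (cong₂ _+ℤ_ (trans (inner-e n P (+ 1) r1) (val-+ P 1 (s≤s z≤n))) (trans (inner-e n P (+ 2) r2) (val-+ P 2 (s≤s z≤n))))
      step1 : h +ℤ + 1 ≤ℤ P 1 +ℤ P 2
      step1 = lia (h ∷ P 1 +ℤ P 2 ∷ []) (λ h y → h :* K 1 :< y ⟹ h :+ K 1 :≤ y) (subst (h *ℤ + 1 <ℤ_) inner1 (proj₁ (proj₂ iswf) 1 r1))
      steps : ∀ i → 1 ≤ i → i ℕ.< n → P i +ℤ (h +ℤ + 1) ≤ℤ P (suc i)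
      steps (suc k) _ q = lia (h ∷ P (suc k) ∷ P (suc (suc k)) ∷ []) (λ h x y → h :* K 1 :< y :- x ⟹ x :+ (h :+ K 1) :≤ y)
        (subst (h *ℤ + 1 <ℤ_) (trans (inner-⊖ n P (e (+ suc (suc k))) (e (+ suc k)))
          (cong₂ _-_ (trans (inner-e n P (+ suc (suc k)) (s≤s z≤n , q)) (val-+ P (suc (suc k)) (s≤s z≤n))) (trans (inner-e n P (+ suc k) (s≤s z≤n , ℕP.<⇒≤ q)) (val-+ P (suc k) (s≤s z≤n)))))
          (proj₁ (proj₂ iswf) (suc (suc k)) (s≤s z≤n , q)))
      roof : P p +ℤ P n <ℤ h *ℤ h
      roof = subst (_<ℤ h *ℤ h) (trans (inner-⊕ n P (e (+ p)) (e (+ n)))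
        (cong₂ _+ℤ_ (trans (inner-e n P (+ p) rp) (val-+ P p (proj₁ rp))) (trans (inner-e n P (+ n) rn) (val-+ P n n≥1)))) (proj₂ (proj₂ iswf))
      -- The deviation from (h + 1)ρ̌. It is weakly increasing along the rows, with L 1 + L 2 ≥ 0
      -- and L (n - 1) + L n ≤ 0, so it is 0.
      L : ℕ → ℤ
      L i = P i - (h +ℤ + 1) *ℤ (+ i - + 1)
      L-up : ∀ d i → 1 ≤ i → i + d ≤ n → L i ≤ℤ L (i + d)
      L-up zero i q r = ℤP.≤-reflexive (cong L (sym (ℕP.+-identityʳ i)))
      L-up (suc d) i q r = ℤP.≤-trans (lia (P i ∷ P (suc i) ∷ h ∷ + i ∷ []) (λ x y h i → x :+ (h :+ K 1) :≤ y ⟹ x :- (h :+ K 1) :* (i :- K 1) :≤ y :- (h :+ K 1) :* (K 1 :+ i :- K 1))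
          (steps i q (ℕP.≤-trans (s≤s (ℕP.m≤m+n i d)) r')))
        (subst (λ k → L (suc i) ≤ℤ L k) (sym (ℕP.+-suc i d)) (L-up d (suc i) (s≤s z≤n) r'))
        where
        r' : suc i + d ≤ n
        r' = subst (_≤ n) (ℕP.+-suc i d) r
      L-mono : ∀ {i k} → 1 ≤ i → i ≤ k → k ≤ n → L i ≤ℤ L k
      L-mono {i} {k} q r s = subst (λ l → L i ≤ℤ L l) (ℕP.m+[n∸m]≡n r) (L-up (k ∸ i) i q (subst (_≤ n) (sym (ℕP.m+[n∸m]≡n r)) s))
      -- The value of (h + 1)ρ̌ at α̃ is (h + 1)(h - 1) = h² - 1, the largest integer below h².
      top : L p +ℤ L n ≤ℤ + 0
      top = lia (P p ∷ P n ∷ h ∷ + p ∷ + n ∷ []) (λ x y h p n → x :+ y :< h :* h ⟹ h :* h :≡ h :* (K 2 :* n :- K 2) ⟹ h :* p :≡ h :* (n :- K 1) ⟹ h :≡ K 2 :* n :- K 2 ⟹ p :≡ n :- K 1 ⟹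
          (x :- (h :+ K 1) :* (p :- K 1)) :+ (y :- (h :+ K 1) :* (n :- K 1)) :≤ K 0) roof (cong (h *ℤ_) h≡) (cong (h *ℤ_) p≡) h≡ p≡
      L1+L2 : + 0 ≤ℤ L 1 +ℤ L 2
      L1+L2 = lia (P 1 ∷ P 2 ∷ h ∷ []) (λ x y h → h :+ K 1 :≤ x :+ y ⟹ K 0 :≤ (x :- (h :+ K 1) :* (K 1 :- K 1)) :+ (y :- (h :+ K 1) :* (K 2 :- K 1))) step1
      L1≤L2 : L 1 ≤ℤ L 2
      L1≤L2 = L-mono (s≤s z≤n) (s≤s z≤n) (proj₂ r2)
      2≤p : 2 ≤ p
      2≤p = ℤP.drop‿+≤+ (lia (+ p ∷ + n ∷ []) (λ p n → p :≡ n :- K 1 ⟹ K 3 :≤ n ⟹ K 2 :≤ p) p≡ (+≤+ n≥3))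
      L2≤Lp : L 2 ≤ℤ L p
      L2≤Lp = L-mono (s≤s z≤n) 2≤p (proj₂ rp)
      Lp≤Ln : L p ≤ℤ L n
      Lp≤Ln = L-mono (proj₁ rp) (proj₂ rp) ℕP.≤-refl
      vs : List ℤ
      vs = L 1 ∷ L 2 ∷ L p ∷ L n ∷ []
      L≡0 : ∀ i → InRange n i → L i ≡ + 0
      L≡0 i r = ℤP.≤-antisym
        (ℤP.≤-trans (L-mono (proj₁ r) (proj₂ r) ℕP.≤-refl) (lia vs (λ a b c d → K 0 :≤ a :+ b ⟹ a :≤ b ⟹ b :≤ c ⟹ c :≤ d ⟹ c :+ d :≤ K 0 ⟹ d :≤ K 0) L1+L2 L1≤L2 L2≤Lp Lp≤Ln top))
        (ℤP.≤-trans (lia vs (λ a b c d → K 0 :≤ a :+ b ⟹ a :≤ b ⟹ b :≤ c ⟹ c :≤ d ⟹ c :+ d :≤ K 0 ⟹ K 0 :≤ a) L1+L2 L1≤L2 L2≤Lp Lp≤Ln top) (L-mono (s≤s z≤n) (proj₁ r) (proj₂ r)))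

      g = lin wf
      sg : Signed n g
      sg = aff-sp n≥3 wf (proj₁ iswf)

    P-eq : ∀ k → InRange n k → P k ≡ (h +ℤ + 1) *ℤ rhoV k
    P-eq k r = lia (P k ∷ h ∷ + k ∷ rhoV k ∷ []) (λ x h k ρ → x :- (h :+ K 1) :* (k :- K 1) :≡ K 0 ⟹ (h :+ K 1) :* ρ :≡ (h :+ K 1) :* (k :- K 1) ⟹ x :≡ (h :+ K 1) :* ρ)
      (L≡0 k r) (cong ((h +ℤ + 1) *ℤ_) (pos∸1 (proj₁ r)))

    S : ZV
    S i = val rhoV (g i)

    tf-frame : ∀ i → InRange n i → h *ℤ val (tr wf) (g i) ≡ (h +ℤ + 1) *ℤ S i - rhoV i
    tf-frame i r = lia (h *ℤ val (tr wf) (g i) ∷ val P (g i) ∷ (h +ℤ + 1) *ℤ S i ∷ rhoV i ∷ []) (λ t x s ρ → x :≡ ρ :+ t ⟹ x :≡ s ⟹ t :≡ s :- ρ)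
      (pt-frame {n} {wf} sg i r)
      (trans (val-cong P ((h +ℤ + 1) ·v rhoV) (g i) (P-eq ∣ g i ∣ (sp-maps sg i r))) (val-*ᵥ (h +ℤ + 1) rhoV (g i)))

    -- As h ≡ -1 modulo h + 1, this says 𝒜(b) ≡ `pt n b`. By `P-eq`, h times the translation part of
    -- w̃_f is (h + 1)ρ̌ - gρ̌ with g its linear part, and S is g⁻¹ρ̌.
    anderson-eq : ∀ b → IsAff n b → ∀ k → InRange n k → h *ℤ anderson n wf b k ≡ (h +ℤ + 1) *ℤ act n (lin b) S k - pt n b k
    anderson-eq b ab k r = lia (h ∷ act n w y k ∷ tr b k ∷ act n w (h ·v y) k ∷ act n w (((h +ℤ + 1) ·v S) ⊖ rhoV) k ∷ act n w S k ∷ act n w rhoV k ∷ act n w ((h +ℤ + 1) ·v S) k ∷ act n w (neg rhoV) k ∷ [])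
        (λ h a t b c d ρ f g → b :≡ h :* a ⟹ b :≡ c ⟹ c :≡ f :+ g ⟹ f :≡ (h :+ K 1) :* d ⟹ g :≡ :- ρ ⟹ h :* (a :- t) :≡ (h :+ K 1) :* d :- (ρ :+ h :* t))
        (act-·v sb h y k p1 p2) (act-cong sb y-eq k p1 p2) (act-⊕ sb ((h +ℤ + 1) ·v S) (neg rhoV) k p1 p2) (act-·v sb (h +ℤ + 1) S k p1 p2) neg-eq
      where
      w = lin b
      sb = aff-sp n≥3 b ab
      p1 = proj₁ r
      p2 = proj₂ r
      y : ZV
      y = act n (inv n g) (tr wf)
      y-eq : (h ·v y) ≗[ n ] (((h +ℤ + 1) ·v S) ⊖ rhoV)
      y-eq i q s = trans (cong (h *ℤ_) (act-inv sg (tr wf) i (q , s))) (tf-frame i (q , s))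
      neg-eq : act n w (neg rhoV) k ≡ - act n w rhoV k
      neg-eq = trans (act-cong sb (λ i _ _ → sym (ℤP.-1*i≡-i (rhoV i))) k p1 p2) (trans (act-·v sb (- + 1) rhoV k p1 p2) (ℤP.-1*i≡-i (act n w rhoV k)))

    anderson-even : ∀ b → IsAff n b → sumTo n (anderson n wf b) ≡₂ + 0
    anderson-even b ab = ≡₂-trans (≡⇒≡₂ (trans (sumTo-+ n (act n w y) (neg (tr b))) (cong (sumTo n (act n w y) +ℤ_) (sumTo-neg n (tr b)))))
      (≡₂-+ (≡₂-trans (act-sum (aff-sp n≥3 b ab) y) (≡₂-trans (act-sum (inv-sp sg) (tr wf)) (∣⇒even (sumTo n (tr wf)) (proj₂ (proj₁ iswf)))))
            (≡₂-trans (≡₂-neg (sumTo n (tr b))) (∣⇒even (sumTo n (tr b)) (proj₂ ab))))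
      where
      w = lin b
      y : ZV
      y = act n (inv n g) (tr wf)

    h+1≡ : + (2 ℕ.* n ∸ 1) ≡ h +ℤ + 1
    h+1≡ = trans (sym (ℤP.⊖-≥ {2 ℕ.* n} {1} 2n≥1)) (trans (sym (ℤP.m-n≡m⊖n (2 ℕ.* n) 1)) (trans (cong (_- + 1) (ℤP.pos-* 2 n))
      (lia (h ∷ + n ∷ []) (λ h n → h :≡ K 2 :* n :- K 2 ⟹ K 2 :* n :- K 1 :≡ h :+ K 1) h≡)))
      where
      2n≥1 : 1 ≤ 2 ℕ.* n
      2n≥1 = ℕP.≤-trans n≥1 (ℕP.m≤m+n n (n + 0))

    -- Modulo h + 1 the Anderson map is b ↦ pt b.
    modEq⇒pt : ∀ b → IsAff n b → ∀ y → ModEq n (anderson n wf b) y → Σ ZV λ z → ∀ k → InRange n k → pt n b k ≡ y k +ℤ (h +ℤ + 1) *ℤ z k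
    modEq⇒pt b ab y (z , _ , e) = (λ k → act n (lin b) S k - anderson n wf b k +ℤ z k) , λ k r →
      lia (h ∷ anderson n wf b k ∷ act n (lin b) S k ∷ pt n b k ∷ y k ∷ z k ∷ + (2 ℕ.* n ∸ 1) *ℤ z k ∷ [])
        (λ h a s q y z N → h :* a :≡ (h :+ K 1) :* s :- q ⟹ a :- y :≡ N ⟹ N :≡ (h :+ K 1) :* z ⟹ q :≡ y :+ (h :+ K 1) :* (s :- a :+ z))
        (anderson-eq b ab k r) (e k (proj₁ r) (proj₂ r)) (cong (_*ℤ z k) h+1≡)

    -- The quotient lies in Q̌ because h + 1 is odd: modulo 2 it is the sum of the two vectors that
    -- are compared, and both lie in Q̌.
    pt⇒modEq : ∀ b → IsAff n b → ∀ y → sumTo n y ≡₂ + 0 → ∀ (z : ZV) → (∀ k → InRange n k → pt n b k ≡ y k +ℤ (h +ℤ + 1) *ℤ z k) → ModEq n (anderson n wf b) y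
    pt⇒modEq b ab y y-even z e = z' , even⇒∣ (sumTo n z') z'-even , λ k p q → trans (eq' k (p , q)) (cong (_*ℤ z' k) (sym h+1≡))
      where
      z' : ZV
      z' k = z k - act n (lin b) S k +ℤ anderson n wf b k
      eq' : ∀ k → InRange n k → anderson n wf b k - y k ≡ (h +ℤ + 1) *ℤ z' k
      eq' k r = lia (h ∷ anderson n wf b k ∷ act n (lin b) S k ∷ pt n b k ∷ y k ∷ z k ∷ [])
        (λ h a s q y z → h :* a :≡ (h :+ K 1) :* s :- q ⟹ q :≡ y :+ (h :+ K 1) :* z ⟹ a :- y :≡ (h :+ K 1) :* (z :- s :+ a))
        (anderson-eq b ab k r) (e k r)
      pointwise : ∀ k → InRange n k → z' k ≡₂ anderson n wf b k +ℤ y k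
      pointwise k r = mod₂ (- y k - (+ n - + 1) *ℤ z' k)
        (lia (h ∷ anderson n wf b k ∷ y k ∷ z' k ∷ + n ∷ []) (λ h a y z n → a :- y :≡ (h :+ K 1) :* z ⟹ h :* z :≡ (K 2 :* n :- K 2) :* z ⟹ z :≡ a :+ y :+ K 2 :* (:- y :- (n :- K 1) :* z))
          (eq' k r) (cong (_*ℤ z' k) h≡))
      z'-even : sumTo n z' ≡₂ + 0
      z'-even = ≡₂-trans (sumTo-≡₂ n pointwise) (≡₂-trans (≡⇒≡₂ (sumTo-+ n (anderson n wf b) y)) (≡₂-+ (anderson-even b ab) y-even))

Sommers-cong : ∀ {n w} {τ τ' : ℕ → ℤ} → 3 ≤ n → (∀ i → InRange n i → τ i ≡ τ' i) → Sommers n w τ → Sommers n w τ'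
Sommers-cong {n} {w} {τ} {τ'} n≥3 e som = record
  { up≤ = λ i p q → subst (_≤ℤ + 1) (up i p q) (up≤ i p q)
  ; up= = λ i p q r → up= i p q (trans (up i p q) r)
  ; lo≤ = subst (_≤ℤ + 1) lo lo≤
  ; lo= = λ r → lo= (trans lo r)
  ; hi≤ = subst (- + 2 ≤ℤ_) hi hi≤
  ; hi= = λ r → hi= (trans hi r)
  }
  where
  open Sommers som
  n≥1 = 3≤⇒1≤ n≥3
  up : ∀ i → 1 ≤ i → i ℕ.< n → τ (suc i) - τ i ≡ τ' (suc i) - τ' i
  up i p q = cong₂ _-_ (e (suc i) (s≤s z≤n , q)) (e i (p , ℕP.<⇒≤ q))
  lo : τ 1 +ℤ τ 2 ≡ τ' 1 +ℤ τ' 2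
  lo = cong₂ _+ℤ_ (e 1 (s≤s z≤n , n≥1)) (e 2 (s≤s z≤n , ℕP.≤-trans (s≤s (s≤s z≤n)) n≥3))
  hi : τ (n ∸ 1) +ℤ τ n ≡ τ' (n ∸ 1) +ℤ τ' n
  hi = cong₂ _+ℤ_ (e (n ∸ 1) (ℕP.m+n≤o⇒m≤o∸n 1 (ℕP.≤-trans (s≤s (s≤s z≤n)) n≥3) , ℕP.m∸n≤m n 1)) (e n (n≥1 , ℕP.≤-refl))

-- Paths

east-mono : ∀ p i → 1 ≤ i → eastBefore p i ≤ eastBefore p (suc i)
east-mono [] i _ = z≤n
east-mono (N ∷ xs) (suc zero) _ = z≤n
east-mono (N ∷ xs) (suc (suc i)) _ = east-mono xs (suc i) (s≤s z≤n)
east-mono (E ∷ xs) i r = s≤s (east-mono xs i r)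
east-mono (E⁺ ∷ xs) i r = s≤s (east-mono xs i r)
east-mono (E⁻ ∷ xs) i r = s≤s (east-mono xs i r)

east≤ : ∀ p i → eastBefore p i ≤ countE p
east≤ [] i = z≤n
east≤ (N ∷ xs) i with i ≡ᵇ 1
... | true = z≤n
... | false = east≤ xs (i ∸ 1)
east≤ (E ∷ xs) i = s≤s (east≤ xs i)
east≤ (E⁺ ∷ xs) i = s≤s (east≤ xs i)
east≤ (E⁻ ∷ xs) i = s≤s (east≤ xs i)

afterNorth-rise : ∀ p i → 1 ≤ i → suc i ≤ countN p → eastBefore p i ≡ eastBefore p (suc i) → afterNorth p i ≡ N ∷ []
afterNorth-rise (N ∷ []) (suc zero) _ (s≤s ()) _
afterNorth-rise (N ∷ N ∷ xs) (suc zero) _ _ _ = refl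
afterNorth-rise (N ∷ xs) (suc (suc i)) _ (s≤s q) e = afterNorth-rise xs (suc i) (s≤s z≤n) q e
afterNorth-rise (E ∷ xs) (suc i) r q e = afterNorth-rise xs (suc i) r q (ℕP.suc-injective e)
afterNorth-rise (E⁺ ∷ xs) (suc i) r q e = afterNorth-rise xs (suc i) r q (ℕP.suc-injective e)
afterNorth-rise (E⁻ ∷ xs) (suc i) r q e = afterNorth-rise xs (suc i) r q (ℕP.suc-injective e)

rise-N : ∀ p i → 1 ≤ i → suc i ≤ countN p → eastBefore p i ≡ eastBefore p (suc i) → NorthFollowedByN p i ≡ true
rise-N p i r q e rewrite afterNorth-rise p i r q e = refl

starts-NN : ∀ p → 2 ≤ countN p → eastBefore p 1 ≡ 0 → eastBefore p 2 ≡ 0 → startsNN p ≡ true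
starts-NN (N ∷ []) (s≤s ()) _ _
starts-NN (N ∷ N ∷ xs) _ _ _ = refl

-- Parity and signs

IsSign : ℤ → Set
IsSign s = s ≡ + 1 ⊎ s ≡ - + 1

parity : ∀ x → x ≡₂ + 0 ⊎ x ≡₂ + 1
parity x with divide (+ 2) (ℤ.+<+ (s≤s z≤n)) x
... | d , 0 , e , _ = inj₁ (mod₂ d e)
... | d , 1 , e , _ = inj₂ (mod₂ d e)
... | d , suc (suc r) , e , ℤ.+<+ (s≤s (s≤s ()))

negOnePow-even : ∀ x → x ≡₂ + 0 → negOnePow x ≡ + 1
negOnePow-even x e rewrite n∣m⇒m%n≡0 ∣ x ∣ 2 (even⇒∣ x e) = refl

negOnePow-odd : ∀ x → x ≡₂ + 1 → negOnePow x ≡ - + 1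
negOnePow-odd x o with ∣ x ∣ % 2 in e
... | suc _ = refl
... | zero = ⊥-elim (1≢₂0 (≡₂-trans (≡₂-sym o) (∣⇒even x (m%n≡0⇒n∣m ∣ x ∣ 2 e))))

negOnePow-cong : ∀ x y → x ≡₂ y → negOnePow x ≡ negOnePow y
negOnePow-cong x y e with parity y
... | inj₁ q = trans (negOnePow-even x (≡₂-trans e q)) (sym (negOnePow-even y q))
... | inj₂ q = trans (negOnePow-odd x (≡₂-trans e q)) (sym (negOnePow-odd y q))

negOnePow-sign : ∀ x → IsSign (negOnePow x)
negOnePow-sign x with parity x
... | inj₁ q = inj₁ (negOnePow-even x q)
... | inj₂ q = inj₂ (negOnePow-odd x q)

eps-sign : ∀ p → IsSign (epsP p)
eps-sign p with hasEm p
... | true = inj₂ refl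
... | false = inj₁ refl

sign-* : ∀ {s t} → IsSign s → IsSign t → IsSign (s *ℤ t)
sign-* (inj₁ refl) (inj₁ refl) = inj₁ refl
sign-* (inj₁ refl) (inj₂ refl) = inj₂ refl
sign-* (inj₂ refl) (inj₁ refl) = inj₂ refl
sign-* (inj₂ refl) (inj₂ refl) = inj₁ refl

∣sign∣ : ∀ {s} x → IsSign s → ∣ s *ℤ x ∣ ≡ ∣ x ∣
∣sign∣ x (inj₁ refl) = cong ∣_∣ (ℤP.*-identityˡ x)
∣sign∣ x (inj₂ refl) = trans (cong ∣_∣ (ℤP.-1*i≡-i x)) (ℤP.∣-i∣≡∣i∣ x)

sign-≥1 : ∀ {s} → IsSign s → 1 ≤ ∣ s ∣
sign-≥1 (inj₁ refl) = s≤s z≤n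
sign-≥1 (inj₂ refl) = s≤s z≤n

sign-sgn : ∀ {s} → IsSign s → sgn s ≡ s
sign-sgn (inj₁ refl) = refl
sign-sgn (inj₂ refl) = refl

prod-negs : ∀ n v → (∀ i → InRange n i → 1 ≤ ∣ v i ∣) →
  (prodTo n (λ i → sgn (v i)) ≡ + 1 × negs n v ≡₂ + 0) ⊎ (prodTo n (λ i → sgn (v i)) ≡ - + 1 × negs n v ≡₂ + 1)
prod-negs zero v nz = inj₁ (refl , ≡⇒≡₂ refl)
prod-negs (suc n) v nz = go (prod-negs n v λ i r → nz i (InRange-suc r)) (v (suc n)) (nz (suc n) InRange-top)
  where
  P = prodTo n (λ i → sgn (v i))
  Q = negs n v
  go : (P ≡ + 1 × Q ≡₂ + 0) ⊎ (P ≡ - + 1 × Q ≡₂ + 1) → ∀ a → 1 ≤ ∣ a ∣ →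
    (P *ℤ sgn a ≡ + 1 × Q +ℤ nb a ≡₂ + 0) ⊎ (P *ℤ sgn a ≡ - + 1 × Q +ℤ nb a ≡₂ + 1)
  go (inj₁ (p , q)) (+ suc _) _ = inj₁ (cong (_*ℤ + 1) p , ≡₂-+ q (≡⇒≡₂ {+ 0} refl))
  go (inj₁ (p , q)) -[1+ _ ] _ = inj₂ (cong (_*ℤ - + 1) p , ≡₂-+ q (≡⇒≡₂ {+ 1} refl))
  go (inj₂ (p , q)) (+ suc _) _ = inj₂ (cong (_*ℤ + 1) p , ≡₂-+ q (≡⇒≡₂ {+ 0} refl))
  go (inj₂ (p , q)) -[1+ _ ] _ = inj₁ (cong (_*ℤ - + 1) p , ≡₂-trans (≡₂-+ q (≡⇒≡₂ {+ 1} refl)) (mod₂ (+ 1) refl))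

-- If s t is the product of the signs of v, attaching s and t to two entries of v leaves an even
-- number of negative entries.
negs-sign : ∀ {s t} P Q → IsSign s → IsSign t → (P ≡ + 1 × Q ≡₂ + 0) ⊎ (P ≡ - + 1 × Q ≡₂ + 1) → P ≡ s *ℤ t → Q +ℤ (nb s +ℤ nb t) ≡₂ + 0
negs-sign P Q (inj₁ refl) (inj₁ refl) (inj₁ (_ , q)) _ = ≡₂-+ q (≡⇒≡₂ {+ 0} refl)
negs-sign P Q (inj₂ refl) (inj₂ refl) (inj₁ (_ , q)) _ = ≡₂-+ q (mod₂ {+ 2} {+ 0} (+ 1) refl)
negs-sign P Q (inj₁ refl) (inj₂ refl) (inj₂ (_ , q)) _ = ≡₂-trans (≡₂-+ q (≡⇒≡₂ {+ 1} refl)) (mod₂ (+ 1) refl)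
negs-sign P Q (inj₂ refl) (inj₁ refl) (inj₂ (_ , q)) _ = ≡₂-trans (≡₂-+ q (≡⇒≡₂ {+ 1} refl)) (mod₂ (+ 1) refl)
negs-sign P Q (inj₁ refl) (inj₂ refl) (inj₁ (refl , _)) ()
negs-sign P Q (inj₂ refl) (inj₁ refl) (inj₁ (refl , _)) ()
negs-sign P Q (inj₁ refl) (inj₁ refl) (inj₂ (refl , _)) ()
negs-sign P Q (inj₂ refl) (inj₂ refl) (inj₂ (refl , _)) ()

-- The case distinction in ν and μ is the parity of 0 + 1 + ... + (n - 1); both have period 4 in n.
triangle : ∀ m → (caseA (suc m) ≡ true × sumTo (suc m) rhoV ≡₂ + 0) ⊎ (caseA (suc m) ≡ false × sumTo (suc m) rhoV ≡₂ + 1)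
triangle 0 = inj₁ (refl , mod₂ (+ 0) refl)
triangle 1 = inj₂ (refl , mod₂ (+ 0) refl)
triangle 2 = inj₂ (refl , mod₂ (+ 1) refl)
triangle 3 = inj₁ (refl , mod₂ (+ 3) refl)
triangle (suc (suc (suc (suc m)))) = go (triangle m)
  where
  S = sumTo (suc m) rhoV
  S' = sumTo (suc (4 + m)) rhoV
  period : caseA (suc (4 + m)) ≡ caseA (suc m)
  period = cong (λ r → (r ≡ᵇ 0) ∨ (r ≡ᵇ 3)) (trans (cong (_% 4) (ℕP.+-comm 4 m)) ([m+n]%n≡m%n m 4))
    where open import Data.Nat.DivMod using ([m+n]%n≡m%n)
  step : S' ≡₂ S
  step = mod₂ (+ 2 *ℤ + m +ℤ + 5) (lia (S ∷ + m ∷ []) λ S m → S :+ (K 1 :+ m) :+ (K 2 :+ m) :+ (K 3 :+ m) :+ (K 4 :+ m) :≡ S :+ K 2 :* (K 2 :* m :+ K 5))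
  go : (caseA (suc m) ≡ true × S ≡₂ + 0) ⊎ (caseA (suc m) ≡ false × S ≡₂ + 1) → (caseA (suc (4 + m)) ≡ true × S' ≡₂ + 0) ⊎ (caseA (suc (4 + m)) ≡ false × S' ≡₂ + 1)
  go (inj₁ (p , q)) = inj₁ (trans period p , ≡₂-trans step q)
  go (inj₂ (p , q)) = inj₂ (trans period p , ≡₂-trans step q)

sum-upTo : ∀ l (f : ℕ → ℕ) → + foldr _+_ 0 (map f (upTo l)) ≡ sumTo l (λ k → + f (k ∸ 1))
sum-upTo zero f = refl
sum-upTo (suc l) f = begin
  + foldr _+_ 0 (map f (upTo (suc l))) ≡⟨ cong (λ xs → + foldr _+_ 0 (map f xs)) (LP.upTo-∷ʳ l) ⟨
  + foldr _+_ 0 (map f (upTo l ++ l ∷ [])) ≡⟨ cong (λ xs → + foldr _+_ 0 xs) (LP.map-++ f (upTo l) (l ∷ [])) ⟩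
  + foldr _+_ 0 (map f (upTo l) ++ f l ∷ []) ≡⟨ cong +_ (sum-++ (map f (upTo l)) (f l ∷ [])) ⟩
  + foldr _+_ 0 (map f (upTo l)) +ℤ + (f l + 0) ≡⟨ cong₂ _+ℤ_ (sum-upTo l f) (cong +_ (ℕP.+-identityʳ (f l))) ⟩
  sumTo l (λ k → + f (k ∸ 1)) +ℤ + f l ∎
  where
  open ≡-Reasoning
  open import Data.Nat.ListAction.Properties using (sum-++)

-- The labels v with the signs that d_D attaches to rows 1 and n.
signed-label : ℕ → List Step → SP → SP
signed-label n p v r =
  if r ≡ᵇ n then negOnePow (+ 1 +ℤ mu n p (n ∸ 1) +ℤ mu n p n) *ℤ v r
  else if r ≡ᵇ 1 then (epsP p *ℤ negOnePow (+ 1 +ℤ nu n (n ∸ 1) +ℤ nu n n)) *ℤ v r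
  else v r

data RowOf (n : ℕ) : ℕ → Set where
  first : RowOf n 1
  middle : ∀ {k} → 1 ℕ.< k → k ℕ.< n → RowOf n k
  last : RowOf n n

row : ∀ n k → InRange n k → RowOf n k
row n (suc zero) r = first
row n (suc (suc k)) (_ , q) with ℕP.m≤n⇒m<n∨m≡n q
... | inj₁ lt = middle (s≤s (s≤s z≤n)) lt
... | inj₂ refl = last

scaled-signed : ∀ {n} {v : SP} {s : ℕ → ℤ} {w : SP} → IsSignedPerm n v → (∀ k → IsSign (s k)) → (∀ k → InRange n k → w k ≡ s k *ℤ v k) → Signed n w
scaled-signed {n} {v} {s} {w} (maps , inj) sg e = signed
  ( (λ k r → subst (InRange n) (sym (abs k r)) (maps k r))
  , (λ k l r r' q → inj k l r r' (trans (sym (abs k r)) (trans q (abs l r')))))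
  where
  abs : ∀ k → InRange n k → ∣ w k ∣ ≡ ∣ v k ∣
  abs k r = trans (cong ∣_∣ (e k r)) (∣sign∣ (v k) (sg k))

nb-if : ∀ a b x y → (a ≡ true → b ≡ true → ⊥) →
  nb (if a then x else (if b then y else + 1)) ≡ (if b then nb y else + 0) +ℤ (if a then nb x else + 0)
nb-if true true x y ne = ⊥-elim (ne refl refl)
nb-if true false x y ne = sym (ℤP.+-identityˡ (nb x))
nb-if false true x y ne = sym (ℤP.+-identityʳ (nb y))
nb-if false false x y ne = refl

-- The alcove of a labelled path.

module Vert (m : ℕ) (p : List Step) (v : SP) (vert : InVert (3 + m) p v) where
  n : ℕ
  n = 3 + m
  n≥3 : 3 ≤ n
  n≥3 = s≤s (s≤s (s≤s z≤n))

  private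
    h = hD n
    h≡ : h ≡ + 2 *ℤ + n - + 2
    h≡ = hD≡ {n} (s≤s z≤n)
    inL = proj₁ vert
    v-sp = proj₁ (proj₂ vert)
    v-rise = proj₁ (proj₂ (proj₂ vert))
    v-NN = proj₁ (proj₂ (proj₂ (proj₂ vert)))
    v-prod = proj₂ (proj₂ (proj₂ (proj₂ vert)))
    ε = epsP p
    P : ℕ → ℤ
    P = piZ p
    μ λ' : ZV
    μ = mu n p
    λ' = lam n p
    q = 2 + m
    1≢n : ¬ 1 ≡ n
    1≢n ()

    P-mono : ∀ i → 1 ≤ i → P i ≤ℤ P (suc i)
    P-mono i r = +≤+ (east-mono p i r)
    P≥0 : ∀ i → + 0 ≤ℤ P i
    P≥0 i = +≤+ z≤n
    P-bound : P n ≤ℤ + n - + 1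
    P-bound = subst (P n ≤ℤ_) (lia (+ m ∷ []) λ m → K 2 :+ m :≡ K 3 :+ m :- K 1) (+≤+ (subst (eastBefore p n ≤_) (proj₁ inL) (east≤ p n)))
    rise : ∀ i → 1 ≤ i → i ℕ.< n → P i ≡ P (suc i) → v i <ℤ v (suc i)
    rise i r s e = v-rise i r s (rise-N p i r (subst (suc i ≤_) (sym (proj₁ (proj₂ inL))) s) (ℤP.+-injective e))
    start : P 1 ≡ + 0 → P 2 ≡ + 0 → + ∣ v 1 ∣ <ℤ v 2
    start e₁ e₂ = v-NN (starts-NN p (subst (2 ≤_) (sym (proj₁ (proj₂ inL))) (s≤s (s≤s z≤n))) (ℤP.+-injective e₁) (ℤP.+-injective e₂))

    ifn : ∀ {A : Set} {x y : A} k → k ℕ.< n → (if k ≡ᵇ n then x else y) ≡ y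
    ifn k lt rewrite eqᵇ-false (ℕP.<⇒≢ lt) = refl
    if1 : ∀ {A : Set} {x y : A} k → 1 ℕ.< k → (if k ≡ᵇ 1 then x else y) ≡ y
    if1 k lt rewrite eqᵇ-false {k} {1} (λ e → ℕP.<⇒≢ lt (sym e)) = refl
    ifnn : ∀ {A : Set} {x y : A} → (if n ≡ᵇ n then x else y) ≡ x
    ifnn rewrite eqᵇ-true {n} refl = refl

    s : ℕ
    s = foldr _+_ 0 (map (λ i → eastBefore p (suc i)) (upTo (1 + m)))

    data Last : Set where
      evenₛ : + s ≡₂ + 0 → λ' n ≡ + 2 *ℤ P n - P q → Last
      oddₛ : + s ≡₂ + 1 → λ' n ≡ + 2 *ℤ + n - + 1 - + 2 *ℤ P n +ℤ P q → Last

    N≡ : + (2 ℕ.* n ∸ 1) ≡ + 2 *ℤ + n - + 1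
    N≡ = trans (sym (ℤP.⊖-≥ {2 ℕ.* n} {1} (s≤s z≤n))) (trans (sym (ℤP.m-n≡m⊖n (2 ℕ.* n) 1)) (cong (_- + 1) (ℤP.pos-* 2 n)))

    lastλ : Last
    lastλ = go (parity (+ s))
      where
      shape : λ' n ≡ (if (s % 2) ≡ᵇ 0 then (+ 2) *ℤ P n - P q else (+ (2 ℕ.* n ∸ 1) - (+ 2) *ℤ P n) +ℤ P q)
      shape = ifnn
      go : + s ≡₂ + 0 ⊎ + s ≡₂ + 1 → Last
      go (inj₁ e) = evenₛ e (trans shape (cong (λ b → if b ≡ᵇ 0 then (+ 2) *ℤ P n - P q else (+ (2 ℕ.* n ∸ 1) - (+ 2) *ℤ P n) +ℤ P q) (n∣m⇒m%n≡0 s 2 (even⇒∣ (+ s) e))))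
      go (inj₂ o) = oddₛ o (trans shape (trans (odd-branch (s % 2) refl) (cong (λ y → y - (+ 2) *ℤ P n +ℤ P q) N≡)))
        where
        odd-branch : ∀ r → s % 2 ≡ r → (if r ≡ᵇ 0 then (+ 2) *ℤ P n - P q else (+ (2 ℕ.* n ∸ 1) - (+ 2) *ℤ P n) +ℤ P q) ≡ (+ (2 ℕ.* n ∸ 1) - (+ 2) *ℤ P n) +ℤ P q
        odd-branch (suc _) _ = refl
        odd-branch zero e = ⊥-elim (1≢₂0 (≡₂-trans (≡₂-sym o) (∣⇒even (+ s) (m%n≡0⇒n∣m s 2 e))))

    λ-mid : ∀ k → 1 ℕ.< k → k ℕ.< n → λ' k ≡ P k
    λ-mid k r t = trans (if1 k r) (ifn k t)

    mid-q : 1 ℕ.< q × q ℕ.< n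
    mid-q = s≤s (s≤s z≤n) , ℕP.≤-refl

    Mid : Set
    Mid = ∀ k → 1 ℕ.< k → k ℕ.< n → μ k ≡ P k - (+ k - + 1)
    μ-mid : Mid
    μ-mid k r t = trans (if1 k r) (trans (ifn k t) (cong₂ _-_ (λ-mid k r t) (pos∸1 (ℕP.<⇒≤ r))))

    σ₁ σₙ : ℤ
    σ₁ = ε *ℤ negOnePow (+ 1 +ℤ nu n (n ∸ 1) +ℤ nu n n)
    σₙ = negOnePow (+ 1 +ℤ μ (n ∸ 1) +ℤ μ n)

    σ₁-sign : IsSign σ₁
    σ₁-sign = sign-* (eps-sign p) (negOnePow-sign (+ 1 +ℤ nu n (n ∸ 1) +ℤ nu n n))
    σₙ-sign : IsSign σₙ
    σₙ-sign = negOnePow-sign (+ 1 +ℤ μ (n ∸ 1) +ℤ μ n)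

    nu-q : nu n q ≡ + (1 + m)
    nu-q = ifn q ℕP.≤-refl

    -- The two cases of n - 1 modulo 4, each with the sign that ν gives to row 1 and with the parity
    -- of the coordinate sum of ρ̌.
    data Case : Set where
      caseI : σ₁ ≡ ε → μ 1 ≡ λ' 1 → μ n ≡ λ' n - + (2 + m) → sumTo n rhoV ≡₂ + 0 → Case
      caseII : σ₁ ≡ - ε → μ 1 ≡ - λ' 1 → μ n ≡ + n - λ' n → sumTo n rhoV ≡₂ + 1 → Case

    case-of : Case
    case-of = go (triangle (2 + m))
      where
      μn : μ n ≡ (if caseA n then λ' n - + (n ∸ 1) else + n - λ' n)
      μn = ifnn
      nun : nu n n ≡ (if caseA n then + (n ∸ 1) else + n)
      nun = ifnn
      go : (caseA n ≡ true × sumTo n rhoV ≡₂ + 0) ⊎ (caseA n ≡ false × sumTo n rhoV ≡₂ + 1) → Case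
      go (inj₁ (a , t)) = caseI
        (trans (cong (ε *ℤ_) (negOnePow-even _ (mod₂ (+ m +ℤ + 2) (lia (nu n q ∷ nu n n ∷ + m ∷ []) (λ x y m → x :≡ K 1 :+ m ⟹ y :≡ K 2 :+ m ⟹ K 1 :+ x :+ y :≡ K 0 :+ K 2 :* (m :+ K 2))
          nu-q (trans nun (cong (λ b → if b then + (n ∸ 1) else + n) a)))))) (ℤP.*-identityʳ ε))
        (cong (λ b → if b then λ' 1 else - λ' 1) a)
        (trans μn (cong (λ b → if b then λ' n - + (n ∸ 1) else + n - λ' n) a)) t
      go (inj₂ (a , t)) = caseII
        (trans (cong (ε *ℤ_) (negOnePow-odd _ (mod₂ (+ m +ℤ + 2) (lia (nu n q ∷ nu n n ∷ + m ∷ []) (λ x y m → x :≡ K 1 :+ m ⟹ y :≡ K 3 :+ m ⟹ K 1 :+ x :+ y :≡ K 1 :+ K 2 :* (m :+ K 2))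
          nu-q (trans nun (cong (λ b → if b then + (n ∸ 1) else + n) a)))))) (trans (ℤP.*-comm ε (- + 1)) (ℤP.-1*i≡-i ε)))
        (cong (λ b → if b then λ' 1 else - λ' 1) a)
        (trans μn (cong (λ b → if b then λ' n - + (n ∸ 1) else + n - λ' n) a)) t

    μ₁≡ : μ 1 ≡ σ₁ *ℤ P 1
    μ₁≡ with case-of
    ... | caseI a b _ _ = trans b (cong (_*ℤ P 1) (sym a))
    ... | caseII a b _ _ = trans b (trans (ℤP.neg-distribˡ-* ε (P 1)) (cong (_*ℤ P 1) (sym a)))

    -- With μ, the four cases in the definition of row n reduce to two.
    data LastRow : Set where
      typeX : σₙ ≡ + 1 → μ n ≡ + 2 *ℤ P n - P q - (+ n - + 1) → LastRow
      typeY : σₙ ≡ - + 1 → μ n ≡ + n - + 2 *ℤ P n +ℤ P q → LastRow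

    mkX : μ n ≡ + 2 *ℤ P n - P q - (+ n - + 1) → LastRow
    mkX e = typeX (negOnePow-even _ (mod₂ (P n - + n +ℤ + 2) (lia (μ q ∷ μ n ∷ P q ∷ P n ∷ + m ∷ [])
      (λ x y a b m → x :≡ a :- (K 2 :+ m :- K 1) ⟹ y :≡ K 2 :* b :- a :- (K 3 :+ m :- K 1) ⟹ K 1 :+ x :+ y :≡ K 0 :+ K 2 :* (b :- (K 3 :+ m) :+ K 2)) (μ-mid q (proj₁ mid-q) (proj₂ mid-q)) e))) e

    mkY : μ n ≡ + n - + 2 *ℤ P n +ℤ P q → LastRow
    mkY e = typeY (negOnePow-odd _ (mod₂ (P q - P n +ℤ + 1) (lia (μ q ∷ μ n ∷ P q ∷ P n ∷ + m ∷ [])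
      (λ x y a b m → x :≡ a :- (K 2 :+ m :- K 1) ⟹ y :≡ K 3 :+ m :- K 2 :* b :+ a ⟹ K 1 :+ x :+ y :≡ K 1 :+ K 2 :* (a :- b :+ K 1)) (μ-mid q (proj₁ mid-q) (proj₂ mid-q)) e))) e

    lastRow : LastRow
    lastRow with case-of | lastλ
    ... | caseI _ _ c _ | evenₛ _ d = mkX (lia (μ n ∷ λ' n ∷ P n ∷ P q ∷ + m ∷ []) (λ x l a b m → x :≡ l :- (K 2 :+ m) ⟹ l :≡ K 2 :* a :- b ⟹ x :≡ K 2 :* a :- b :- (K 3 :+ m :- K 1)) c d)
    ... | caseI _ _ c _ | oddₛ _ d = mkY (lia (μ n ∷ λ' n ∷ P n ∷ P q ∷ + m ∷ []) (λ x l a b m → x :≡ l :- (K 2 :+ m) ⟹ l :≡ K 2 :* (K 3 :+ m) :- K 1 :- K 2 :* a :+ b ⟹ x :≡ K 3 :+ m :- K 2 :* a :+ b) c d)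
    ... | caseII _ _ c _ | evenₛ _ d = mkY (lia (μ n ∷ λ' n ∷ P n ∷ P q ∷ + m ∷ []) (λ x l a b m → x :≡ K 3 :+ m :- l ⟹ l :≡ K 2 :* a :- b ⟹ x :≡ K 3 :+ m :- K 2 :* a :+ b) c d)
    ... | caseII _ _ c _ | oddₛ _ d = mkX (lia (μ n ∷ λ' n ∷ P n ∷ P q ∷ + m ∷ []) (λ x l a b m → x :≡ K 3 :+ m :- l ⟹ l :≡ K 2 :* (K 3 :+ m) :- K 1 :- K 2 :* a :+ b ⟹ x :≡ K 2 :* a :- b :- (K 3 :+ m :- K 1)) c d)

  w₀ : SP
  w₀ = signed-label n p v

  private
    w-first : w₀ 1 ≡ σ₁ *ℤ v 1
    w-first = refl
    w-last : w₀ n ≡ σₙ *ℤ v n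
    w-last = ifnn
    w-mid : ∀ k → 1 ℕ.< k → k ℕ.< n → w₀ k ≡ v k
    w-mid k r t = trans (ifn k t) (if1 k r)

    sgnRow : ℕ → ℤ
    sgnRow k = if k ≡ᵇ n then σₙ else (if k ≡ᵇ 1 then σ₁ else + 1)
    sgnRow-sign : ∀ k → IsSign (sgnRow k)
    sgnRow-sign k with k ≡ᵇ n | k ≡ᵇ 1
    ... | true | _ = σₙ-sign
    ... | false | true = σ₁-sign
    ... | false | false = inj₁ refl
    w-row : ∀ k → InRange n k → w₀ k ≡ sgnRow k *ℤ v k
    w-row k _ with k ≡ᵇ n | k ≡ᵇ 1
    ... | true | _ = refl
    ... | false | true = refl
    ... | false | false = sym (ℤP.*-identityˡ (v k))

  w₀-signed : Signed n w₀
  w₀-signed = scaled-signed {n} {v} {sgnRow} v-sp sgnRow-sign w-row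

  private
    v≥1 : ∀ k → InRange n k → 1 ≤ ∣ v k ∣
    v≥1 k r = proj₁ (proj₁ v-sp k r)

    -- The sign condition in `InVert` is phrased with λ. Rewritten with μ it says that the signs of
    -- v multiply to the product of the signs that d_D attaches to the rows 1 and n.
    σ-prod : prodTo n (λ i → sgn (v i)) ≡ σ₁ *ℤ σₙ
    σ-prod = trans v-prod (go case-of)
      where
      L = λ' (n ∸ 1) +ℤ λ' n
      go : Case → ε *ℤ negOnePow L ≡ σ₁ *ℤ σₙ
      go (caseI a _ c _) = cong₂ _*ℤ_ (sym a) (negOnePow-cong L (+ 1 +ℤ μ q +ℤ μ n) (mod₂ (+ m +ℤ + 1)
        (lia (λ' q ∷ λ' n ∷ P q ∷ μ q ∷ μ n ∷ + m ∷ []) (λ l l' a x y m → l :≡ a ⟹ x :≡ a :- (K 2 :+ m :- K 1) ⟹ y :≡ l' :- (K 2 :+ m) ⟹ l :+ l' :≡ K 1 :+ x :+ y :+ K 2 :* (m :+ K 1))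
          (λ-mid q (proj₁ mid-q) (proj₂ mid-q)) (μ-mid q (proj₁ mid-q) (proj₂ mid-q)) c)))
      go (caseII a _ c _) = trans (cong (ε *ℤ_) flip) (trans (lia (ε ∷ σₙ ∷ []) λ e s → e :* :- s :≡ :- e :* s) (cong (_*ℤ σₙ) (sym a)))
        where
        flip : negOnePow L ≡ - σₙ
        flip with parity L
        ... | inj₁ e = trans (negOnePow-even L e) (sym (cong -_ (negOnePow-odd (+ 1 +ℤ μ q +ℤ μ n) (≡₂-trans (mod₂ (+ 1 - λ' n)
            (lia (λ' q ∷ λ' n ∷ P q ∷ μ q ∷ μ n ∷ + m ∷ []) (λ l l' a x y m → l :≡ a ⟹ x :≡ a :- (K 2 :+ m :- K 1) ⟹ y :≡ K 3 :+ m :- l' ⟹ K 1 :+ x :+ y :≡ (l :+ l' :+ K 1) :+ K 2 :* (K 1 :- l'))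
              (λ-mid q (proj₁ mid-q) (proj₂ mid-q)) (μ-mid q (proj₁ mid-q) (proj₂ mid-q)) c)) (≡₂-+ e (≡⇒≡₂ {+ 1} refl))))))
        ... | inj₂ o = trans (negOnePow-odd L o) (sym (cong -_ (negOnePow-even (+ 1 +ℤ μ q +ℤ μ n) (≡₂-trans (mod₂ (+ 1 - λ' n)
            (lia (λ' q ∷ λ' n ∷ P q ∷ μ q ∷ μ n ∷ + m ∷ []) (λ l l' a x y m → l :≡ a ⟹ x :≡ a :- (K 2 :+ m :- K 1) ⟹ y :≡ K 3 :+ m :- l' ⟹ K 1 :+ x :+ y :≡ (l :+ l' :+ K 1) :+ K 2 :* (K 1 :- l'))
              (λ-mid q (proj₁ mid-q) (proj₂ mid-q)) (μ-mid q (proj₁ mid-q) (proj₂ mid-q)) c)) (≡₂-trans (≡₂-+ o (≡⇒≡₂ {+ 1} refl)) (mod₂ (+ 1) refl))))))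

  w₀-D : DPerm n w₀
  w₀-D = dperm w₀-signed (≡₂-trans step (negs-sign (prodTo n (λ i → sgn (v i))) (negs n v) σ₁-sign σₙ-sign (prod-negs n v v≥1) σ-prod))
    where
    f g : ℕ → ℤ
    f k = if k ≡ᵇ 1 then nb σ₁ else + 0
    g k = if k ≡ᵇ n then nb σₙ else + 0
    f≡ : sumTo n f ≡ nb σ₁
    f≡ = sumTo-single n 1 (s≤s z≤n , s≤s z≤n) λ k r ne → trans (cong (λ b → if b then nb σ₁ else + 0) (eqᵇ-false ne)) refl
    g≡ : sumTo n g ≡ nb σₙ
    g≡ = trans (sumTo-single n n (s≤s z≤n , ℕP.≤-refl) λ k r ne → trans (cong (λ b → if b then nb σₙ else + 0) (eqᵇ-false ne)) refl) ifnn
    nb-row : ∀ k → nb (sgnRow k) ≡ f k +ℤ g k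
    nb-row k = nb-if (k ≡ᵇ n) (k ≡ᵇ 1) σₙ σ₁ λ a b →
      1≢n (trans (sym (ℕP.≡ᵇ⇒≡ k 1 (subst T (sym b) tt))) (ℕP.≡ᵇ⇒≡ k n (subst T (sym a) tt)))
    pointwise : ∀ k → InRange n k → nb (w₀ k) ≡₂ nb (v k) +ℤ (f k +ℤ g k)
    pointwise k r = ≡₂-trans (≡⇒≡₂ (cong nb (trans (w-row k r) (cong (_*ℤ v k) (sym (sign-sgn (sgnRow-sign k)))))))
      (≡₂-trans (nb-* (sgnRow k) (v k) (sign-≥1 (sgnRow-sign k)) (v≥1 k r))
        (≡⇒≡₂ (trans (ℤP.+-comm (nb (sgnRow k)) (nb (v k))) (cong (nb (v k) +ℤ_) (nb-row k)))))
    step : negs n w₀ ≡₂ negs n v +ℤ (nb σ₁ +ℤ nb σₙ)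
    step = ≡₂-trans (sumTo-≡₂ n pointwise) (≡⇒≡₂ (trans (sumTo-+ n (λ k → nb (v k)) (λ k → f k +ℤ g k))
      (cong (negs n v +ℤ_) (trans (sumTo-+ n f g) (cong₂ _+ℤ_ f≡ g≡)))))

  private
    sum-s : + s ≡ sumTo (1 + m) P
    sum-s = trans (sum-upTo (1 + m) (λ i → eastBefore p (suc i))) (sumTo-cong (1 + m) λ { (suc k) _ → refl })

    sign-≡₂ : ∀ {t} x → IsSign t → t *ℤ x ≡₂ x
    sign-≡₂ x (inj₁ refl) = ≡⇒≡₂ (ℤP.*-identityˡ x)
    sign-≡₂ x (inj₂ refl) = ≡₂-trans (≡⇒≡₂ (ℤP.-1*i≡-i x)) (≡₂-neg x)

    low : ∀ {k} → InRange (1 + m) k → InRange n k × k ℕ.< n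
    low (a , b) = (a , ℕP.m≤n⇒m≤1+n (ℕP.m≤n⇒m≤1+n b)) , s≤s (ℕP.m≤n⇒m≤1+n b)

    μ-low : ∀ k → InRange (1 + m) k → μ k ≡₂ P k +ℤ rhoV k
    μ-low (suc zero) r = ≡₂-trans (≡⇒≡₂ μ₁≡) (≡₂-trans (sign-≡₂ (P 1) σ₁-sign) (≡⇒≡₂ (sym (ℤP.+-identityʳ (P 1)))))
    μ-low (suc (suc k)) r = ≡₂-trans (≡⇒≡₂ (μ-mid (suc (suc k)) (s≤s (s≤s z≤n)) (proj₂ (low r))))
      (mod₂ (- + suc k) (lia (P (suc (suc k)) ∷ + k ∷ []) λ a k → a :- (K 2 :+ k :- K 1) :≡ a :+ (K 1 :+ k) :+ K 2 :* (:- (K 1 :+ k))))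

    λ-low : ∀ k → InRange (1 + m) k → λ' k ≡₂ P k
    λ-low (suc zero) r = sign-≡₂ (P 1) (eps-sign p)
    λ-low (suc (suc k)) r = ≡⇒≡₂ (λ-mid (suc (suc k)) (s≤s (s≤s z≤n)) (proj₂ (low r)))

  -- By the choice of λₙ: modulo 2 it is πₙ₋₁ if π₁ + ... + πₙ₋₂ is even, and πₙ₋₁ + 1 otherwise.
  λ-even : sumTo n λ' ≡₂ + 0
  λ-even = ≡₂-trans (≡₂-+ (≡₂-+ (≡₂-trans (sumTo-≡₂ (1 + m) λ-low) (≡⇒≡₂ (sym sum-s))) (≡⇒≡₂ (λ-mid q (proj₁ mid-q) (proj₂ mid-q)))) (≡⇒≡₂ refl)) (go lastλ)
    where
    go : Last → + s +ℤ P q +ℤ λ' n ≡₂ + 0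
    go (evenₛ (mod₂ z e) d) = mod₂ (z +ℤ P n) (lia (+ s ∷ P q ∷ P n ∷ λ' n ∷ z ∷ []) (λ s b a l z → s :≡ K 0 :+ K 2 :* z ⟹ l :≡ K 2 :* a :- b ⟹ s :+ b :+ l :≡ K 0 :+ K 2 :* (z :+ a)) e d)
    go (oddₛ (mod₂ z e) d) = mod₂ (z +ℤ + n - P n +ℤ P q) (lia (+ s ∷ P q ∷ P n ∷ λ' n ∷ z ∷ + m ∷ []) (λ s b a l z m → s :≡ K 1 :+ K 2 :* z ⟹ l :≡ K 2 :* (K 3 :+ m) :- K 1 :- K 2 :* a :+ b ⟹ s :+ b :+ l :≡ K 0 :+ K 2 :* (z :+ (K 3 :+ m) :- a :+ b)) e d)

  -- Modulo 2, μ is λ + ρ̌, except that the second case changes row n by 1; this is the case in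
  -- which ρ̌ has an odd coordinate sum.
  μ-even : sumTo n μ ≡₂ + 0
  μ-even = ≡₂-trans (≡₂-+ (≡₂-+ (≡₂-trans (sumTo-≡₂ (1 + m) μ-low) (≡⇒≡₂ (trans (sumTo-+ (1 + m) P rhoV) (cong (_+ℤ R) (sym sum-s))))) (≡⇒≡₂ (μ-mid q (proj₁ mid-q) (proj₂ mid-q)))) (≡⇒≡₂ refl)) (go case-of lastλ)
    where
    R = sumTo (1 + m) rhoV
    vs : ℤ → ℤ → List ℤ
    vs x y = + s ∷ R ∷ P q ∷ P n ∷ μ n ∷ λ' n ∷ + m ∷ x ∷ y ∷ []
    go : Case → Last → + s +ℤ R +ℤ (P q - (+ q - + 1)) +ℤ μ n ≡₂ + 0
    go (caseI _ _ c (mod₂ y t)) (evenₛ (mod₂ x e) d) = mod₂ (x +ℤ y +ℤ P n - + (2 + m) - + (1 + m)) (lia (vs x y)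
      (λ s R b a u l m x y → s :≡ K 0 :+ K 2 :* x ⟹ R :+ (K 1 :+ m) :+ (K 2 :+ m) :≡ K 0 :+ K 2 :* y ⟹ u :≡ l :- (K 2 :+ m) ⟹ l :≡ K 2 :* a :- b ⟹ s :+ R :+ (b :- (K 2 :+ m :- K 1)) :+ u :≡ K 0 :+ K 2 :* (x :+ y :+ a :- (K 2 :+ m) :- (K 1 :+ m))) e t c d)
    go (caseI _ _ c (mod₂ y t)) (oddₛ (mod₂ x e) d) = mod₂ (x +ℤ y - P n +ℤ P q - + m) (lia (vs x y)
      (λ s R b a u l m x y → s :≡ K 1 :+ K 2 :* x ⟹ R :+ (K 1 :+ m) :+ (K 2 :+ m) :≡ K 0 :+ K 2 :* y ⟹ u :≡ l :- (K 2 :+ m) ⟹ l :≡ K 2 :* (K 3 :+ m) :- K 1 :- K 2 :* a :+ b ⟹ s :+ R :+ (b :- (K 2 :+ m :- K 1)) :+ u :≡ K 0 :+ K 2 :* (x :+ y :- a :+ b :- m)) e t c d)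
    go (caseII _ _ c (mod₂ y t)) (evenₛ (mod₂ x e) d) = mod₂ (x +ℤ y - P n +ℤ P q - + m) (lia (vs x y)
      (λ s R b a u l m x y → s :≡ K 0 :+ K 2 :* x ⟹ R :+ (K 1 :+ m) :+ (K 2 :+ m) :≡ K 1 :+ K 2 :* y ⟹ u :≡ K 3 :+ m :- l ⟹ l :≡ K 2 :* a :- b ⟹ s :+ R :+ (b :- (K 2 :+ m :- K 1)) :+ u :≡ K 0 :+ K 2 :* (x :+ y :- a :+ b :- m)) e t c d)
    go (caseII _ _ c (mod₂ y t)) (oddₛ (mod₂ x e) d) = mod₂ (x +ℤ y +ℤ P n - + m - + m - + 2) (lia (vs x y)
      (λ s R b a u l m x y → s :≡ K 1 :+ K 2 :* x ⟹ R :+ (K 1 :+ m) :+ (K 2 :+ m) :≡ K 1 :+ K 2 :* y ⟹ u :≡ K 3 :+ m :- l ⟹ l :≡ K 2 :* (K 3 :+ m) :- K 1 :- K 2 :* a :+ b ⟹ s :+ R :+ (b :- (K 2 :+ m :- K 1)) :+ u :≡ K 0 :+ K 2 :* (x :+ y :+ a :- m :- m :- K 2)) e t c d)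

  private
    -- The walls at row 1, for either sign t of row 1: used with t and with −t.
    first-row : ∀ {t} → IsSign t → P 1 ≤ℤ P 2 →
      t *ℤ P 1 - P 2 ≤ℤ + 0 × (t *ℤ P 1 ≡ P 2 → t *ℤ v 1 <ℤ v 2)
    first-row (inj₁ refl) le = lia (P 1 ∷ P 2 ∷ []) (λ a b → a :≤ b ⟹ K 1 :* a :- b :≤ K 0) le ,
      λ e → subst (_<ℤ v 2) (sym (ℤP.*-identityˡ (v 1))) (rise 1 ℕP.≤-refl (s≤s (s≤s z≤n)) (trans (sym (ℤP.*-identityˡ (P 1))) e))
    first-row (inj₂ refl) le = lia (P 1 ∷ P 2 ∷ - + 1 *ℤ P 1 ∷ []) (λ a b c → c :≡ :- a ⟹ a :≤ b ⟹ K 0 :≤ a ⟹ c :- b :≤ K 0) (ℤP.-1*i≡-i (P 1)) le (P≥0 1) ,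
      λ e → ℤP.≤-<-trans (subst (_≤ℤ + ∣ v 1 ∣) (sym (ℤP.-1*i≡-i (v 1))) (neg≤ (v 1)))
        (start (zero₁ e) (zero₂ e))
      where
      neg≤ : ∀ x → - x ≤ℤ + ∣ x ∣
      neg≤ (+ zero) = ℤP.≤-refl
      neg≤ (+ suc _) = -≤+
      neg≤ -[1+ _ ] = ℤP.≤-refl
      zero₁ : - + 1 *ℤ P 1 ≡ P 2 → P 1 ≡ + 0
      zero₁ e = lia (P 1 ∷ P 2 ∷ - + 1 *ℤ P 1 ∷ []) (λ a b c → c :≡ :- a ⟹ c :≡ b ⟹ a :≤ b ⟹ K 0 :≤ a ⟹ a :≡ K 0) (ℤP.-1*i≡-i (P 1)) e le (P≥0 1)
      zero₂ : - + 1 *ℤ P 1 ≡ P 2 → P 2 ≡ + 0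
      zero₂ e = lia (P 1 ∷ P 2 ∷ - + 1 *ℤ P 1 ∷ []) (λ a b c → c :≡ :- a ⟹ c :≡ b ⟹ a :≤ b ⟹ K 0 :≤ a ⟹ b :≡ K 0) (ℤP.-1*i≡-i (P 1)) e le (P≥0 1)

    neg-sign : ∀ {t} → IsSign t → IsSign (- t)
    neg-sign (inj₁ refl) = inj₂ refl
    neg-sign (inj₂ refl) = inj₁ refl

    P12 = P-mono 1 ℕP.≤-refl
    mid2 : 1 ℕ.< 2 × 2 ℕ.< n
    mid2 = ℕP.≤-refl , s≤s (s≤s (s≤s z≤n))
    μ₂≡ : μ 2 ≡ P 2 - + 1
    μ₂≡ = μ-mid 2 (proj₁ mid2) (proj₂ mid2)
    μq≡ = μ-mid q (proj₁ mid-q) (proj₂ mid-q)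
    Pqn : P q ≤ℤ P n
    Pqn = P-mono q (s≤s z≤n)

    τ : ℕ → ℤ
    τ i = - μ i

    -- In the middle rows τ (i + 1) - τ i is 1 minus the number of East steps between the North
    -- steps i and i + 1. So level 1 occurs exactly at the rises, where the labels increase.
    up-all : ∀ i → 1 ≤ i → i ℕ.< n → τ (suc i) - τ i ≤ℤ + 1 × (τ (suc i) - τ i ≡ + 1 → w₀ i <ℤ w₀ (suc i))
    up-all i i≥1 i<n = go (row n i (i≥1 , ℕP.<⇒≤ i<n)) (row n (suc i) (s≤s z≤n , i<n))
      where
      go : RowOf n i → RowOf n (suc i) → τ (suc i) - τ i ≤ℤ + 1 × (τ (suc i) - τ i ≡ + 1 → w₀ i <ℤ w₀ (suc i))
      go last _ = ⊥-elim (ℕP.<-irrefl refl i<n)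
      go first _ =
          lia (μ 1 ∷ μ 2 ∷ σ₁ *ℤ P 1 ∷ P 2 ∷ []) (λ x y a b → x :≡ a ⟹ y :≡ b :- K 1 ⟹ a :- b :≤ K 0 ⟹ :- y :- :- x :≤ K 1) μ₁≡ μ₂≡ (proj₁ fr)
        , λ e → subst (w₀ 1 <ℤ_) (sym (w-mid 2 (proj₁ mid2) (proj₂ mid2))) (proj₂ fr
            (lia (μ 1 ∷ μ 2 ∷ σ₁ *ℤ P 1 ∷ P 2 ∷ []) (λ x y a b → x :≡ a ⟹ y :≡ b :- K 1 ⟹ :- y :- :- x :≡ K 1 ⟹ a :≡ b) μ₁≡ μ₂≡ e))
        where fr = first-row σ₁-sign P12
      go (middle r t) (middle r' t') =
          lia (μ i ∷ μ (suc i) ∷ P i ∷ P (suc i) ∷ + i ∷ []) (λ x y a b i → x :≡ a :- (i :- K 1) ⟹ y :≡ b :- (K 1 :+ i :- K 1) ⟹ a :≤ b ⟹ :- y :- :- x :≤ K 1) (μ-mid i r t) (μ-mid (suc i) r' t') (P-mono i i≥1)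
        , λ e → subst₂ _<ℤ_ (sym (w-mid i r t)) (sym (w-mid (suc i) r' t')) (rise i i≥1 i<n
            (lia (μ i ∷ μ (suc i) ∷ P i ∷ P (suc i) ∷ + i ∷ []) (λ x y a b i → x :≡ a :- (i :- K 1) ⟹ y :≡ b :- (K 1 :+ i :- K 1) ⟹ :- y :- :- x :≡ K 1 ⟹ a :≡ b) (μ-mid i r t) (μ-mid (suc i) r' t') e))
      go (middle r t) last = lst lastRow
        where
        lst : LastRow → τ n - τ q ≤ℤ + 1 × (τ n - τ q ≡ + 1 → w₀ q <ℤ w₀ n)
        lst (typeX s e) =
            lia (μ q ∷ μ n ∷ P q ∷ P n ∷ + m ∷ []) (λ x y a b m → x :≡ a :- (K 2 :+ m :- K 1) ⟹ y :≡ K 2 :* b :- a :- (K 3 :+ m :- K 1) ⟹ a :≤ b ⟹ :- y :- :- x :≤ K 1) μq≡ e Pqn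
          , λ eq → subst₂ _<ℤ_ (sym (w-mid q (proj₁ mid-q) (proj₂ mid-q))) (sym (trans w-last (trans (cong (_*ℤ v n) s) (ℤP.*-identityˡ (v n))))) (rise q (s≤s z≤n) ℕP.≤-refl
              (lia (μ q ∷ μ n ∷ P q ∷ P n ∷ + m ∷ []) (λ x y a b m → x :≡ a :- (K 2 :+ m :- K 1) ⟹ y :≡ K 2 :* b :- a :- (K 3 :+ m :- K 1) ⟹ :- y :- :- x :≡ K 1 ⟹ a :≡ b) μq≡ e eq))
        -- Here τ n - τ (n - 1) = 2 (πₙ - n + 1) ≤ 0. The last rise shows at the affine wall
        -- instead, in `hi-all`.
        lst (typeY s e) =
            lia (μ q ∷ μ n ∷ P q ∷ P n ∷ + m ∷ []) (λ x y a b m → x :≡ a :- (K 2 :+ m :- K 1) ⟹ y :≡ K 3 :+ m :- K 2 :* b :+ a ⟹ b :≤ K 3 :+ m :- K 1 ⟹ :- y :- :- x :≤ K 1) μq≡ e P-bound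
          , λ eq → ⊥-elim (lia (μ q ∷ μ n ∷ P q ∷ P n ∷ + m ∷ []) (λ x y a b m → x :≡ a :- (K 2 :+ m :- K 1) ⟹ y :≡ K 3 :+ m :- K 2 :* b :+ a ⟹ b :≤ K 3 :+ m :- K 1 ⟹ :- y :- :- x :≡ K 1 ⟹ :⊥) μq≡ e P-bound eq)

    lo-all : τ 1 +ℤ τ 2 ≤ℤ + 1 × (τ 1 +ℤ τ 2 ≡ + 1 → - w₀ 1 <ℤ w₀ 2)
    lo-all =
        lia (μ 1 ∷ μ 2 ∷ σ₁ ∷ P 1 ∷ P 2 ∷ []) (λ x y s a b → x :≡ s :* a ⟹ y :≡ b :- K 1 ⟹ :- s :* a :- b :≤ K 0 ⟹ :- x :+ :- y :≤ K 1) μ₁≡ μ₂≡ (proj₁ fr)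
      , λ e → subst₂ _<ℤ_ (sym (ℤP.neg-distribˡ-* σ₁ (v 1))) (sym (w-mid 2 (proj₁ mid2) (proj₂ mid2))) (proj₂ fr
          (lia (μ 1 ∷ μ 2 ∷ σ₁ ∷ P 1 ∷ P 2 ∷ []) (λ x y s a b → x :≡ s :* a ⟹ y :≡ b :- K 1 ⟹ :- x :+ :- y :≡ K 1 ⟹ :- s :* a :≡ b) μ₁≡ μ₂≡ e))
      where fr = first-row (neg-sign σ₁-sign) P12

    -- The two types exchange their roles. In type Y the sum is 2 (πₙ - πₙ₋₁) - 2, which is -2
    -- exactly at a rise; in type X it is at least -1 because πₙ ≤ n - 1.
    hi-all : - + 2 ≤ℤ τ q +ℤ τ n × (τ q +ℤ τ n ≡ - + 2 → w₀ q <ℤ - w₀ n)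
    hi-all = lst lastRow
      where
      lst : LastRow → - + 2 ≤ℤ τ q +ℤ τ n × (τ q +ℤ τ n ≡ - + 2 → w₀ q <ℤ - w₀ n)
      lst (typeX s e) =
          lia (μ q ∷ μ n ∷ P q ∷ P n ∷ + m ∷ []) (λ x y a b m → x :≡ a :- (K 2 :+ m :- K 1) ⟹ y :≡ K 2 :* b :- a :- (K 3 :+ m :- K 1) ⟹ b :≤ K 3 :+ m :- K 1 ⟹ :- K 2 :≤ :- x :+ :- y) μq≡ e P-bound
        , λ eq → ⊥-elim (lia (μ q ∷ μ n ∷ P q ∷ P n ∷ + m ∷ []) (λ x y a b m → x :≡ a :- (K 2 :+ m :- K 1) ⟹ y :≡ K 2 :* b :- a :- (K 3 :+ m :- K 1) ⟹ b :≤ K 3 :+ m :- K 1 ⟹ :- x :+ :- y :≡ :- K 2 ⟹ :⊥) μq≡ e P-bound eq)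
      lst (typeY s e) =
          lia (μ q ∷ μ n ∷ P q ∷ P n ∷ + m ∷ []) (λ x y a b m → x :≡ a :- (K 2 :+ m :- K 1) ⟹ y :≡ K 3 :+ m :- K 2 :* b :+ a ⟹ a :≤ b ⟹ :- K 2 :≤ :- x :+ :- y) μq≡ e Pqn
        , λ eq → subst₂ _<ℤ_ (sym (w-mid q (proj₁ mid-q) (proj₂ mid-q))) (sym (trans (cong -_ (trans w-last (trans (cong (_*ℤ v n) s) (ℤP.-1*i≡-i (v n))))) (ℤP.neg-involutive (v n))))
            (rise q (s≤s z≤n) ℕP.≤-refl
              (lia (μ q ∷ μ n ∷ P q ∷ P n ∷ + m ∷ []) (λ x y a b m → x :≡ a :- (K 2 :+ m :- K 1) ⟹ y :≡ K 3 :+ m :- K 2 :* b :+ a ⟹ :- x :+ :- y :≡ :- K 2 ⟹ a :≡ b) μq≡ e eq))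

  b₀ : Aff
  b₀ = aff w₀ (act n w₀ τ)

  b₀-aff : IsAff n b₀
  b₀-aff = fromDPerm w₀-D , even⇒∣ (sumTo n (act n w₀ τ)) (≡₂-trans (act-sum w₀-signed τ)
    (≡₂-trans (≡⇒≡₂ (sumTo-neg n μ)) (≡₂-trans (≡₂-neg (sumTo n μ)) μ-even)))

  b₀-τ : ∀ i → InRange n i → - μ i ≡ frameτ n≥3 b₀ i
  b₀-τ i r = sym (act-val w₀-signed τ i r)

  b₀-sommers : Sommers n w₀ (frameτ n≥3 b₀)
  b₀-sommers = Sommers-cong n≥3 b₀-τ (record
    { up≤ = λ i p q → proj₁ (up-all i p q)
    ; up= = λ i p q → proj₂ (up-all i p q)
    ; lo≤ = proj₁ lo-all
    ; lo= = proj₂ lo-all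
    ; hi≤ = proj₁ hi-all
    ; hi= = proj₂ hi-all
    })

  private
    u : SP
    u = uOf n p v
    sgnU : ℕ → ℤ
    sgnU k = if k ≡ᵇ 1 then ε else (if k ≡ᵇ n then negOnePow (λ' (n ∸ 1) +ℤ λ' n) else + 1)
    sgnU-sign : ∀ k → IsSign (sgnU k)
    sgnU-sign k with k ≡ᵇ 1 | k ≡ᵇ n
    ... | true | _ = eps-sign p
    ... | false | true = negOnePow-sign (λ' (n ∸ 1) +ℤ λ' n)
    ... | false | false = inj₁ refl
    u-row : ∀ k → InRange n k → u k ≡ sgnU k *ℤ v k
    u-row k _ with k ≡ᵇ 1 in e₁ | k ≡ᵇ n in e₂
    ... | true | _ = cong (λ i → ε *ℤ v i) (sym (ℕP.≡ᵇ⇒≡ k 1 (subst T (sym e₁) tt)))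
    ... | false | true = cong (λ i → negOnePow (λ' (n ∸ 1) +ℤ λ' n) *ℤ v i) (sym (ℕP.≡ᵇ⇒≡ k n (subst T (sym e₂) tt)))
    ... | false | false = sym (ℤP.*-identityˡ (v k))
    u-signed : Signed n u
    u-signed = scaled-signed {n} {v} {sgnU} v-sp sgnU-sign u-row

    ψ : ZV
    ψ = psi n p v

    -- u and w₀ differ by a sign in rows 1 and n, and only in the second case.
    u-first : (σ₁ ≡ ε → w₀ 1 ≡ u 1) × (σ₁ ≡ - ε → w₀ 1 ≡ - u 1)
    u-first = (λ e → cong (_*ℤ v 1) e) , λ e → trans (cong (_*ℤ v 1) e) (sym (ℤP.neg-distribˡ-* ε (v 1)))
    u-mid : ∀ k → 1 ℕ.< k → k ℕ.< n → w₀ k ≡ u k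
    u-mid k r t = trans (w-mid k r t) (sym (trans (if1 k r) (ifn k t)))
    ψ-u : ∀ k → InRange n k → val ψ (u k) ≡ λ' k
    ψ-u k r = act-val u-signed λ' k r

    u-last : u n ≡ negOnePow (λ' q +ℤ λ' n) *ℤ v n
    u-last = ifnn

    last-I : ε *ℤ negOnePow (λ' q +ℤ λ' n) ≡ σ₁ *ℤ σₙ → σ₁ ≡ ε → w₀ n ≡ u n
    last-I eq e = trans w-last (trans (cong (_*ℤ v n) (sym (cancel (eps-sign p) (trans eq (cong (_*ℤ σₙ) e))))) (sym u-last))
      where
      cancel : ∀ {t x y} → IsSign t → t *ℤ x ≡ t *ℤ y → x ≡ y
      cancel {x = x} {y} (inj₁ refl) e = trans (sym (ℤP.*-identityˡ x)) (trans e (ℤP.*-identityˡ y))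
      cancel {x = x} {y} (inj₂ refl) e = ℤP.neg-injective (trans (sym (ℤP.-1*i≡-i x)) (trans e (ℤP.-1*i≡-i y)))
    last-II : ε *ℤ negOnePow (λ' q +ℤ λ' n) ≡ σ₁ *ℤ σₙ → σ₁ ≡ - ε → w₀ n ≡ - u n
    last-II eq e = trans w-last (trans (cong (_*ℤ v n) (cancel (eps-sign p) (trans eq (cong (_*ℤ σₙ) e))))
      (trans (sym (ℤP.neg-distribˡ-* (negOnePow (λ' q +ℤ λ' n)) (v n))) (cong -_ (sym u-last))))
      where
      cancel : ∀ {t x y} → IsSign t → t *ℤ x ≡ - t *ℤ y → y ≡ - x
      cancel {x = x} {y} (inj₁ refl) e = trans (sym (ℤP.neg-involutive y)) (cong -_ (trans (sym (ℤP.-1*i≡-i y)) (trans (sym e) (ℤP.*-identityˡ x))))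
      cancel {x = x} {y} (inj₂ refl) e = trans (sym (ℤP.*-identityˡ y)) (trans (sym e) (ℤP.-1*i≡-i x))

    pr-eq : ε *ℤ negOnePow (λ' q +ℤ λ' n) ≡ σ₁ *ℤ σₙ
    pr-eq = trans (sym v-prod) σ-prod

    ψ-first : val ψ (w₀ 1) ≡ μ 1
    ψ-first = go case-of
      where
      r1 : InRange n 1
      r1 = s≤s z≤n , s≤s z≤n
      go : Case → val ψ (w₀ 1) ≡ μ 1
      go (caseI a b _ _) = trans (cong (val ψ) (proj₁ u-first a)) (trans (ψ-u 1 r1) (sym b))
      go (caseII a b _ _) = trans (cong (val ψ) (proj₂ u-first a)) (trans (val-neg ψ (u 1)) (trans (cong -_ (ψ-u 1 r1)) (sym b)))

    ψ-mid : ∀ k → 1 ℕ.< k → k ℕ.< n → val ψ (w₀ k) ≡ μ k +ℤ (+ k - + 1)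
    ψ-mid k r t = trans (cong (val ψ) (u-mid k r t)) (trans (ψ-u k (ℕP.<⇒≤ r , ℕP.<⇒≤ t)) (lia (λ' k ∷ μ k ∷ P k ∷ + k ∷ []) (λ l x a k → l :≡ a ⟹ x :≡ a :- (k :- K 1) ⟹ l :≡ x :+ (k :- K 1)) (λ-mid k r t) (μ-mid k r t)))

    -- The two possible values differ by 2n - 1 = h + 1, so both cases give the same class.
    ψ-last : (val ψ (w₀ n) ≡ μ n +ℤ (+ n - + 1)) ⊎ (val ψ (w₀ n) ≡ μ n - + n)
    ψ-last = go case-of
      where
      rn : InRange n n
      rn = s≤s z≤n , ℕP.≤-refl
      go : Case → (val ψ (w₀ n) ≡ μ n +ℤ (+ n - + 1)) ⊎ (val ψ (w₀ n) ≡ μ n - + n)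
      go (caseI a _ c _) = inj₁ (trans (cong (val ψ) (last-I pr-eq a)) (trans (ψ-u n rn) (lia (λ' n ∷ μ n ∷ + m ∷ []) (λ l x m → x :≡ l :- (K 2 :+ m) ⟹ l :≡ x :+ (K 3 :+ m :- K 1)) c)))
      go (caseII a _ c _) = inj₂ (trans (cong (val ψ) (last-II pr-eq a)) (trans (val-neg ψ (u n)) (trans (cong -_ (ψ-u n rn)) (lia (λ' n ∷ μ n ∷ + n ∷ []) (λ l x n → x :≡ n :- l ⟹ :- l :≡ x :- n) c))))

  pt-row : ∀ i → InRange n i → val (pt n b₀) (w₀ i) ≡ + i - + 1 - h *ℤ μ i
  pt-row i r = lia (val (pt n b₀) (w₀ i) ∷ rhoV i ∷ + i ∷ h ∷ frameτ n≥3 b₀ i ∷ μ i ∷ [])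
    (λ x ρ i h t u → x :≡ ρ :+ h :* t ⟹ ρ :≡ i :- K 1 ⟹ h :* :- u :≡ h :* t ⟹ x :≡ i :- K 1 :- h :* u)
    (pt-frame {n} {b₀} w₀-signed i r) (pos∸1 (proj₁ r)) (cong (h *ℤ_) (b₀-τ i r))

  private
    -- From i - 1 - h μᵢ = (i - 1 + μᵢ) - (h + 1) μᵢ.
    ζ-exists : ∀ i → InRange n i → ∃[ z ] (val (pt n b₀) (w₀ i) ≡ val ψ (w₀ i) +ℤ (h +ℤ + 1) *ℤ z)
    ζ-exists i r = go (row n i r)
      where
      go : ∀ {i} → RowOf n i → ∃[ z ] (val (pt n b₀) (w₀ i) ≡ val ψ (w₀ i) +ℤ (h +ℤ + 1) *ℤ z)
      go first = - μ 1 , lia (val (pt n b₀) (w₀ 1) ∷ val ψ (w₀ 1) ∷ h ∷ μ 1 ∷ []) (λ x y h u → x :≡ K 1 :- K 1 :- h :* u ⟹ y :≡ u ⟹ x :≡ y :+ (h :+ K 1) :* :- u) (pt-row 1 (s≤s z≤n , s≤s z≤n)) ψ-first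
      go {i} (middle r t) = - μ i , lia (val (pt n b₀) (w₀ i) ∷ val ψ (w₀ i) ∷ h ∷ μ i ∷ + i ∷ []) (λ x y h u i → x :≡ i :- K 1 :- h :* u ⟹ y :≡ u :+ (i :- K 1) ⟹ x :≡ y :+ (h :+ K 1) :* :- u) (pt-row i (ℕP.<⇒≤ r , ℕP.<⇒≤ t)) (ψ-mid i r t)
      go last = lst ψ-last
        where
        rn : InRange n n
        rn = s≤s z≤n , ℕP.≤-refl
        lst : (val ψ (w₀ n) ≡ μ n +ℤ (+ n - + 1)) ⊎ (val ψ (w₀ n) ≡ μ n - + n) → ∃[ z ] (val (pt n b₀) (w₀ n) ≡ val ψ (w₀ n) +ℤ (h +ℤ + 1) *ℤ z)
        lst (inj₁ e) = - μ n , lia (val (pt n b₀) (w₀ n) ∷ val ψ (w₀ n) ∷ h ∷ μ n ∷ + n ∷ []) (λ x y h u i → x :≡ i :- K 1 :- h :* u ⟹ y :≡ u :+ (i :- K 1) ⟹ x :≡ y :+ (h :+ K 1) :* :- u) (pt-row n rn) e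
        lst (inj₂ e) = + 1 - μ n , lia (val (pt n b₀) (w₀ n) ∷ val ψ (w₀ n) ∷ h ∷ μ n ∷ + n ∷ []) (λ x y h u i → x :≡ i :- K 1 :- h :* u ⟹ y :≡ u :- i ⟹ h :≡ K 2 :* i :- K 2 ⟹ x :≡ y :+ (h :+ K 1) :* (K 1 :- u)) (pt-row n rn) e h≡

    ζ : ZV
    ζ i with InRange? n i
    ... | yes r = proj₁ (ζ-exists i r)
    ... | no _ = + 0

    ζ-eq : ∀ i → InRange n i → val (pt n b₀) (w₀ i) ≡ val ψ (w₀ i) +ℤ (h +ℤ + 1) *ℤ ζ i
    ζ-eq i r with InRange? n i
    ... | yes r' = proj₂ (ζ-exists i r')
    ... | no ¬r = ⊥-elim (¬r r)

  pt≡psi : Σ ZV λ z → ∀ k → InRange n k → pt n b₀ k ≡ psi n p v k +ℤ (h +ℤ + 1) *ℤ z k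
  pt≡psi = act n w₀ ζ , λ k r → frame-ext w₀-signed {pt n b₀} {ψ ⊕ ((h +ℤ + 1) ·v act n w₀ ζ)} (λ i ri → trans (ζ-eq i ri) (sym (trans
    (val-+ᵥ ψ ((h +ℤ + 1) ·v act n w₀ ζ) (w₀ i)) (cong (val ψ (w₀ i) +ℤ_) (trans (val-*ᵥ (h +ℤ + 1) (act n w₀ ζ) (w₀ i)) (cong ((h +ℤ + 1) *ℤ_) (act-val w₀-signed ζ i ri))))))) k (proj₁ r) (proj₂ r)

  psi-even : sumTo n (psi n p v) ≡₂ + 0
  psi-even = ≡₂-trans (act-sum u-signed λ') λ-even

-- Lists sorted by a key.

module _ {A : Set} {R : A → A → Set} where

  pairs-++ : ∀ {xs ys} → AllPairs R xs → AllPairs R ys → (∀ {x y} → x ∈ xs → y ∈ ys → R x y) → AllPairs R (xs ++ ys)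
  pairs-++ p q r = AllPairsP.++⁺ p q (All.tabulate λ x∈ → All.tabulate λ y∈ → r x∈ y∈)

  pairs-split : ∀ xs {ys} → AllPairs R (xs ++ ys) → ∀ {x y} → x ∈ xs → y ∈ ys → R x y
  pairs-split (x ∷ xs) (p ∷ ps) (here refl) y∈ = All.lookup p (∈-++⁺ʳ xs y∈)
  pairs-split (x ∷ xs) (p ∷ ps) (there x∈) y∈ = pairs-split xs ps x∈ y∈

  pairs-left : ∀ xs {ys} → AllPairs R (xs ++ ys) → AllPairs R xs
  pairs-left [] p = []
  pairs-left (x ∷ xs) (p ∷ ps) = AllP.++⁻ˡ xs p ∷ pairs-left xs ps

  pairs-right : ∀ xs {ys} → AllPairs R (xs ++ ys) → AllPairs R ys
  pairs-right [] p = p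
  pairs-right (x ∷ xs) (p ∷ ps) = pairs-right xs ps

  pairs-reverse : ∀ {xs} → AllPairs R xs → AllPairs (λ x y → R y x) (reverse xs)
  pairs-reverse {[]} [] = []
  pairs-reverse {x ∷ xs} (p ∷ ps) = subst (AllPairs _) (sym (LP.unfold-reverse x xs))
    (AllPairsP.++⁺ (pairs-reverse ps) ([] ∷ []) (All.tabulate λ y∈ → All.lookup p (∈-reverse⁻ y∈) ∷ []))
    where
    ∈-reverse⁻ : ∀ {y} → y ∈ reverse xs → y ∈ xs
    ∈-reverse⁻ = AnyP.reverse⁻

  pairs-concatMap : ∀ {B : Set} (g : B → List A) {xs} → (∀ {b} → b ∈ xs → AllPairs R (g b)) →
    AllPairs (λ b c → ∀ {x y} → x ∈ g b → y ∈ g c → R x y) xs → AllPairs R (concatMap g xs)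
  pairs-concatMap g {[]} p [] = []
  pairs-concatMap g {b ∷ bs} p (q ∷ qs) = pairs-++ (p (here refl)) (pairs-concatMap g (λ b∈ → p (there b∈)) qs)
    λ x∈ y∈ → let c , c∈ , y∈gc = find (∈-concatMap⁻ g y∈) in All.lookup q c∈ x∈ y∈gc

  pairs-if : ∀ (b : Bool) t → AllPairs R (if b then t ∷ [] else [])
  pairs-if true t = [] ∷ []
  pairs-if false t = []

pairs-ranged : ∀ {m} {R : ℕ → ℕ → Set} {xs} → AllPairs R xs → (∀ {k} → k ∈ xs → InRange m k) →
  AllPairs (λ j k → InRange m j × InRange m k × R j k) xs
pairs-ranged [] f = []
pairs-ranged (p ∷ ps) f = All.tabulate (λ k∈ → f (here refl) , f (there k∈) , All.lookup p k∈) ∷ pairs-ranged ps (λ k∈ → f (there k∈))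

∈-if : ∀ {A : Set} (b : Bool) {t t' : A} → t' ∈ (if b then t ∷ [] else []) → b ≡ true × t' ≡ t
∈-if true (here e) = refl , e

∈-if⁺ : ∀ {A : Set} {b : Bool} {t : A} → b ≡ true → t ∈ (if b then t ∷ [] else [])
∈-if⁺ refl = here refl

eqZ-sound : ∀ {x y} → eqZ x y ≡ true → x ≡ y
eqZ-sound {x} {y} p with x ℤP.≟ y
... | yes q = q

eqZ-complete : ∀ {x y} → x ≡ y → eqZ x y ≡ true
eqZ-complete {x} {y} p = dec-true (x ℤP.≟ y) p

-- The heads must agree, since each is the unique element of smallest key. This identifies the lists
-- read off μ without following how they are built: order and membership suffice.
sorted-unique : ∀ {A : Set} (key : A → ℤ) xs ys → AllPairs (λ a b → key a <ℤ key b) xs → AllPairs (λ a b → key a <ℤ key b) ys →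
  (∀ {a} → a ∈ xs → a ∈ ys) → (∀ {a} → a ∈ ys → a ∈ xs) → xs ≡ ys
sorted-unique key [] [] _ _ _ _ = refl
sorted-unique key [] (y ∷ ys) _ _ _ g with g (here refl)
... | ()
sorted-unique key (x ∷ xs) [] _ _ f _ with f (here refl)
... | ()
sorted-unique key (x ∷ xs) (y ∷ ys) (p ∷ ps) (q ∷ qs) f g = cong₂ _∷_ x≡y (sorted-unique key xs ys ps qs f' g')
  where
  x≡y : x ≡ y
  x≡y with f (here refl) | g (here refl)
  ... | here e | _ = e
  ... | there _ | here e = sym e
  ... | there x∈ | there y∈ = ⊥-elim (ℤP.<-asym (All.lookup q x∈) (All.lookup p y∈))
  f' : ∀ {a} → a ∈ xs → a ∈ ys
  f' a∈ with f (there a∈)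
  ... | there a∈' = a∈'
  ... | here refl = ⊥-elim (ℤP.<-irrefl (cong key x≡y) (All.lookup p a∈))
  g' : ∀ {a} → a ∈ ys → a ∈ xs
  g' a∈ with g (there a∈)
  ... | there a∈' = a∈'
  ... | here refl = ⊥-elim (ℤP.<-irrefl (cong key (sym x≡y)) (All.lookup q a∈))

idxUp-sorted : ∀ n → AllPairs ℕ._<_ (idxUp n)
idxUp-sorted n = AllPairsP.map⁺ (AllPairsP.applyUpTo⁺₁ id n λ i<j _ → s≤s i<j)

idxDown-sorted : ∀ n → AllPairs ℕ._>_ (idxDown n)
idxDown-sorted n = pairs-reverse (idxUp-sorted n)

∈-idxDown⁺ : ∀ {n i} → InRange n i → i ∈ idxDown n
∈-idxDown⁺ r = AnyP.reverse⁺ (∈-idxUp⁺ r)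

∈-idxDown⁻ : ∀ {n i} → i ∈ idxDown n → InRange n i
∈-idxDown⁻ p = ∈-idxUp⁻ (AnyP.reverse⁻ p)

upTo-sorted : ∀ n → AllPairs ℕ._<_ (upTo n)
upTo-sorted n = AllPairsP.applyUpTo⁺₁ id n λ i<j _ → i<j

downFrom-sorted : ∀ n → AllPairs ℕ._>_ (downFrom n)
downFrom-sorted n = AllPairsP.applyDownFrom⁺₁ id n λ j<i _ → j<i

∈-sum : ∀ {A : Set} (f : A → ℕ) xs {a} → a ∈ xs → f a ≤ foldr _+_ 0 (map f xs)
∈-sum f (x ∷ xs) (here refl) = ℕP.m≤m+n (f x) _
∈-sum f (x ∷ xs) (there p) = ℕP.≤-trans (∈-sum f xs p) (ℕP.m≤n+m _ (f x))

nthZ-idx : ∀ n (f : ℕ → ℤ) k → InRange n k → nthZ (map f (idxUp n)) k ≡ f k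
nthZ-idx n f (suc k) (_ , q) = go n id k q
  where
  go : ∀ n (g : ℕ → ℕ) i → i ℕ.< n → nthZ (map f (map suc (Data.List.applyUpTo g n))) (suc i) ≡ f (suc (g i))
  go (suc n) g zero _ = refl
  go (suc n) g (suc i) (s≤s q) = go n (g ∘ suc) i q

-- The labels of d_D and the chamber of the alcove.

-- The rows of d_D, for an arbitrary vector μ and arbitrary signs in rows 1 and n.
module Blocks (n : ℕ) (μ : ZV) (v : SP) (s₁ sₙ : ℤ) where

  up down block : ℕ → List Entry
  up i = concatMap (λ j → if eqZ (μ j) (- (+ i)) then ent j (v j) ∷ [] else []) (idxUp n)
  down i = concatMap (λ j → if eqZ (μ j) (+ suc i) then ent j (- v j) ∷ [] else []) (idxDown n)
  block i = up i ++ down i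

  total : ℕ
  total = foldr _+_ 0 (map (λ k → ∣ μ k ∣) (idxUp n))

  raw : List Entry
  raw = concatMap block (upTo (suc total))

  scaleRow : ℕ → ℤ → ℤ
  scaleRow r x = if r ≡ᵇ n then sₙ *ℤ x else if r ≡ᵇ 1 then s₁ *ℤ x else x

  fixed : Entry → ℤ
  fixed (ent r x) = scaleRow r x

  evenᵇ : Bool
  evenᵇ = (posCount n μ % 2) ≡ᵇ 0

  flipHead : Bool → List ℤ → List ℤ
  flipHead b [] = []
  flipHead b (x ∷ xs) = if b then x ∷ xs else (- x) ∷ xs

  flipHead-1 : ∀ b xs → nthZ (flipHead b xs) 1 ≡ (if b then nthZ xs 1 else - nthZ xs 1)
  flipHead-1 true [] = refl
  flipHead-1 false [] = refl
  flipHead-1 true (x ∷ xs) = refl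
  flipHead-1 false (x ∷ xs) = refl

  flipHead-≥2 : ∀ b xs k → nthZ (flipHead b xs) (suc (suc k)) ≡ nthZ xs (suc (suc k))
  flipHead-≥2 b [] k = refl
  flipHead-≥2 true (x ∷ xs) k = refl
  flipHead-≥2 false (x ∷ xs) k = refl

module Label (n : ℕ) (p : List Step) (v : SP) where
  μ : ZV
  μ = mu n p
  open Blocks n μ v (epsP p *ℤ negOnePow (+ 1 +ℤ nu n (n ∸ 1) +ℤ nu n n)) (negOnePow (+ 1 +ℤ μ (n ∸ 1) +ℤ μ n))

  -- The local functions of dD cannot be named: H stands for a term in which they occur, and is found by unification.
  dD-spec : ∀ k (H : List Entry → List Entry → List ℕ → ℤ) → H [] [] [] ≡ + 0 →
    (∀ e U D L → H (e ∷ U) D L ≡ nthZ (flipHead evenᵇ (map fixed (((e ∷ U) ++ D) ++ concatMap block L))) k) →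
    (∀ e D L → H [] (e ∷ D) L ≡ nthZ (flipHead evenᵇ (map fixed ((e ∷ D) ++ concatMap block L))) k) →
    (∀ i L → H [] [] (i ∷ L) ≡ H (up i) (down i) L) →
    ∀ U D L → H U D L ≡ nthZ (flipHead evenᵇ (map fixed ((U ++ D) ++ concatMap block L))) k
  dD-spec k H e₀ e₁ e₂ e₃ (e ∷ U) D L = e₁ e U D L
  dD-spec k H e₀ e₁ e₂ e₃ [] (e ∷ D) L = e₂ e D L
  dD-spec k H e₀ e₁ e₂ e₃ [] [] [] = e₀
  dD-spec k H e₀ e₁ e₂ e₃ [] [] (i ∷ L) = trans (e₃ i L) (dD-spec k H e₀ e₁ e₂ e₃ (up i) (down i) L)

  mutual
    private
      local : ℕ → List Entry → List Entry → List ℕ → ℤ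
      local = _

    dD-eq : ∀ k → dD n p v k ≡ nthZ (flipHead evenᵇ (map fixed raw)) k
    -- The first block and the remaining levels are generalised to variables, so that unification
    -- can find `local` as a function of them.
    dD-eq k with up 0 | down 0 | Data.List.applyUpTo suc (foldr _+_ 0 (map (λ k → ∣ μ k ∣) (idxUp n)))
    ... | U | D | L = dD-spec k (local k) refl (λ _ _ _ _ → refl) (λ _ _ _ → refl) (λ _ _ → refl) U D L

-- The rows in the order of |x|, where x lists pt b in the frame w₀; y lists it in the chamber frame w.
module Order (n : ℕ) (n≥3 : 3 ≤ n) (q : ZV) (w₀ : SP) (s₀ : Signed n w₀) (μ : ZV)
  (x-eq' : ∀ i → InRange n i → val q (w₀ i) ≡ + i - + 1 - hD n *ℤ μ i)
  (w : SP) (sw : Signed n w)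
  (up : ∀ i → 1 ≤ i → i ℕ.< n → val q (w i) <ℤ val q (w (suc i))) (lo : + 0 <ℤ val q (w 1) +ℤ val q (w 2)) where

  n≥1 : 1 ≤ n
  n≥1 = 3≤⇒1≤ n≥3
  h : ℤ
  h = hD n
  h≡ : h ≡ + 2 *ℤ + n - + 2
  h≡ = hD≡ n≥1

  x y : ℕ → ℤ
  x i = val q (w₀ i)
  y i = val q (w i)

  τ : ℕ → ℤ
  τ i = - μ i

  x-eq : ∀ i → InRange n i → x i ≡ + i - + 1 +ℤ h *ℤ τ i
  x-eq i r = trans (x-eq' i r) (cong (+ i - + 1 +ℤ_) (ℤP.neg-distribʳ-* h (μ i)))

  open Frame n n≥3 h h≡ w₀ x τ x-eq using (X; X-neg; h>0; generic; n≥3ℤ) public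

  key : ℕ → ℤ
  key j = + ∣ x j ∣

  key-inj : ∀ j k → InRange n j → InRange n k → key j ≡ key k → j ≡ k
  key-inj j k rj rk e with j ℕ.≟ k
  ... | yes p = p
  ... | no ne = ⊥-elim (go (abs-cases (x j) (x k) (ℤP.+-injective e)))
    where
    rj' : InRange n ∣ - + j ∣
    rj' = subst (InRange n) (sym (ℤP.∣-i∣≡∣i∣ (+ j))) rj
    go : x j ≡ x k ⊎ x j ≡ - x k → ⊥
    go (inj₁ p) = generic (+ j) (+ k) rj rk ne (+ 0)
      (lia (X (+ k) ∷ X (+ j) ∷ x k ∷ x j ∷ h ∷ []) (λ a b c d h → a :≡ c ⟹ b :≡ d ⟹ d :≡ c ⟹ a :- b :≡ h :* K 0) (val-+ x k (proj₁ rk)) (val-+ x j (proj₁ rj)) p)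
    go (inj₂ p) = generic (- + j) (+ k) rj' rk (λ e' → ne (trans (sym (ℤP.∣-i∣≡∣i∣ (+ j))) e')) (+ 0)
      (lia (X (+ k) ∷ X (- + j) ∷ X (+ j) ∷ x k ∷ x j ∷ h ∷ []) (λ a b b' c d h → a :≡ c ⟹ b :≡ :- b' ⟹ b' :≡ d ⟹ d :≡ :- c ⟹ a :- b :≡ h :* K 0) (val-+ x k (proj₁ rk)) (X-neg (+ j)) (val-+ x j (proj₁ rj)) p)

  row≥ : ∀ {j} → InRange n j → + 0 ≤ℤ + j - + 1 × + j - + 1 ≤ℤ + n - + 1
  row≥ {j} (p , q) = lia (+ j ∷ []) (λ j → K 1 :≤ j ⟹ K 0 :≤ j :- K 1) (+≤+ p)
    , lia (+ j ∷ + n ∷ []) (λ j n → j :≤ n ⟹ j :- K 1 :≤ n :- K 1) (+≤+ q)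

  -- Block i of d_D holds the rows with |x| between h i and h (i + 1). Those with μ = -i have |x| =
  -- h i + (j - 1), growing with j; those with μ = i + 1 have |x| = h (i + 1) - (j - 1), falling
  -- with j. Hence the two reading directions.
  key-neg : ∀ j i → InRange n j → μ j ≡ - + i → x j ≡ key j × key j ≡ h *ℤ + i +ℤ (+ j - + 1)
  key-neg j i r e = sym k≡ , trans k≡ xj
    where
    xj : x j ≡ h *ℤ + i +ℤ (+ j - + 1)
    xj = lia (x j ∷ h ∷ μ j ∷ + i ∷ + j ∷ []) (λ x h u i j → x :≡ j :- K 1 :- h :* u ⟹ h :* u :≡ h :* :- i ⟹ x :≡ h :* i :+ (j :- K 1)) (x-eq' j r) (cong (h *ℤ_) e)
    k≡ : key j ≡ x j
    k≡ = ℤP.0≤i⇒+∣i∣≡i (subst (+ 0 ≤ℤ_) (sym xj) (lia (h *ℤ + i ∷ + j ∷ []) (λ a j → K 0 :≤ a ⟹ K 0 :≤ j :- K 1 ⟹ K 0 :≤ a :+ (j :- K 1)) (*-nonneg (ℤP.<⇒≤ h>0) (+≤+ z≤n)) (proj₁ (row≥ r))))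

  key-pos : ∀ j i → InRange n j → μ j ≡ + suc i → x j ≡ - key j × key j ≡ h *ℤ + suc i - (+ j - + 1) × x j <ℤ + 0
  key-pos j i r e = trans (sym (ℤP.neg-involutive (x j))) (cong -_ (sym k≡)) , trans k≡ (trans (cong -_ xj) (lia (h ∷ + suc i ∷ + j ∷ []) λ h i j → :- (j :- K 1 :- h :* i) :≡ h :* i :- (j :- K 1))) , x<0
    where
    xj : x j ≡ + j - + 1 - h *ℤ + suc i
    xj = trans (x-eq' j r) (cong (λ u → + j - + 1 - h *ℤ u) e)
    x<0 : x j <ℤ + 0
    x<0 = lia (x j ∷ h ∷ + i ∷ + j ∷ + n ∷ []) (λ x h i j n → x :≡ j :- K 1 :- h :* (K 1 :+ i) ⟹ K 0 :≤ h :* i ⟹ j :- K 1 :≤ n :- K 1 ⟹ h :≡ K 2 :* n :- K 2 ⟹ K 3 :≤ n ⟹ x :< K 0)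
      xj (*-nonneg (ℤP.<⇒≤ h>0) (+≤+ z≤n)) (proj₂ (row≥ r)) h≡ n≥3ℤ
    k≡ : key j ≡ - x j
    k≡ = trans (cong +_ (sym (ℤP.∣-i∣≡∣i∣ (x j)))) (ℤP.0≤i⇒+∣i∣≡i (ℤP.neg-mono-≤ (ℤP.<⇒≤ x<0)))

  chain : Chain n (y (n ∸ 1) +ℤ y n +ℤ + 1) y
  -- A chamber has no upper wall, so any M above y (n - 1) + y n provides a roof.
  chain = record { rise = up ; base = lo ; roof = lia (y (n ∸ 1) +ℤ y n ∷ []) λ s → s :< s :+ K 1 }

  open ChainProps n≥3 chain using (∣∣-mono; positive; ∣c∣; split1) public

  -- r i is the row with the i-th smallest |x|.
  private
    match : ∀ i → ∃[ j ] (InRange n i → InRange n j × ∣ w₀ j ∣ ≡ ∣ w i ∣)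
    match i with InRange? n i
    ... | no ¬r = 0 , λ r → ⊥-elim (¬r r)
    ... | yes r = let j , rj , e = sp-surj s₀ ∣ w i ∣ (sp-maps sw i r) in j , λ _ → rj , e

  r : ℕ → ℕ
  r i = proj₁ (match i)

  r-range : ∀ i → InRange n i → InRange n (r i)
  r-range i ri = proj₁ (proj₂ (match i) ri)

  w-r : ∀ i → InRange n i → (w i ≡ w₀ (r i) × y i ≡ x (r i)) ⊎ (w i ≡ - w₀ (r i) × y i ≡ - x (r i))
  w-r i ri with abs-cases (w i) (w₀ (r i)) (sym (proj₂ (proj₂ (match i) ri)))
  ... | inj₁ e = inj₁ (e , cong (val q) e)
  ... | inj₂ e = inj₂ (e , trans (cong (val q) e) (val-neg q (w₀ (r i))))

  key-r : ∀ i → InRange n i → key (r i) ≡ + ∣ y i ∣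
  key-r i ri with w-r i ri
  ... | inj₁ (_ , e) = cong (λ a → + ∣ a ∣) (sym e)
  ... | inj₂ (_ , e) = cong +_ (trans (sym (ℤP.∣-i∣≡∣i∣ (x (r i)))) (cong ∣_∣ (sym e)))

  r-mono : ∀ {i k} → 1 ≤ i → i ℕ.< k → k ≤ n → key (r i) <ℤ key (r k)
  r-mono {i} {k} p lt s = subst₂ _<ℤ_ (sym (key-r i (p , ℕP.≤-trans (ℕP.<⇒≤ lt) s))) (sym (key-r k (ℕP.≤-trans p (ℕP.<⇒≤ lt) , s))) (∣∣-mono p lt s)

  r-injective : ∀ i k → InRange n i → InRange n k → r i ≡ r k → i ≡ k
  r-injective i k ri rk e with ℕP.<-cmp i k
  ... | tri≈ _ p _ = p
  ... | tri< lt _ _ = ⊥-elim (ℤP.<-irrefl (cong key e) (r-mono (proj₁ ri) lt (proj₂ rk)))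
  ... | tri> _ _ gt = ⊥-elim (ℤP.<-irrefl (cong key (sym e)) (r-mono (proj₁ rk) gt (proj₂ ri)))

  r-injects : Injects n r
  r-injects = r-range , r-injective

  r-surj : ∀ j → InRange n j → ∃[ i ] (InRange n i × r i ≡ j)
  r-surj = surjects n r r-injects

  r-mono⁻ : ∀ i k → InRange n i → InRange n k → key (r i) <ℤ key (r k) → i ℕ.< k
  r-mono⁻ i k ri rk lt with ℕP.<-cmp i k
  ... | tri< p _ _ = p
  ... | tri≈ _ refl _ = ⊥-elim (ℤP.<-irrefl refl lt)
  ... | tri> _ _ p = ⊥-elim (ℤP.<-asym lt (r-mono (proj₁ rk) p (proj₂ ri)))

  y>0 : ∀ {i} → 2 ≤ i → i ≤ n → + 0 <ℤ y i
  y>0 = positive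

  key-y : ∀ {i} → 2 ≤ i → i ≤ n → key (r i) ≡ y i
  key-y p s = trans (key-r _ (ℕP.≤-trans (s≤s z≤n) p , s)) (∣c∣ p s)

module Labelled (n : ℕ) (n≥3 : 3 ≤ n) (μ : ZV) (v : SP) (s₁ sₙ : ℤ) (q : ZV)
  (d₀ : DPerm n (λ j → Blocks.scaleRow n μ v s₁ sₙ j (v j)))
  (x-eq' : ∀ i → InRange n i → val q (Blocks.scaleRow n μ v s₁ sₙ i (v i)) ≡ + i - + 1 - hD n *ℤ μ i)
  (w : SP) (dw : DPerm n w)
  (up' : ∀ i → 1 ≤ i → i ℕ.< n → val q (w i) <ℤ val q (w (suc i))) (lo' : + 0 <ℤ val q (w 1) +ℤ val q (w 2)) where

  open Blocks n μ v s₁ sₙ public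
  w₀ : SP
  w₀ j = scaleRow j (v j)
  open Order n n≥3 q w₀ (sgnd d₀) μ x-eq' w (sgnd dw) up' lo' public

  posᵇ : ℕ → Bool
  posᵇ j = ltZ (+ 0) (μ j)

  -- The one of ±`w₀ j` on which q takes the value |x j|, see `val-sv`: x j is negative exactly if μ
  -- j is positive.
  sv : ℕ → ℤ
  sv j = if posᵇ j then - w₀ j else w₀ j

  private
    Up Down : ℕ → Entry → Set
    Up i t = InRange n (Entry.row t) × μ (Entry.row t) ≡ - + i × t ≡ ent (Entry.row t) (v (Entry.row t))
    Down i t = InRange n (Entry.row t) × μ (Entry.row t) ≡ + suc i × t ≡ ent (Entry.row t) (- v (Entry.row t))

    upAt downAt : ℕ → ℕ → List Entry
    upAt i j = if eqZ (μ j) (- + i) then ent j (v j) ∷ [] else []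
    downAt i j = if eqZ (μ j) (+ suc i) then ent j (- v j) ∷ [] else []

    upAt⁻ : ∀ i j t → t ∈ upAt i j → μ j ≡ - + i × t ≡ ent j (v j)
    upAt⁻ i j t m with ∈-if (eqZ (μ j) (- + i)) m
    ... | e , refl = eqZ-sound e , refl

    downAt⁻ : ∀ i j t → t ∈ downAt i j → μ j ≡ + suc i × t ≡ ent j (- v j)
    downAt⁻ i j t m with ∈-if (eqZ (μ j) (+ suc i)) m
    ... | e , refl = eqZ-sound e , refl

    up⁻ : ∀ i t → t ∈ up i → Up i t
    up⁻ i t m with find (∈-concatMap⁻ (upAt i) m)
    ... | j , j∈ , t∈ with upAt⁻ i j t t∈
    ... | e , refl = ∈-idxUp⁻ j∈ , e , refl

    down⁻ : ∀ i t → t ∈ down i → Down i t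
    down⁻ i t m with find (∈-concatMap⁻ (downAt i) m)
    ... | j , j∈ , t∈ with downAt⁻ i j t t∈
    ... | e , refl = ∈-idxDown⁻ j∈ , e , refl

    block⁻ : ∀ i t → t ∈ block i → Up i t ⊎ Down i t
    block⁻ i t m with ∈-++⁻ (up i) m
    ... | inj₁ a = inj₁ (up⁻ i t a)
    ... | inj₂ b = inj₂ (down⁻ i t b)

    Less : Entry → Entry → Set
    Less s t = key (Entry.row s) <ℤ key (Entry.row t)

    up-key : ∀ i t → Up i t → key (Entry.row t) ≡ h *ℤ + i +ℤ (+ Entry.row t - + 1)
    up-key i t (r , e , _) = proj₂ (key-neg (Entry.row t) i r e)
    down-key : ∀ i t → Down i t → key (Entry.row t) ≡ h *ℤ + suc i - (+ Entry.row t - + 1)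
    down-key i t (r , e , _) = proj₁ (proj₂ (key-pos (Entry.row t) i r e))

    strict : ∀ s t → InRange n (Entry.row s) → InRange n (Entry.row t) → key (Entry.row s) ≤ℤ key (Entry.row t) →
      ¬ μ (Entry.row s) ≡ μ (Entry.row t) → Less s t
    strict s t rs rt le ne = ℤP.≤∧≢⇒< le λ e → ne (cong μ (key-inj _ _ rs rt e))

    -- The first half of block i ends at h i + (n - 1) at most, and the second begins there at
    -- least. The two cannot coincide, since distinct rows have distinct |x|.
    up-down : ∀ i s t → Up i s → Down i t → Less s t
    up-down i s t us dt@(rt , et , _) = strict s t (proj₁ us) rt
      (lia (key (Entry.row s) ∷ key (Entry.row t) ∷ h ∷ + i ∷ + Entry.row s ∷ + Entry.row t ∷ + n ∷ [])
        (λ a b h i j k n → a :≡ h :* i :+ (j :- K 1) ⟹ b :≡ h :* (K 1 :+ i) :- (k :- K 1) ⟹ j :- K 1 :≤ n :- K 1 ⟹ k :- K 1 :≤ n :- K 1 ⟹ h :≡ K 2 :* n :- K 2 ⟹ a :≤ b)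
        (up-key i s us) (down-key i t dt) (proj₂ (row≥ (proj₁ us))) (proj₂ (row≥ rt)) h≡)
      λ e → clash (trans (sym (proj₁ (proj₂ us))) (trans e et))
      where
      clash : ∀ {i} → ¬ - + i ≡ + suc i
      clash {zero} ()
      clash {suc i} ()

    up-sorted : ∀ i → AllPairs Less (up i)
    up-sorted i = pairs-concatMap (upAt i) (λ {j} _ → pairs-if (eqZ (μ j) (- + i)) (ent j (v j)))
      (AllPairs.map (λ {j} {k} lt {s} {t} s∈ t∈ → step j k lt s t s∈ t∈) (pairs-ranged (idxUp-sorted n) ∈-idxUp⁻))
      where
      step : ∀ j k → InRange n j × InRange n k × j ℕ.< k → ∀ s t → s ∈ upAt i j → t ∈ upAt i k → Less s t
      step j k (rj , rk , lt) s t s∈ t∈ with upAt⁻ i j s s∈ | upAt⁻ i k t t∈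
      ... | e , refl | e' , refl = lia (key j ∷ key k ∷ h *ℤ + i ∷ + j ∷ + k ∷ []) (λ a b c j k → a :≡ c :+ (j :- K 1) ⟹ b :≡ c :+ (k :- K 1) ⟹ K 1 :+ j :≤ k ⟹ a :< b)
        (proj₂ (key-neg j i rj e)) (proj₂ (key-neg k i rk e')) (+≤+ lt)

    down-sorted : ∀ i → AllPairs Less (down i)
    down-sorted i = pairs-concatMap (downAt i) (λ {j} _ → pairs-if (eqZ (μ j) (+ suc i)) (ent j (- v j)))
      (AllPairs.map (λ {j} {k} lt {s} {t} s∈ t∈ → step j k lt s t s∈ t∈) (pairs-ranged (idxDown-sorted n) ∈-idxDown⁻))
      where
      step : ∀ j k → InRange n j × InRange n k × k ℕ.< j → ∀ s t → s ∈ downAt i j → t ∈ downAt i k → Less s t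
      step j k (rj , rk , lt) s t s∈ t∈ with downAt⁻ i j s s∈ | downAt⁻ i k t t∈
      ... | e , refl | e' , refl = lia (key j ∷ key k ∷ h *ℤ + suc i ∷ + j ∷ + k ∷ []) (λ a b c j k → a :≡ c :- (j :- K 1) ⟹ b :≡ c :- (k :- K 1) ⟹ K 1 :+ k :≤ j ⟹ a :< b)
        (proj₁ (proj₂ (key-pos j i rj e))) (proj₁ (proj₂ (key-pos k i rk e'))) (+≤+ lt)

    block-bounds : ∀ i t → Up i t ⊎ Down i t → h *ℤ + i ≤ℤ key (Entry.row t) × key (Entry.row t) ≤ℤ h *ℤ + suc i
    block-bounds i t (inj₁ u) =
        lia (key (Entry.row t) ∷ h *ℤ + i ∷ + Entry.row t ∷ []) (λ a c j → a :≡ c :+ (j :- K 1) ⟹ K 0 :≤ j :- K 1 ⟹ c :≤ a) (up-key i t u) (proj₁ (row≥ (proj₁ u)))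
      , lia (key (Entry.row t) ∷ h ∷ + i ∷ + Entry.row t ∷ + n ∷ []) (λ a h i j n → a :≡ h :* i :+ (j :- K 1) ⟹ j :- K 1 :≤ n :- K 1 ⟹ h :≡ K 2 :* n :- K 2 ⟹ K 3 :≤ n ⟹ a :≤ h :* (K 1 :+ i)) (up-key i t u) (proj₂ (row≥ (proj₁ u))) h≡ n≥3ℤ
    block-bounds i t (inj₂ u) =
        lia (key (Entry.row t) ∷ h ∷ + i ∷ + Entry.row t ∷ + n ∷ []) (λ a h i j n → a :≡ h :* (K 1 :+ i) :- (j :- K 1) ⟹ j :- K 1 :≤ n :- K 1 ⟹ h :≡ K 2 :* n :- K 2 ⟹ K 3 :≤ n ⟹ h :* i :≤ a) (down-key i t u) (proj₂ (row≥ (proj₁ u))) h≡ n≥3ℤ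
      , lia (key (Entry.row t) ∷ h *ℤ + suc i ∷ + Entry.row t ∷ []) (λ a c j → a :≡ c :- (j :- K 1) ⟹ K 0 :≤ j :- K 1 ⟹ a :≤ c) (down-key i t u) (proj₁ (row≥ (proj₁ u)))

    μ-block : ∀ i t → Up i t ⊎ Down i t → μ (Entry.row t) ≡ - + i ⊎ μ (Entry.row t) ≡ + suc i
    μ-block i t (inj₁ (_ , e , _)) = inj₁ e
    μ-block i t (inj₂ (_ , e , _)) = inj₂ e

    block-range : ∀ i t → Up i t ⊎ Down i t → InRange n (Entry.row t)
    block-range i t (inj₁ u) = proj₁ u
    block-range i t (inj₂ u) = proj₁ u

    raw-sorted : AllPairs Less raw
    raw-sorted = pairs-concatMap block {upTo (suc total)}
      (λ {i} _ → pairs-++ (up-sorted i) (down-sorted i) λ {s} {t} s∈ t∈ → up-down i s t (up⁻ i s s∈) (down⁻ i t t∈))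
      (AllPairs.map (λ {i} {k} lt {s} {t} s∈ t∈ → step i k lt s t (block⁻ i s s∈) (block⁻ k t t∈)) (upTo-sorted (suc total)))
      where
      differ : ∀ {i k a b} → i ℕ.< k → a ≡ - + i ⊎ a ≡ + suc i → b ≡ - + k ⊎ b ≡ + suc k → ¬ a ≡ b
      differ {i} {k} lt (inj₁ refl) (inj₁ refl) e = ℕP.<⇒≢ lt (ℤP.+-injective (ℤP.neg-injective e))
      differ {zero} lt (inj₁ refl) (inj₂ refl) ()
      differ {suc i} lt (inj₁ refl) (inj₂ refl) ()
      differ {i} {zero} lt (inj₂ refl) (inj₁ refl) ()
      differ {i} {suc k} lt (inj₂ refl) (inj₁ refl) ()
      differ lt (inj₂ refl) (inj₂ refl) e = ℕP.<⇒≢ lt (ℕP.suc-injective (ℤP.+-injective e))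
      step : ∀ i k → i ℕ.< k → ∀ s t → Up i s ⊎ Down i s → Up k t ⊎ Down k t → Less s t
      step i k lt s t bs bt = strict s t (block-range i s bs) (block-range k t bt)
        (ℤP.≤-trans (proj₂ (block-bounds i s bs)) (ℤP.≤-trans (ℤP.*-monoˡ-≤-nonNeg h {{ℤ.nonNegative (ℤP.<⇒≤ h>0)}} (+≤+ lt)) (proj₁ (block-bounds k t bt))))
        (differ lt (μ-block i s bs) (μ-block k t bt))

    rows : List ℕ
    rows = map Entry.row raw

    fixed-sv : ∀ t → t ∈ raw → fixed t ≡ sv (Entry.row t)
    fixed-sv t m with find (∈-concatMap⁻ block {xs = upTo (suc total)} m)
    ... | i , _ , t∈ = go (block⁻ i t t∈)
      where
      neg-fixed : ∀ j → fixed (ent j (- v j)) ≡ - w₀ j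
      neg-fixed j with j ≡ᵇ n
      ... | true = sym (ℤP.neg-distribʳ-* sₙ (v j))
      ... | false with j ≡ᵇ 1
      ... | true = sym (ℤP.neg-distribʳ-* s₁ (v j))
      ... | false = refl
      go : Up i t ⊎ Down i t → fixed t ≡ sv (Entry.row t)
      go (inj₁ (_ , e , refl)) rewrite ltZ-false {+ 0} {μ (Entry.row t)} (λ lt → ℤP.<⇒≱ lt (subst (_≤ℤ + 0) (sym e) ℤP.neg-≤-pos)) = refl
      go (inj₂ (_ , e , refl)) rewrite ltZ-true {+ 0} {μ (Entry.row t)} (subst (+ 0 <ℤ_) (sym e) (ℤ.+<+ (s≤s z≤n))) = neg-fixed (Entry.row t)

    fixed-rows : map fixed raw ≡ map sv rows
    fixed-rows = trans (map-local raw fixed-sv) (LP.map-∘ raw)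
      where
      map-local : ∀ ts → (∀ t → t ∈ ts → fixed t ≡ sv (Entry.row t)) → map fixed ts ≡ map (λ t → sv (Entry.row t)) ts
      map-local [] f = refl
      map-local (t ∷ ts) f = cong₂ _∷_ (f t (here refl)) (map-local ts λ t t∈ → f t (there t∈))

    rows⁺ : ∀ j → InRange n j → j ∈ rows
    rows⁺ j rj = go (μ j) refl
      where
      inBlock : ∀ i t → t ∈ block i → i ≤ total → Entry.row t ∈ rows
      inBlock i t t∈ le = ∈-map⁺ Entry.row (∈-concatMap⁺ block {xs = upTo (suc total)} (lose (∈-upTo⁺ (s≤s le)) t∈))
      bound : ∣ μ j ∣ ≤ total
      bound = ∈-sum (λ k → ∣ μ k ∣) (idxUp n) (∈-idxUp⁺ rj)
      up⁺ : ∀ i → μ j ≡ - + i → ent j (v j) ∈ block i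
      up⁺ i e = ∈-++⁺ˡ (∈-concatMap⁺ (upAt i) (lose (∈-idxUp⁺ rj) (∈-if⁺ {b = eqZ (μ j) (- + i)} (eqZ-complete e))))
      go : ∀ a → μ j ≡ a → j ∈ rows
      go (+ zero) e = inBlock 0 (ent j (v j)) (up⁺ 0 e) z≤n
      go (+ suc i) e = inBlock i (ent j (- v j)) (∈-++⁺ʳ (up i) (∈-concatMap⁺ (downAt i) (lose (∈-idxDown⁺ rj) (∈-if⁺ {b = eqZ (μ j) (+ suc i)} (eqZ-complete e)))))
        (ℕP.≤-trans (ℕP.n≤1+n i) (subst (λ a → ∣ a ∣ ≤ total) e bound))
      go -[1+ i ] e = inBlock (suc i) (ent j (v j)) (up⁺ (suc i) e) (subst (λ a → ∣ a ∣ ≤ total) e bound)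

    rows⁻ : ∀ {j} → j ∈ rows → InRange n j
    rows⁻ m with ∈-map⁻ Entry.row m
    ... | t , t∈ , refl with find (∈-concatMap⁻ block {xs = upTo (suc total)} t∈)
    ... | i , _ , t∈' = block-range i t (block⁻ i t t∈')

    rows≡ : rows ≡ map r (idxUp n)
    rows≡ = sorted-unique key rows (map r (idxUp n)) (AllPairsP.map⁺ raw-sorted)
      (AllPairsP.map⁺ (AllPairs.map (λ { (ri , rk , lt) → r-mono (proj₁ ri) lt (proj₂ rk) }) (pairs-ranged (idxUp-sorted n) ∈-idxUp⁻)))
      (λ j∈ → let i , ri , e = r-surj _ (rows⁻ j∈) in subst (_∈ map r (idxUp n)) e (∈-map⁺ r (∈-idxUp⁺ ri)))
      (λ j∈ → let i , i∈ , e = ∈-map⁻ r j∈ in rows⁺ _ (subst (InRange n) (sym e) (r-range i (∈-idxUp⁻ i∈))))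

    values : map fixed raw ≡ map (λ i → sv (r i)) (idxUp n)
    values = trans fixed-rows (trans (cong (map sv) rows≡) (sym (LP.map-∘ (idxUp n))))

    label≡ : ∀ k → nthZ (flipHead evenᵇ (map fixed raw)) k ≡ nthZ (flipHead evenᵇ (map (λ i → sv (r i)) (idxUp n))) k
    label≡ k = cong (λ l → nthZ (flipHead evenᵇ l) k) values

    pos-x : ∀ j → InRange n j → (posᵇ j ≡ true → x j <ℤ + 0) × (posᵇ j ≡ false → x j ≡ key j)
    pos-x j rj with μ j in e
    ... | + zero = (λ ()) , λ _ → proj₁ (key-neg j 0 rj e)
    ... | + suc i = (λ _ → proj₂ (proj₂ (key-pos j i rj e))) , λ ()
    ... | -[1+ i ] = (λ ()) , λ _ → proj₁ (key-neg j (suc i) rj e)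

  val-sv : ∀ j → InRange n j → val q (sv j) ≡ key j
  val-sv j rj with posᵇ j in e
  ... | false = proj₂ (pos-x j rj) e
  ... | true = trans (val-neg q (w₀ j)) (trans (sym (ℤP.0≤i⇒+∣i∣≡i (ℤP.neg-mono-≤ (ℤP.<⇒≤ (proj₁ (pos-x j rj) e))))) (cong +_ (ℤP.∣-i∣≡∣i∣ (x j))))

  private
    sv-cases : ∀ j → sv j ≡ w₀ j ⊎ sv j ≡ - w₀ j
    sv-cases j with posᵇ j
    ... | false = inj₁ refl
    ... | true = inj₂ refl

  w-sv : ∀ k → InRange n k → w k ≡ sv (r k) ⊎ w k ≡ - sv (r k)
  w-sv k rk with w-r k rk | sv-cases (r k)
  ... | inj₁ (e , _) | inj₁ e' = inj₁ (trans e (sym e'))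
  ... | inj₁ (e , _) | inj₂ e' = inj₂ (trans e (trans (sym (ℤP.neg-involutive (w₀ (r k)))) (cong -_ (sym e'))))
  ... | inj₂ (e , _) | inj₁ e' = inj₂ (trans e (cong -_ (sym e')))
  ... | inj₂ (e , _) | inj₂ e' = inj₁ (trans e (sym e'))

  -- From row 2 on the chamber makes y k positive, and this decides the sign.
  w≥2 : ∀ k → 2 ≤ k → k ≤ n → w k ≡ sv (r k)
  w≥2 k k≥2 k≤n with w-sv k (ℕP.≤-trans (s≤s z≤n) k≥2 , k≤n)
  ... | inj₁ e = e
  ... | inj₂ e = ⊥-elim (ℤP.<⇒≱ (y>0 k≥2 k≤n) (subst (_≤ℤ + 0) (sym (trans (cong (val q) e) (trans (val-neg q (sv (r k))) (cong -_ (val-sv (r k) (r-range k (ℕP.≤-trans (s≤s z≤n) k≥2 , k≤n))))))) ℤP.neg-≤-pos))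

  private
    r1 : InRange n 1
    r1 = s≤s z≤n , n≥1

    pos-ind : ℕ → ℤ
    pos-ind j = if posᵇ j then + 1 else + 0

    posCount-sum : ∀ l → + countTo l posᵇ ≡ sumTo l pos-ind
    posCount-sum zero = refl
    posCount-sum (suc l) with posᵇ (suc l)
    ... | true = cong (_+ℤ + 1) (posCount-sum l)
    ... | false = cong (_+ℤ + 0) (posCount-sum l)

    nb-sv : ∀ j → InRange n j → nb (sv j) ≡₂ nb (w₀ j) +ℤ pos-ind j
    nb-sv j rj with posᵇ j
    ... | false = ≡⇒≡₂ (sym (ℤP.+-identityʳ (nb (w₀ j))))
    ... | true = nb-neg (w₀ j) (sp-≥1 (sgnd d₀) j rj)
      where
      nb-neg : ∀ a → 1 ≤ ∣ a ∣ → nb (- a) ≡₂ nb a +ℤ + 1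
      nb-neg (+ suc _) _ = ≡⇒≡₂ refl
      nb-neg -[1+ _ ] _ = mod₂ (- + 1) refl

    negs-sv : sumTo n (λ k → nb (sv (r k))) ≡₂ + posCount n μ
    negs-sv = ≡₂-trans (≡⇒≡₂ (sumTo-reindex n r r-injects (λ j → nb (sv j))))
      (≡₂-trans (sumTo-≡₂ n nb-sv) (≡₂-trans (≡⇒≡₂ (sumTo-+ n (λ j → nb (w₀ j)) pos-ind))
        (≡₂-trans (≡₂-+ (even d₀) (≡⇒≡₂ (sym (posCount-sum n)))) (≡⇒≡₂ (ℤP.+-identityˡ _)))))

    -- w and k ↦ sv (r k) differ at most at 1, and w has an even number of negative entries.
    first-parity : nb (w 1) +ℤ nb (sv (r 1)) ≡₂ + posCount n μ
    first-parity = ≡₂-trans (≡₂-sym (≡₂-trans rest (≡⇒≡₂ single)))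
      (≡₂-trans (≡⇒≡₂ (sumTo-+ n (λ k → nb (w k)) (λ k → nb (sv (r k)))))
        (≡₂-trans (≡₂-+ (even dw) negs-sv) (≡⇒≡₂ (ℤP.+-identityˡ _))))
      where
      g : ℕ → ℤ
      g k = if k ≡ᵇ 1 then nb (w 1) +ℤ nb (sv (r 1)) else + 0
      single : sumTo n g ≡ nb (w 1) +ℤ nb (sv (r 1))
      single = sumTo-single n 1 r1 λ k _ ne → cong (λ b → if b then nb (w 1) +ℤ nb (sv (r 1)) else + 0) (eqᵇ-false ne)
      rest : sumTo n (λ k → nb (w k) +ℤ nb (sv (r k))) ≡₂ sumTo n g
      rest = sumTo-≡₂ n λ { (suc zero) _ → ≡⇒≡₂ refl
        ; (suc (suc k)) (_ , s) → ≡₂-trans (≡⇒≡₂ (cong (λ a → nb a +ℤ nb (sv (r (suc (suc k))))) (w≥2 (suc (suc k)) (s≤s (s≤s z≤n)) s)))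
            (mod₂ (nb (sv (r (suc (suc k))))) (lia (nb (sv (r (suc (suc k)))) ∷ []) λ a → a :+ a :≡ K 0 :+ K 2 :* a)) }

  even-pos : (evenᵇ ≡ true × + posCount n μ ≡₂ + 0) ⊎ (evenᵇ ≡ false × + posCount n μ ≡₂ + 1)
  even-pos with parity (+ posCount n μ)
  ... | inj₁ e = inj₁ (cong (_≡ᵇ 0) (n∣m⇒m%n≡0 (posCount n μ) 2 (even⇒∣ (+ posCount n μ) e)) , e)
  ... | inj₂ o = inj₂ (odd (posCount n μ % 2) refl , o)
    where
    odd : ∀ k → posCount n μ % 2 ≡ k → (k ≡ᵇ 0) ≡ false
    odd (suc _) _ = refl
    odd zero e = ⊥-elim (1≢₂0 (≡₂-trans (≡₂-sym o) (∣⇒even (+ posCount n μ) (m%n≡0⇒n∣m (posCount n μ) 2 e))))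

  -- The value y 1 may have either sign or be 0, so q does not decide here. But w and w₀ both have
  -- an even number of negative entries, and `sv` changes one sign for each positive entry of μ.
  -- Therefore d_D flips its first entry according to the parity of these entries.
  w-first : w 1 ≡ (if evenᵇ then sv (r 1) else - sv (r 1))
  w-first = go even-pos (w-sv 1 r1)
    where
    a₁ : ℤ
    a₁ = sv (r 1)
    nb-two : ∀ a → nb a +ℤ nb a ≡₂ + 0
    nb-two a = mod₂ (nb a) (lia (nb a ∷ []) λ a → a :+ a :≡ K 0 :+ K 2 :* a)
    nb-opp : ∀ a → 1 ≤ ∣ a ∣ → nb (- a) +ℤ nb a ≡₂ + 1
    nb-opp (+ suc _) _ = ≡⇒≡₂ refl
    nb-opp -[1+ _ ] _ = ≡⇒≡₂ refl
    a≥1 : 1 ≤ ∣ a₁ ∣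
    a≥1 with sv-cases (r 1)
    ... | inj₁ e = subst (λ b → 1 ≤ ∣ b ∣) (sym e) (sp-≥1 (sgnd d₀) (r 1) (r-range 1 r1))
    ... | inj₂ e = subst (λ b → 1 ≤ ∣ b ∣) (sym e) (subst (1 ≤_) (sym (ℤP.∣-i∣≡∣i∣ (w₀ (r 1)))) (sp-≥1 (sgnd d₀) (r 1) (r-range 1 r1)))
    go : (evenᵇ ≡ true × + posCount n μ ≡₂ + 0) ⊎ (evenᵇ ≡ false × + posCount n μ ≡₂ + 1) → w 1 ≡ a₁ ⊎ w 1 ≡ - a₁ → w 1 ≡ (if evenᵇ then a₁ else - a₁)
    go (inj₁ (b , _)) (inj₁ e) = trans e (cong (λ b → if b then a₁ else - a₁) (sym b))
    go (inj₂ (b , _)) (inj₂ e) = trans e (cong (λ b → if b then a₁ else - a₁) (sym b))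
    go (inj₁ (_ , z)) (inj₂ e) = ⊥-elim (1≢₂0 (≡₂-trans (≡₂-sym (nb-opp a₁ a≥1)) (≡₂-trans (≡⇒≡₂ (cong (λ c → nb c +ℤ nb a₁) (sym e))) (≡₂-trans first-parity z))))
    go (inj₂ (_ , z)) (inj₁ e) = ⊥-elim (1≢₂0 (≡₂-trans (≡₂-sym (≡₂-trans first-parity z)) (≡₂-trans (≡⇒≡₂ (cong (λ c → nb c +ℤ nb a₁) e)) (nb-two a₁))))

  label≡w : ∀ k → InRange n k → nthZ (flipHead evenᵇ (map fixed raw)) k ≡ w k
  label≡w (suc zero) rk = trans (label≡ 1) (trans (flipHead-1 evenᵇ (map (λ i → sv (r i)) (idxUp n)))
    (trans (cong (λ c → if evenᵇ then c else - c) (nthZ-idx n (λ i → sv (r i)) 1 rk)) (sym w-first)))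
  label≡w (suc (suc k)) rk = trans (label≡ (suc (suc k))) (trans (flipHead-≥2 evenᵇ (map (λ i → sv (r i)) (idxUp n)) k)
    (trans (nthZ-idx n (λ i → sv (r i)) (suc (suc k)) rk) (sym (w≥2 (suc (suc k)) (s≤s (s≤s z≤n)) (proj₂ rk)))))

  y-first : y 1 ≡ (if evenᵇ then key (r 1) else - key (r 1))
  y-first = trans (cong (val q) w-first) (go evenᵇ)
    where
    go : ∀ b → val q (if b then sv (r 1) else - sv (r 1)) ≡ (if b then key (r 1) else - key (r 1))
    go true = val-sv (r 1) (r-range 1 r1)
    go false = trans (val-neg q (sv (r 1))) (cong -_ (val-sv (r 1) (r-range 1 r1)))

-- Floors of an alcove.

act-neg : ∀ {n w} → Signed n w → ∀ x → act n w (neg x) ≗[ n ] neg (act n w x)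
act-neg {n} {w} sp x k p q = trans (act-cong sp (λ i _ _ → sym (ℤP.-1*i≡-i (x i))) k p q)
  (trans (act-·v sp (- + 1) x k p q) (ℤP.-1*i≡-i (act n w x k)))

module ActRoots {n : ℕ} (n≥3 : 3 ≤ n) {w : SP} (sb : Signed n w) where
  open Ends n≥3 public

  Δ : ℤ → ℤ → ZV
  Δ x y = e y ⊖ e x

  E-neg : ∀ x y k → Δ (- y) (- x) k ≡ Δ x y k
  E-neg x y k = trans (cong₂ _-_ (e-neg x k) (e-neg y k)) (lia (e x k ∷ e y k ∷ []) λ x y → :- x :- :- y :≡ y :- x)

  inner-E : ∀ z i k → InRange n i → InRange n k → inner n z (Δ (w i) (w k)) ≡ val z (w k) - val z (w i)
  inner-E z i k ri rk = trans (inner-⊖ n z (e (w k)) (e (w i))) (cong₂ _-_ (inner-e n z (w k) (sp-maps sb k rk)) (inner-e n z (w i) (sp-maps sb i ri)))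

  inner-S : ∀ z i k → InRange n i → InRange n k → inner n z (e (w i) ⊕ e (w k)) ≡ val z (w i) +ℤ val z (w k)
  inner-S z i k ri rk = trans (inner-⊕ n z (e (w i)) (e (w k))) (cong₂ _+ℤ_ (inner-e n z (w i) (sp-maps sb i ri)) (inner-e n z (w k) (sp-maps sb k rk)))

  act-e+ : ∀ i → InRange n i → act n w (e (+ i)) ≗[ n ] e (w i)
  act-e+ i r k a c = trans (act-e sb (+ i) r k a c) (cong (λ x → e x k) (val-+ w i (proj₁ r)))

  act-sum-e : ∀ i k → InRange n i → InRange n k → act n w (e (+ i) ⊕ e (+ k)) ≗[ n ] (e (w i) ⊕ e (w k))
  act-sum-e i k ri rk l a c = trans (act-⊕ sb (e (+ i)) (e (+ k)) l a c) (cong₂ _+ℤ_ (act-e+ i ri l a c) (act-e+ k rk l a c))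

  act-diff-e : ∀ i k → InRange n i → InRange n k → act n w (e (+ k) ⊖ e (+ i)) ≗[ n ] Δ (w i) (w k)
  act-diff-e i k ri rk l a c = trans (act-⊕ sb (e (+ k)) (neg (e (+ i))) l a c)
    (cong₂ _+ℤ_ (act-e+ k rk l a c) (trans (act-neg sb (e (+ i)) l a c) (cong -_ (act-e+ i ri l a c))))

  first-form : ∀ z → inner n z (act n w (simpleR 1)) ≡ val z (w 1) +ℤ val z (w 2)
  first-form z = trans (inner-cong n {z} (λ _ _ _ → refl) (act-sum-e 1 2 r1 r2)) (inner-S z 1 2 r1 r2)

  step-form : ∀ k → InRange n (suc (suc k)) → ∀ z → inner n z (act n w (simpleR (suc (suc k)))) ≡ val z (w (suc (suc k))) - val z (w (suc k))
  step-form k r z = trans (inner-cong n {z} (λ _ _ _ → refl) (act-diff-e (suc k) (suc (suc k)) r' r)) (inner-E z (suc k) (suc (suc k)) r' r)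
    where
    r' : InRange n (suc k)
    r' = s≤s z≤n , ℕP.<⇒≤ (proj₂ r)

  high-form : ∀ z → inner n z (act n w (highR n)) ≡ val z (w p) +ℤ val z (w n)
  high-form z = trans (inner-cong n {z} (λ _ _ _ → refl) (act-sum-e p n rp rn)) (inner-S z p n rp rn)

module Floors {n : ℕ} (n≥3 : 3 ≤ n) (b : Aff) (sb : Signed n (lin b)) where
  private
    open ActRoots n≥3 sb
    h = hD n
    h≡ = hD≡ n≥1
    w = lin b
    t = tr b
    module G = FrameOf n≥3 b sb
    τ : ℕ → ℤ
    τ = G.τ
    P : ZV → ℤ
    P = inner n (pt n b)

    ptw : ∀ i → InRange n i → val (pt n b) (w i) ≡ + i - + 1 +ℤ h *ℤ τ i
    ptw = G.x-eq

    simple : ∀ i → InRange n i → P (act n w (simpleR i)) ≡ + 1 +ℤ h *ℤ inner n t (act n w (simpleR i))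
    simple (suc zero) r = lia (P α ∷ inner n t α ∷ val (pt n b) (w 1) ∷ val (pt n b) (w 2) ∷ h ∷ τ 1 ∷ τ 2 ∷ [])
        (λ P T x y h s t → P :≡ x :+ y ⟹ h :* T :≡ h :* (s :+ t) ⟹ x :≡ K 1 :- K 1 :+ h :* s ⟹ y :≡ K 2 :- K 1 :+ h :* t ⟹ P :≡ K 1 :+ h :* T)
        (first-form (pt n b)) (cong (h *ℤ_) (first-form t)) (ptw 1 r1) (ptw 2 r2)
      where
      α = act n w (simpleR 1)
    simple (suc (suc k)) r = lia (P α ∷ inner n t α ∷ val (pt n b) (w (suc k)) ∷ val (pt n b) (w (suc (suc k))) ∷ h ∷ τ (suc k) ∷ τ (suc (suc k)) ∷ + k ∷ [])
        (λ P T x y h s t k → P :≡ y :- x ⟹ h :* T :≡ h :* (t :- s) ⟹ x :≡ K 1 :+ k :- K 1 :+ h :* s ⟹ y :≡ K 2 :+ k :- K 1 :+ h :* t ⟹ P :≡ K 1 :+ h :* T)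
        (step-form k r (pt n b)) (cong (h *ℤ_) (step-form k r t)) (ptw (suc k) r') (ptw (suc (suc k)) r)
      where
      r' : InRange n (suc k)
      r' = s≤s z≤n , ℕP.<⇒≤ (proj₂ r)
      α = act n w (simpleR (suc (suc k)))

    highest : P (act n w (highR n)) ≡ h - + 1 +ℤ h *ℤ inner n t (act n w (highR n))
    highest = lia (P α ∷ inner n t α ∷ val (pt n b) (w p) ∷ val (pt n b) (w n) ∷ h ∷ τ p ∷ τ n ∷ + p ∷ + n ∷ [])
        (λ P T x y h s t p n → P :≡ x :+ y ⟹ h :* T :≡ h :* (s :+ t) ⟹ x :≡ p :- K 1 :+ h :* s ⟹ y :≡ n :- K 1 :+ h :* t ⟹ p :≡ n :- K 1 ⟹ h :≡ K 2 :* n :- K 2 ⟹ P :≡ h :- K 1 :+ h :* T)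
        (high-form (pt n b)) (cong (h *ℤ_) (high-form t)) (ptw p rp) (ptw n rn) p≡ h≡
      where
      α = act n w (highR n)

    P-cong : ∀ {γ γ'} → γ ≗[ n ] γ' → P γ ≡ P γ'
    P-cong = inner-cong n {pt n b} (λ _ _ _ → refl)

    P-neg : ∀ {γ γ'} → γ ≗[ n ] neg γ' → P γ ≡ - P γ'
    P-neg {γ} {γ'} q = trans (P-cong q) (inner-neg n (pt n b) γ')

  -- Since ρ̌ has the value 1 at simple roots and h - 1 at the highest root, the root of a wall of
  -- level m takes a value h m ± 1 at the point of the alcove. For a floor of level 1, which lies
  -- below the alcove, this is h + 1.
  floor⇒ : ∀ c → FloorH1 n b c → inner n (pt n b) (vecPR c) ≡ h +ℤ + 1
  floor⇒ c (inj₁ (i , r , inj₁ (q , m)) , _) = lia (P γ ∷ P α ∷ h ∷ inner n t α ∷ []) (λ P Q h T → P :≡ Q ⟹ Q :≡ K 1 :+ h :* T ⟹ h :* K 1 :≡ h :* T ⟹ P :≡ h :+ K 1)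
      (P-cong q) (simple i r) (cong (h *ℤ_) m)
    where
    γ = vecPR c
    α = act n w (simpleR i)
  floor⇒ c (inj₁ (i , r , inj₂ (q , m)) , above) = ⊥-elim (lia (P γ ∷ P α ∷ h ∷ inner n t α ∷ []) (λ P Q h T → P :≡ :- Q ⟹ Q :≡ K 1 :+ h :* T ⟹ h :* K 1 :≡ h :* :- T ⟹ h :* K 1 :< P ⟹ :⊥)
      (P-neg {γ} {α} q) (simple i r) (cong (h *ℤ_) m) above)
    where
    γ = vecPR c
    α = act n w (simpleR i)
  floor⇒ c (inj₂ (inj₁ (q , m)) , above) = ⊥-elim (lia (P γ ∷ P α ∷ h ∷ inner n t α ∷ []) (λ P Q h T → P :≡ Q ⟹ Q :≡ h :- K 1 :+ h :* T ⟹ h :* K 1 :≡ h :* (K 1 :+ T) ⟹ h :* K 1 :< P ⟹ :⊥)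
      (P-cong q) highest (cong (h *ℤ_) m) above)
    where
    γ = vecPR c
    α = act n w (highR n)
  floor⇒ c (inj₂ (inj₂ (q , m)) , _) = lia (P γ ∷ P α ∷ h ∷ inner n t α ∷ []) (λ P Q h T → P :≡ :- Q ⟹ Q :≡ h :- K 1 :+ h :* T ⟹ h :* K 1 :≡ h :* :- (K 1 :+ T) ⟹ P :≡ h :+ K 1)
      (P-neg {γ} {α} q) highest (cong (h *ℤ_) m)
    where
    γ = vecPR c
    α = act n w (highR n)

  -- The value h + 1 means that the two rows of the root differ by 1 modulo h. `adjacent` lists such
  -- pairs, and each is the image of a wall of A∘.
  ⇒floor : ∀ c → ValidPR n c → inner n (pt n b) (vecPR c) ≡ h +ℤ + 1 → FloorH1 n b c
  ⇒floor c v eq = isWall , subst (h *ℤ + 1 <ℤ_) (sym eq) (lia (h ∷ []) λ h → h :* K 1 :< h :+ K 1)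
    where
    γ = vecPR c
    pair = pairOf {n} c v
    U = G.index (- a c) (proj₁ (proj₂ (proj₂ (proj₂ pair))))
    V = G.index (+ j c) (proj₂ (proj₂ (proj₂ (proj₂ pair))))
    i = proj₁ U
    k = proj₁ V
    gap : G.F.X k - G.F.X i ≡ h *ℤ + 1 +ℤ + 1
    gap = trans (cong₂ _-_ (proj₂ (proj₂ (proj₂ (proj₂ V)))) (proj₂ (proj₂ (proj₂ (proj₂ U)))))
      (trans (sym (proj₁ pair (pt n b))) (trans eq (cong (_+ℤ + 1) (sym (ℤP.*-identityʳ h)))))
    γ≡ : ∀ l → γ l ≡ Δ (val w i) (val w k) l
    γ≡ l = trans (lia (e (a c) l ∷ e (+ j c) l ∷ e (- a c) l ∷ []) (λ x y z → z :≡ :- x ⟹ x :+ y :≡ y :- z) (e-neg (a c) l))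
      (cong₂ (λ x y → Δ x y l) (sym (proj₁ (proj₂ (proj₂ U)))) (sym (proj₁ (proj₂ (proj₂ V)))))
    w+ : ∀ {i} → InRange n i → val w (+ i) ≡ w i
    w+ {i} r = val-+ w i (proj₁ r)
    w- : ∀ {i} → InRange n i → val w (- + i) ≡ - w i
    w- {i} r = trans (val-neg w (+ i)) (cong -_ (w+ r))
    up-case : ∀ i → InRange n i → InRange n (suc i) → + 1 ≡ τ (suc i) - τ i → (∀ l → γ l ≡ Δ (w i) (w (suc i)) l) → IsWall n b γ (+ 1)
    up-case (suc i) ri rs m q = inj₁ (suc (suc i) , rs , inj₁ ((λ l x y → trans (q l) (sym (act-diff-e (suc i) (suc (suc i)) ri rs l x y))) ,
      trans m (sym (trans (inner-cong n {t} (λ _ _ _ → refl) (act-diff-e (suc i) (suc (suc i)) ri rs)) (inner-E t (suc i) (suc (suc i)) ri rs)))))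
    lo-case : + 1 ≡ τ 1 +ℤ τ 2 → (∀ l → γ l ≡ Δ (- w 1) (w 2) l) → IsWall n b γ (+ 1)
    lo-case m q = inj₁ (1 , r1 , inj₁ ((λ l x y → trans (q l) (trans (lia (e (w 1) l ∷ e (- w 1) l ∷ e (w 2) l ∷ []) (λ x y z → y :≡ :- x ⟹ z :- y :≡ x :+ z) (e-neg (w 1) l)) (sym (act-sum-e 1 2 r1 r2 l x y)))) ,
      trans m (sym (trans (inner-cong n {t} (λ _ _ _ → refl) (act-sum-e 1 2 r1 r2)) (inner-S t 1 2 r1 r2)))))
    hi-case : + 1 ≡ - (τ p +ℤ τ n) - + 1 → (∀ l → γ l ≡ Δ (w p) (- w n) l) → IsWall n b γ (+ 1)
    hi-case m q = inj₂ (inj₂ ((λ l x y → trans (q l) (trans (lia (e (w p) l ∷ e (w n) l ∷ e (- w n) l ∷ []) (λ x y z → z :≡ :- y ⟹ z :- x :≡ :- (x :+ y)) (e-neg (w n) l)) (cong -_ (sym (act-sum-e p n rp rn l x y))))) ,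
      lia (inner n t (act n w (highR n)) ∷ τ p ∷ τ n ∷ []) (λ T s t → T :≡ s :+ t ⟹ K 1 :≡ :- (s :+ t) :- K 1 ⟹ K 1 :≡ :- (K 1 :+ T)) (high-form t) m))
    go : ∀ {i k m} → G.F.Adjacent i k m → m ≡ + 1 → (∀ l → γ l ≡ Δ (val w i) (val w k) l) → IsWall n b γ (+ 1)
    go (G.F.up⁺ i ri rs e₁) refl q = up-case i ri rs e₁ λ l → trans (q l) (cong₂ (λ x y → Δ x y l) (w+ ri) (w+ rs))
    go (G.F.up⁻ i ri rs e₁) refl q = up-case i ri rs e₁ λ l → trans (q l) (trans (cong₂ (λ x y → Δ x y l) (w- rs) (w- ri)) (E-neg (w i) (w (suc i)) l))
    go (G.F.lo⁺ e₁) refl q = lo-case e₁ λ l → trans (q l) (cong₂ (λ x y → Δ x y l) (w- r1) (w+ r2))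
    go (G.F.lo⁻ e₁) refl q = lo-case e₁ λ l → trans (q l) (trans (cong₂ (λ x y → Δ x y l) (w- r2) (trans (w+ r1) (sym (ℤP.neg-involutive (w 1))))) (E-neg (- w 1) (w 2) l))
    go (G.F.hi⁺ e₁) refl q = hi-case e₁ λ l → trans (q l) (cong₂ (λ x y → Δ x y l) (w+ rp) (w- rn))
    go (G.F.hi⁻ e₁) refl q = hi-case e₁ λ l → trans (q l) (trans (cong₂ (λ x y → Δ x y l) (trans (w+ rn) (sym (ℤP.neg-involutive (w n)))) (w- rp)) (E-neg (w p) (- w n) l))
    isWall : IsWall n b γ (+ 1)
    isWall = go (G.F.adjacent i k (+ 1) (proj₁ (proj₂ U)) (proj₁ (proj₂ V)) gap) refl γ≡

-- Valleys of paths, and the marked East step.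

valleysFrom : ℕ → ℕ → List Step → List (ℕ × ℕ)
valleysFrom i k [] = []
valleysFrom i k (x ∷ []) = if isEast x then (suc i , suc k) ∷ [] else []
valleysFrom i k (x ∷ y ∷ xs) = (if isEast x ∧ isN y then (suc i , suc k) ∷ [] else [])
  ++ valleysFrom (if isEast x then suc i else i) (if isN x then suc k else k) (y ∷ xs)

valleys-spec : (g : ℕ → ℕ → List Step → List (ℕ × ℕ)) → (∀ i k → g i k [] ≡ []) →
  (∀ i k x → g i k (x ∷ []) ≡ (if isEast x then (suc i , suc k) ∷ [] else [])) →
  (∀ i k x y xs → g i k (x ∷ y ∷ xs) ≡ (if isEast x ∧ isN y then (suc i , suc k) ∷ [] else [])
    ++ g (if isEast x then suc i else i) (if isN x then suc k else k) (y ∷ xs)) →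
  ∀ i k p → g i k p ≡ valleysFrom i k p
valleys-spec g e₀ e₁ e₂ i k [] = e₀ i k
valleys-spec g e₀ e₁ e₂ i k (x ∷ []) = e₁ i k x
valleys-spec g e₀ e₁ e₂ i k (x ∷ y ∷ xs) = trans (e₂ i k x y xs)
  (cong ((if isEast x ∧ isN y then (suc i , suc k) ∷ [] else []) ++_)
    (valleys-spec g e₀ e₁ e₂ (if isEast x then suc i else i) (if isN x then suc k else k) (y ∷ xs)))

-- As for dD, the local function of valleys is found by unification.
mutual
  private
    local-valleys : ℕ → ℕ → List Step → List (ℕ × ℕ)
    local-valleys = _

  valleys≡ : ∀ p → valleys p ≡ valleysFrom 0 0 p
  valleys≡ [] = refl
  valleys≡ (x ∷ []) = refl
  valleys≡ (x ∷ y ∷ xs) with (if isEast x then 1 else 0) | (if isN x then 1 else 0) | y ∷ xs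
  ... | i | k | p = cong ((if isEast x ∧ isN y then (1 , 1) ∷ [] else []) ++_) (valleys-spec local-valleys (λ _ _ → refl) (λ _ _ _ → refl) (λ _ _ _ _ _ → refl) i k p)

-- A valley is an East step followed by a North step, where a final North step is added to the path.
record Valley (p : List Step) (i k : ℕ) : Set where
  constructor valley
  field
    before : List Step
    x y : Step
    after : List Step
    eq : p ++ N ∷ [] ≡ before ++ x ∷ y ∷ after
    east : isEast x ≡ true
    north : isN y ≡ true
    i≡ : i ≡ suc (countE before)
    k≡ : k ≡ suc (countN before)

east-count : ∀ x i → (if isEast x then suc i else i) ≡ i + (if isEast x then 1 else 0)
east-count N i = sym (ℕP.+-identityʳ i)
east-count E i = ℕP.+-comm 1 i
east-count E⁺ i = ℕP.+-comm 1 i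
east-count E⁻ i = ℕP.+-comm 1 i

north-count : ∀ x i → (if isN x then suc i else i) ≡ i + (if isN x then 1 else 0)
north-count N i = ℕP.+-comm 1 i
north-count E i = sym (ℕP.+-identityʳ i)
north-count E⁺ i = sym (ℕP.+-identityʳ i)
north-count E⁻ i = sym (ℕP.+-identityʳ i)

record ValleyFrom (i₀ k₀ : ℕ) (p : List Step) (i k : ℕ) : Set where
  constructor valleyFrom
  field
    {i' k'} : ℕ
    isValley : Valley p i' k'
    i-eq : i ≡ i₀ + i'
    k-eq : k ≡ k₀ + k'

shift : ∀ a b c → a + b + suc c ≡ a + suc (b + c)
shift a b c = trans (ℕP.+-assoc a b (suc c)) (cong (λ k → a + k) (ℕP.+-suc b c))

∧-split : ∀ {a b} → a ∧ b ≡ true → a ≡ true × b ≡ true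
∧-split {true} {true} _ = refl , refl

valleysFrom-sound : ∀ i₀ k₀ p {i k} → (i , k) ∈ valleysFrom i₀ k₀ p → ValleyFrom i₀ k₀ p i k
valleysFrom-sound i₀ k₀ (x ∷ []) m with ∈-if (isEast x) m
... | e , refl = valleyFrom (valley [] x N [] refl e refl refl refl) (ℕP.+-comm 1 i₀) (ℕP.+-comm 1 k₀)
valleysFrom-sound i₀ k₀ (x ∷ y ∷ xs) {i} {k} m = go (∈-++⁻ (if isEast x ∧ isN y then (suc i₀ , suc k₀) ∷ [] else []) m)
  (valleysFrom-sound (if isEast x then suc i₀ else i₀) (if isN x then suc k₀ else k₀) (y ∷ xs))
  where
  go : (i , k) ∈ (if isEast x ∧ isN y then (suc i₀ , suc k₀) ∷ [] else [])
         ⊎ (i , k) ∈ valleysFrom (if isEast x then suc i₀ else i₀) (if isN x then suc k₀ else k₀) (y ∷ xs) →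
       (∀ {i k} → (i , k) ∈ valleysFrom (if isEast x then suc i₀ else i₀) (if isN x then suc k₀ else k₀) (y ∷ xs) →
         ValleyFrom (if isEast x then suc i₀ else i₀) (if isN x then suc k₀ else k₀) (y ∷ xs) i k) →
       ValleyFrom i₀ k₀ (x ∷ y ∷ xs) i k
  go (inj₁ m') _ with ∈-if (isEast x ∧ isN y) m'
  ... | e , refl = valleyFrom (valley [] x y (xs ++ N ∷ []) refl (proj₁ (∧-split e)) (proj₂ (∧-split e)) refl refl) (ℕP.+-comm 1 i₀) (ℕP.+-comm 1 k₀)
  go (inj₂ m') rec with rec m'
  ... | valleyFrom (valley bf a b af eq ea nb refl refl) i≡ k≡ =
    valleyFrom (valley (x ∷ bf) a b af (cong (x ∷_) eq) ea nb refl refl)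
      (trans i≡ (trans (cong (_+ suc (countE bf)) (east-count x i₀)) (shift i₀ (if isEast x then 1 else 0) (countE bf))))
      (trans k≡ (trans (cong (_+ suc (countN bf)) (north-count x k₀)) (shift k₀ (if isN x then 1 else 0) (countN bf))))

valleysFrom-complete : ∀ i₀ k₀ p bf a b af → p ++ N ∷ [] ≡ bf ++ a ∷ b ∷ af → isEast a ≡ true → isN b ≡ true →
  (i₀ + suc (countE bf) , k₀ + suc (countN bf)) ∈ valleysFrom i₀ k₀ p
valleysFrom-complete i₀ k₀ [] [] a b af () ea nb
valleysFrom-complete i₀ k₀ [] (_ ∷ []) a b af () ea nb
valleysFrom-complete i₀ k₀ [] (_ ∷ _ ∷ _) a b af () ea nb
valleysFrom-complete i₀ k₀ (x ∷ []) [] .x .N .[] refl ea nb =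
  subst (_∈ (if isEast x then (suc i₀ , suc k₀) ∷ [] else [])) (cong₂ _,_ (ℕP.+-comm 1 i₀) (ℕP.+-comm 1 k₀)) (∈-if⁺ {b = isEast x} ea)
valleysFrom-complete i₀ k₀ (x ∷ []) (_ ∷ []) a b af () ea nb
valleysFrom-complete i₀ k₀ (x ∷ []) (_ ∷ _ ∷ []) a b af () ea nb
valleysFrom-complete i₀ k₀ (x ∷ []) (_ ∷ _ ∷ _ ∷ _) a b af () ea nb
valleysFrom-complete i₀ k₀ (x ∷ y ∷ xs) [] .x .y .(xs ++ N ∷ []) refl ea nb =
  ∈-++⁺ˡ (subst (_∈ (if isEast x ∧ isN y then (suc i₀ , suc k₀) ∷ [] else [])) (cong₂ _,_ (ℕP.+-comm 1 i₀) (ℕP.+-comm 1 k₀)) (∈-if⁺ {b = isEast x ∧ isN y} (cong₂ _∧_ ea nb)))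
valleysFrom-complete i₀ k₀ (x ∷ y ∷ xs) (z ∷ bf) a b af eq ea nb =
  ∈-++⁺ʳ (if isEast x ∧ isN y then (suc i₀ , suc k₀) ∷ [] else [])
    (subst (_∈ valleysFrom (if isEast x then suc i₀ else i₀) (if isN x then suc k₀ else k₀) (y ∷ xs)) (cong₂ _,_
        (trans (cong (_+ suc (countE bf)) (east-count x i₀)) (trans (shift i₀ (if isEast x then 1 else 0) (countE bf)) (cong (λ x → i₀ + suc ((if isEast x then 1 else 0) + countE bf)) (LP.∷-injectiveˡ eq))))
        (trans (cong (_+ suc (countN bf)) (north-count x k₀)) (trans (shift k₀ (if isN x then 1 else 0) (countN bf)) (cong (λ x → k₀ + suc ((if isN x then 1 else 0) + countN bf)) (LP.∷-injectiveˡ eq)))))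
      (valleysFrom-complete (if isEast x then suc i₀ else i₀) (if isN x then suc k₀ else k₀) (y ∷ xs) bf a b af (LP.∷-injectiveʳ eq) ea nb))

valley⇒ : ∀ p {i k} → (i , k) ∈ valleys p → Valley p i k
valley⇒ p {i} {k} m with valleysFrom-sound 0 0 p (subst ((i , k) ∈_) (valleys≡ p) m)
... | valleyFrom v refl refl = v

⇒valley : ∀ p {i k} → Valley p i k → (i , k) ∈ valleys p
⇒valley p {i} {k} (valley bf a b af eq ea nb refl refl) = subst ((i , k) ∈_) (sym (valleys≡ p)) (valleysFrom-complete 0 0 p bf a b af eq ea nb)

valleysFrom-cong : ∀ i k p p' → map isN p ≡ map isN p' → valleysFrom i k p ≡ valleysFrom i k p'
valleysFrom-cong i k [] [] e = refl
valleysFrom-cong i k (x ∷ []) (x' ∷ []) e = cong (λ b → if not b then (suc i , suc k) ∷ [] else []) (LP.∷-injectiveˡ e)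
valleysFrom-cong i k (x ∷ y ∷ xs) (x' ∷ y' ∷ xs') e = cong₂ _++_
  (cong₂ (λ a b → if not a ∧ b then (suc i , suc k) ∷ [] else []) ex (LP.∷-injectiveˡ (LP.∷-injectiveʳ e)))
  (trans (cong₂ (λ a b → valleysFrom (if not a then suc i else i) (if b then suc k else k) (y ∷ xs)) ex ex)
    (valleysFrom-cong (if isEast x' then suc i else i) (if isN x' then suc k else k) (y ∷ xs) (y' ∷ xs') (LP.∷-injectiveʳ e)))
  where
  ex : isN x ≡ isN x'
  ex = LP.∷-injectiveˡ e
valleysFrom-cong i k (x ∷ []) (x' ∷ y' ∷ xs') ()
valleysFrom-cong i k (x ∷ y ∷ xs) (x' ∷ []) ()

-- Valleys only see which steps are North, so marking an East step does not affect them.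
valleys-cong : ∀ p p' → map isN p ≡ map isN p' → valleys p ≡ valleys p'
valleys-cong p p' e = trans (valleys≡ p) (trans (valleysFrom-cong 0 0 p p' e) (sym (valleys≡ p')))

east-N : ∀ s → isEast s ≡ true → isN s ≡ false
east-N E _ = refl
east-N E⁺ _ = refl
east-N E⁻ _ = refl

mark-isN : ∀ i s p → isEast s ≡ true → map isN (markAfterNorth i s p) ≡ map isN p
mark-isN i s [] es = refl
mark-isN i s (N ∷ xs) es with i ≡ᵇ 1
... | false = cong (true ∷_) (mark-isN (i ∸ 1) s xs es)
mark-isN i s (N ∷ []) es | true = refl
mark-isN i s (N ∷ N ∷ xs) es | true = refl
mark-isN i s (N ∷ E ∷ xs) es | true = cong (λ b → true ∷ b ∷ map isN xs) (east-N s es)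
mark-isN i s (N ∷ E⁺ ∷ xs) es | true = cong (λ b → true ∷ b ∷ map isN xs) (east-N s es)
mark-isN i s (N ∷ E⁻ ∷ xs) es | true = cong (λ b → true ∷ b ∷ map isN xs) (east-N s es)
mark-isN i s (E ∷ xs) es = cong (false ∷_) (mark-isN i s xs es)
mark-isN i s (E⁺ ∷ xs) es = cong (false ∷_) (mark-isN i s xs es)
mark-isN i s (E⁻ ∷ xs) es = cong (false ∷_) (mark-isN i s xs es)

-- The local function of afterNorth is the value of afterNorth at the first North step.
private
  after₁ : List Step → List Step
  after₁ xs = afterNorth (N ∷ xs) 1

  after₁-isN : ∀ xs xs' → map isN xs ≡ map isN xs' → map isN (after₁ xs) ≡ map isN (after₁ xs')
  after₁-isN [] [] e = refl
  after₁-isN (y ∷ _) (y' ∷ _) e = cong (_∷ []) (LP.∷-injectiveˡ e)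

afterNorth-isN : ∀ p p' i → map isN p ≡ map isN p' → map isN (afterNorth p i) ≡ map isN (afterNorth p' i)
afterNorth-isN [] [] i e = refl
afterNorth-isN (x ∷ xs) (x' ∷ xs') i e with isN x | isN x' | LP.∷-injectiveˡ e
... | false | .false | refl = afterNorth-isN xs xs' i (LP.∷-injectiveʳ e)
... | true | .true | refl with i ≡ᵇ 1
... | false = afterNorth-isN xs xs' (i ∸ 1) (LP.∷-injectiveʳ e)
... | true = after₁-isN xs xs' (LP.∷-injectiveʳ e)

nfe-value : ∀ p i {b} → map isN (afterNorth p i) ≡ b ∷ [] → NorthFollowedByE p i ≡ not b
nfe-value p i e with afterNorth p i
nfe-value p i refl | y ∷ [] = ∨-identityʳ (isEast y)

nfe-none : ∀ p i → map isN (afterNorth p i) ≡ [] → NorthFollowedByE p i ≡ false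
nfe-none p i e with afterNorth p i
nfe-none p i refl | [] = refl

-- The appended North step also agrees with the convention for a final North step, which is not
-- followed by an East step.
nfe-split : ∀ p bf y af → p ++ N ∷ [] ≡ bf ++ N ∷ y ∷ af → NorthFollowedByE p (suc (countN bf)) ≡ isEast y
nfe-split p bf y af e = go (split p bf e)
  where
  split : ∀ p bf → p ++ N ∷ [] ≡ bf ++ N ∷ y ∷ af → map isN (afterNorth p (suc (countN bf))) ≡ isN y ∷ []
    ⊎ (map isN (afterNorth p (suc (countN bf))) ≡ [] × y ≡ N)
  split (x ∷ []) [] refl = inj₂ (refl , refl)
  split (x ∷ z ∷ p) [] refl = inj₁ refl
  split [] (_ ∷ []) ()
  split [] (_ ∷ _ ∷ _) ()
  split (x ∷ p) (x' ∷ bf) e with LP.∷-injective e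
  split (N ∷ p) (.N ∷ bf) e | refl , e' = split p bf e'
  split (E ∷ p) (.E ∷ bf) e | refl , e' = split p bf e'
  split (E⁺ ∷ p) (.E⁺ ∷ bf) e | refl , e' = split p bf e'
  split (E⁻ ∷ p) (.E⁻ ∷ bf) e | refl , e' = split p bf e'
  go : _ → NorthFollowedByE p (suc (countN bf)) ≡ isEast y
  go (inj₁ q) = nfe-value p (suc (countN bf)) q
  go (inj₂ (q , refl)) = nfe-none p (suc (countN bf)) q

afterNorth-short : ∀ p i → (afterNorth p i ≡ []) ⊎ (∃[ y ] (afterNorth p i ≡ y ∷ []))
afterNorth-short [] i = inj₁ refl
afterNorth-short (x ∷ xs) i with isN x
... | false = afterNorth-short xs i
... | true with i ≡ᵇ 1
... | false = afterNorth-short xs (i ∸ 1)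
afterNorth-short (x ∷ []) i | true | true = inj₁ refl
afterNorth-short (x ∷ y ∷ xs) i | true | true = inj₂ (y , refl)

nfe-cong : ∀ p p' i → map isN p ≡ map isN p' → NorthFollowedByE p i ≡ NorthFollowedByE p' i
nfe-cong p p' i e = go (afterNorth p i) refl
  where
  pattern-eq : map isN (afterNorth p i) ≡ map isN (afterNorth p' i)
  pattern-eq = afterNorth-isN p p' i e
  go : ∀ l → afterNorth p i ≡ l → NorthFollowedByE p i ≡ NorthFollowedByE p' i
  go _ _ with afterNorth-short p i
  ... | inj₁ q = trans (nfe-none p i (cong (map isN) q)) (sym (nfe-none p' i (trans (sym pattern-eq) (cong (map isN) q))))
  ... | inj₂ (y , q) = trans (nfe-value p i (cong (map isN) q)) (sym (nfe-value p' i (trans (sym pattern-eq) (cong (map isN) q))))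

Plain : List Step → Set
Plain p = All (λ x → x ≡ N ⊎ x ≡ E) p

plain-em : ∀ p → Plain p → hasEm p ≡ false
plain-em [] [] = refl
plain-em (.N ∷ p) (inj₁ refl ∷ q) = plain-em p q
plain-em (.E ∷ p) (inj₂ refl ∷ q) = plain-em p q

mark-em⁺ : ∀ i p → Plain p → hasEm (markAfterNorth i E⁺ p) ≡ false
mark-em⁺ i [] [] = refl
mark-em⁺ i (.N ∷ p) (inj₁ refl ∷ q) with i ≡ᵇ 1
... | false = mark-em⁺ (i ∸ 1) p q
mark-em⁺ i (.N ∷ []) (inj₁ refl ∷ q) | true = refl
mark-em⁺ i (.N ∷ .N ∷ p) (inj₁ refl ∷ (inj₁ refl ∷ q)) | true = plain-em p q
mark-em⁺ i (.N ∷ .E ∷ p) (inj₁ refl ∷ (inj₂ refl ∷ q)) | true = plain-em p q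
mark-em⁺ i (.E ∷ p) (inj₂ refl ∷ q) = mark-em⁺ i p q

-- There is a step to mark only if the North step in question is followed by an East step; otherwise
-- ε stays 1.
mark-em⁻ : ∀ i p → Plain p → NorthFollowedByE p i ≡ true → hasEm (markAfterNorth i E⁻ p) ≡ true
mark-em⁻ i p pl nfe = go p i pl (east-next (afterNorth p i) refl)
  where
  east-next : ∀ l → afterNorth p i ≡ l → map isN (afterNorth p i) ≡ false ∷ []
  east-next l e with afterNorth-short p i
  ... | inj₁ q with trans (sym nfe) (nfe-none p i (cong (map isN) q))
  ... | ()
  east-next l e | inj₂ (y , q) with isN y in ey
  ... | false = trans (cong (map isN) q) (cong (_∷ []) ey)
  ... | true with trans (sym nfe) (nfe-value p i (trans (cong (map isN) q) (cong (_∷ []) ey)))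
  ... | ()
  go : ∀ p i → Plain p → map isN (afterNorth p i) ≡ false ∷ [] → hasEm (markAfterNorth i E⁻ p) ≡ true
  go [] i [] ()
  go (.N ∷ p) i (inj₁ refl ∷ q) e with i ≡ᵇ 1
  ... | false = go p (i ∸ 1) q e
  go (.N ∷ .E ∷ p) i (inj₁ refl ∷ (inj₂ refl ∷ q)) e | true = refl
  go (.N ∷ .N ∷ p) i (inj₁ refl ∷ (inj₁ refl ∷ q)) () | true
  go (.E ∷ p) i (inj₂ refl ∷ q) e = go p i q e

-- Consecutive letters of a sorted word.

module Descending {A : Set} (f : A → ℤ) where

  Sorted : List A → Set
  Sorted = AllPairs (λ s t → f t <ℤ f s)

  before-greater : ∀ xs {s ys m} → Sorted (xs ++ s ∷ ys) → m ∈ xs → f s <ℤ f m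
  before-greater xs p m∈ = pairs-split xs p m∈ (here refl)

  greater-before : ∀ xs {s ys m} → Sorted (xs ++ s ∷ ys) → m ∈ xs ++ s ∷ ys → f s <ℤ f m → m ∈ xs
  greater-before xs {s} {ys} p m∈ lt with ∈-++⁻ xs m∈
  ... | inj₁ q = q
  ... | inj₂ (here refl) = ⊥-elim (ℤP.<-irrefl refl lt)
  ... | inj₂ (there q) = ⊥-elim (ℤP.<-asym lt (All.lookup (AllPairs.head (pairs-right xs p)) q))

  none-between : ∀ xs {s t ys m} → Sorted (xs ++ s ∷ t ∷ ys) → m ∈ xs ++ s ∷ t ∷ ys → f m <ℤ f s → ¬ f t <ℤ f m
  none-between xs {s} {t} {ys} p m∈ m<s t<m with ∈-++⁻ xs m∈
  ... | inj₁ q = ℤP.<-asym m<s (before-greater xs p q)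
  ... | inj₂ (here refl) = ℤP.<-irrefl refl m<s
  ... | inj₂ (there (here refl)) = ℤP.<-irrefl refl t<m
  ... | inj₂ (there (there q)) = ℤP.<-asym t<m (All.lookup (AllPairs.head (AllPairs.tail (pairs-right xs p))) q)

  successor : ∀ W {s t} → Sorted W → s ∈ W → t ∈ W → f t <ℤ f s → ∃[ xs ] ∃[ u ] ∃[ ys ] (W ≡ xs ++ s ∷ u ∷ ys)
  successor (x ∷ W) (p ∷ ps) (here refl) (here refl) lt = ⊥-elim (ℤP.<-irrefl refl lt)
  successor (x ∷ u ∷ ys) (p ∷ ps) (here refl) (there t∈) lt = [] , u , ys , refl
  successor (x ∷ W) (p ∷ ps) (there s∈) (here refl) lt = ⊥-elim (ℤP.<-asym lt (All.lookup p s∈))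
  successor (x ∷ W) (p ∷ ps) (there s∈) (there t∈) lt with successor W ps s∈ t∈ lt
  ... | xs , u , ys , e = x ∷ xs , u , ys , cong (x ∷_) e

  neighbours : ∀ W {s t} → Sorted W → s ∈ W → t ∈ W → f t <ℤ f s → (∀ m → m ∈ W → f m <ℤ f s → ¬ f t <ℤ f m) →
    ∃[ xs ] ∃[ ys ] (W ≡ xs ++ s ∷ t ∷ ys)
  neighbours W {s} {t} p s∈ t∈ lt none with successor W p s∈ t∈ lt
  ... | xs , u , ys , refl with ∈-++⁻ xs t∈
  ... | inj₁ q = ⊥-elim (ℤP.<-asym lt (before-greater xs p q))
  ... | inj₂ (here refl) = ⊥-elim (ℤP.<-irrefl refl lt)
  ... | inj₂ (there (here refl)) = xs , ys , refl
  ... | inj₂ (there (there q)) = ⊥-elim (none u (∈-++⁺ʳ xs (there (here refl)))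
    (All.lookup (AllPairs.head (pairs-right xs p)) (here refl)) (All.lookup (AllPairs.head (AllPairs.tail (pairs-right xs p))) q))

map-split : ∀ {A B : Set} (f : A → B) ts bf {x y af} → map f ts ≡ bf ++ x ∷ y ∷ af →
  ∃[ xs ] ∃[ s ] ∃[ t ] ∃[ ys ] (ts ≡ xs ++ s ∷ t ∷ ys × map f xs ≡ bf × f s ≡ x × f t ≡ y)
map-split f [] [] ()
map-split f [] (_ ∷ _) ()
map-split f (s ∷ []) [] ()
map-split f (s ∷ t ∷ ts) [] e = [] , s , t , ts , refl , refl , LP.∷-injectiveˡ e , LP.∷-injectiveˡ (LP.∷-injectiveʳ e)
map-split f (s ∷ ts) (b ∷ bf) e with map-split f ts bf (LP.∷-injectiveʳ e)
... | xs , u , t , ys , refl , e₁ , e₂ , e₃ = s ∷ xs , u , t , ys , refl , cong₂ _∷_ (LP.∷-injectiveˡ e) e₁ , e₂ , e₃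

dropLast-∷ʳ : ∀ xs x → dropLast (xs ++ x ∷ []) ≡ xs
dropLast-∷ʳ [] x = refl
dropLast-∷ʳ (y ∷ []) x = refl
dropLast-∷ʳ (y ∷ z ∷ xs) x = cong (y ∷_) (dropLast-∷ʳ (z ∷ xs) x)

concatMap-downFrom : ∀ {A : Set} (f : ℕ → List A) k → concatMap f (downFrom (suc k)) ≡ concatMap (f ∘ suc) (downFrom k) ++ f 0
concatMap-downFrom f zero = LP.++-identityʳ (f 0)
concatMap-downFrom f (suc k) = trans (cong (f (suc k) ++_) (concatMap-downFrom f k)) (sym (LP.++-assoc (f (suc k)) _ (f 0)))

concatMap-idxUp : ∀ {A : Set} (f : ℕ → List A) k → concatMap f (idxUp (suc k)) ≡ concatMap f (idxUp k) ++ f (suc k)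
concatMap-idxUp f k = begin
  concatMap f (map suc (upTo (suc k))) ≡⟨ cong (λ l → concatMap f (map suc l)) (sym (LP.upTo-∷ʳ k)) ⟩
  concatMap f (map suc (upTo k ++ k ∷ [])) ≡⟨ cong (concatMap f) (LP.map-++ suc (upTo k) (k ∷ [])) ⟩
  concatMap f (idxUp k ++ suc k ∷ []) ≡⟨ LP.concatMap-++ f (idxUp k) (suc k ∷ []) ⟩
  concatMap f (idxUp k) ++ f (suc k) ++ [] ≡⟨ cong (concatMap f (idxUp k) ++_) (LP.++-identityʳ (f (suc k))) ⟩
  concatMap f (idxUp k) ++ f (suc k) ∎
  where open ≡-Reasoning

-- The word of ζ_D, with each letter traced to its row.

data Tok : Set where
  N⁺ N⁻ Eᵗ : ℕ → Tok

letter : Tok → Step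
letter (N⁺ k) = N
letter (N⁻ k) = N
letter (Eᵗ k) = E

-- The letters of the word read off μ, with the rows they come from. Every row gives a North step N⁺; row k gives a
-- second North step N⁻ if |x k| ≤ n − 1, and an East step otherwise. The one exception is the last letter of the word,
-- which is an East step if μ n = 1; since it is deleted, it may be replaced by N⁻ n.
module Word (n : ℕ) (μ : ZV) where

  nTok eTok eTok₀ : ℕ → ℕ → Tok
  nTok zero k = N⁻ k
  nTok (suc j) k = N⁺ k
  eTok zero k = if k ≡ᵇ n then N⁻ k else Eᵗ k
  eTok (suc j) k = Eᵗ k
  eTok₀ j k = Eᵗ k

  leftT : ℕ → ℕ → List Tok
  leftT j k = if eqZ (μ k) (- + j) then N⁺ k ∷ [] else if eqZ (μ k) (- + j - + 1) then Eᵗ k ∷ [] else []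

  rightT : (ℕ → ℕ → Tok) → ℕ → ℕ → List Tok
  rightT e j k = if eqZ (μ k) (+ j) then nTok j k ∷ [] else if eqZ (μ k) (+ j +ℤ + 1) then e j k ∷ [] else []

  leftB : ℕ → List Tok
  leftB j = concatMap (leftT j) (idxDown n)

  rightB blockT : (ℕ → ℕ → Tok) → ℕ → List Tok
  rightB e j = concatMap (rightT e j) (idxUp n)
  blockT e j = leftB j ++ rightB e j

  word : (ℕ → ℕ → Tok) → List Tok
  word e = concatMap (blockT e) (downFrom (2 ℕ.* n))

  path : List Step
  path = dropLast (concatMap (λ j → Sleft n μ (+ j) ++ Sright n μ (+ j)) (downFrom (2 ℕ.* n)))

  private
    letter-nTok : ∀ j k → letter (nTok j k) ≡ N
    letter-nTok zero k = refl
    letter-nTok (suc j) k = refl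

    left-letters : ∀ j → map letter (leftB j) ≡ Sleft n μ (+ j)
    left-letters j = trans (LP.map-concatMap letter (leftT j) (idxDown n)) (LP.concatMap-cong at (idxDown n))
      where
      at : ∀ k → map letter (leftT j k) ≡ (if eqZ (μ k) (- + j) then N ∷ [] else if eqZ (μ k) (- + j - + 1) then E ∷ [] else [])
      at k with eqZ (μ k) (- + j) | eqZ (μ k) (- + j - + 1)
      ... | true | _ = refl
      ... | false | true = refl
      ... | false | false = refl

    right-letters : ∀ j → map letter (rightB eTok₀ j) ≡ Sright n μ (+ j)
    right-letters j = trans (LP.map-concatMap letter (rightT eTok₀ j) (idxUp n)) (LP.concatMap-cong at (idxUp n))
      where
      at : ∀ k → map letter (rightT eTok₀ j k) ≡ (if eqZ (μ k) (+ j) then N ∷ [] else if eqZ (μ k) (+ j +ℤ + 1) then E ∷ [] else [])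
      at k with eqZ (μ k) (+ j) | eqZ (μ k) (+ j +ℤ + 1)
      ... | true | _ = cong (_∷ []) (letter-nTok j k)
      ... | false | true = refl
      ... | false | false = refl

  word₀-path : dropLast (map letter (word eTok₀)) ≡ path
  word₀-path = cong dropLast (trans (LP.map-concatMap letter (blockT eTok₀) (downFrom (2 ℕ.* n)))
    (LP.concatMap-cong (λ j → trans (LP.map-++ letter (leftB j) (rightB eTok₀ j)) (cong₂ _++_ (left-letters j) (right-letters j))) (downFrom (2 ℕ.* n))))

  private
    data Short : List Tok → List Tok → Set where
      none : Short [] []
      one : ∀ {s t} → Short (s ∷ []) (t ∷ [])

    dropLast-short : ∀ xs {u v} → Short u v → dropLast (map letter (xs ++ u)) ≡ dropLast (map letter (xs ++ v))
    dropLast-short xs none = refl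
    dropLast-short xs (one {s} {t}) = trans (cut s) (sym (cut t))
      where
      cut : ∀ s → dropLast (map letter (xs ++ s ∷ [])) ≡ map letter xs
      cut s = trans (cong dropLast (LP.map-++ letter xs (s ∷ []))) (dropLast-∷ʳ (map letter xs) (letter s))

    right-eq : ∀ k → ¬ k ≡ n → rightT eTok 0 k ≡ rightT eTok₀ 0 k
    right-eq k ne rewrite eqᵇ-false ne = refl

    local-cong : ∀ {A : Set} (f g : ℕ → List A) xs → (∀ {k} → k ∈ xs → f k ≡ g k) → concatMap f xs ≡ concatMap g xs
    local-cong f g [] q = refl
    local-cong f g (x ∷ xs) q = cong₂ _++_ (q (here refl)) (local-cong f g xs λ k∈ → q (there k∈))

  -- The two words differ at most in what row n contributes to the right half of block 0. This is
  -- the end of the word and at most one letter, so deleting the last letter removes the difference.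
  word-path : 1 ≤ n → dropLast (map letter (word eTok)) ≡ path
  word-path n≥1 = trans (go n refl n≥1) word₀-path
    where
    go : ∀ k → k ≡ n → 1 ≤ k → dropLast (map letter (word eTok)) ≡ dropLast (map letter (word eTok₀))
    go (suc k) k≡n _ = trans (cong (λ l → dropLast (map letter l)) (expand eTok pre refl))
      (trans (dropLast-short pre (short (eqZ (μ (suc k)) (+ 0)) (eqZ (μ (suc k)) (+ 0 +ℤ + 1))))
        (cong (λ l → dropLast (map letter l)) (sym (expand eTok₀ pre pre≡))))
      where
      pre₀ : (ℕ → ℕ → Tok) → List Tok
      pre₀ e = (concatMap (blockT e ∘ suc) (downFrom (k + suc (k + 0))) ++ leftB 0) ++ concatMap (rightT e 0) (idxUp k)
      pre : List Tok
      pre = pre₀ eTok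
      pre≡ : pre ≡ pre₀ eTok₀
      pre≡ = cong ((concatMap (blockT eTok ∘ suc) (downFrom (k + suc (k + 0))) ++ leftB 0) ++_)
        (local-cong (rightT eTok 0) (rightT eTok₀ 0) (idxUp k) λ {i} i∈ → right-eq i λ e → ℕP.<⇒≢ (s≤s (proj₂ (∈-idxUp⁻ i∈))) (trans e (sym k≡n)))
      short : ∀ (a b : Bool) → Short (if a then nTok 0 (suc k) ∷ [] else if b then eTok 0 (suc k) ∷ [] else [])
        (if a then nTok 0 (suc k) ∷ [] else if b then eTok₀ 0 (suc k) ∷ [] else [])
      short true b = one
      short false true = one
      short false false = none
      expand : ∀ e l → l ≡ pre₀ e → word e ≡ l ++ rightT e 0 (suc k)
      expand e .(pre₀ e) refl = begin
        concatMap (blockT e) (downFrom (2 ℕ.* n)) ≡⟨ cong (λ m → concatMap (blockT e) (downFrom (2 ℕ.* m))) (sym k≡n) ⟩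
        concatMap (blockT e) (downFrom (suc (k + suc (k + 0)))) ≡⟨ concatMap-downFrom (blockT e) (k + suc (k + 0)) ⟩
        P ++ leftB 0 ++ concatMap (rightT e 0) (idxUp n) ≡⟨ cong (λ m → P ++ leftB 0 ++ concatMap (rightT e 0) (idxUp m)) (sym k≡n) ⟩
        P ++ leftB 0 ++ concatMap (rightT e 0) (idxUp (suc k)) ≡⟨ cong (λ l → P ++ leftB 0 ++ l) (concatMap-idxUp (rightT e 0) k) ⟩
        P ++ leftB 0 ++ Q ++ rightT e 0 (suc k) ≡⟨ sym (LP.++-assoc P (leftB 0) _) ⟩
        (P ++ leftB 0) ++ Q ++ rightT e 0 (suc k) ≡⟨ sym (LP.++-assoc (P ++ leftB 0) Q _) ⟩
        ((P ++ leftB 0) ++ Q) ++ rightT e 0 (suc k) ∎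
        where
        open ≡-Reasoning
        P = concatMap (blockT e ∘ suc) (downFrom (k + suc (k + 0)))
        Q = concatMap (rightT e 0) (idxUp k)

plusRow minusRow eastRow : Tok → List ℕ
plusRow (N⁺ k) = k ∷ []
plusRow _ = []
minusRow (N⁻ k) = k ∷ []
minusRow _ = []
eastRow (Eᵗ k) = k ∷ []
eastRow _ = []

countE-rows : ∀ ts → countE (map letter ts) ≡ length (concatMap eastRow ts)
countE-rows [] = refl
countE-rows (N⁺ k ∷ ts) = countE-rows ts
countE-rows (N⁻ k ∷ ts) = countE-rows ts
countE-rows (Eᵗ k ∷ ts) = cong suc (countE-rows ts)

countN-rows : ∀ ts → countN (map letter ts) ≡ length (concatMap plusRow ts) + length (concatMap minusRow ts)
countN-rows [] = refl
countN-rows (N⁺ k ∷ ts) = cong suc (countN-rows ts)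
countN-rows (N⁻ k ∷ ts) = trans (cong suc (countN-rows ts)) (sym (ℕP.+-suc (length (concatMap plusRow ts)) _))
countN-rows (Eᵗ k ∷ ts) = countN-rows ts

inner-·v : ∀ n x c y → inner n x (c ·v y) ≡ c *ℤ inner n x y
inner-·v n x c y = trans (sumTo-cong n λ i _ → lia (x i ∷ c ∷ y i ∷ []) λ x c y → x :* (c :* y) :≡ c :* (x :* y)) (sumTo-* n c (λ i → x i *ℤ y i))

countN-east : ∀ xs k → countN (map letter (xs ++ Eᵗ k ∷ [])) ≡ countN (map letter xs)
countN-east [] k = refl
countN-east (t ∷ xs) k = cong (λ c → (if isN (letter t) then 1 else 0) + c) (countN-east xs k)

sub-index : ∀ n i → 1 ≤ i → i ≤ n → n + 1 ∸ suc (n ∸ i) ≡ i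
sub-index n i p q = trans (cong (_∸ suc (n ∸ i)) (ℕP.+-comm n 1)) (ℕP.m∸[m∸n]≡n q)

≤ᵇ-true : ∀ {i k} → i ≤ k → (i ℕ.≤ᵇ k) ≡ true
≤ᵇ-true {i} {k} p = dec-true (i ℕ.≤? k) p

≤ᵇ-false : ∀ {i k} → ¬ i ≤ k → (i ℕ.≤ᵇ k) ≡ false
≤ᵇ-false {i} {k} p = dec-false (i ℕ.≤? k) p

-- For the i-th row in the order of |x|, the East step gives the first index n + 1 - i of a valley.
-- For the k-th row, N⁺ gives the second index n + 1 - k and N⁻ gives n + k. The lemmas state
-- `alphaIJ` in these terms; k = 1 yields the indices n and n + 1, where ε enters.
module Roots (n : ℕ) (n≥1 : 1 ≤ n) (β : List Step) where

  ε : ℤ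
  ε = epsP β

  at-sub : ∀ i k → suc i ≤ n → 2 ≤ k → k ≤ n → alphaIJ n β (suc (n ∸ suc i)) (suc (n ∸ k)) ≡ e (+ suc i) ⊖ e (+ k)
  at-sub i (suc zero) i≤ (s≤s ()) k≤
  at-sub i (suc (suc k)) i≤ _ k≤ rewrite sub-index n (suc i) (s≤s z≤n) i≤ | sub-index n (suc (suc k)) (s≤s z≤n) k≤
    | ≤ᵇ-true {suc (n ∸ suc (suc k))} {n ∸ 1} (ℕP.∸-monoʳ-< (s≤s (s≤s z≤n)) k≤) = refl

  at-first⁻ : ∀ i → suc i ≤ n → alphaIJ n β (suc (n ∸ suc i)) n ≡ e (+ suc i) ⊖ (ε ·v e (+ 1))
  at-first⁻ i i≤ rewrite sub-index n (suc i) (s≤s z≤n) i≤ | ≤ᵇ-false {n} {n ∸ 1} (ℕP.<⇒≱ (ℕP.∸-monoʳ-< {n} {1} {0} (s≤s z≤n) n≥1)) | eqᵇ-true {n} refl = refl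

  at-first⁺ : ∀ i → suc i ≤ n → alphaIJ n β (suc (n ∸ suc i)) (suc n) ≡ e (+ suc i) ⊕ (ε ·v e (+ 1))
  at-first⁺ i i≤ rewrite sub-index n (suc i) (s≤s z≤n) i≤ | ≤ᵇ-false {suc n} {n ∸ 1} (ℕP.<⇒≱ (s≤s (ℕP.m∸n≤m n 1))) | eqᵇ-false {suc n} {n} (λ p → ℕP.<⇒≢ (ℕP.n<1+n n) (sym p)) | eqᵇ-true {n} refl = refl

  at-add : ∀ i k → suc i ≤ n → 2 ≤ k → alphaIJ n β (suc (n ∸ suc i)) (suc (n + (k ∸ 1))) ≡ e (+ suc i) ⊕ e (+ k)
  at-add i (suc zero) i≤ (s≤s ())
  at-add i (suc (suc k)) i≤ _ rewrite sub-index n (suc i) (s≤s z≤n) i≤ | ≤ᵇ-false {suc (n + suc k)} {n ∸ 1} (ℕP.<⇒≱ (s≤s (ℕP.≤-trans (ℕP.m∸n≤m n 1) (ℕP.m≤m+n n (suc k)))))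
    | eqᵇ-false {suc (n + suc k)} {n} (λ p → ℕP.<⇒≢ (s≤s (ℕP.m≤m+n n (suc k))) (sym p))
    | eqᵇ-false {n + suc k} {n} (λ p → ℕP.<⇒≢ (subst (suc n ≤_) (sym (ℕP.+-suc n k)) (s≤s (ℕP.m≤m+n n k))) (sym p))
    | sym (ℕP.+-suc n (suc k)) | ℕP.m+n∸m≡n n (suc (suc k)) = refl

-- The word is sorted by height, and its valleys are level.

module Tokens (n : ℕ) (n≥3 : 3 ≤ n) (q : ZV) (w₀ : SP) (s₀ : Signed n w₀) (μ : ZV)
  (x-eq' : ∀ i → InRange n i → val q (w₀ i) ≡ + i - + 1 - hD n *ℤ μ i)
  (som : Sommers n w₀ (λ i → - μ i)) (w : SP) (sw : Signed n w)
  (up' : ∀ i → 1 ≤ i → i ℕ.< n → val q (w i) <ℤ val q (w (suc i))) (lo' : + 0 <ℤ val q (w 1) +ℤ val q (w 2)) where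

  open Order n n≥3 q w₀ s₀ μ x-eq' w sw up' lo' public
  open Levels n n≥3 h h≡ w₀ x τ x-eq som using (On; over; step; walk; between; onClass; neg-range; On-cast) public
  open Word n μ public

  -- The word lists its letters by decreasing 4 · height + δ, where δ is 2 for E, 1 for N⁺ and 0 for N⁻.
  tkey : Tok → ℤ
  tkey (N⁺ k) = + 4 *ℤ key k +ℤ + 1
  tkey (N⁻ k) = - (+ 4 *ℤ key k)
  tkey (Eᵗ k) = + 4 *ℤ (key k - h - + 1) +ℤ + 2

  open Descending tkey public

  Valid : Tok → Set
  Valid (N⁺ k) = InRange n k
  Valid (N⁻ k) = InRange n k × key k ≤ℤ + n - + 1
  Valid (Eᵗ k) = InRange n k × + n ≤ℤ key k

  W : List Tok
  W = word eTok

  -- P is the position h j ± (k - 1) at which the letter is read. The offsets fill an interval of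
  -- length 3, so letters at distinct positions, which are 4 or more apart after scaling, are
  -- ordered like their positions.
  record Around (P : ℤ) (t : Tok) : Set where
    constructor around
    field
      offset : ℤ
      exact  : tkey t ≡ + 4 *ℤ P +ℤ offset
      bounds : - + 2 ≤ℤ offset × offset ≤ℤ + 1
      valid  : Valid t
  open Around

  private
    at-1 : - + 2 ≤ℤ + 1 × + 1 ≤ℤ + 1
    at-1 = -≤+ , ℤP.≤-refl
    at-0 : - + 2 ≤ℤ + 0 × + 0 ≤ℤ + 1
    at-0 = -≤+ , +≤+ z≤n
    at-2 : - + 2 ≤ℤ - + 2 × - + 2 ≤ℤ + 1
    at-2 = ℤP.≤-refl , -≤+

  left-N : ∀ j k → InRange n k → μ k ≡ - + j → Around (h *ℤ + j +ℤ (+ k - + 1)) (N⁺ k)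
  left-N j k rk e = around (+ 1) (lia (key k ∷ h *ℤ + j ∷ + k ∷ []) (λ x a k → x :≡ a :+ (k :- K 1) ⟹ K 4 :* x :+ K 1 :≡ K 4 :* (a :+ (k :- K 1)) :+ K 1) (proj₂ (key-neg k j rk e))) at-1 rk

  left-E : ∀ j k → InRange n k → μ k ≡ - + suc j → Around (h *ℤ + j +ℤ (+ k - + 1)) (Eᵗ k)
  left-E j k rk e = around (- + 2) (lia (key k ∷ h ∷ + j ∷ + k ∷ []) (λ x h j k → x :≡ h :* (K 1 :+ j) :+ (k :- K 1) ⟹ K 4 :* (x :- h :- K 1) :+ K 2 :≡ K 4 :* (h :* j :+ (k :- K 1)) :- K 2) (proj₂ (key-neg k (suc j) rk e))) at-2
    (rk , lia (key k ∷ h ∷ + j ∷ + k ∷ + n ∷ []) (λ x h j k n → x :≡ h :* (K 1 :+ j) :+ (k :- K 1) ⟹ K 0 :≤ h :* j ⟹ K 0 :≤ k :- K 1 ⟹ h :≡ K 2 :* n :- K 2 ⟹ K 3 :≤ n ⟹ n :≤ x)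
      (proj₂ (key-neg k (suc j) rk e)) (*-nonneg (ℤP.<⇒≤ h>0) (+≤+ z≤n)) (proj₁ (row≥ rk)) h≡ n≥3ℤ)

  right-N : ∀ j k → InRange n k → μ k ≡ + j → Around (h *ℤ + j - (+ k - + 1)) (nTok j k)
  right-N zero k rk e = around (+ 0) (lia (key k ∷ h ∷ + k ∷ []) (λ x h k → x :≡ h :* K 0 :+ (k :- K 1) ⟹ :- (K 4 :* x) :≡ K 4 :* (h :* K 0 :- (k :- K 1)) :+ K 0) (proj₂ (key-neg k 0 rk e))) at-0
    (rk , lia (key k ∷ h ∷ + k ∷ + n ∷ []) (λ x h k n → x :≡ h :* K 0 :+ (k :- K 1) ⟹ k :- K 1 :≤ n :- K 1 ⟹ x :≤ n :- K 1) (proj₂ (key-neg k 0 rk e)) (proj₂ (row≥ rk)))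
  right-N (suc j) k rk e = around (+ 1) (lia (key k ∷ h *ℤ + suc j ∷ + k ∷ []) (λ x a k → x :≡ a :- (k :- K 1) ⟹ K 4 :* x :+ K 1 :≡ K 4 :* (a :- (k :- K 1)) :+ K 1) (proj₁ (proj₂ (key-pos k j rk e)))) at-1 rk

  right-E' : ∀ j k → InRange n k → μ k ≡ + suc j → + n ≤ℤ key k → Around (h *ℤ + j - (+ k - + 1)) (Eᵗ k)
  right-E' j k rk e v = around (- + 2) (lia (key k ∷ h ∷ + j ∷ + k ∷ []) (λ x h j k → x :≡ h :* (K 1 :+ j) :- (k :- K 1) ⟹ K 4 :* (x :- h :- K 1) :+ K 2 :≡ K 4 :* (h :* j :- (k :- K 1)) :- K 2) (proj₁ (proj₂ (key-pos k j rk e)))) at-2 (rk , v)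

  right-E : ∀ j k → InRange n k → μ k ≡ + suc j → Around (h *ℤ + j - (+ k - + 1)) (eTok j k)
  right-E (suc j) k rk e = right-E' (suc j) k rk e
    (lia (key k ∷ h ∷ + j ∷ + k ∷ + n ∷ []) (λ x h j k n → x :≡ h :* (K 2 :+ j) :- (k :- K 1) ⟹ K 0 :≤ h :* j ⟹ k :- K 1 :≤ n :- K 1 ⟹ h :≡ K 2 :* n :- K 2 ⟹ K 3 :≤ n ⟹ n :≤ x)
      (proj₁ (proj₂ (key-pos k (suc j) rk e))) (*-nonneg (ℤP.<⇒≤ h>0) (+≤+ z≤n)) (proj₂ (row≥ rk)) h≡ n≥3ℤ)
  right-E zero k rk e with k ℕ.≟ n
  -- For μ n = 1 one has |x n| = h - (n - 1) = n - 1, so row n is among the rows with a second North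
  -- step.
  ... | yes refl rewrite eqᵇ-true {k} refl = around (+ 0) (lia (key k ∷ h ∷ + k ∷ []) (λ x h k → x :≡ h :* K 1 :- (k :- K 1) ⟹ h :≡ K 2 :* k :- K 2 ⟹ :- (K 4 :* x) :≡ K 4 :* (h :* K 0 :- (k :- K 1)) :+ K 0) (proj₁ (proj₂ (key-pos k 0 rk e))) h≡) at-0
    (rk , lia (key k ∷ h ∷ + k ∷ []) (λ x h k → x :≡ h :* K 1 :- (k :- K 1) ⟹ h :≡ K 2 :* k :- K 2 ⟹ x :≤ k :- K 1) (proj₁ (proj₂ (key-pos k 0 rk e))) h≡)
  ... | no ne rewrite eqᵇ-false ne = right-E' 0 k rk e
    (lia (key k ∷ h ∷ + k ∷ + n ∷ []) (λ x h k n → x :≡ h :* K 1 :- (k :- K 1) ⟹ K 1 :+ k :≤ n ⟹ h :≡ K 2 :* n :- K 2 ⟹ n :≤ x)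
      (proj₁ (proj₂ (key-pos k 0 rk e))) (+≤+ (ℕP.≤∧≢⇒< (proj₂ rk) ne)) h≡)

  data Left (j k : ℕ) : Tok → Set where
    leftN : μ k ≡ - + j → Left j k (N⁺ k)
    leftE : μ k ≡ - + suc j → Left j k (Eᵗ k)

  data Right (j k : ℕ) : Tok → Set where
    rightN : μ k ≡ + j → Right j k (nTok j k)
    rightE : μ k ≡ + suc j → Right j k (eTok j k)

  private
    pred-neg : ∀ j → - + j - + 1 ≡ - + suc j
    pred-neg j = lia (+ j ∷ []) λ j → :- j :- K 1 :≡ :- (K 1 :+ j)

    apart : ∀ j → ¬ + j ≡ + suc j
    apart j p = ℕP.<⇒≢ (ℕP.n<1+n j) (ℤP.+-injective p)

    succ-pos : ∀ j → + j +ℤ + 1 ≡ + suc j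
    succ-pos j = lia (+ j ∷ []) λ j → j :+ K 1 :≡ K 1 :+ j

  leftT⁻ : ∀ j k {t} → t ∈ leftT j k → Left j k t
  leftT⁻ j k m with eqZ (μ k) (- + j) in e₁ | eqZ (μ k) (- + j - + 1) in e₂
  leftT⁻ j k (here refl) | true | _ = leftN (eqZ-sound e₁)
  leftT⁻ j k (here refl) | false | true = leftE (trans (eqZ-sound e₂) (pred-neg j))

  rightT⁻ : ∀ j k {t} → t ∈ rightT eTok j k → Right j k t
  rightT⁻ j k m with eqZ (μ k) (+ j) in e₁ | eqZ (μ k) (+ j +ℤ + 1) in e₂
  rightT⁻ j k (here refl) | true | _ = rightN (eqZ-sound e₁)
  rightT⁻ j k (here refl) | false | true = rightE (trans (eqZ-sound e₂) (succ-pos j))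

  leftT⁺ : ∀ j k {t} → Left j k t → t ∈ leftT j k
  leftT⁺ j k (leftN e) rewrite eqZ-complete e = here refl
  leftT⁺ j k (leftE e) rewrite dec-false (μ k ℤP.≟ - + j) (λ e' → apart j (ℤP.neg-injective (trans (sym e') e))) | eqZ-complete (trans e (sym (pred-neg j))) = here refl

  rightT⁺ : ∀ j k {t} → Right j k t → t ∈ rightT eTok j k
  rightT⁺ j k (rightN e) rewrite eqZ-complete e = here refl
  rightT⁺ j k (rightE e) rewrite dec-false (μ k ℤP.≟ + j) (λ e' → apart j (trans (sym e') e)) | eqZ-complete (trans e (sym (succ-pos j))) = here refl

  left-near : ∀ j k {t} → InRange n k → Left j k t → Around (h *ℤ + j +ℤ (+ k - + 1)) t
  left-near j k rk (leftN e) = left-N j k rk e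
  left-near j k rk (leftE e) = left-E j k rk e

  right-near : ∀ j k {t} → InRange n k → Right j k t → Around (h *ℤ + j - (+ k - + 1)) t
  right-near j k rk (rightN e) = right-N j k rk e
  right-near j k rk (rightE e) = right-E j k rk e

  near-< : ∀ {P Q s t} → Around P s → Around Q t → Q +ℤ + 1 ≤ℤ P → tkey t <ℤ tkey s
  near-< {P} {Q} {s} {t} a b lt = lia (P ∷ Q ∷ tkey s ∷ tkey t ∷ offset a ∷ offset b ∷ []) (λ P Q s t u v → s :≡ K 4 :* P :+ u ⟹ t :≡ K 4 :* Q :+ v ⟹ :- K 2 :≤ u ⟹ v :≤ K 1 ⟹ Q :+ K 1 :≤ P ⟹ t :< s)
    (exact a) (exact b) (proj₁ (bounds a)) (proj₂ (bounds b)) lt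

  left≤0 : ∀ {j k t} → Left j k t → μ k ≤ℤ + 0
  left≤0 (leftN e) = subst (_≤ℤ + 0) (sym e) ℤP.neg-≤-pos
  left≤0 (leftE e) = subst (_≤ℤ + 0) (sym e) ℤP.neg-≤-pos

  right≥ : ∀ {j k t} → Right j k t → + j ≤ℤ μ k
  right≥ (rightN e) = ℤP.≤-reflexive (sym e)
  right≥ {j} (rightE e) = subst (+ j ≤ℤ_) (sym e) (+≤+ (ℕP.n≤1+n j))

  distinct : ∀ {k k'} → InRange n k → InRange n k' → ¬ k ≡ k' → + 1 ≤ℤ (+ k - + 1) +ℤ (+ k' - + 1) × (+ k - + 1) +ℤ (+ k' - + 1) ≤ℤ h - + 1
  distinct {k} {k'} rk rk' ne with ℕP.<-cmp k k'
  ... | tri≈ _ p _ = ⊥-elim (ne p)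
  ... | tri< lt _ _ = lia (+ k ∷ + k' ∷ []) (λ k l → K 1 :+ k :≤ l ⟹ K 1 :≤ k ⟹ K 1 :≤ (k :- K 1) :+ (l :- K 1)) (+≤+ lt) (+≤+ (proj₁ rk))
    , lia (+ k ∷ + k' ∷ + n ∷ h ∷ []) (λ k l n h → K 1 :+ k :≤ l ⟹ l :≤ n ⟹ h :≡ K 2 :* n :- K 2 ⟹ (k :- K 1) :+ (l :- K 1) :≤ h :- K 1) (+≤+ lt) (+≤+ (proj₂ rk')) h≡
  ... | tri> _ _ gt = lia (+ k ∷ + k' ∷ []) (λ k l → K 1 :+ l :≤ k ⟹ K 1 :≤ l ⟹ K 1 :≤ (k :- K 1) :+ (l :- K 1)) (+≤+ gt) (+≤+ (proj₁ rk'))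
    , lia (+ k ∷ + k' ∷ + n ∷ h ∷ []) (λ k l n h → K 1 :+ l :≤ k ⟹ k :≤ n ⟹ h :≡ K 2 :* n :- K 2 ⟹ (k :- K 1) :+ (l :- K 1) :≤ h :- K 1) (+≤+ gt) (+≤+ (proj₂ rk)) h≡

  left-left : ∀ {j k k' s t} → InRange n k → InRange n k' → k' ℕ.< k → Left j k s → Left j k' t → tkey t <ℤ tkey s
  left-left {j} {k} {k'} rk rk' lt a b = near-< (left-near j k rk a) (left-near j k' rk' b)
    (lia (h *ℤ + j ∷ + k ∷ + k' ∷ []) (λ a k l → K 1 :+ l :≤ k ⟹ a :+ (l :- K 1) :+ K 1 :≤ a :+ (k :- K 1)) (+≤+ lt))

  right-right : ∀ {j k k' s t} → InRange n k → InRange n k' → k ℕ.< k' → Right j k s → Right j k' t → tkey t <ℤ tkey s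
  right-right {j} {k} {k'} rk rk' lt a b = near-< (right-near j k rk a) (right-near j k' rk' b)
    (lia (h *ℤ + j ∷ + k ∷ + k' ∷ []) (λ a k l → K 1 :+ k :≤ l ⟹ a :- (l :- K 1) :+ K 1 :≤ a :- (k :- K 1)) (+≤+ lt))

  -- Row k is read from both sides at level j only if μ k = 0 = j.
  left-right : ∀ {j k k' s t} → InRange n k → InRange n k' → Left j k s → Right j k' t → tkey t <ℤ tkey s
  left-right {j} {k} {k'} rk rk' a b with k ℕ.≟ k'
  ... | no ne = near-< (left-near j k rk a) (right-near j k' rk' b)
    (lia (h *ℤ + j ∷ + k ∷ + k' ∷ []) (λ a k l → K 1 :≤ (k :- K 1) :+ (l :- K 1) ⟹ a :- (l :- K 1) :+ K 1 :≤ a :+ (k :- K 1)) (proj₁ (distinct rk rk' ne)))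
  ... | yes refl = zeroRow (ℤP.≤-antisym (left≤0 a) (ℤP.≤-trans (+≤+ z≤n) (right≥ b))) a b
    where
    key≥0 : + 0 ≤ℤ key k
    key≥0 = +≤+ z≤n
    zeroRow : μ k ≡ + 0 → ∀ {j s t} → Left j k s → Right j k t → tkey t <ℤ tkey s
    zeroRow z {zero} (leftN _) (rightN _) = lia (key k ∷ []) (λ x → K 0 :≤ x ⟹ :- (K 4 :* x) :< K 4 :* x :+ K 1) key≥0
    zeroRow z {suc j} (leftN e) _ with trans (sym z) e
    ... | ()
    zeroRow z {j} (leftE e) _ with trans (sym z) e
    ... | ()
    zeroRow z {j} _ (rightE e) with trans (sym z) e
    ... | ()

  private
    levels : ∀ {j j'} → j' ℕ.< j → h *ℤ + j' +ℤ h ≤ℤ h *ℤ + j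
    levels {j} {j'} lt = lia (h ∷ + j ∷ + j' ∷ []) (λ h j i → K 0 :≤ h :* (j :- (K 1 :+ i)) ⟹ h :* i :+ h :≤ h :* j)
      (*-nonneg (ℤP.<⇒≤ h>0) (lia (+ j ∷ + j' ∷ []) (λ j i → K 1 :+ i :≤ j ⟹ K 0 :≤ j :- (K 1 :+ i)) (+≤+ lt)))

  -- From block to block the base h j drops by at least h, which outweighs the shifts. The tight
  -- case is a right half followed by a left half: it needs (k - 1) + (k' - 1) < h, hence k ≠ k',
  -- which holds because μ is positive at k and not at k'.
  block-block : ∀ {j j' k k' s t} → j' ℕ.< j → InRange n k → InRange n k' → Left j k s ⊎ Right j k s → Left j' k' t ⊎ Right j' k' t → tkey t <ℤ tkey s
  block-block {j} {j'} {k} {k'} lt rk rk' (inj₁ a) (inj₁ b) = near-< (left-near j k rk a) (left-near j' k' rk' b)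
    (lia (h *ℤ + j ∷ h *ℤ + j' ∷ h ∷ + n ∷ + k ∷ + k' ∷ []) (λ a b h n k l → b :+ h :≤ a ⟹ h :≡ K 2 :* n :- K 2 ⟹ K 3 :≤ n ⟹ K 0 :≤ k :- K 1 ⟹ l :- K 1 :≤ n :- K 1 ⟹ b :+ (l :- K 1) :+ K 1 :≤ a :+ (k :- K 1))
      (levels lt) h≡ n≥3ℤ (proj₁ (row≥ rk)) (proj₂ (row≥ rk')))
  block-block {j} {j'} {k} {k'} lt rk rk' (inj₁ a) (inj₂ b) = near-< (left-near j k rk a) (right-near j' k' rk' b)
    (lia (h *ℤ + j ∷ h *ℤ + j' ∷ h ∷ + k ∷ + k' ∷ []) (λ a b h k l → b :+ h :≤ a ⟹ K 0 :< h ⟹ K 0 :≤ k :- K 1 ⟹ K 0 :≤ l :- K 1 ⟹ b :- (l :- K 1) :+ K 1 :≤ a :+ (k :- K 1))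
      (levels lt) h>0 (proj₁ (row≥ rk)) (proj₁ (row≥ rk')))
  block-block {j} {j'} {k} {k'} lt rk rk' (inj₂ a) (inj₂ b) = near-< (right-near j k rk a) (right-near j' k' rk' b)
    (lia (h *ℤ + j ∷ h *ℤ + j' ∷ h ∷ + n ∷ + k ∷ + k' ∷ []) (λ a b h n k l → b :+ h :≤ a ⟹ h :≡ K 2 :* n :- K 2 ⟹ K 3 :≤ n ⟹ k :- K 1 :≤ n :- K 1 ⟹ K 0 :≤ l :- K 1 ⟹ b :- (l :- K 1) :+ K 1 :≤ a :- (k :- K 1))
      (levels lt) h≡ n≥3ℤ (proj₂ (row≥ rk)) (proj₁ (row≥ rk')))
  block-block {j} {j'} {k} {k'} lt rk rk' (inj₂ a) (inj₁ b) = near-< (right-near j k rk a) (left-near j' k' rk' b)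
    (lia (h *ℤ + j ∷ h *ℤ + j' ∷ h ∷ + k ∷ + k' ∷ []) (λ a b h k l → b :+ h :≤ a ⟹ (k :- K 1) :+ (l :- K 1) :≤ h :- K 1 ⟹ b :+ (l :- K 1) :+ K 1 :≤ a :- (k :- K 1))
      (levels lt) (proj₂ (distinct rk rk' ne)))
    where
    ne : ¬ k ≡ k'
    ne refl = ℤP.<⇒≱ (ℤ.+<+ {0} {j} (ℕP.≤-trans (s≤s z≤n) lt)) (ℤP.≤-trans (right≥ a) (left≤0 b))

  leftB⁻ : ∀ j {t} → t ∈ leftB j → ∃[ k ] (InRange n k × Left j k t)
  leftB⁻ j m with find (∈-concatMap⁻ (leftT j) {xs = idxDown n} m)
  ... | k , k∈ , t∈ = k , ∈-idxDown⁻ k∈ , leftT⁻ j k t∈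

  rightB⁻ : ∀ j {t} → t ∈ rightB eTok j → ∃[ k ] (InRange n k × Right j k t)
  rightB⁻ j m with find (∈-concatMap⁻ (rightT eTok j) {xs = idxUp n} m)
  ... | k , k∈ , t∈ = k , ∈-idxUp⁻ k∈ , rightT⁻ j k t∈

  blockT⁻ : ∀ j {t} → t ∈ blockT eTok j → ∃[ k ] (InRange n k × (Left j k t ⊎ Right j k t))
  blockT⁻ j m with ∈-++⁻ (leftB j) m
  ... | inj₁ p = let k , rk , l = leftB⁻ j p in k , rk , inj₁ l
  ... | inj₂ p = let k , rk , l = rightB⁻ j p in k , rk , inj₂ l


  W-sorted : Sorted W
  W-sorted = pairs-concatMap (blockT eTok) {downFrom (2 ℕ.* n)}
    (λ {j} _ → pairs-++ (left-sorted j) (right-sorted j) λ {s} {t} s∈ t∈ → let k , rk , a = leftB⁻ j s∈ ; k' , rk' , b = rightB⁻ j t∈ in left-right rk rk' a b)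
    (AllPairs.map (λ {j} {j'} lt {s} {t} s∈ t∈ → let k , rk , a = blockT⁻ j s∈ ; k' , rk' , b = blockT⁻ j' t∈ in block-block lt rk rk' a b) (downFrom-sorted (2 ℕ.* n)))
    where
    pairs-if₂ : ∀ (b c : Bool) s t → Sorted (if b then s ∷ [] else if c then t ∷ [] else [])
    pairs-if₂ true c s t = [] ∷ []
    pairs-if₂ false c s t = pairs-if c t
    left-sorted : ∀ j → Sorted (leftB j)
    left-sorted j = pairs-concatMap (leftT j) (λ {k} _ → pairs-if₂ (eqZ (μ k) (- + j)) (eqZ (μ k) (- + j - + 1)) (N⁺ k) (Eᵗ k))
      (AllPairs.map (λ {k} {k'} p {s} {t} s∈ t∈ → left-left (proj₁ p) (proj₁ (proj₂ p)) (proj₂ (proj₂ p)) (leftT⁻ j k s∈) (leftT⁻ j k' t∈)) (pairs-ranged (idxDown-sorted n) ∈-idxDown⁻))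
    right-sorted : ∀ j → Sorted (rightB eTok j)
    right-sorted j = pairs-concatMap (rightT eTok j) (λ {k} _ → pairs-if₂ (eqZ (μ k) (+ j)) (eqZ (μ k) (+ j +ℤ + 1)) (nTok j k) (eTok j k))
      (AllPairs.map (λ {k} {k'} p {s} {t} s∈ t∈ → right-right (proj₁ p) (proj₁ (proj₂ p)) (proj₂ (proj₂ p)) (rightT⁻ j k s∈) (rightT⁻ j k' t∈)) (pairs-ranged (idxUp-sorted n) ∈-idxUp⁻))

  W⁻ : ∀ {t} → t ∈ W → Valid t
  W⁻ m with find (∈-concatMap⁻ (blockT eTok) {xs = downFrom (2 ℕ.* n)} m)
  ... | j , _ , t∈ with blockT⁻ j t∈
  ... | k , rk , inj₁ l = valid (left-near j k rk l)
  ... | k , rk , inj₂ l = valid (right-near j k rk l)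

  private
    μ-step : ∀ i → 1 ≤ i → i ℕ.< n → μ i - + 1 ≤ℤ μ (suc i)
    μ-step i p lt = lia (μ i ∷ μ (suc i) ∷ []) (λ u v → :- v :- :- u :≤ K 1 ⟹ u :- K 1 :≤ v) (Sommers.up≤ som i p lt)

    μ-from : ∀ i d → 1 ≤ i → i + d ≤ n → μ i - + d ≤ℤ μ (i + d)
    μ-from i zero p le = subst (λ k → μ i - + 0 ≤ℤ μ k) (sym (ℕP.+-identityʳ i)) (ℤP.≤-reflexive (ℤP.+-identityʳ (μ i)))
    μ-from i (suc d) p le = subst (λ k → μ i - + suc d ≤ℤ μ k) (sym (ℕP.+-suc i d))
      (lia (μ i ∷ μ (i + d) ∷ μ (suc (i + d)) ∷ + d ∷ []) (λ a b c d → a :- d :≤ b ⟹ b :- K 1 :≤ c ⟹ a :- (K 1 :+ d) :≤ c)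
        (μ-from i d p (ℕP.≤-trans (ℕP.n≤1+n _) le')) (μ-step (i + d) (ℕP.≤-trans p (ℕP.m≤m+n i d)) le'))
      where
      le' : suc (i + d) ≤ n
      le' = subst (_≤ n) (ℕP.+-suc i d) le

    -- Along the rows μ falls by at most 1 per step, while `lo≤` bounds it from below at the
    -- beginning and `hi≤` from above at the end. So the blocks with j < 2n contain all letters.
    μ-bounds : ∀ k → InRange n k → - + n ≤ℤ μ k × μ k ≤ℤ + n
    μ-bounds k rk = bounds′ n refl n≥3 k rk
      where
      bounds′ : ∀ m → m ≡ n → 3 ≤ m → ∀ k → InRange n k → - + n ≤ℤ μ k × μ k ≤ℤ + n
      bounds′ (suc zero) _ (s≤s ())
      bounds′ (suc (suc zero)) _ (s≤s (s≤s ()))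
      bounds′ (suc (suc (suc m))) refl _ k rk = low k rk , high k rk
        where
        N' = 3 + m
        μ12 : - + 1 ≤ℤ μ 1 +ℤ μ 2
        μ12 = lia (μ 1 ∷ μ 2 ∷ []) (λ u v → :- u :+ :- v :≤ K 1 ⟹ :- K 1 :≤ u :+ v) (Sommers.lo≤ som)
        μn : μ (2 + m) +ℤ μ N' ≤ℤ + 2
        μn = lia (μ (2 + m) ∷ μ N' ∷ []) (λ u v → :- K 2 :≤ :- u :+ :- v ⟹ u :+ v :≤ K 2) (Sommers.hi≤ som)
        μ2≥ : - + 1 ≤ℤ μ 2
        μ2≥ = lia (μ 1 ∷ μ 2 ∷ []) (λ u v → :- K 1 :≤ u :+ v ⟹ u :- K 1 :≤ v ⟹ :- K 1 :≤ v) μ12 (μ-step 1 (s≤s z≤n) (s≤s (s≤s z≤n)))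
        μpen≤ : μ (2 + m) ≤ℤ + 1
        μpen≤ = lia (μ (2 + m) ∷ μ N' ∷ []) (λ u v → u :+ v :≤ K 2 ⟹ u :- K 1 :≤ v ⟹ u :≤ K 1) μn (μ-step (2 + m) (s≤s z≤n) ℕP.≤-refl)
        from2 : ∀ i → 2 ≤ i → i ≤ N' → + 1 - + i ≤ℤ μ i
        from2 (suc (suc i)) (s≤s (s≤s z≤n)) le = lia (μ 2 ∷ + i ∷ μ (suc (suc i)) ∷ []) (λ a i b → :- K 1 :≤ a ⟹ a :- i :≤ b ⟹ K 1 :- (K 2 :+ i) :≤ b) μ2≥ (μ-from 2 i (s≤s z≤n) le)
        toPen : ∀ i → 1 ≤ i → i ≤ 2 + m → μ i ≤ℤ + N' - + i
        toPen i p le = lia (μ i ∷ μ (2 + m) ∷ + (2 + m ∸ i) ∷ + m ∷ + i ∷ []) (λ a b d m i → a :- d :≤ b ⟹ b :≤ K 1 ⟹ d :≡ K 2 :+ m :- i ⟹ a :≤ K 3 :+ m :- i)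
          (subst (λ k → μ i - + (2 + m ∸ i) ≤ℤ μ k) e≡ (μ-from i (2 + m ∸ i) p (ℕP.≤-trans (ℕP.≤-reflexive e≡) (ℕP.n≤1+n _)))) μpen≤
          (trans (sym (ℤP.⊖-≥ {2 + m} {i} le)) (sym (ℤP.m-n≡m⊖n (2 + m) i)))
          where
          e≡ : i + (2 + m ∸ i) ≡ 2 + m
          e≡ = ℕP.m+[n∸m]≡n le
        low : ∀ k → InRange N' k → - + N' ≤ℤ μ k
        low (suc zero) _ = lia (μ 1 ∷ μ 2 ∷ + m ∷ []) (λ u v m → :- K 1 :≤ u :+ v ⟹ v :≤ K 3 :+ m :- K 2 ⟹ :- (K 3 :+ m) :≤ u) μ12 (toPen 2 (s≤s z≤n) (s≤s (s≤s z≤n)))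
        low (suc (suc k)) (_ , le) = lia (μ (suc (suc k)) ∷ + suc (suc k) ∷ + m ∷ []) (λ u k m → K 1 :- k :≤ u ⟹ k :≤ K 3 :+ m ⟹ :- (K 3 :+ m) :≤ u) (from2 (suc (suc k)) (s≤s (s≤s z≤n)) le) (+≤+ le)
        high : ∀ k → InRange N' k → μ k ≤ℤ + N'
        high k (p , le) with ℕP.m≤n⇒m<n∨m≡n le
        ... | inj₁ (s≤s le') = lia (μ k ∷ + k ∷ + m ∷ []) (λ u k m → u :≤ K 3 :+ m :- k ⟹ K 1 :≤ k ⟹ u :≤ K 3 :+ m) (toPen k p le') (+≤+ p)
        ... | inj₂ refl = lia (μ (2 + m) ∷ μ N' ∷ + m ∷ []) (λ u v m → u :+ v :≤ K 2 ⟹ K 1 :- (K 2 :+ m) :≤ u ⟹ v :≤ K 3 :+ m) μn (from2 (2 + m) (s≤s (s≤s z≤n)) (ℕP.n≤1+n _))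

    in-W : ∀ {j t} → j ≤ n → t ∈ blockT eTok j → t ∈ W
    in-W {j} le t∈ = ∈-concatMap⁺ (blockT eTok) {xs = downFrom (2 ℕ.* n)} (lose (∈-downFrom⁺ (ℕP.<-≤-trans (s≤s le) n<2n)) t∈)
      where
      n<2n : suc n ≤ 2 ℕ.* n
      n<2n = subst (suc n ≤_) (cong (λ k → n + k) (sym (ℕP.+-identityʳ n))) (ℕP.+-monoˡ-≤ n n≥1)

    in-left : ∀ {j k t} → InRange n k → j ≤ n → Left j k t → t ∈ W
    in-left {j} {k} rk le l = in-W le (∈-++⁺ˡ (∈-concatMap⁺ (leftT j) {xs = idxDown n} (lose (∈-idxDown⁺ rk) (leftT⁺ j k l))))

    in-right : ∀ {j k t} → InRange n k → j ≤ n → Right j k t → t ∈ W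
    in-right {j} {k} rk le l = in-W le (∈-++⁺ʳ (leftB j) (∈-concatMap⁺ (rightT eTok j) {xs = idxUp n} (lose (∈-idxUp⁺ rk) (rightT⁺ j k l))))

    pos≤ : ∀ {k j} → InRange n k → μ k ≡ + j → j ≤ n
    pos≤ {k} rk e = ℤP.drop‿+≤+ (subst (_≤ℤ + n) e (proj₂ (μ-bounds k rk)))

    neg≤ : ∀ {k j} → InRange n k → μ k ≡ - + j → j ≤ n
    neg≤ {k} {j} rk e = ℤP.drop‿+≤+ (ℤP.neg-cancel-≤ (subst (- + n ≤ℤ_) e (proj₁ (μ-bounds k rk))))

  -- The condition |x k| ≤ n - 1 means μ k = 0, or μ k = 1 and k = n. In all other cases row k is
  -- read as an East step one level closer to 0.
  W⁺ : ∀ {t} → Valid t → t ∈ W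
  W⁺ {N⁺ k} rk = go (μ k) refl
    where
    go : ∀ u → μ k ≡ u → N⁺ k ∈ W
    go (+ zero) e = in-left rk z≤n (leftN e)
    go (+ suc j) e = in-right rk (pos≤ {k} rk e) (rightN e)
    go -[1+ j ] e = in-left rk (neg≤ {k} rk e) (leftN {suc j} e)
  W⁺ {N⁻ k} (rk , small) = go (μ k) refl
    where
    go : ∀ u → μ k ≡ u → N⁻ k ∈ W
    go (+ zero) e = in-right rk z≤n (rightN e)
    go (+ suc zero) e = in-right rk z≤n (subst (Right 0 k) (eTok-n (range-eq (lia (key k ∷ h ∷ + k ∷ + n ∷ [])
        (λ x h k n → x :≡ h :* K 1 :- (k :- K 1) ⟹ x :≤ n :- K 1 ⟹ k :≤ n ⟹ h :≡ K 2 :* n :- K 2 ⟹ k :≡ n) (proj₁ (proj₂ (key-pos k 0 rk e))) small (+≤+ (proj₂ rk)) h≡))) (rightE e))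
      where
      eTok-n : k ≡ n → eTok 0 k ≡ N⁻ k
      eTok-n e rewrite eqᵇ-true e = refl
    go (+ suc (suc j)) e = ⊥-elim (lia (key k ∷ h ∷ + k ∷ + n ∷ + j ∷ [])
      (λ x h k n j → x :≡ h :* (K 2 :+ j) :- (k :- K 1) ⟹ K 0 :≤ h :* j ⟹ x :≤ n :- K 1 ⟹ k :≤ n ⟹ h :≡ K 2 :* n :- K 2 ⟹ K 3 :≤ n ⟹ :⊥) (proj₁ (proj₂ (key-pos k (suc j) rk e))) (*-nonneg (ℤP.<⇒≤ h>0) (+≤+ z≤n)) small (+≤+ (proj₂ rk)) h≡ n≥3ℤ)
    go -[1+ j ] e = ⊥-elim (lia (key k ∷ h ∷ + k ∷ + n ∷ + j ∷ [])
      (λ x h k n j → x :≡ h :* (K 1 :+ j) :+ (k :- K 1) ⟹ K 0 :≤ h :* j ⟹ x :≤ n :- K 1 ⟹ K 1 :≤ k ⟹ h :≡ K 2 :* n :- K 2 ⟹ K 3 :≤ n ⟹ :⊥) (proj₂ (key-neg k (suc j) rk e)) (*-nonneg (ℤP.<⇒≤ h>0) (+≤+ z≤n)) small (+≤+ (proj₁ rk)) h≡ n≥3ℤ)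
  W⁺ {Eᵗ k} (rk , big) = go (μ k) refl
    where
    go : ∀ u → μ k ≡ u → Eᵗ k ∈ W
    go (+ zero) e = ⊥-elim (lia (key k ∷ h ∷ + k ∷ + n ∷ []) (λ x h k n → x :≡ h :* K 0 :+ (k :- K 1) ⟹ k :≤ n ⟹ n :≤ x ⟹ :⊥) (proj₂ (key-neg k 0 rk e)) (+≤+ (proj₂ rk)) big)
    go (+ suc (suc j)) e = in-right rk (ℕP.≤-trans (ℕP.n≤1+n _) (pos≤ {k} rk e)) (rightE e)
    go (+ suc zero) e = in-right rk z≤n (subst (Right 0 k) eTok-E (rightE e))
      where
      k≢n : ¬ k ≡ n
      k≢n refl = lia (key k ∷ h ∷ + k ∷ []) (λ x h n → x :≡ h :* K 1 :- (n :- K 1) ⟹ n :≤ x ⟹ h :≡ K 2 :* n :- K 2 ⟹ :⊥) (proj₁ (proj₂ (key-pos k 0 rk e))) big h≡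
      eTok-E : eTok 0 k ≡ Eᵗ k
      eTok-E rewrite eqᵇ-false k≢n = refl
    go -[1+ j ] e = in-left rk (ℕP.≤-trans (ℕP.n≤1+n _) (neg≤ {k} {suc j} rk e)) (leftE e)

  key≥ : ∀ c → InRange n ∣ c ∣ → + 0 ≤ℤ X c → key ∣ c ∣ ≡ X c
  key≥ c rc = go (signed± c rc)
    where
    go : ∀ {c} → Signed± n c → + 0 ≤ℤ X c → key ∣ c ∣ ≡ X c
    go (plus i ri) p = trans (cong (λ u → + ∣ u ∣) (sym (val-+ x i (proj₁ ri)))) (ℤP.0≤i⇒+∣i∣≡i p)
    go (minus (suc i) ri) p = trans (cong (λ u → + ∣ u ∣) (sym (val-+ x (suc i) (proj₁ ri))))
      (trans (cong +_ (sym (ℤP.∣-i∣≡∣i∣ (X (+ suc i))))) (trans (cong (λ u → + ∣ u ∣) (sym (X-neg (+ suc i)))) (ℤP.0≤i⇒+∣i∣≡i p)))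
    go (minus zero (() , _)) p

  key≤ : ∀ c → InRange n ∣ c ∣ → X c ≤ℤ + 0 → key ∣ c ∣ ≡ - X c
  key≤ c rc p = trans (cong key (sym (ℤP.∣-i∣≡∣i∣ c)))
    (trans (key≥ (- c) (neg-range {c} rc) (subst (+ 0 ≤ℤ_) (sym (X-neg c)) (ℤP.neg-mono-≤ p))) (X-neg c))

  record Lift (k : ℕ) : Set where
    field
      sign : ℤ
      range : InRange n ∣ sign ∣
      value : X sign ≡ key k

  lift : ∀ k → InRange n k → Lift k
  lift k rk with ℤP.≤-total (+ 0) (X (+ k))
  ... | inj₁ p = record { sign = + k ; range = rk ; value = sym (key≥ (+ k) rk p) }
  ... | inj₂ p = record { sign = - + k ; range = neg-range {+ k} rk ; value = trans (X-neg (+ k)) (sym (key≤ (+ k) rk p)) }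

  at : ∀ c {p} → InRange n ∣ c ∣ → X c ≡ p → On c p (+ 0)
  at c r refl = over c r

  betweenℤ : ∀ L → + 2 ≤ℤ L → ∀ c p b m → On c p (+ 0) → On b (p +ℤ L) m → + 1 ≤ℤ m →
    ∃[ s ] ∃[ c' ] (+ 1 ≤ℤ s × s +ℤ + 1 ≤ℤ L × InRange n ∣ c' ∣ × (X c' ≡ p +ℤ s ⊎ X c' ≡ p +ℤ s +ℤ h))
  betweenℤ (+ suc (suc k)) _ c p b m oc ob m≥1 with between k c p b m oc ob m≥1
  ... | s , c' , d , s≥1 , s≤k , (rc , oc') , d01 = + s , c' , +≤+ s≥1
    , lia (+ s ∷ + k ∷ []) (λ s k → s :≤ K 1 :+ k ⟹ s :+ K 1 :≤ K 2 :+ k) (+≤+ s≤k) , rc , level d01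
    where
    level : d ≡ + 0 ⊎ d ≡ + 1 → X c' ≡ p +ℤ + s ⊎ X c' ≡ p +ℤ + s +ℤ h
    level (inj₁ refl) = inj₁ (lia (X c' ∷ p ∷ + s ∷ h ∷ []) (λ x p s h → x :≡ p :+ s :+ h :* K 0 ⟹ x :≡ p :+ s) oc')
    level (inj₂ refl) = inj₂ (lia (X c' ∷ p ∷ + s ∷ h ∷ []) (λ x p s h → x :≡ p :+ s :+ h :* K 1 ⟹ x :≡ p :+ s :+ h) oc')
  betweenℤ (+ zero) (+≤+ ())
  betweenℤ (+ suc zero) (+≤+ (s≤s ()))
  betweenℤ -[1+ _ ] ()

  below : ∀ {y m} → ¬ y ≤ℤ m - + 1 → m ≤ℤ y
  below {y} {m} p = lia (y ∷ m ∷ []) (λ y m → m :- K 1 :< y ⟹ m :≤ y) (ℤP.≰⇒> p)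

  -- No East step is last.
  lowerTok : ∀ k → Valid (Eᵗ k) → ∃[ t ] (Valid t × tkey t <ℤ tkey (Eᵗ k))
  -- The signed row of value |x k| has level 1 over |x k| - h, and its negative has level 0 over -|x
  -- k|. As |x k| ≥ n, these places are at least 2 apart, so some row lies between them, and one of
  -- its letters is lower.
  lowerTok k (rk , big) with betweenℤ (key k +ℤ key k - h)
      (lia (key k ∷ h ∷ + n ∷ []) (λ x h n → n :≤ x ⟹ h :≡ K 2 :* n :- K 2 ⟹ K 2 :≤ x :+ x :- h) big h≡)
      (- Lift.sign (lift k rk)) (- key k) (Lift.sign (lift k rk)) (+ 1)
      (at (- Lift.sign (lift k rk)) (neg-range {Lift.sign (lift k rk)} (Lift.range (lift k rk))) (trans (X-neg (Lift.sign (lift k rk))) (cong -_ (Lift.value (lift k rk)))))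
      (Lift.range (lift k rk) , trans (Lift.value (lift k rk)) (lia (key k ∷ h ∷ []) λ x h → x :≡ :- x :+ (x :+ x :- h) :+ h :* K 1)) ℤP.≤-refl
  ... | s , c , s≥1 , s≤ , rc , inj₁ z≡ = go (ℤP.≤-total (+ 0) (X c))
    where
    go : + 0 ≤ℤ X c ⊎ X c ≤ℤ + 0 → ∃[ t ] (Valid t × tkey t <ℤ tkey (Eᵗ k))
    go (inj₁ p) = N⁺ ∣ c ∣ , rc , lia (key ∣ c ∣ ∷ X c ∷ key k ∷ s ∷ h ∷ [])
      (λ y z x s h → y :≡ z ⟹ z :≡ :- x :+ s ⟹ s :+ K 1 :≤ x :+ x :- h ⟹ K 4 :* y :+ K 1 :< K 4 :* (x :- h :- K 1) :+ K 2) (key≥ c rc p) z≡ s≤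
    go (inj₂ p) with key ∣ c ∣ ℤP.≤? + n - + 1
    ... | yes small = N⁻ ∣ c ∣ , (rc , small) , lia (key ∣ c ∣ ∷ X c ∷ key k ∷ s ∷ h ∷ [])
      (λ y z x s h → y :≡ :- z ⟹ z :≡ :- x :+ s ⟹ s :+ K 1 :≤ x :+ x :- h ⟹ :- (K 4 :* y) :< K 4 :* (x :- h :- K 1) :+ K 2) (key≤ c rc p) z≡ s≤
    ... | no large = Eᵗ ∣ c ∣ , (rc , below large) , lia (key ∣ c ∣ ∷ X c ∷ key k ∷ s ∷ h ∷ [])
      (λ y z x s h → y :≡ :- z ⟹ z :≡ :- x :+ s ⟹ K 1 :≤ s ⟹ K 4 :* (y :- h :- K 1) :+ K 2 :< K 4 :* (x :- h :- K 1) :+ K 2) (key≤ c rc p) z≡ s≥1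
  ... | s , c , s≥1 , s≤ , rc , inj₂ z≡ = go (ℤP.≤-total (+ 0) (X c))
    where
    go : + 0 ≤ℤ X c ⊎ X c ≤ℤ + 0 → ∃[ t ] (Valid t × tkey t <ℤ tkey (Eᵗ k))
    go (inj₁ p) with key ∣ c ∣ ℤP.≤? + n - + 1
    ... | yes small = N⁻ ∣ c ∣ , (rc , small) , lia (key ∣ c ∣ ∷ X c ∷ key k ∷ s ∷ h ∷ [])
      (λ y z x s h → y :≡ z ⟹ z :≡ :- x :+ s :+ h ⟹ K 1 :≤ s ⟹ :- (K 4 :* y) :< K 4 :* (x :- h :- K 1) :+ K 2) (key≥ c rc p) z≡ s≥1
    ... | no large = Eᵗ ∣ c ∣ , (rc , below large) , lia (key ∣ c ∣ ∷ X c ∷ key k ∷ s ∷ h ∷ [])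
      (λ y z x s h → y :≡ z ⟹ z :≡ :- x :+ s :+ h ⟹ s :+ K 1 :≤ x :+ x :- h ⟹ K 4 :* (y :- h :- K 1) :+ K 2 :< K 4 :* (x :- h :- K 1) :+ K 2) (key≥ c rc p) z≡ s≤
    go (inj₂ p) with key ∣ c ∣ ℤP.≤? + n - + 1
    ... | yes small = N⁻ ∣ c ∣ , (rc , small) , lia (key ∣ c ∣ ∷ X c ∷ key k ∷ s ∷ h ∷ [])
      (λ y z x s h → y :≡ :- z ⟹ z :≤ K 0 ⟹ z :≡ :- x :+ s :+ h ⟹ K 1 :≤ s ⟹ :- (K 4 :* y) :< K 4 :* (x :- h :- K 1) :+ K 2) (key≤ c rc p) p z≡ s≥1
    ... | no large = Eᵗ ∣ c ∣ , (rc , below large) , lia (key ∣ c ∣ ∷ X c ∷ key k ∷ s ∷ h ∷ [])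
      (λ y z x s h → y :≡ :- z ⟹ z :≡ :- x :+ s :+ h ⟹ K 1 :≤ s ⟹ K 0 :< h ⟹ K 4 :* (y :- h :- K 1) :+ K 2 :< K 4 :* (x :- h :- K 1) :+ K 2) (key≤ c rc p) z≡ s≥1 h>0

  height : Tok → ℤ
  height (N⁺ k) = key k
  height (N⁻ k) = - key k
  height (Eᵗ k) = key k - h - + 1

  NoneBetween : Tok → Tok → Set
  NoneBetween s t = ∀ m → Valid m → tkey m <ℤ tkey s → ¬ tkey t <ℤ tkey m

  private
    -- Here c is the signed row, of value V, behind the North step t. If V were below the height of
    -- the East step, a row at level 0 or 1 would lie between V and |x k| - h. One of its letters,
    -- North at level 0 and East at level 1, would stand between the two.
    meet : ∀ k t V c → Valid (Eᵗ k) → InRange n ∣ c ∣ → X c ≡ V → - (+ n - + 1) ≤ℤ V → + 4 *ℤ V ≤ℤ tkey t → tkey t ≤ℤ + 4 *ℤ V +ℤ + 1 →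
      tkey t <ℤ tkey (Eᵗ k) → NoneBetween (Eᵗ k) t → V ≡ height (Eᵗ k)
    meet k t V c (rk , big) rc xc V≥ t≥ t≤ t<E none with V ℤP.≟ key k - h - + 1
    ... | yes p = p
    ... | no ne with betweenℤ (key k - h - V)
        (lia (key k ∷ h ∷ V ∷ []) (λ x h V → V :< x :- h :- K 1 ⟹ K 2 :≤ x :- h :- V) (ℤP.≤∧≢⇒<
          (lia (V ∷ tkey t ∷ key k ∷ h ∷ []) (λ V T x h → K 4 :* V :≤ T ⟹ T :< K 4 :* (x :- h :- K 1) :+ K 2 ⟹ V :≤ x :- h :- K 1) t≥ t<E) ne))
        c V (Lift.sign (lift k rk)) (+ 1) (at c rc xc)
        (Lift.range (lift k rk) , trans (Lift.value (lift k rk)) (lia (key k ∷ V ∷ h ∷ []) λ x V h → x :≡ V :+ (x :- h :- V) :+ h :* K 1)) ℤP.≤-refl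
    ... | s , d , s≥1 , s≤ , rd , inj₁ z≡ = ⊥-elim (go (ℤP.≤-total (+ 0) (X d)))
      where
      go : + 0 ≤ℤ X d ⊎ X d ≤ℤ + 0 → ⊥
      go (inj₁ p) = none (N⁺ ∣ d ∣) rd
        (lia (key ∣ d ∣ ∷ X d ∷ key k ∷ V ∷ s ∷ h ∷ []) (λ y z x V s h → y :≡ z ⟹ z :≡ V :+ s ⟹ s :+ K 1 :≤ x :- h :- V ⟹ K 4 :* y :+ K 1 :< K 4 :* (x :- h :- K 1) :+ K 2) (key≥ d rd p) z≡ s≤)
        (lia (key ∣ d ∣ ∷ X d ∷ V ∷ s ∷ tkey t ∷ []) (λ y z V s T → y :≡ z ⟹ z :≡ V :+ s ⟹ K 1 :≤ s ⟹ T :≤ K 4 :* V :+ K 1 ⟹ T :< K 4 :* y :+ K 1) (key≥ d rd p) z≡ s≥1 t≤)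
      go (inj₂ p) = none (N⁻ ∣ d ∣) (rd , lia (key ∣ d ∣ ∷ X d ∷ V ∷ s ∷ + n ∷ []) (λ y z V s n → y :≡ :- z ⟹ z :≡ V :+ s ⟹ K 1 :≤ s ⟹ :- (n :- K 1) :≤ V ⟹ y :≤ n :- K 1) (key≤ d rd p) z≡ s≥1 V≥)
        (lia (key ∣ d ∣ ∷ X d ∷ key k ∷ V ∷ s ∷ h ∷ []) (λ y z x V s h → y :≡ :- z ⟹ z :≡ V :+ s ⟹ s :+ K 1 :≤ x :- h :- V ⟹ :- (K 4 :* y) :< K 4 :* (x :- h :- K 1) :+ K 2) (key≤ d rd p) z≡ s≤)
        (lia (key ∣ d ∣ ∷ X d ∷ V ∷ s ∷ tkey t ∷ []) (λ y z V s T → y :≡ :- z ⟹ z :≡ V :+ s ⟹ K 1 :≤ s ⟹ T :≤ K 4 :* V :+ K 1 ⟹ T :< :- (K 4 :* y)) (key≤ d rd p) z≡ s≥1 t≤)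
    ... | s , d , s≥1 , s≤ , rd , inj₂ z≡ = ⊥-elim (none (Eᵗ ∣ d ∣) (rd , lia (key ∣ d ∣ ∷ X d ∷ + n ∷ []) (λ y z n → y :≡ z ⟹ n :≤ z ⟹ n :≤ y) d≡ d≥n)
        (lia (key ∣ d ∣ ∷ X d ∷ key k ∷ V ∷ s ∷ h ∷ []) (λ y z x V s h → y :≡ z ⟹ z :≡ V :+ s :+ h ⟹ s :+ K 1 :≤ x :- h :- V ⟹ K 4 :* (y :- h :- K 1) :+ K 2 :< K 4 :* (x :- h :- K 1) :+ K 2) d≡ z≡ s≤)
        (lia (key ∣ d ∣ ∷ X d ∷ V ∷ s ∷ tkey t ∷ h ∷ []) (λ y z V s T h → y :≡ z ⟹ z :≡ V :+ s :+ h ⟹ K 1 :≤ s ⟹ T :≤ K 4 :* V :+ K 1 ⟹ T :< K 4 :* (y :- h :- K 1) :+ K 2) d≡ z≡ s≥1 t≤))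
      where
      d≥n : + n ≤ℤ X d
      d≥n = lia (X d ∷ V ∷ s ∷ h ∷ + n ∷ []) (λ z V s h n → z :≡ V :+ s :+ h ⟹ K 1 :≤ s ⟹ :- (n :- K 1) :≤ V ⟹ h :≡ K 2 :* n :- K 2 ⟹ n :≤ z) z≡ s≥1 V≥ h≡
      d≡ : key ∣ d ∣ ≡ X d
      d≡ = key≥ d rd (ℤP.≤-trans (+≤+ z≤n) d≥n)

  data IsNorth : Tok → Set where
    north⁺ : ∀ {k} → IsNorth (N⁺ k)
    north⁻ : ∀ {k} → IsNorth (N⁻ k)

  equalHeights : ∀ k {t} → Valid (Eᵗ k) → Valid t → IsNorth t → tkey t <ℤ tkey (Eᵗ k) → NoneBetween (Eᵗ k) t → height t ≡ height (Eᵗ k)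
  equalHeights k {t} vE vt (north⁺ {i}) lt none = meet k t (key i) (Lift.sign (lift i vt)) vE (Lift.range (lift i vt)) (Lift.value (lift i vt))
    (lia (key i ∷ + n ∷ []) (λ y n → K 0 :≤ y ⟹ K 3 :≤ n ⟹ :- (n :- K 1) :≤ y) (+≤+ z≤n) n≥3ℤ)
    (lia (key i ∷ []) λ y → K 4 :* y :≤ K 4 :* y :+ K 1) ℤP.≤-refl lt none
  equalHeights k {t} vE (ri , small) (north⁻ {i}) lt none = meet k t (- key i) (- Lift.sign (lift i ri)) vE (neg-range {Lift.sign (lift i ri)} (Lift.range (lift i ri)))
    (trans (X-neg (Lift.sign (lift i ri))) (cong -_ (Lift.value (lift i ri))))
    (ℤP.neg-mono-≤ small) (lia (key i ∷ []) λ y → K 4 :* :- y :≤ :- (K 4 :* y)) (lia (key i ∷ []) λ y → :- (K 4 :* y) :≤ K 4 :* :- y :+ K 1) lt none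

  -- Conversely, only N⁺ and N⁻ of one and the same row 1 can have equal heights.
  adjacent : ∀ k {t} → Valid (Eᵗ k) → Valid t → IsNorth t → height t ≡ height (Eᵗ k) → (∀ {i} → t ≡ N⁻ i → ¬ key i ≡ + 0) →
    ∃[ xs ] ∃[ ys ] (W ≡ xs ++ Eᵗ k ∷ t ∷ ys)
  adjacent k {t} vE vt nt ht nz = neighbours W W-sorted (W⁺ vE) (W⁺ vt) (lt nt ht) λ m m∈ → none nt ht nz m
    where
    lt : ∀ {t} → IsNorth t → height t ≡ height (Eᵗ k) → tkey t <ℤ tkey (Eᵗ k)
    lt (north⁺ {i}) e = lia (key i ∷ key k ∷ h ∷ []) (λ y x h → y :≡ x :- h :- K 1 ⟹ K 4 :* y :+ K 1 :< K 4 :* (x :- h :- K 1) :+ K 2) e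
    lt (north⁻ {i}) e = lia (key i ∷ key k ∷ h ∷ []) (λ y x h → :- y :≡ x :- h :- K 1 ⟹ :- (K 4 :* y) :< K 4 :* (x :- h :- K 1) :+ K 2) e
    none : ∀ {t} → IsNorth t → height t ≡ height (Eᵗ k) → (∀ {i} → t ≡ N⁻ i → ¬ key i ≡ + 0) → ∀ m → tkey m <ℤ tkey (Eᵗ k) → ¬ tkey t <ℤ tkey m
    none (north⁺ {i}) e nz m m<E t<m = lia (key i ∷ key k ∷ h ∷ tkey m ∷ []) (λ y x h T → y :≡ x :- h :- K 1 ⟹ T :< K 4 :* (x :- h :- K 1) :+ K 2 ⟹ K 4 :* y :+ K 1 :< T ⟹ :⊥) e m<E t<m
    none (north⁻ {i}) e nz (N⁺ m) m<E t<m = nz refl (lia (key i ∷ key k ∷ h ∷ key m ∷ [])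
      (λ y x h z → :- y :≡ x :- h :- K 1 ⟹ K 0 :≤ y ⟹ K 0 :≤ z ⟹ K 4 :* z :+ K 1 :< K 4 :* (x :- h :- K 1) :+ K 2 ⟹ y :≡ K 0) e (+≤+ z≤n) (+≤+ z≤n) m<E)
    none (north⁻ {i}) e nz (N⁻ m) m<E t<m = four (height (Eᵗ k)) (- key m)
      (lia (key m ∷ height (Eᵗ k) ∷ []) (λ z H → :- (K 4 :* z) :< K 4 :* H :+ K 2 ⟹ K 4 :* :- z :< K 4 :* H :+ K 2) m<E)
      (lia (key i ∷ key m ∷ height (Eᵗ k) ∷ []) (λ y z H → :- y :≡ H ⟹ :- (K 4 :* y) :< :- (K 4 :* z) ⟹ K 4 :* H :< K 4 :* :- z) e t<m)
      where
      four : ∀ H z → + 4 *ℤ z <ℤ + 4 *ℤ H +ℤ + 2 → ¬ + 4 *ℤ H <ℤ + 4 *ℤ z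
      four H z a b = lia (H ∷ z ∷ []) (λ H z → H :< z ⟹ K 4 :* z :< K 4 :* H :+ K 2 ⟹ :⊥) (ℤP.*-cancelˡ-<-nonNeg (+ 4) b) a
    none (north⁻ {i}) e nz (Eᵗ m) m<E t<m = four (height (Eᵗ k)) (key m - h - + 1)
      m<E (lia (key i ∷ key m - h - + 1 ∷ height (Eᵗ k) ∷ []) (λ y z H → :- y :≡ H ⟹ :- (K 4 :* y) :< K 4 :* z :+ K 2 ⟹ K 4 :* H :< K 4 :* z :+ K 2) e t<m)
      where
      four : ∀ H z → + 4 *ℤ z +ℤ + 2 <ℤ + 4 *ℤ H +ℤ + 2 → ¬ + 4 *ℤ H <ℤ + 4 *ℤ z +ℤ + 2
      four H z a b = lia (H ∷ z ∷ []) (λ H z → z :< H ⟹ K 4 :* H :< K 4 :* z :+ K 2 ⟹ :⊥) (ℤP.*-cancelˡ-<-nonNeg (+ 4) (lia (+ 4 *ℤ z ∷ + 4 *ℤ H ∷ []) (λ a b → a :+ K 2 :< b :+ K 2 ⟹ a :< b) a)) b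

  1∈ : InRange n 1
  1∈ = ℕP.≤-refl , n≥1

  -- One kind of letter: its constructor C, and the row of a letter as a list that is empty for the
  -- other kinds.
  record Listed (C : ℕ → Tok) (rows : Tok → List ℕ) : Set₁ where
    field
      sound : ∀ {t k} → k ∈ rows t → t ≡ C k
      complete : ∀ k → k ∈ rows (C k)
      short : ∀ (R : ℕ → ℕ → Set) t → AllPairs R (rows t)

  plusListed : Listed N⁺ plusRow
  plusListed = record { sound = λ { {N⁺ k} (here refl) → refl } ; complete = λ k → here refl ; short = λ { R (N⁺ k) → [] ∷ [] ; R (N⁻ k) → [] ; R (Eᵗ k) → [] } }
  minusListed : Listed N⁻ minusRow
  minusListed = record { sound = λ { {N⁻ k} (here refl) → refl } ; complete = λ k → here refl ; short = λ { R (N⁺ k) → [] ; R (N⁻ k) → [] ∷ [] ; R (Eᵗ k) → [] } }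
  eastListed : Listed Eᵗ eastRow
  eastListed = record { sound = λ { {Eᵗ k} (here refl) → refl } ; complete = λ k → here refl ; short = λ { R (N⁺ k) → [] ; R (N⁻ k) → [] ; R (Eᵗ k) → [] ∷ [] } }

  -- The letters of one kind before s are those of larger key, and the word lists them in order. So
  -- their rows form the unique list sorted by f with these members, from which they can be counted.
  rowsBefore : ∀ {C rows} → Listed C rows → (f : ℕ → ℤ) → (∀ k k' → tkey (C k') <ℤ tkey (C k) → f k <ℤ f k') →
    ∀ xs s ys L → W ≡ xs ++ s ∷ ys → AllPairs (λ k k' → f k <ℤ f k') L →
    (∀ k → Valid (C k) → tkey s <ℤ tkey (C k) → k ∈ L) → (∀ k → k ∈ L → Valid (C k) × tkey s <ℤ tkey (C k)) → concatMap rows xs ≡ L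
  rowsBefore {C} {rows} listed f mono xs s ys L W≡ L-sorted into out = sorted-unique f (concatMap rows xs) L
    (pairs-concatMap rows (λ {t} _ → short _ t) (AllPairs.map (λ {s} {t} lt {k} {k'} k∈ k'∈ → mono k k' (subst₂ (λ s t → tkey t <ℤ tkey s) (sound k∈) (sound k'∈) lt)) (pairs-left xs sorted)))
    L-sorted
    (λ {k} k∈ → let C∈ = up k k∈ in into k (W⁻ {C k} (subst (C k ∈_) (sym W≡) (∈-++⁺ˡ C∈))) (before-greater xs {s} {ys} {C k} sorted C∈))
    (λ {k} k∈ → let v , lt = out k k∈ in ∈-concatMap⁺ rows {xs = xs} (lose (greater-before xs {s} {ys} {C k} sorted (subst (C k ∈_) W≡ (W⁺ {C k} v)) lt) (complete k)))
    where
    open Listed listed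
    sorted : Sorted (xs ++ s ∷ ys)
    sorted = subst Sorted W≡ W-sorted
    up : ∀ k → k ∈ concatMap rows xs → C k ∈ xs
    up k k∈ with find (∈-concatMap⁻ rows {xs = xs} k∈)
    ... | t , t∈ , k∈t = subst (_∈ xs) (sound k∈t) t∈

  key-mono⁺ : ∀ k k' → tkey (N⁺ k') <ℤ tkey (N⁺ k) → - key k <ℤ - key k'
  key-mono⁺ k k' lt = ℤP.neg-mono-< (ℤP.*-cancelˡ-<-nonNeg (+ 4) (lia (+ 4 *ℤ key k ∷ + 4 *ℤ key k' ∷ []) (λ a b → b :+ K 1 :< a :+ K 1 ⟹ b :< a) lt))

  key-mono⁻ : ∀ k k' → tkey (N⁻ k') <ℤ tkey (N⁻ k) → key k <ℤ key k'
  key-mono⁻ k k' lt = ℤP.*-cancelˡ-<-nonNeg (+ 4) (ℤP.neg-cancel-< lt)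

  key-monoᵗ : ∀ k k' → tkey (Eᵗ k') <ℤ tkey (Eᵗ k) → - key k <ℤ - key k'
  key-monoᵗ k k' lt = lia (key k ∷ key k' ∷ key k - h - + 1 ∷ key k' - h - + 1 ∷ h ∷ []) (λ x y a b h → b :< a ⟹ a :≡ x :- h :- K 1 ⟹ b :≡ y :- h :- K 1 ⟹ :- x :< :- y)
    (ℤP.*-cancelˡ-<-nonNeg (+ 4) (lia (+ 4 *ℤ (key k - h - + 1) ∷ + 4 *ℤ (key k' - h - + 1) ∷ []) (λ a b → b :+ K 2 :< a :+ K 2 ⟹ b :< a) lt)) refl refl

  -- The rows r n, ..., r (i + 1), by decreasing |x|.
  rowsAbove : ℕ → List ℕ
  rowsAbove i = map (λ d → r (i + d)) (idxDown (n ∸ i))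

  above⁺ : ∀ i k → i ℕ.< k → k ≤ n → r k ∈ rowsAbove i
  above⁺ i k lt le = subst (λ l → r l ∈ rowsAbove i) (ℕP.m+[n∸m]≡n (ℕP.<⇒≤ lt))
    (∈-map⁺ (λ d → r (i + d)) (∈-idxDown⁺ (ℕP.m<n⇒0<n∸m lt , ℕP.∸-monoˡ-≤ i le)))

  above⁻ : ∀ i j → j ∈ rowsAbove i → ∃[ k ] (i ℕ.< k × k ≤ n × j ≡ r k)
  above⁻ i j j∈ with ∈-map⁻ (λ d → r (i + d)) j∈
  ... | d , d∈ , e with ∈-idxDown⁻ {n ∸ i} d∈
  ... | d≥1 , d≤ = i + d , subst (ℕ._≤ i + d) (ℕP.+-comm i 1) (ℕP.+-monoʳ-≤ i d≥1)
    , subst (i + d ≤_) (ℕP.m+[n∸m]≡n i≤n) (ℕP.+-monoʳ-≤ i d≤) , e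
    where
    i≤n : i ≤ n
    i≤n with i ℕ.≤? n
    ... | yes p = p
    ... | no p = ⊥-elim (ℕP.<⇒≱ d≥1 (subst (d ≤_) (ℕP.m≤n⇒m∸n≡0 (ℕP.<⇒≤ (ℕP.≰⇒> p))) d≤))

  above-sorted : ∀ i → AllPairs (λ k k' → - key k <ℤ - key k') (rowsAbove i)
  above-sorted i = AllPairsP.map⁺ (AllPairs.map (λ {d} {d'} (rd , rd' , lt) → ℤP.neg-mono-< (mono d d' rd rd' lt)) (pairs-ranged (idxDown-sorted (n ∸ i)) λ d∈ → ∈-idxDown⁻ d∈))
    where
    mono : ∀ d d' → InRange (n ∸ i) d → InRange (n ∸ i) d' → d' ℕ.< d → key (r (i + d')) <ℤ key (r (i + d))
    mono d d' rd rd' lt = r-mono (ℕP.≤-trans (proj₁ rd') (ℕP.m≤n+m d' i)) (ℕP.+-monoʳ-< i lt) (bound i d rd)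
      where
      bound : ∀ i d → InRange (n ∸ i) d → i + d ≤ n
      bound i d (p , p') with i ℕ.≤? n
      ... | yes le = subst (i + d ≤_) (ℕP.m+[n∸m]≡n le) (ℕP.+-monoʳ-≤ i p')
      ... | no gt = ⊥-elim (ℕP.<⇒≱ p (subst (d ≤_) (ℕP.m≤n⇒m∸n≡0 (ℕP.<⇒≤ (ℕP.≰⇒> gt))) p'))

  length-idxUp : ∀ m → length (idxUp m) ≡ m
  length-idxUp m = trans (LP.length-map suc (upTo m)) (LP.length-upTo m)

  length-above : ∀ i → length (rowsAbove i) ≡ n ∸ i
  length-above i = trans (LP.length-map (λ d → r (i + d)) (idxDown (n ∸ i))) (trans (LP.length-reverse (idxUp (n ∸ i))) (length-idxUp (n ∸ i)))

  into-above : ∀ i k → InRange n i → InRange n k → key (r i) <ℤ key k → k ∈ rowsAbove i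
  into-above i k ri rk lt with r-surj k rk
  ... | l , rl , refl = above⁺ i l (r-mono⁻ i l ri rl lt) (proj₂ rl)

  out-above : ∀ i k → InRange n i → k ∈ rowsAbove i → InRange n k × key (r i) <ℤ key k
  out-above i k ri k∈ with above⁻ i k k∈
  ... | l , lt , le , refl = r-range l (ℕP.≤-trans (s≤s z≤n) lt , le) , r-mono (proj₁ ri) lt le

  countE-before : ∀ xs i ys → InRange n i → W ≡ xs ++ Eᵗ (r i) ∷ ys → countE (map letter xs) ≡ n ∸ i
  countE-before xs i ys ri W≡ = trans (countE-rows xs) (trans (cong length (rowsBefore eastListed (λ k → - key k) key-monoᵗ xs (Eᵗ (r i)) ys (rowsAbove i) W≡ (above-sorted i)
      (λ k v lt → into-above i k ri (proj₁ v) (ℤP.neg-cancel-< (key-monoᵗ k (r i) lt)))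
      (λ k k∈ → let rk , lt = out-above i k ri k∈ in (rk , ℤP.≤-trans big (ℤP.<⇒≤ lt)) ,
        lia (key (r i) ∷ key k ∷ h ∷ []) (λ x y h → x :< y ⟹ K 4 :* (x :- h :- K 1) :+ K 2 :< K 4 :* (y :- h :- K 1) :+ K 2) lt)))
    (length-above i))
    where
    big : + n ≤ℤ key (r i)
    big = proj₂ (W⁻ {Eᵗ (r i)} (subst (Eᵗ (r i) ∈_) (sym W≡) (∈-++⁺ʳ xs (here refl))))

  private
    sign-gap : ∀ k k' → tkey (N⁻ k') <ℤ tkey (N⁺ k)
    sign-gap k k' = lia (key k ∷ key k' ∷ []) (λ x y → K 0 :≤ x ⟹ K 0 :≤ y ⟹ :- (K 4 :* y) :< K 4 :* x :+ K 1) (+≤+ z≤n) (+≤+ z≤n)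

  countN-before⁺ : ∀ xs i ys → InRange n i → W ≡ xs ++ N⁺ (r i) ∷ ys → countN (map letter xs) ≡ n ∸ i
  countN-before⁺ xs i ys ri W≡ = trans (countN-rows xs) (trans (cong₂ _+_
      (trans (cong length (rowsBefore plusListed (λ k → - key k) key-mono⁺ xs (N⁺ (r i)) ys (rowsAbove i) W≡ (above-sorted i)
        (λ k v lt → into-above i k ri v (ℤP.neg-cancel-< (key-mono⁺ k (r i) lt)))
        (λ k k∈ → let rk , lt = out-above i k ri k∈ in rk , lia (key (r i) ∷ key k ∷ []) (λ x y → x :< y ⟹ K 4 :* x :+ K 1 :< K 4 :* y :+ K 1) lt))) (length-above i))
      (cong length (rowsBefore minusListed key key-mono⁻ xs (N⁺ (r i)) ys [] W≡ [] (λ k v lt → ⊥-elim (ℤP.<-asym lt (sign-gap (r i) k))) (λ k ()))))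
    (ℕP.+-identityʳ (n ∸ i)))

  -- All n letters N⁺ precede every N⁻, and the letters N⁻ come by increasing |x|.
  countN-before⁻ : ∀ xs i ys → InRange n i → W ≡ xs ++ N⁻ (r i) ∷ ys → countN (map letter xs) ≡ n + (i ∸ 1)
  countN-before⁻ xs i ys ri W≡ = trans (countN-rows xs) (cong₂ _+_
      (trans (cong length (rowsBefore plusListed (λ k → - key k) key-mono⁺ xs (N⁻ (r i)) ys (rowsAbove 0) W≡ (above-sorted 0)
        (λ k v lt → let l , rl , e = r-surj k v in subst (_∈ rowsAbove 0) e (above⁺ 0 l (proj₁ rl) (proj₂ rl)))
        (λ k k∈ → let l , l≥1 , l≤n , e = above⁻ 0 k k∈ in subst (InRange n) (sym e) (r-range l (l≥1 , l≤n)) , sign-gap k (r i)))) (length-above 0))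
      (trans (cong length (rowsBefore minusListed key key-mono⁻ xs (N⁻ (r i)) ys (map r (idxUp (i ∸ 1))) W≡
        (AllPairsP.map⁺ (AllPairs.map (λ {d} {d'} (rd , rd' , lt) → r-mono (proj₁ rd) lt (below-n d' rd')) (pairs-ranged (idxUp-sorted (i ∸ 1)) λ d∈ → ∈-idxUp⁻ d∈)))
        (λ k v lt → into k (proj₁ v) (key-mono⁻ k (r i) lt))
        (λ k k∈ → out k (∈-map⁻ r k∈)))) (trans (LP.length-map r (idxUp (i ∸ 1))) (length-idxUp (i ∸ 1)))))
    where
    small : key (r i) ≤ℤ + n - + 1
    small = proj₂ (W⁻ {N⁻ (r i)} (subst (N⁻ (r i) ∈_) (sym W≡) (∈-++⁺ʳ xs (here refl))))
    pred< : ∀ {d i} → 1 ≤ i → d ≤ i ∸ 1 → d ℕ.< i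
    pred< {d} {suc i} _ le = s≤s le
    below-n : ∀ d → InRange (i ∸ 1) d → d ≤ n
    below-n d (_ , le) = ℕP.≤-trans le (ℕP.≤-trans (ℕP.m∸n≤m i 1) (proj₂ ri))
    into : ∀ k → InRange n k → key k <ℤ key (r i) → k ∈ map r (idxUp (i ∸ 1))
    into k rk lt with r-surj k rk
    ... | l , rl , refl = ∈-map⁺ r (∈-idxUp⁺ (proj₁ rl , ℕP.∸-monoˡ-≤ 1 (r-mono⁻ l i rl ri lt)))
    out : ∀ k → ∃[ l ] (l ∈ idxUp (i ∸ 1) × k ≡ r l) → Valid (N⁻ k) × tkey (N⁻ (r i)) <ℤ tkey (N⁻ k)
    out k (l , l∈ , refl) with ∈-idxUp⁻ {i ∸ 1} l∈
    ... | l≥1 , l≤ = (r-range l (l≥1 , below-n l (l≥1 , l≤)) , ℤP.≤-trans (ℤP.<⇒≤ lt) small) , lia (key (r i) ∷ key (r l) ∷ []) (λ x y → y :< x ⟹ :- (K 4 :* x) :< :- (K 4 :* y)) lt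
      where
      lt : key (r l) <ℤ key (r i)
      lt = r-mono l≥1 (pred< (proj₁ ri) l≤) (proj₂ ri)

  key-min : ∀ k → InRange n k → key (r 1) ≤ℤ key k
  key-min k rk with r-surj k rk
  ... | suc zero , rl , refl = ℤP.≤-refl
  ... | suc (suc l) , rl , refl = ℤP.<⇒≤ (r-mono ℕP.≤-refl (s≤s (s≤s z≤n)) (proj₂ rl))

  -- Otherwise no row has a letter N⁻, and the East step of the smallest row would be the last
  -- letter, against `lowerTok`.
  key-min≤ : key (r 1) ≤ℤ + n - + 1
  key-min≤ with key (r 1) ℤP.≤? + n - + 1
  ... | yes p = p
  ... | no p with lowerTok (r 1) (r-range 1 1∈ , below p)
  ... | N⁺ k , rk , lt = ⊥-elim (lia (key k ∷ key (r 1) ∷ h ∷ []) (λ y x h → x :≤ y ⟹ K 4 :* y :+ K 1 :< K 4 :* (x :- h :- K 1) :+ K 2 ⟹ K 0 :< h ⟹ :⊥) (key-min k rk) lt h>0)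
  ... | N⁻ k , (rk , small) , lt = ⊥-elim (p (ℤP.≤-trans (key-min k rk) small))
  ... | Eᵗ k , (rk , _) , lt = ⊥-elim (lia (key k ∷ key (r 1) ∷ h ∷ []) (λ y x h → x :≤ y ⟹ K 4 :* (y :- h :- K 1) :+ K 2 :< K 4 :* (x :- h :- K 1) :+ K 2 ⟹ :⊥) (key-min k rk) lt)

  EastNear : Set
  EastNear = ∃[ k ] (Valid (Eᵗ k) × tkey (Eᵗ k) <ℤ tkey (N⁺ (r 1)) × tkey (N⁻ (r 1)) <ℤ tkey (Eᵗ k))

  -- Otherwise the walk from −x to x would meet a smaller |x|.
  eastNear : ∀ κ → key (r 1) ≡ + κ → 1 ≤ κ → EastNear
  eastNear κ e κ≥1 with onClass (- + κ +ℤ + 1)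
  -- This is the row right after -κ. At level 0 its |x| would be less than κ. At level 1 its East
  -- step has the height -κ of the letter N⁻ of the smallest row. From a negative level one walks to
  -- the mirror image, as in `Mirror`; for κ = 1 the mirror image itself has level 1.
  ... | c , d , (rc , oc) = go κ κ≥1 e (ℤP.<-cmp d (+ 0)) oc
    where
    open Lift (lift (r 1) (r-range 1 1∈)) renaming (sign to b)
    start : ∀ {κ} → key (r 1) ≡ + κ → On (- b) (- + κ) (+ 0)
    start e' = at (- b) (neg-range {b} range) (trans (X-neg b) (cong -_ (trans value e')))
    found : ∀ {κ} → key (r 1) ≡ + κ → 1 ≤ κ → ∀ c → InRange n ∣ c ∣ → X c ≡ - + κ +ℤ + 1 +ℤ h → EastNear
    found {κ} e' κ≥1 c rc z = ∣ c ∣ , (rc , lia (key ∣ c ∣ ∷ X c ∷ + n ∷ []) (λ k z n → k :≡ z ⟹ n :≤ z ⟹ n :≤ k) (key≥ c rc (ℤP.≤-trans (+≤+ z≤n) n≤)) n≤)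
      , lia (key ∣ c ∣ ∷ X c ∷ key (r 1) ∷ + κ ∷ h ∷ []) (λ k z x κ h → k :≡ z ⟹ z :≡ :- κ :+ K 1 :+ h ⟹ x :≡ κ ⟹ K 1 :≤ κ ⟹ K 4 :* (k :- h :- K 1) :+ K 2 :< K 4 :* x :+ K 1) (key≥ c rc (ℤP.≤-trans (+≤+ z≤n) n≤)) z e' (+≤+ κ≥1)
      , lia (key ∣ c ∣ ∷ X c ∷ key (r 1) ∷ + κ ∷ h ∷ []) (λ k z x κ h → k :≡ z ⟹ z :≡ :- κ :+ K 1 :+ h ⟹ x :≡ κ ⟹ :- (K 4 :* x) :< K 4 :* (k :- h :- K 1) :+ K 2) (key≥ c rc (ℤP.≤-trans (+≤+ z≤n) n≤)) z e'
      where
      n≤ : + n ≤ℤ X c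
      n≤ = lia (X c ∷ key (r 1) ∷ + κ ∷ h ∷ + n ∷ []) (λ z x κ h n → z :≡ :- κ :+ K 1 :+ h ⟹ x :≡ κ ⟹ x :≤ n :- K 1 ⟹ h :≡ K 2 :* n :- K 2 ⟹ n :≤ z) z e' key-min≤ h≡
    smaller : ∀ {κ} → key (r 1) ≡ + κ → ∀ c u → InRange n ∣ c ∣ → X c ≡ u → - + κ <ℤ u → u <ℤ + κ → EastNear
    smaller {κ} e' c u rc z lo hi with ℤP.≤-total (+ 0) (X c)
    ... | inj₁ p = ⊥-elim (lia (key ∣ c ∣ ∷ X c ∷ key (r 1) ∷ + κ ∷ u ∷ []) (λ k z x κ u → x :≤ k ⟹ k :≡ z ⟹ z :≡ u ⟹ x :≡ κ ⟹ u :< κ ⟹ :⊥) (key-min ∣ c ∣ rc) (key≥ c rc p) z e' hi)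
    ... | inj₂ p = ⊥-elim (lia (key ∣ c ∣ ∷ X c ∷ key (r 1) ∷ + κ ∷ u ∷ []) (λ k z x κ u → x :≤ k ⟹ k :≡ :- z ⟹ z :≡ u ⟹ x :≡ κ ⟹ :- κ :< u ⟹ :⊥) (key-min ∣ c ∣ rc) (key≤ c rc p) z e' lo)
    go : ∀ κ → 1 ≤ κ → key (r 1) ≡ + κ → Tri (d <ℤ + 0) (d ≡ + 0) (d ℤ.> + 0) → X c ≡ - + κ +ℤ + 1 +ℤ h *ℤ d → EastNear
    go (suc κ) κ≥1 e' (tri≈ _ refl _) oc = smaller e' c (- + suc κ +ℤ + 1) rc (lia (X c ∷ + κ ∷ h ∷ []) (λ z κ h → z :≡ :- (K 1 :+ κ) :+ K 1 :+ h :* K 0 ⟹ z :≡ :- (K 1 :+ κ) :+ K 1) oc)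
      (lia (+ κ ∷ []) λ κ → :- (K 1 :+ κ) :< :- (K 1 :+ κ) :+ K 1) (lia (+ κ ∷ []) (λ κ → K 0 :≤ κ ⟹ :- (K 1 :+ κ) :+ K 1 :< K 1 :+ κ) (+≤+ z≤n))
    go κ κ≥1 e' (tri> _ _ d>0) oc = found e' κ≥1 c rc (lia (X c ∷ + κ ∷ h ∷ d ∷ []) (λ z κ h d → z :≡ :- κ :+ K 1 :+ h :* d ⟹ h :* d :≡ h :* K 1 ⟹ z :≡ :- κ :+ K 1 :+ h) oc (cong (h *ℤ_) d≡1))
      where
      d≡1 : d ≡ + 1
      d≡1 = lia (d ∷ []) (λ d → K 0 :< d ⟹ d :≤ K 0 :+ K 1 ⟹ d :≡ K 1) d>0 (step (- b) c (- + κ) (+ 0) d (start e') (rc , oc))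
    go (suc zero) κ≥1 e' (tri< d<0 _ _) oc = found e' κ≥1 (- c) (neg-range {c} rc) (lia (X (- c) ∷ X c ∷ h ∷ d ∷ []) (λ y z h d → y :≡ :- z ⟹ z :≡ :- K 1 :+ K 1 :+ h :* d ⟹ h :* d :≡ h :* :- K 1 ⟹ y :≡ :- K 1 :+ K 1 :+ h) (X-neg c) oc (cong (h *ℤ_) d≡-1))
      where
      d≡-1 : d ≡ - + 1
      d≡-1 = lia (d ∷ []) (λ d → d :< K 0 ⟹ :- d :≤ K 0 :+ K 1 ⟹ d :≡ :- K 1) d<0
        (step (- b) (- c) (- + 1) (+ 0) (- d) (start e') (neg-range {c} rc , lia (X (- c) ∷ X c ∷ h ∷ d ∷ []) (λ y z h d → y :≡ :- z ⟹ z :≡ :- K 1 :+ K 1 :+ h :* d ⟹ y :≡ :- K 1 :+ K 1 :+ h :* :- d) (X-neg c) oc))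
    go (suc (suc m)) κ≥1 e' (tri< d<0 _ _) oc with walk (suc (m + m)) c (- + suc (suc m) +ℤ + 1) d (- c) (- d) (rc , oc) d<0
      (neg-range {c} rc , lia (X (- c) ∷ X c ∷ h ∷ d ∷ + m ∷ []) (λ y z h d m → y :≡ :- z ⟹ z :≡ :- (K 2 :+ m) :+ K 1 :+ h :* d ⟹ y :≡ :- (K 2 :+ m) :+ K 1 :+ (K 2 :+ (m :+ m)) :+ h :* :- d) (X-neg c) oc)
      (lia (d ∷ []) (λ d → d :< K 0 ⟹ K 1 :≤ :- d) d<0)
    ... | s , c' , s≥1 , s≤ , (rc' , oc') = smaller e' c' (- + suc (suc m) +ℤ + 1 +ℤ + s) rc' (lia (X c' ∷ + m ∷ + s ∷ h ∷ []) (λ z m s h → z :≡ :- (K 2 :+ m) :+ K 1 :+ s :+ h :* K 0 ⟹ z :≡ :- (K 2 :+ m) :+ K 1 :+ s) oc')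
      (lia (+ m ∷ + s ∷ []) (λ m s → K 1 :≤ s ⟹ :- (K 2 :+ m) :< :- (K 2 :+ m) :+ K 1 :+ s) (+≤+ s≥1))
      (lia (+ m ∷ + s ∷ []) (λ m s → s :≤ K 1 :+ (m :+ m) ⟹ :- (K 2 :+ m) :+ K 1 :+ s :< K 2 :+ m) (+≤+ s≤))

  -- The letter N⁺ of the smallest row is the n-th North step. So whether the smallest |x| is 0
  -- decides whether the path has a step to mark.
  afterFirst-east : ¬ key (r 1) ≡ + 0 → ∃[ xs ] ∃[ k ] ∃[ ys ] (W ≡ xs ++ N⁺ (r 1) ∷ Eᵗ k ∷ ys)
  afterFirst-east ne with eastNear ∣ x (r 1) ∣ refl (ℕP.n≢0⇒n>0 λ z → ne (cong +_ z))
  ... | k , v , lt , gt with successor W {N⁺ (r 1)} {Eᵗ k} W-sorted (W⁺ {N⁺ (r 1)} (r-range 1 1∈)) (W⁺ {Eᵗ k} v) lt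
  ... | xs , t , ys , W≡ = go t W≡
    where
    sorted : ∀ t → W ≡ xs ++ N⁺ (r 1) ∷ t ∷ ys → Sorted (xs ++ N⁺ (r 1) ∷ t ∷ ys)
    sorted t W≡ = subst Sorted W≡ W-sorted
    here∈ : ∀ t → W ≡ xs ++ N⁺ (r 1) ∷ t ∷ ys → t ∈ W
    here∈ t W≡ = subst (t ∈_) (sym W≡) (∈-++⁺ʳ xs (there (here refl)))
    descends : ∀ t → W ≡ xs ++ N⁺ (r 1) ∷ t ∷ ys → tkey t <ℤ tkey (N⁺ (r 1))
    descends t W≡ = All.lookup (AllPairs.head (pairs-right xs (sorted t W≡))) (here refl)
    go : ∀ t → W ≡ xs ++ N⁺ (r 1) ∷ t ∷ ys → ∃[ xs ] ∃[ k ] ∃[ ys ] (W ≡ xs ++ N⁺ (r 1) ∷ Eᵗ k ∷ ys)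
    go (Eᵗ k') W≡ = xs , k' , ys , W≡
    go (N⁺ k') W≡ = ⊥-elim (lia (key k' ∷ key (r 1) ∷ []) (λ y x → x :≤ y ⟹ K 4 :* y :+ K 1 :< K 4 :* x :+ K 1 ⟹ :⊥) (key-min k' (W⁻ {N⁺ k'} (here∈ (N⁺ k') W≡))) (descends (N⁺ k') W≡))
    go (N⁻ k') W≡ = ⊥-elim (none-between xs (sorted (N⁻ k') W≡) (subst (Eᵗ k ∈_) W≡ (W⁺ {Eᵗ k} v)) lt
      (ℤP.≤-<-trans (lia (key k' ∷ key (r 1) ∷ []) (λ y x → x :≤ y ⟹ :- (K 4 :* y) :≤ :- (K 4 :* x)) (key-min k' (proj₁ (W⁻ {N⁻ k'} (here∈ (N⁻ k') W≡))))) gt))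

  afterFirst-north : key (r 1) ≡ + 0 → ∃[ xs ] ∃[ ys ] (W ≡ xs ++ N⁺ (r 1) ∷ N⁻ (r 1) ∷ ys)
  afterFirst-north z = neighbours W {N⁺ (r 1)} {N⁻ (r 1)} W-sorted (W⁺ {N⁺ (r 1)} (r-range 1 1∈)) (W⁺ {N⁻ (r 1)} (r-range 1 1∈ , key-min≤)) (sign-gap (r 1) (r 1))
    λ m _ lt gt → lia (key (r 1) ∷ tkey m ∷ []) (λ x T → x :≡ K 0 ⟹ T :< K 4 :* x :+ K 1 ⟹ :- (K 4 :* x) :< T ⟹ :⊥) z lt gt

  private
    data Ending : Set where
      ends : ∀ xs t → W ≡ xs ++ t ∷ [] → IsNorth t → Ending

    ending : Ending
    ending = go W refl
      where
      go : ∀ l → W ≡ l → Ending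
      go l W≡ with Data.List.initLast l
      go .[] W≡ | Data.List.[] with subst (N⁺ (r 1) ∈_) W≡ (W⁺ {N⁺ (r 1)} (r-range 1 1∈))
      ... | ()
      go .(xs ++ t ∷ []) W≡ | xs Data.List.∷ʳ′ t = last-north t W≡
        where
        last-north : ∀ t → W ≡ xs ++ t ∷ [] → Ending
        last-north (N⁺ k) e = ends xs (N⁺ k) e north⁺
        last-north (N⁻ k) e = ends xs (N⁻ k) e north⁻
        last-north (Eᵗ k) e with lowerTok k (W⁻ {Eᵗ k} (subst (Eᵗ k ∈_) (sym e) (∈-++⁺ʳ xs (here refl))))
        ... | t' , v , lt with ∈-++⁻ xs (subst (t' ∈_) e (W⁺ v))
        ... | inj₁ t'∈ = ⊥-elim (ℤP.<-asym lt (before-greater xs (subst Sorted e W-sorted) t'∈))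
        ... | inj₂ (here refl) = ⊥-elim (ℤP.<-irrefl refl lt)

  -- By `lowerTok` the word ends with a North step. It is deleted in the path and restored by the
  -- North step appended in `Valley`, so the valleys are the East-North pairs of the whole word.
  path-letters : path ++ N ∷ [] ≡ map letter W × Plain path
  path-letters with ending
  ... | ends xs t W≡ nt = trans (cong (_++ N ∷ []) path≡) (sym (trans (cong (map letter) W≡) (trans (LP.map-++ letter xs (t ∷ [])) (cong (λ s → map letter xs ++ s ∷ []) (north nt)))))
    , subst Plain (sym path≡) (AllP.map⁺ (All.universal plain xs))
    where
    path≡ : path ≡ map letter xs
    path≡ = trans (sym (word-path n≥1)) (trans (cong (λ l → dropLast (map letter l)) W≡) (trans (cong dropLast (LP.map-++ letter xs (t ∷ []))) (dropLast-∷ʳ (map letter xs) (letter t))))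
    north : ∀ {t} → IsNorth t → letter t ≡ N
    north north⁺ = refl
    north north⁻ = refl
    plain : ∀ t → letter t ≡ N ⊎ letter t ≡ E
    plain (N⁺ k) = inj₁ refl
    plain (N⁻ k) = inj₁ refl
    plain (Eᵗ k) = inj₂ refl

  -- The roots of the valleys are those of value h + 1.

  module Marked (even : Bool) (β : List Step) (β≡ : β ≡ markAfterNorth n (if even then E⁺ else E⁻) path)
    (y-first : y 1 ≡ (if even then key (r 1) else - key (r 1))) where

    open Roots n n≥1 β

    β-isN : map isN β ≡ map isN path
    β-isN = trans (cong (map isN) β≡) (mark-isN n (if even then E⁺ else E⁻) path (mark-east even))
      where
      mark-east : ∀ b → isEast (if b then E⁺ else E⁻) ≡ true
      mark-east true = refl
      mark-east false = refl

    W-path : ∀ xs s t ys → W ≡ xs ++ s ∷ t ∷ ys → path ++ N ∷ [] ≡ map letter xs ++ letter s ∷ letter t ∷ map letter ys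
    W-path xs s t ys W≡ = trans (proj₁ path-letters) (trans (cong (map letter) W≡) (LP.map-++ letter xs (s ∷ t ∷ ys)))

    nfe-at : ∀ xs t ys → W ≡ xs ++ N⁺ (r 1) ∷ t ∷ ys → NorthFollowedByE path n ≡ isEast (letter t)
    nfe-at xs t ys W≡ = trans (cong (NorthFollowedByE path) (sym count)) (nfe-split path (map letter xs) (letter t) (map letter ys) (W-path xs (N⁺ (r 1)) t ys W≡))
      where
      count : suc (countN (map letter xs)) ≡ n
      count = trans (cong suc (countN-before⁺ xs 1 (t ∷ ys) 1∈ W≡)) (ℕP.m+[n∸m]≡n n≥1)

    nfe-β : NorthFollowedByE β n ≡ NorthFollowedByE path n
    nfe-β = nfe-cong β path n β-isN

    nfe-nonzero : ¬ key (r 1) ≡ + 0 → NorthFollowedByE path n ≡ true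
    nfe-nonzero ne = let xs , k , ys , W≡ = afterFirst-east ne in nfe-at xs (Eᵗ k) ys W≡

    nfe-zero : key (r 1) ≡ + 0 → NorthFollowedByE path n ≡ false
    nfe-zero z = let xs , ys , W≡ = afterFirst-north z in nfe-at xs (N⁻ (r 1)) ys W≡

    ε-sign : IsSign ε
    ε-sign = eps-sign β

    -- The mark records the parity of the number of positive entries of μ, which by `y-first` is
    -- also the sign of y 1. If y 1 = 0, either sign gives 0.
    ε-key : ε *ℤ y 1 ≡ key (r 1)
    ε-key = by-zero (key (r 1) ℤP.≟ + 0)
      where
      zero-if : key (r 1) ≡ + 0 → ∀ b → (if b then key (r 1) else - key (r 1)) ≡ + 0
      zero-if z true = z
      zero-if z false = cong -_ z
      by-zero : Dec (key (r 1) ≡ + 0) → ε *ℤ y 1 ≡ key (r 1)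
      by-zero (yes z) = trans (cong (ε *ℤ_) (trans y-first (zero-if z even))) (trans (ℤP.*-zeroʳ ε) (sym z))
      by-zero (no ne) = go even refl
        where
        go : ∀ b → even ≡ b → ε *ℤ y 1 ≡ key (r 1)
        go true refl = trans (cong₂ _*ℤ_ (cong (λ b → if b then - + 1 else + 1) (trans (cong hasEm β≡) (mark-em⁺ n path (proj₂ path-letters)))) y-first) (ℤP.*-identityˡ (key (r 1)))
        go false refl = trans (cong₂ _*ℤ_ (cong (λ b → if b then - + 1 else + 1) (trans (cong hasEm β≡) (mark-em⁻ n path (proj₂ path-letters) (nfe-nonzero ne)))) y-first)
          (lia (key (r 1) ∷ []) λ x → :- K 1 :* :- x :≡ x)

    record AtValley (i k : ℕ) : Set where
      field
        a⁰ : ℕ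
        ra : InRange n a⁰
        t : Tok
        xs ys : List Tok
        W≡ : W ≡ xs ++ Eᵗ (r a⁰) ∷ t ∷ ys
        north : IsNorth t
        i≡ : i ≡ suc (n ∸ a⁰)
        k≡ : k ≡ suc (countN (map letter xs))

    atValley : ∀ {i k} → (i , k) ∈ valleys β → AtValley i k
    atValley {i} {k} m = from-path (valley⇒ path (subst ((i , k) ∈_) (valleys-cong β path β-isN) m))
      where
      isNorth : ∀ t → isN (letter t) ≡ true → IsNorth t
      isNorth (N⁺ k) _ = north⁺
      isNorth (N⁻ k) _ = north⁻
      from-row : ∀ xs k t ys → W ≡ xs ++ Eᵗ k ∷ t ∷ ys → isN (letter t) ≡ true → ∃[ l ] (InRange n l × r l ≡ k) → AtValley (suc (countE (map letter xs))) (suc (countN (map letter xs)))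
      from-row xs k t ys W≡ nn (l , rl , refl) = record { a⁰ = l ; ra = rl ; t = t ; xs = xs ; ys = ys ; W≡ = W≡ ; north = isNorth t nn
        ; i≡ = cong suc (countE-before xs l (t ∷ ys) rl W≡) ; k≡ = refl }
      from-tokens : ∀ xs s t ys → W ≡ xs ++ s ∷ t ∷ ys → isEast (letter s) ≡ true → isN (letter t) ≡ true → AtValley (suc (countE (map letter xs))) (suc (countN (map letter xs)))
      from-tokens xs (Eᵗ k) t ys W≡ _ nn = from-row xs k t ys W≡ nn (r-surj k (proj₁ (W⁻ {Eᵗ k} (subst (Eᵗ k ∈_) (sym W≡) (∈-++⁺ʳ xs (here refl))))))
      from-split : ∀ {bf x' y'} → isEast x' ≡ true → isN y' ≡ true → ∃[ xs ] ∃[ s ] ∃[ t ] ∃[ ys ] (W ≡ xs ++ s ∷ t ∷ ys × map letter xs ≡ bf × letter s ≡ x' × letter t ≡ y') →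
        AtValley (suc (countE bf)) (suc (countN bf))
      from-split ea nn (xs , s , t , ys , W≡ , refl , refl , refl) = from-tokens xs s t ys W≡ ea nn
      from-path : Valley path i k → AtValley i k
      from-path (valley bf x' y' af eq ea nn refl refl) = from-split ea nn (map-split letter W bf (trans (sym (proj₁ path-letters)) eq))

    makeValley : ∀ xs l t ys → InRange n l → IsNorth t → W ≡ xs ++ Eᵗ (r l) ∷ t ∷ ys → (suc (n ∸ l) , suc (countN (map letter xs))) ∈ valleys β
    makeValley xs l t ys rl nt W≡ = subst ((suc (n ∸ l) , suc (countN (map letter xs))) ∈_) (sym (valleys-cong β path β-isN))
      (⇒valley path (valley (map letter xs) E (letter t) (map letter ys) (W-path xs (Eᵗ (r l)) t ys W≡) refl (north nt) (cong suc (sym (countE-before xs l (t ∷ ys) rl W≡))) refl))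
      where
      north : ∀ {t} → IsNorth t → isN (letter t) ≡ true
      north north⁺ = refl
      north north⁻ = refl

    reassoc : ∀ xs s t ys → W ≡ xs ++ s ∷ t ∷ ys → W ≡ (xs ++ s ∷ []) ++ t ∷ ys
    reassoc xs s t ys W≡ = trans W≡ (sym (LP.++-assoc xs (s ∷ []) (t ∷ ys)))

    count⁺ : ∀ xs k l ys → InRange n l → W ≡ xs ++ Eᵗ k ∷ N⁺ (r l) ∷ ys → countN (map letter xs) ≡ n ∸ l
    count⁺ xs k l ys rl W≡ = trans (sym (countN-east xs k)) (countN-before⁺ (xs ++ Eᵗ k ∷ []) l ys rl (reassoc xs (Eᵗ k) (N⁺ (r l)) ys W≡))

    count⁻ : ∀ xs k l ys → InRange n l → W ≡ xs ++ Eᵗ k ∷ N⁻ (r l) ∷ ys → countN (map letter xs) ≡ n + (l ∸ 1)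
    count⁻ xs k l ys rl W≡ = trans (sym (countN-east xs k)) (countN-before⁻ (xs ++ Eᵗ k ∷ []) l ys rl (reassoc xs (Eᵗ k) (N⁻ (r l)) ys W≡))

    inner-first : inner n y (ε ·v e (+ 1)) ≡ key (r 1)
    inner-first = trans (inner-·v n y ε (e (+ 1))) (trans (cong (ε *ℤ_) (trans (inner-e n y (+ 1) 1∈) (val-+ y 1 ℕP.≤-refl))) ε-key)

    inner-row : ∀ l → InRange n l → inner n y (e (+ l)) ≡ y l
    inner-row l rl = trans (inner-e n y (+ l) rl) (val-+ y l (proj₁ rl))

    -- For l = 1 the root contains ε e₁, whose value is |x (r 1)| by `ε-key`. This makes the formula
    -- uniform in l.
    inner⁺ : ∀ i l → InRange n i → InRange n l → inner n y (alphaIJ n β (suc (n ∸ i)) (suc (n ∸ l))) ≡ y i - key (r l)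
    inner⁺ (suc i) (suc zero) ri rl = trans (cong (λ k → inner n y (alphaIJ n β (suc (n ∸ suc i)) k)) (ℕP.m+[n∸m]≡n n≥1))
      (trans (cong (inner n y) (at-first⁻ i (proj₂ ri))) (trans (inner-⊖ n y (e (+ suc i)) (ε ·v e (+ 1))) (cong₂ _-_ (inner-row (suc i) ri) inner-first)))
    inner⁺ (suc i) (suc (suc l)) ri rl = trans (cong (inner n y) (at-sub i (suc (suc l)) (proj₂ ri) (s≤s (s≤s z≤n)) (proj₂ rl)))
      (trans (inner-⊖ n y (e (+ suc i)) (e (+ suc (suc l)))) (cong₂ _-_ (inner-row (suc i) ri) (trans (inner-row (suc (suc l)) rl) (sym (key-y (s≤s (s≤s z≤n)) (proj₂ rl))))))

    inner⁻ : ∀ i l → InRange n i → InRange n l → inner n y (alphaIJ n β (suc (n ∸ i)) (suc (n + (l ∸ 1)))) ≡ y i +ℤ key (r l)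
    inner⁻ (suc i) (suc zero) ri rl = trans (cong (λ k → inner n y (alphaIJ n β (suc (n ∸ suc i)) (suc k))) (ℕP.+-identityʳ n))
      (trans (cong (inner n y) (at-first⁺ i (proj₂ ri))) (trans (inner-⊕ n y (e (+ suc i)) (ε ·v e (+ 1))) (cong₂ _+ℤ_ (inner-row (suc i) ri) inner-first)))
    inner⁻ (suc i) (suc (suc l)) ri rl = trans (cong (inner n y) (at-add i (suc (suc l)) (proj₂ ri) (s≤s (s≤s z≤n))))
      (trans (inner-⊕ n y (e (+ suc i)) (e (+ suc (suc l)))) (cong₂ _+ℤ_ (inner-row (suc i) ri) (trans (inner-row (suc (suc l)) rl) (sym (key-y (s≤s (s≤s z≤n)) (proj₂ rl))))))

    module _ {i k : ℕ} (v : AtValley i k) where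
      open AtValley v

      private
        sorted : Sorted (xs ++ Eᵗ (r a⁰) ∷ t ∷ ys)
        sorted = subst Sorted W≡ W-sorted
        vE : Valid (Eᵗ (r a⁰))
        vE = W⁻ {Eᵗ (r a⁰)} (subst (Eᵗ (r a⁰) ∈_) (sym W≡) (∈-++⁺ʳ xs (here refl)))
        vt : Valid t
        vt = W⁻ {t} (subst (t ∈_) (sym W≡) (∈-++⁺ʳ xs (there (here refl))))
        heights : height t ≡ height (Eᵗ (r a⁰))
        heights = equalHeights (r a⁰) {t} vE vt north (All.lookup (AllPairs.head (pairs-right xs sorted)) (here refl))
          λ m vm → none-between xs {Eᵗ (r a⁰)} {t} {ys} {m} sorted (subst (m ∈_) W≡ (W⁺ {m} vm))
        -- The smallest row has no East step. From row 2 on, y is positive and equals |x|.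
        a≥2 : 2 ≤ a⁰
        a≥2 = ℕP.≤∧≢⇒< (proj₁ ra) λ { refl → lia (key (r 1) ∷ + n ∷ []) (λ x n → x :≤ n :- K 1 ⟹ n :≤ x ⟹ :⊥) key-min≤ (proj₂ vE) }
        ya : key (r a⁰) ≡ y a⁰
        ya = key-y a≥2 (proj₂ ra)

        inner-t : ∀ t → IsNorth t → Valid t → W ≡ xs ++ Eᵗ (r a⁰) ∷ t ∷ ys → inner n y (alphaIJ n β i k) ≡ y a⁰ - height t
        inner-t (N⁺ l') north⁺ rl' W≡ = go (r-surj l' rl') W≡
          where
          go : ∀ {l'} → ∃[ l ] (InRange n l × r l ≡ l') → W ≡ xs ++ Eᵗ (r a⁰) ∷ N⁺ l' ∷ ys → inner n y (alphaIJ n β i k) ≡ y a⁰ - key l'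
          go (l , rl , refl) W≡ = trans (cong₂ (λ i k → inner n y (alphaIJ n β i k)) i≡ (trans k≡ (cong suc (count⁺ xs (r a⁰) l ys rl W≡)))) (inner⁺ a⁰ l ra rl)
        inner-t (N⁻ l') north⁻ (rl' , _) W≡ = go (r-surj l' rl') W≡
          where
          go : ∀ {l'} → ∃[ l ] (InRange n l × r l ≡ l') → W ≡ xs ++ Eᵗ (r a⁰) ∷ N⁻ l' ∷ ys → inner n y (alphaIJ n β i k) ≡ y a⁰ - - key l'
          go (l , rl , refl) W≡ = trans (cong₂ (λ i k → inner n y (alphaIJ n β i k)) i≡ (trans k≡ (cong suc (count⁻ xs (r a⁰) l ys rl W≡))))
            (trans (inner⁻ a⁰ l ra rl) (cong (y a⁰ +ℤ_) (sym (ℤP.neg-involutive (key (r l))))))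

        zero-height : k ≡ n → key (r 1) ≡ + 0 → ∀ t → IsNorth t → Valid t → W ≡ xs ++ Eᵗ (r a⁰) ∷ t ∷ ys → height t ≡ + 0
        zero-height k≡n z (N⁺ l') north⁺ rl' W≡ = go (r-surj l' rl') W≡
          where
          go : ∀ {l'} → ∃[ l ] (InRange n l × r l ≡ l') → W ≡ xs ++ Eᵗ (r a⁰) ∷ N⁺ l' ∷ ys → key l' ≡ + 0
          go (l , rl , refl) W≡ = trans (cong (λ l → key (r l)) (ℕP.∸-cancelˡ-≡ (proj₂ rl) n≥1
            (ℕP.suc-injective (trans (sym (trans k≡ (cong suc (count⁺ xs (r a⁰) l ys rl W≡)))) (trans k≡n (sym (ℕP.m+[n∸m]≡n n≥1))))))) z
        zero-height k≡n z (N⁻ l') north⁻ (rl' , _) W≡ = ⊥-elim (go (r-surj l' rl') W≡)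
          where
          go : ∀ {l'} → ∃[ l ] (InRange n l × r l ≡ l') → W ≡ xs ++ Eᵗ (r a⁰) ∷ N⁻ l' ∷ ys → ⊥
          go (l , rl , refl) W≡ = ℕP.<⇒≢ (s≤s (ℕP.m≤m+n n (l ∸ 1))) (sym (trans (sym (trans k≡ (cong suc (count⁻ xs (r a⁰) l ys rl W≡)))) k≡n))

      -- The root takes the value |x| of the East row minus the height of the North step, and the
      -- latter equals the height |x| - h - 1 of the East step.
      inner-valley : inner n y (alphaIJ n β i k) ≡ h +ℤ + 1
      inner-valley = trans (inner-t t north vt W≡) (lia (y a⁰ ∷ height t ∷ key (r a⁰) ∷ h ∷ []) (λ y H x h → H :≡ x :- h :- K 1 ⟹ x :≡ y ⟹ y :- H :≡ h :+ K 1) heights ya)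

      -- If the n-th North step is not followed by an East step, then |x (r 1)| = 0, so the roots
      -- with +ε e₁ and -ε e₁ take the same value.
      inner-extra : k ≡ n → NorthFollowedByE β n ≡ false → inner n y (alphaIJ n β i (suc n)) ≡ h +ℤ + 1
      inner-extra k≡n nfe = by-zero (key (r 1) ℤP.≟ + 0)
        where
        clash : true ≡ false → ⊥
        clash ()
        by-zero : Dec (key (r 1) ≡ + 0) → inner n y (alphaIJ n β i (suc n)) ≡ h +ℤ + 1
        by-zero (no ne) = ⊥-elim (clash (trans (sym (nfe-nonzero ne)) (trans (sym nfe-β) nfe)))
        by-zero (yes z) = trans (cong₂ (λ i k → inner n y (alphaIJ n β i (suc k))) i≡ (sym (ℕP.+-identityʳ n))) (trans (inner⁻ a⁰ 1 ra 1∈)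
          (lia (y a⁰ ∷ height t ∷ key (r a⁰) ∷ h ∷ key (r 1) ∷ []) (λ y H x h z → H :≡ x :- h :- K 1 ⟹ x :≡ y ⟹ H :≡ K 0 ⟹ z :≡ K 0 ⟹ y :+ z :≡ h :+ K 1) heights ya (zero-height k≡n z t north vt W≡) z))

    Abeta⇒ : ∀ c → Abeta n β c → inner n y (vecPR c) ≡ h +ℤ + 1
    Abeta⇒ c (i , k , m , inj₁ eq) = trans (inner-cong n {y} (λ _ _ _ → refl) eq) (inner-valley (atValley m))
    Abeta⇒ c (i , k , m , inj₂ (k≡n , nfe , eq)) = trans (inner-cong n {y} (λ _ _ _ → refl) eq) (inner-extra (atValley m) k≡n nfe)

    -- The value h + 1 says that the East step of row l has the height of a North step of row |a c|,
    -- namely N⁺ if y is not positive at `a c`, and N⁻ if it is positive; `adjacent` makes them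
    -- neighbours. For |x (r 1)| = 0 both letters have this height and N⁺ comes first, which is
    -- where the extra root of A_β is used.
    ⇒Abeta : ∀ c → ValidPR n c → inner n y (vecPR c) ≡ h +ℤ + 1 → Abeta n β c
    ⇒Abeta c v eq = go (signed± (a c) (proj₁ (PR-ranges c v))) refl
      where
      l = j c
      rl : InRange n l
      rl = proj₂ (PR-ranges c v)
      l≥2 : 2 ≤ l
      l≥2 = ℕP.≤-trans (s≤s (proj₁ v)) (proj₁ (proj₂ v))
      sum : val y (a c) +ℤ y l ≡ h +ℤ + 1
      sum = trans (sym (inner-PR n y c v)) eq
      yl : key (r l) ≡ y l
      yl = key-y l≥2 (proj₂ rl)
      key< : key (r ∣ a c ∣) <ℤ key (r l)
      key< = r-mono (proj₁ v) (proj₁ (proj₂ v)) (proj₂ rl)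
      -- Two values with sum h + 1 = 2n - 1: the larger one is at least n, so row l has an East
      -- step.
      validE : val y (a c) ≤ℤ key (r ∣ a c ∣) → Valid (Eᵗ (r l))
      validE le = r-range l rl , lia (val y (a c) ∷ key (r ∣ a c ∣) ∷ key (r l) ∷ y l ∷ h ∷ + n ∷ [])
        (λ u z x y h n → u :+ y :≡ h :+ K 1 ⟹ z :< x ⟹ x :≡ y ⟹ u :≤ z ⟹ h :≡ K 2 :* n :- K 2 ⟹ n :≤ x) sum key< yl le h≡
      north : ∀ b → InRange n b → b ≡ ∣ a c ∣ → val y (a c) ≡ - key (r b) →
        (vecPR c ≗[ n ] alphaIJ n β (suc (n ∸ l)) (suc (n ∸ b)) ⊎ (suc (n ∸ b) ≡ n × NorthFollowedByE β n ≡ false × vecPR c ≗[ n ] alphaIJ n β (suc (n ∸ l)) (suc n))) → Abeta n β c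
      north b rb b≡ u shape = found (adjacent (r l) {N⁺ (r b)} (validE (lia (val y (a c) ∷ key (r b) ∷ key (r ∣ a c ∣) ∷ []) (λ u z z' → u :≡ :- z ⟹ z :≡ z' ⟹ K 0 :≤ z ⟹ u :≤ z') u (cong (key ∘ r) b≡) (+≤+ z≤n))) (r-range b rb) north⁺
          (lia (val y (a c) ∷ key (r b) ∷ key (r l) ∷ y l ∷ h ∷ []) (λ u z x y h → u :+ y :≡ h :+ K 1 ⟹ u :≡ :- z ⟹ x :≡ y ⟹ z :≡ x :- h :- K 1) sum u yl) (λ ()))
        where
        found : ∃[ xs ] ∃[ ys ] (W ≡ xs ++ Eᵗ (r l) ∷ N⁺ (r b) ∷ ys) → Abeta n β c
        found (xs , ys , W≡) = suc (n ∸ l) , suc (n ∸ b) , subst (λ m → (suc (n ∸ l) , suc m) ∈ valleys β) (count⁺ xs (r l) b ys rb W≡) (makeValley xs l (N⁺ (r b)) ys rl north⁺ W≡) , shape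
      mirrored : ∀ b → InRange n b → b ≡ ∣ a c ∣ → val y (a c) ≡ key (r b) → ¬ key (r b) ≡ + 0 →
        vecPR c ≗[ n ] alphaIJ n β (suc (n ∸ l)) (suc (n + (b ∸ 1))) → Abeta n β c
      mirrored b rb b≡ u nz shape = found (adjacent (r l) {N⁻ (r b)} (validE (ℤP.≤-reflexive (trans u (cong (key ∘ r) b≡))))
          (r-range b rb , lia (val y (a c) ∷ key (r b) ∷ key (r ∣ a c ∣) ∷ key (r l) ∷ y l ∷ h ∷ + n ∷ []) (λ u z z' x y h n → u :+ y :≡ h :+ K 1 ⟹ u :≡ z ⟹ z :≡ z' ⟹ z' :< x ⟹ x :≡ y ⟹ h :≡ K 2 :* n :- K 2 ⟹ z :≤ n :- K 1) sum u (cong (key ∘ r) b≡) key< yl h≡) north⁻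
          (lia (val y (a c) ∷ key (r b) ∷ key (r l) ∷ y l ∷ h ∷ []) (λ u z x y h → u :+ y :≡ h :+ K 1 ⟹ u :≡ z ⟹ x :≡ y ⟹ :- z :≡ x :- h :- K 1) sum u yl) (λ { refl → nz }))
        where
        found : ∃[ xs ] ∃[ ys ] (W ≡ xs ++ Eᵗ (r l) ∷ N⁻ (r b) ∷ ys) → Abeta n β c
        found (xs , ys , W≡) = suc (n ∸ l) , suc (n + (b ∸ 1)) , subst (λ m → (suc (n ∸ l) , suc m) ∈ valleys β) (count⁻ xs (r l) b ys rb W≡) (makeValley xs l (N⁻ (r b)) ys rl north⁻ W≡) , inj₁ shape
      suc-l : ∃[ l' ] (l ≡ suc l')
      suc-l = l ∸ 1 , sym (ℕP.m+[n∸m]≡n (proj₁ rl))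
      unfold : ∀ k (γ : ℕ → ZV) → (∀ l' → suc l' ≤ n → alphaIJ n β (suc (n ∸ suc l')) k ≡ γ (suc l')) → alphaIJ n β (suc (n ∸ l)) k ≡ γ l
      unfold k γ f = subst (λ l → l ≤ n → alphaIJ n β (suc (n ∸ l)) k ≡ γ l) (sym (proj₂ suc-l)) (f (proj₁ suc-l)) (proj₂ rl)
      ≗-eq : ∀ (γ : ZV) {γ'} → (∀ k → vecPR c k ≡ γ k) → γ' ≡ γ → vecPR c ≗[ n ] γ'
      ≗-eq γ f refl k _ _ = f k
      big : ∀ b → 2 ≤ b → b ≤ n → a c ≡ + b ⊎ a c ≡ - + b → Abeta n β c
      big b b≥2 b≤ (inj₁ e≡) = mirrored b (ℕP.<⇒≤ b≥2 , b≤) (sym (cong ∣_∣ e≡)) (trans (cong (val y) e≡) (trans (val-+ y b (ℕP.<⇒≤ b≥2)) (sym (key-y b≥2 b≤))))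
        (λ z → ℤP.<-irrefl (trans (sym z) (key-y b≥2 b≤)) (y>0 b≥2 b≤))
        (≗-eq (e (+ l) ⊕ e (+ b)) (λ k → trans (cong (λ u → e u k +ℤ e (+ l) k) e≡) (ℤP.+-comm (e (+ b) k) (e (+ l) k))) (unfold (suc (n + (b ∸ 1))) (λ l → e (+ l) ⊕ e (+ b)) λ l' le → at-add l' b le b≥2))
      big b b≥2 b≤ (inj₂ e≡) = north b (ℕP.<⇒≤ b≥2 , b≤) (sym (trans (cong ∣_∣ e≡) (ℤP.∣-i∣≡∣i∣ (+ b)))) (trans (cong (val y) e≡) (trans (val-neg y (+ b)) (cong -_ (trans (val-+ y b (ℕP.<⇒≤ b≥2)) (sym (key-y b≥2 b≤))))))
        (inj₁ (≗-eq (e (+ l) ⊖ e (+ b)) (λ k → trans (cong₂ _+ℤ_ (trans (cong (λ u → e u k) e≡) (e-neg (+ b) k)) refl) (ℤP.+-comm (- e (+ b) k) (e (+ l) k))) (unfold (suc (n ∸ b)) (λ l → e (+ l) ⊖ e (+ b)) λ l' le → at-sub l' b le b≥2 b≤)))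
      ε-e : ∀ k → e ε k ≡ ε *ℤ e (+ 1) k
      ε-e k = by-sign ε ε-sign
        where
        by-sign : ∀ s → IsSign s → e s k ≡ s *ℤ e (+ 1) k
        by-sign .(+ 1) (inj₁ refl) = sym (ℤP.*-identityˡ (e (+ 1) k))
        by-sign .(- + 1) (inj₂ refl) = trans (e-neg (+ 1) k) (sym (ℤP.-1*i≡-i (e (+ 1) k)))
      val-ε : val y ε ≡ key (r 1)
      val-ε = trans (go' ε ε-sign) ε-key
        where
        go' : ∀ s → s ≡ + 1 ⊎ s ≡ - + 1 → val y s ≡ s *ℤ y 1
        go' .(+ 1) (inj₁ refl) = refl
        go' .(- + 1) (inj₂ refl) = refl
      plusRoot : a c ≡ ε → vecPR c ≗[ n ] alphaIJ n β (suc (n ∸ l)) (suc n)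
      plusRoot e≡ = ≗-eq (e (+ l) ⊕ (ε ·v e (+ 1))) (λ k → trans (cong (_+ℤ e (+ l) k) (trans (cong (λ u → e u k) e≡) (ε-e k))) (ℤP.+-comm (ε *ℤ e (+ 1) k) (e (+ l) k))) (unfold (suc n) (λ l → e (+ l) ⊕ (ε ·v e (+ 1))) at-first⁺)
      minusRoot : a c ≡ - ε → vecPR c ≗[ n ] alphaIJ n β (suc (n ∸ l)) (suc (n ∸ 1))
      minusRoot e≡ = subst (λ m → vecPR c ≗[ n ] alphaIJ n β (suc (n ∸ l)) m) (sym (ℕP.m+[n∸m]≡n n≥1))
        (≗-eq (e (+ l) ⊖ (ε ·v e (+ 1))) (λ k → trans (cong (_+ℤ e (+ l) k) (trans (cong (λ u → e u k) e≡) (trans (e-neg ε k) (cong -_ (ε-e k))))) (ℤP.+-comm (- (ε *ℤ e (+ 1) k)) (e (+ l) k))) (unfold n (λ l → e (+ l) ⊖ (ε ·v e (+ 1))) at-first⁻))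
      one-row : 1 ≡ ∣ a c ∣ → a c ≡ ε ⊎ a c ≡ - ε → Abeta n β c
      one-row b≡ (inj₂ e≡) = north 1 1∈ b≡ (trans (cong (val y) e≡) (trans (val-neg y ε) (cong -_ val-ε))) (inj₁ (minusRoot e≡))
      one-row b≡ (inj₁ e≡) = by-zero (key (r 1) ℤP.≟ + 0)
        where
        by-zero : Dec (key (r 1) ≡ + 0) → Abeta n β c
        by-zero (no nz) = mirrored 1 1∈ b≡ (trans (cong (val y) e≡) val-ε) nz (subst (λ m → vecPR c ≗[ n ] alphaIJ n β (suc (n ∸ l)) (suc m)) (sym (ℕP.+-identityʳ n)) (plusRoot e≡))
        by-zero (yes z) = north 1 1∈ b≡ (trans (cong (val y) e≡) (trans val-ε (trans z (cong -_ (sym z))))) (inj₂ (ℕP.m+[n∸m]≡n n≥1 , trans nfe-β (nfe-zero z) , plusRoot e≡))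
      sign-of : a c ≡ + 1 ⊎ a c ≡ - + 1 → a c ≡ ε ⊎ a c ≡ - ε
      sign-of s with ε-sign
      sign-of (inj₁ p) | inj₁ q = inj₁ (trans p (sym q))
      sign-of (inj₁ p) | inj₂ q = inj₂ (trans p (cong -_ (sym q)))
      sign-of (inj₂ p) | inj₁ q = inj₂ (trans p (cong -_ (sym q)))
      sign-of (inj₂ p) | inj₂ q = inj₁ (trans p (sym q))
      go : ∀ {u} → Signed± n u → a c ≡ u → Abeta n β c
      go (plus (suc zero) rb) e≡ = one-row (sym (cong ∣_∣ e≡)) (sign-of (inj₁ e≡))
      go (plus (suc (suc b)) rb) e≡ = big (suc (suc b)) (s≤s (s≤s z≤n)) (proj₂ rb) (inj₁ e≡)
      go (minus (suc zero) rb) e≡ = one-row (sym (cong ∣_∣ e≡)) (sign-of (inj₂ e≡))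
      go (minus (suc (suc b)) rb) e≡ = big (suc (suc b)) (s≤s (s≤s z≤n)) (proj₂ rb) (inj₂ e≡)

-- Comparison of the two maps.

module Chamber (n : ℕ) (n≥3 : 3 ≤ n) (μ : ZV) (v : SP) (s₁ sₙ : ℤ) (q : ZV)
  (d₀ : DPerm n (λ j → Blocks.scaleRow n μ v s₁ sₙ j (v j)))
  (x-eq' : ∀ i → InRange n i → val q (Blocks.scaleRow n μ v s₁ sₙ i (v i)) ≡ + i - + 1 - hD n *ℤ μ i)
  (som : Sommers n (λ j → Blocks.scaleRow n μ v s₁ sₙ j (v j)) (λ i → - μ i)) (w : SP) (dw : DPerm n w)
  (inside : ∀ i → InRange n i → hD n *ℤ + 0 <ℤ inner n q (act n w (simpleR i))) where

  private
    open ActRoots n≥3 (sgnd dw)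
    h = hD n

    rises : ∀ i → 1 ≤ i → i ℕ.< n → val q (w i) <ℤ val q (w (suc i))
    rises (suc k) _ lt = lia (h ∷ val q (w (suc k)) ∷ val q (w (suc (suc k))) ∷ []) (λ h x y → h :* K 0 :< y :- x ⟹ x :< y)
      (subst (h *ℤ + 0 <ℤ_) (step-form k (s≤s z≤n , lt) q) (inside (suc (suc k)) (s≤s z≤n , lt)))

    base : + 0 <ℤ val q (w 1) +ℤ val q (w 2)
    base = lia (h ∷ val q (w 1) +ℤ val q (w 2) ∷ []) (λ h s → h :* K 0 :< s ⟹ K 0 :< s) (subst (h *ℤ + 0 <ℤ_) (first-form q) (inside 1 r1))

    module L = Labelled n n≥3 μ v s₁ sₙ q d₀ x-eq' w dw rises base
    module T = Tokens n n≥3 q L.w₀ (sgnd d₀) μ x-eq' som w (sgnd dw) rises base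

  open Blocks n μ v s₁ sₙ

  label : ∀ k → InRange n k → nthZ (flipHead evenᵇ (map fixed raw)) k ≡ w k
  label = L.label≡w

  module _ (β : List Step) (β≡ : β ≡ markAfterNorth n (if evenᵇ then E⁺ else E⁻) (Word.path n μ)) where
    private
      module C = T.Marked evenᵇ β β≡ L.y-first

    roots⇒ : ∀ c → Abeta n β c → inner n (λ k → val q (w k)) (vecPR c) ≡ hD n +ℤ + 1
    roots⇒ = C.Abeta⇒

    ⇒roots : ∀ c → ValidPR n c → inner n (λ k → val q (w k)) (vecPR c) ≡ hD n +ℤ + 1 → Abeta n β c
    ⇒roots = C.⇒Abeta

module Final (m : ℕ) (p : List Step) (v : SP) (vert : InVert (3 + m) p v) (wf : Aff) (iswf : IsWf (3 + m) wf) where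
  open Vert m p v vert
  open Wf n≥3 wf iswf

  exists : ∃[ b ] (MinAlcove n b × ModEq n (anderson n wf b) (psi n p v))
  exists = b₀ , sommers⇒min n≥3 b₀ b₀-aff b₀-sommers , pt⇒modEq b₀ b₀-aff (psi n p v) psi-even (proj₁ pt≡psi) (proj₂ pt≡psi)

  module _ (b : Aff) (minimal : MinAlcove n b) (modEq : ModEq n (anderson n wf b) (psi n p v))
    (w : SP) (dw : IsDPerm n w) (inside : InChamber n b w) where

    private
      h = hD n
      ab : IsAff n b
      ab = proj₁ minimal

      q : ZV
      q = pt n b

      -- Both points are congruent to ψ(π , v) modulo h + 1, and both alcoves satisfy the Sommers
      -- condition. Only the points are identified, not the frames; the values of `pt n b` in the
      -- frame `w₀` are all that is used below.
      q≡ : ∀ k → InRange n k → q k ≡ pt n b₀ k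
      q≡ = pt-unique n≥3 b b₀ ab b₀-aff (min⇒sommers n≥3 b minimal) b₀-sommers (λ k → proj₁ pt-b k - proj₁ pt≡psi k)
        λ k r → lia (pt n b k ∷ pt n b₀ k ∷ psi n p v k ∷ h ∷ proj₁ pt-b k ∷ proj₁ pt≡psi k ∷ [])
          (λ x x₀ u h z z₀ → x :≡ u :+ (h :+ K 1) :* z ⟹ x₀ :≡ u :+ (h :+ K 1) :* z₀ ⟹ x :≡ x₀ :+ (h :+ K 1) :* (z :- z₀)) (proj₂ pt-b k r) (proj₂ pt≡psi k r)
        where
        pt-b : Σ ZV λ z → ∀ k → InRange n k → pt n b k ≡ psi n p v k +ℤ (h +ℤ + 1) *ℤ z k
        pt-b = modEq⇒pt b ab (psi n p v) modEq

      sw : Signed n w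
      sw = signed (proj₁ dw)

      row-eq : ∀ i → InRange n i → val q (w₀ i) ≡ + i - + 1 - h *ℤ mu n p i
      row-eq i r = trans (val-cong q (pt n b₀) (w₀ i) (q≡ ∣ w₀ i ∣ (sp-maps w₀-signed i r))) (pt-row i r)

      som : Sommers n w₀ (λ i → - mu n p i)
      som = Sommers-cong n≥3 (λ i r → sym (b₀-τ i r)) b₀-sommers

      module Ch = Chamber n n≥3 (mu n p) v (epsP p *ℤ negOnePow (+ 1 +ℤ nu n (n ∸ 1) +ℤ nu n n)) (negOnePow (+ 1 +ℤ mu n p (n ∸ 1) +ℤ mu n p n))
        q w₀-D row-eq som w (toDPerm dw) inside

      module Fl = Floors n≥3 (relative n w b) (comp-sp (inv-sp sw) (aff-sp n≥3 b ab))

      point : pt n (relative n w b) ≗[ n ] (λ k → val q (w k))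
      point k s t = pt-relative sw (aff-sp n≥3 b ab) k (s , t)

      on-roots : ∀ c → inner n (pt n (relative n w b)) (vecPR c) ≡ inner n (λ k → val q (w k)) (vecPR c)
      on-roots c = inner-cong n {y = vecPR c} point (λ _ _ _ → refl)

      label≡ : dD n p v ≗[ n ] comp w idSP
      label≡ k s t = trans (Label.dD-eq n p v k) (trans (Ch.label k (s , t)) (sym (comp-id k s)))
        where
        comp-id : ∀ k → 1 ≤ k → comp w idSP k ≡ w k
        comp-id (suc k) _ = ℤP.*-identityˡ (w (suc k))

    parkEq : ParkEq n w (floorSet n w b) (dD n p v) (Abeta n (zetaDpath n p))
    parkEq = (λ c valid → mk⇔ (λ fl → Ch.⇒roots (zetaDpath n p) refl c valid (trans (sym (on-roots c)) (Fl.floor⇒ c fl)))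
        (λ r → Fl.⇒floor c valid (trans (on-roots c) (Ch.roots⇒ (zetaDpath n p) refl c r))))
      -- The labels agree with w itself and not only up to the subgroup H, so the identity serves as
      -- its element.
      , idSP , gen-id , label≡

theorem5p28 : ∀ (m : ℕ) → let n = 3 + m in
    ∀ (π : List Step) (v : SP) → InVert n π v →
    ∀ (wf : Aff) → IsWf n wf →
      (∃[ b ] (MinAlcove n b × ModEq n (anderson n wf b) (psi n π v)))
      × (∀ (b : Aff) → MinAlcove n b → ModEq n (anderson n wf b) (psi n π v) →
         ∀ (w : SP) → IsDPerm n w → InChamber n b w →
         ParkEq n w (floorSet n w b) (dD n π v) (Abeta n (zetaDpath n π)))
theorem5p28 m π v vert wf iswf = exists , parkEq
  where open Final m π v vert wf iswf
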